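{- For all partitions $\lambda,\mu,\nu$, $$g^\lambda_{\mu,\nu}(\alpha)=(-1)^{|\mu|+|\nu|-|\lambda|}\sum_{m\ge0}(-1)^m\sum_{\substack{\pi_1,\dots,\pi_m\\ |\lambda|<|\pi_1|<\dots<|\pi_m|}}a^\lambda_{\pi_1}a^{\pi_1}_{\pi_2}\cdots a^{\pi_{m-1}}_{\pi_m}d^{\pi_m}_{\mu,\nu},$$ where the term $m=0$ is interpreted as $d^\lambda_{\mu,\nu}$.
   Context: Let $\alpha$ be an indeterminate and $b:=\alpha-1$. Partitions $\lambda=[\lambda_1\ge\dots\ge\lambda_s>0]$: $|\lambda|=\sum\lambda_i$, $\ell(\lambda)=s$, $m_i(\lambda)$ number of parts equal to $i$, $1^k$ the partition with $k$ parts $1$, $\lambda\cup\mu$ union of parts. For an alphabet $\mathbf p=(p_i)_{i\ge1}$, $p_\lambda=\prod_ip_{\lambda_i}$ (similarly $q_\lambda,r_\lambda$). Symmetric functions over $\mathbb Q(\alpha)$ are $\mathbb Q(\alpha)[\mathbf p]$ via $p_n=\sum_ix_i^n$. Jack polynomials $J^{(\alpha)}_\lambda$: unique symmetric functions, orthogonal for $\langle p_\lambda,p_\mu\rangle_\alpha=\delta_{\lambda,\mu}\alpha^{\ell(\lambda)}\prod_im_i(\lambda)!i^{m_i(\lambda)}$, whose monomial expansion involves only $m_\mu$ with $|\mu|=|\lambda|$ and $\mu$ dominated by $\lambda$, with $[p_{1^n}]J_\lambda=1$ for $|\lambda|=n$. An $\alpha$-shifted symmetric function is a sequence $(f_k)_{k\ge1}$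 of polynomials $f_k\in\mathbb Q(\alpha)[s_1,\dots,s_k]$ of bounded degree, symmetric in the $s_i-i/\alpha$, with $f_{k+1}(s_1,\dots,s_k,0)=f_k$; $f(\lambda):=f_k(\lambda_1,\dots,\lambda_k)$ for $k\ge\ell(\lambda)$. Jack character $\theta^{(\alpha)}_\mu$: shifted symmetric function with $\theta_\mu(\lambda)=0$ if $|\lambda|<|\mu|$, $\theta_\mu(\lambda)=\binom{|\lambda|-|\mu|+m_1(\mu)}{m_1(\mu)}[p_{\mu\cup1^{|\lambda|-|\mu|}}]J^{(\alpha)}_\lambda$ otherwise; these form a basis of shifted symmetric functions, and $g^\pi_{\mu,\nu}(\alpha)$ is defined by $\theta_\mu\theta_\nu=\sum_\pi g^\pi_{\mu,\nu}\theta_\pi$. Operators: with catalytic indeterminates $y_0,y_1,\dots$, $Y_+=\sum_{i\ge0}y_{i+1}\frac{\partial}{\partial y_i}$, $\Gamma_Y=(1+b)\sum_{i,j\ge1}y_{i+j}\frac{j\,\partial^2}{\partial y_{i-1}\partial p_j}+\sum_{i,j\ge1}y_ip_j\frac{\partial}{\partial y_{i+j-1}}+b\sum_{i\ge1}y_{i+1}\frac{i\,\partial}{\partial y_i}$, $\Theta_Y=\sum_{i\ge1}p_i\frac{\partial}{\partial y_i}$; $\mathcal B^{(\alpha)}_n(\mathbf p,u):=\Theta_Y(\Gamma_Y+uY_+)^n\frac{y_0}{1+b}$ for $n\ge1$ (rightmost factor multiplication), $\mathcal B^{(\alpha)}_\infty(t,\mathbf p,u)=\sum_{n\ge1}\frac{t^n}{n}\mathcal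 B^{(\alpha)}_n(\mathbf p,u)$, and $\mathcal C^{(\alpha)}_\ell(t,\mathbf p):=[u^\ell]\mathcal B^{(\alpha)}_\infty(t,\mathbf p,u)$ for $\ell\ge0$ (these operators pairwise commute for $\ell\ge1$). For partitions $\lambda,\xi$, $a^\lambda_\xi:=[t^{|\xi|}p_\xi]\left(\prod_{i=1}^{\ell(\lambda)}\alpha\lambda_i\,\mathcal C^{(\alpha)}_{\lambda_i}(t,\mathbf p)\right)\cdot1$ (with $a^\emptyset_\xi=\delta_{\xi,\emptyset}$). For partitions $\lambda,\mu,\nu$, $d^\lambda_{\mu,\nu}:=\sum_{S\subseteq\{1,\dots,\ell(\lambda)\}}a^{\lambda_S}_\mu a^{\lambda_{S^c}}_\nu$, where $\lambda_S$ is the partition formed by the parts $\lambda_i$, $i\in S$; equivalently $d^\lambda_{\mu,\nu}=[t^{|\mu|+|\nu|}q_\mu r_\nu]\prod_{i=1}^{\ell(\lambda)}\alpha\lambda_i\big(\mathcal C^{(\alpha)}_{\lambda_i}(t,\mathbf q)+\mathcal C^{(\alpha)}_{\lambda_i}(t,\mathbf r)\big)\cdot1$. One has $a^\lambda_\xi=0$ for $|\xi|<|\lambda|$ and $d^\lambda_{\mu,\nu}=0$ for $|\lambda|>|\mu|+|\nu|$, so the sum is finite. -}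

module Defs where

open import Data.Nat as ℕ using (ℕ; zero; suc; _∸_; _≤_; _<_; _!)
open import Data.Nat.Combinatorics using (_C_)
open import Data.Integer as ℤ using (ℤ; +_)
open import Data.Rational as Q using (ℚ; 0ℚ; 1ℚ)
open import Data.List using (List; []; _∷_; _++_; map; foldr; concatMap; upTo; length; replicate; filter; take)
open import Data.List.Relation.Unary.All using (All)
open import Data.List.Relation.Unary.Linked using (Linked)
open import Data.Bool using (Bool; true; false; if_then_else_; _∧_)
open import Data.Product using (Σ; _×_; _,_; proj₁; proj₂)
open import Relation.Nullary using (¬_; does)
open import Relation.Binary.PropositionalEquality using (_≡_; _≢_)
import Data.List.Properties as LP

IsPartition : List ℕ → Set
IsPartition l = All (λ x → 1 ≤ x) l × Linked (λ a b → b ≤ a) l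

size : List ℕ → ℕ
size = foldr ℕ._+_ 0

mult : ℕ → List ℕ → ℕ
mult i [] = 0
mult i (x ∷ xs) = if does (x ℕ.≟ i) then suc (mult i xs) else mult i xs

_==L_ : List ℕ → List ℕ → Bool
l ==L m = does (LP.≡-dec ℕ._≟_ l m)

range1 : ℕ → List ℕ
range1 n = map suc (upTo n)

-- all partitions of n with all parts ≤ k (fuel f ≥ n)
partsFuel : ℕ → ℕ → ℕ → List (List ℕ)
partsFuel f zero k = [] ∷ []
partsFuel zero (suc n) k = []
partsFuel (suc f) (suc n) k =
  concatMap (λ a → map (a ∷_) (partsFuel f (suc n ∸ a) a))
            (filter (λ a → a ℕ.≤? k) (range1 (suc n)))

partitionsOf : ℕ → List (List ℕ)
partitionsOf n = partsFuel n n n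

partitionsUpTo : ℕ → List (List ℕ)
partitionsUpTo n = concatMap partitionsOf (upTo (suc n))

-- dominance order (for partitions of the same size): μ ⊴ λ
Dominated : List ℕ → List ℕ → Set
Dominated μ la = ∀ k → size (take k μ) ≤ size (take k la)

-- ℚ[α]: coefficient lists, lowest degree first.

PolyQ : Set
PolyQ = List ℚ

addP : PolyQ → PolyQ → PolyQ
addP [] q = q
addP (a ∷ p) [] = a ∷ p
addP (a ∷ p) (b ∷ q) = (a Q.+ b) ∷ addP p q

scaleP : ℚ → PolyQ → PolyQ
scaleP c = map (c Q.*_)

mulP : PolyQ → PolyQ → PolyQ
mulP [] q = []
mulP (a ∷ p) q = addP (scaleP a q) (0ℚ ∷ mulP p q)

coeffP : PolyQ → ℕ → ℚ
coeffP [] _ = 0ℚ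
coeffP (a ∷ p) zero = a
coeffP (a ∷ p) (suc i) = coeffP p i

_≈P_ : PolyQ → PolyQ → Set
p ≈P q = ∀ i → coeffP p i ≡ coeffP q i

NonZeroP : PolyQ → Set
NonZeroP p = Σ ℕ (λ i → coeffP p i ≢ 0ℚ)

-- ℚ(α): fractions num / (product of nonzero polynomials)

record Qα : Set where
  constructor frac
  field
    num  : PolyQ
    dens : List (Σ PolyQ NonZeroP)
open Qα public

den : Qα → PolyQ
den x = foldr (λ d acc → mulP (proj₁ d) acc) (1ℚ ∷ []) (dens x)

infix 4 _≈_
_≈_ : Qα → Qα → Set
x ≈ y = mulP (num x) (den y) ≈P mulP (num y) (den x)

fromQ : ℚ → Qα
fromQ c = frac (c ∷ []) []

fromℕ : ℕ → Qα
fromℕ n = fromQ (+ n Q./ 1)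

0q 1q : Qα
0q = fromQ 0ℚ
1q = fromQ 1ℚ

infixl 6 _+q_ _-q_
infixl 7 _*q_
_+q_ : Qα → Qα → Qα
x +q y = frac (addP (mulP (num x) (den y)) (mulP (num y) (den x))) (dens x ++ dens y)

_*q_ : Qα → Qα → Qα
x *q y = frac (mulP (num x) (num y)) (dens x ++ dens y)

-q_ : Qα → Qα
-q x = frac (scaleP (Q.- 1ℚ) (num x)) (dens x)

_-q_ : Qα → Qα → Qα
x -q y = x +q (-q y)

invq : (x : Qα) → NonZeroP (num x) → Qα
invq x nz = frac (den x) ((num x , nz) ∷ [])

_^q_ : Qα → ℕ → Qα
x ^q zero = 1q
x ^q suc n = x *q (x ^q n)

sumq : List Qα → Qα
sumq = foldr _+q_ 0q

signq : ℤ → Qα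
signq z = (-q 1q) ^q ℤ.∣ z ∣

αq : Qα
αq = frac (0ℚ ∷ 1ℚ ∷ []) []

bq : Qα
bq = αq -q 1q

inv1+b : Qα
inv1+b = invq (1q +q bq) (1 , λ ())

recipSuc : ℕ → Qα
recipSuc k = fromQ (+ 1 Q./ suc k)

-- Symmetric functions over ℚ(α) in the power-sum basis:
-- a formal sum of c · p_ρ, each ρ a partition.

SymF : Set
SymF = List (Qα × List ℕ)

pcoeff : SymF → List ℕ → Qα
pcoeff f ρ = sumq (map (λ e → if proj₂ e ==L ρ then proj₁ e else 0q) f)

-- number of maps f : {1..ℓ(ρ)} → {1..ℓ(μ)} with Σ_{f(i)=j} ρ_i = μ_j,
-- i.e. the coefficient of x^μ (hence of m_μ) in p_ρ
getAt : List ℕ → ℕ → ℕ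
getAt [] _ = 0
getAt (x ∷ xs) zero = x
getAt (x ∷ xs) (suc j) = getAt xs j

subAt : ℕ → ℕ → List ℕ → List ℕ
subAt j r [] = []
subAt zero r (x ∷ xs) = (x ∸ r) ∷ xs
subAt (suc j) r (x ∷ xs) = x ∷ subAt j r xs

sumℕ : List ℕ → ℕ
sumℕ = foldr ℕ._+_ 0

countMaps : List ℕ → List ℕ → ℕ
countMaps [] caps = if foldr (λ c acc → does (c ℕ.≟ 0) ∧ acc) true caps then 1 else 0
countMaps (r ∷ rs) caps =
  sumℕ (map (λ j → if does (r ℕ.≤? getAt caps j) then countMaps rs (subAt j r caps) else 0)
            (upTo (length caps)))

mcoeff : SymF → List ℕ → Qα
mcoeff f μ = sumq (map (λ e → proj₁ e *q fromℕ (countMaps (proj₂ e) μ)) f)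

zee : List ℕ → ℕ
zee ρ = foldr (λ i acc → ((mult i ρ) !) ℕ.* (i ℕ.^ mult i ρ) ℕ.* acc) 1 (range1 (size ρ))

inner : SymF → SymF → Qα
inner f g = sumq (concatMap (λ e → map (λ e′ →
  if proj₂ e ==L proj₂ e′
  then proj₁ e *q proj₁ e′ *q (αq ^q length (proj₂ e)) *q fromℕ (zee (proj₂ e))
  else 0q) g) f)

record IsJackFamily (J : List ℕ → SymF) : Set where
  field
    wellFormed : ∀ la → IsPartition la → All (λ e → IsPartition (proj₂ e)) (J la)
    triangular : ∀ la μ → IsPartition la → IsPartition μ →
                 ¬ (size μ ≡ size la × Dominated μ la) → mcoeff (J la) μ ≈ 0q
    orthogonal : ∀ la μ → IsPartition la → IsPartition μ → la ≢ μ →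
                 inner (J la) (J μ) ≈ 0q
    normalised : ∀ la → IsPartition la → pcoeff (J la) (replicate (size la) 1) ≈ 1q

θ : (J : List ℕ → SymF) → List ℕ → List ℕ → Qα
θ J μ la = if does (size la ℕ.<? size μ) then 0q
          else fromℕ ((size la ∸ size μ ℕ.+ mult 1 μ) C mult 1 μ)
               *q pcoeff (J la) (μ ++ replicate (size la ∸ size μ) 1)

-- Polynomials in p_1,p_2,…, y_0,y_1,…, u, t over ℚ(α): formal sums of terms.

record Mono : Set where
  constructor mono
  field
    pe : List ℕ   -- exponent of p_i at index i (index 0 unused)
    ye : List ℕ   -- exponent of y_i at index i
    ue : ℕ
    te : ℕ
open Mono public

Poly : Set
Poly = List (Qα × Mono)

data Var : Set where
  pv yv : ℕ → Var
  uv tv : Var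

modAt : (ℕ → ℕ) → ℕ → List ℕ → List ℕ
modAt h zero [] = h 0 ∷ []
modAt h zero (x ∷ xs) = h x ∷ xs
modAt h (suc i) [] = 0 ∷ modAt h i []
modAt h (suc i) (x ∷ xs) = x ∷ modAt h i xs

expOf : Var → Mono → ℕ
expOf (pv i) m = getAt (pe m) i
expOf (yv i) m = getAt (ye m) i
expOf uv m = ue m
expOf tv m = te m

modExp : (ℕ → ℕ) → Var → Mono → Mono
modExp h (pv i) (mono p y u t) = mono (modAt h i p) y u t
modExp h (yv i) (mono p y u t) = mono p (modAt h i y) u t
modExp h uv (mono p y u t) = mono p y (h u) t
modExp h tv (mono p y u t) = mono p y u (h t)

scale : Qα → Poly → Poly
scale c = map (λ e → c *q proj₁ e , proj₂ e)

mulV : Var → Poly → Poly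
mulV v = map (λ e → proj₁ e , modExp suc v (proj₂ e))

∂ : Var → Poly → Poly
∂ v = concatMap (λ e → if does (expOf v (proj₂ e) ℕ.≟ 0) then []
                       else (proj₁ e *q fromℕ (expOf v (proj₂ e)) , modExp ℕ.pred v (proj₂ e)) ∷ [])

sumP : List Poly → Poly
sumP = foldr _++_ []

-- a bound beyond which all derivatives of f vanish
bnd : Poly → ℕ
bnd f = suc (sumℕ (map (λ e → length (pe (proj₂ e)) ℕ.+ length (ye (proj₂ e))) f))

-- Y_+ = Σ_{i≥0} y_{i+1} ∂/∂y_i  (terms with i ≥ bnd f vanish)
Y₊ : Poly → Poly
Y₊ f = sumP (map (λ i → mulV (yv (suc i)) (∂ (yv i) f)) (upTo (bnd f)))

ΓY : Poly → Poly
ΓY f =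
  scale (1q +q bq) (sumP (concatMap (λ i → map (λ j →
      scale (fromℕ j) (mulV (yv (i ℕ.+ j)) (∂ (yv (i ∸ 1)) (∂ (pv j) f))))
    (range1 B)) (range1 B)))
  ++ sumP (concatMap (λ i → map (λ j →
      mulV (yv i) (mulV (pv j) (∂ (yv (i ℕ.+ j ∸ 1)) f)))
    (range1 B)) (range1 B))
  ++ scale bq (sumP (map (λ i → scale (fromℕ i) (mulV (yv (suc i)) (∂ (yv i) f))) (range1 B)))
  where B = bnd f

ΘY : Poly → Poly
ΘY f = sumP (map (λ i → mulV (pv i) (∂ (yv i) f)) (range1 (bnd f)))

iter : ℕ → (Poly → Poly) → Poly → Poly
iter zero h f = f
iter (suc n) h f = h (iter n h f)

Bop : ℕ → Poly → Poly
Bop n f = ΘY (iter n (λ g → ΓY g ++ mulV uv (Y₊ g)) (scale inv1+b (mulV (yv 0) f)))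

coeffU : ℕ → Poly → Poly
coeffU ℓ = concatMap (λ e → if does (ue (proj₂ e) ℕ.≟ ℓ)
                            then (proj₁ e , modExp (λ _ → 0) uv (proj₂ e)) ∷ [] else [])

-- C_ℓ(t,p) = [u^ℓ] Σ_{n≥1} t^n/n B_n(p,u), truncated to n ≤ N
-- (terms with n > N only contribute to powers t^k with k > N)
Ctrunc : ℕ → ℕ → Poly → Poly
Ctrunc N ℓ f = sumP (map (λ n → scale (recipSuc (n ∸ 1)) (iter n (mulV tv) (coeffU ℓ (Bop n f))))
                         (range1 N))

eqExp : List ℕ → List ℕ → Bool
eqExp [] [] = true
eqExp [] (y ∷ ys) = does (y ℕ.≟ 0) ∧ eqExp [] ys
eqExp (x ∷ xs) [] = does (x ℕ.≟ 0) ∧ eqExp xs []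
eqExp (x ∷ xs) (y ∷ ys) = does (x ℕ.≟ y) ∧ eqExp xs ys

pExp : List ℕ → List ℕ
pExp ξ = map (λ i → mult i ξ) (upTo (suc (size ξ)))

coeffTP : ℕ → List ℕ → Poly → Qα
coeffTP N ξ f = sumq (map (λ e → if eqExp (pe (proj₂ e)) (pExp ξ) ∧ eqExp (ye (proj₂ e)) []
                                    ∧ does (ue (proj₂ e) ℕ.≟ 0) ∧ does (te (proj₂ e) ℕ.≟ N)
                                 then proj₁ e else 0q) f)

onePoly : Poly
onePoly = (1q , mono [] [] 0 0) ∷ []

aCoef : List ℕ → List ℕ → Qα
aCoef la ξ = coeffTP (size ξ) ξ
  (foldr (λ l g → scale (αq *q fromℕ l) (Ctrunc (size ξ) l g)) onePoly la)

splits : List ℕ → List (List ℕ × List ℕ)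
splits [] = ([] , []) ∷ []
splits (x ∷ xs) = map (λ s → x ∷ proj₁ s , proj₂ s) (splits xs)
               ++ map (λ s → proj₁ s , x ∷ proj₂ s) (splits xs)

dCoef : List ℕ → List ℕ → List ℕ → Qα
dCoef la μ ν = sumq (map (λ s → aCoef (proj₁ s) μ *q aCoef (proj₂ s) ν) (splits la))

-- sum over chains π_1,…,π_m with |π| < |π_1| < … < |π_m| ≤ N of
-- a^π_{π_1} a^{π_1}_{π_2} ⋯ a^{π_{m-1}}_{π_m} d^{π_m}_{μ,ν}
-- (N = |μ|+|ν|; terms with |π_m| > N vanish since d^{π_m}_{μ,ν} = 0)
chainSum : ℕ → List ℕ → List ℕ → ℕ → List ℕ → Qα
chainSum N μ ν zero π = dCoef π μ ν
chainSum N μ ν (suc m) π =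
  sumq (map (λ π′ → if does (size π ℕ.<? size π′) then aCoef π π′ *q chainSum N μ ν m π′ else 0q)
            (partitionsUpTo N))

-- right-hand side of Theorem 6.1 (chains have length m ≤ N)
rhs : List ℕ → List ℕ → List ℕ → Qα
rhs la μ ν = signq ((+ (size μ ℕ.+ size ν)) ℤ.- (+ size la))
  *q sumq (map (λ m → signq (+ m) *q chainSum (size μ ℕ.+ size ν) μ ν m la)
               (upTo (suc (size μ ℕ.+ size ν))))

-- Put t = -1 and let A^λ = Π α λ_i C_{λ_i} · 1. With X = S(L + u), where L is the Nazarov–Sklyanin Lax
-- operator, B_n = (1/α) Θ Xⁿ. Commutators with the Laplace–Beltrami operator lift the B_n to operators B̂_n with
-- [L, B̂_n] = n Xⁿ, whence [I⁺_k, C_ℓ] = (-1)^ℓ I⁺_{k-1-ℓ} for I⁺_k = ⟨0|(L + S*)^k|0⟩. So I⁺_k acts on the A^λ by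
-- splitting λ, and Σ_λ Π (c_i^{m_i} / m_i!) A^λ is a joint eigenvector of all I⁺_k for every choice of the constants c_i.
-- Conversely, Jack functions are eigenvectors of I_k = ⟨0|L^k|0⟩ (I_k is self-adjoint and triangular on monomials),
-- and p₁ ↦ p₁ + 1 turns L into L + S* and J_κ into the generating function of θ_μ(κ). A joint eigenvector is
-- determined by its eigenvalues, so θ_μ(κ) = ± Σ_λ Π (c_i^{m_i} / m_i!) a^λ_μ with c depending on κ only. The weights
-- are multiplicative, so θ_μ θ_ν is the same sum over d^λ_{μ,ν}; the sum over chains inverts the unitriangular matrix
-- a^λ_π and rewrites it in terms of the θ_π, which are linearly independent because the Jack functions span.
module Submission where

open import Algebra.Bundles using (CommutativeMonoid; CommutativeRing; Ring)
open import Algebra.Module.Bundles using (LeftModule)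
open import Data.Bool using (Bool; true; if_then_else_; _∧_)
import Data.Integer as ℤ
import Data.Integer.Properties as ℤP
open import Data.List using (List; []; _∷_; _++_; applyUpTo; concatMap; foldr; length; map; replicate; upTo)
import Data.List.Properties as LP
open import Data.List.Relation.Binary.Permutation.Propositional as Perm using (_↭_; prep; swap; ↭-refl; ↭-trans)
import Data.List.Relation.Binary.Permutation.Propositional.Properties as PermP
open import Data.List.Relation.Unary.All as All using (All; []; _∷_)
import Data.List.Relation.Unary.All.Properties as AllP
open import Data.List.Relation.Unary.AllPairs as AllPairs using ([]; _∷_)
open import Data.List.Relation.Unary.Linked as Linked using (Linked; []; [-]; _∷_)
open import Data.List.Relation.Unary.Unique.Propositional using (Unique)
import Data.List.Relation.Unary.Unique.Propositional.Properties as Unique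
open import Data.Nat as ℕ using (ℕ; zero; suc)
import Data.Nat.Properties as NP
open import Data.Product using (Σ; _×_; _,_; proj₁; proj₂)
open import Data.Sum using (_⊎_; inj₁; inj₂)
open import Data.Vec using (Vec; []; _∷_)
import Defs as D
open import Level using (0ℓ)
open import Relation.Binary.PropositionalEquality as P using (_≡_; _≢_)
open import Relation.Nullary using (¬_; Dec; yes; no; does; contradiction)

-- All spaces consist of functions instead of polynomials: a symmetric function is stored by its
-- iterated derivatives at p = 0, and the powers of y and of u become indices of sequences. An
-- infinite sum such as Θ or C_ℓ then needs no completion, since its value at a word involves
-- finitely many terms, and convergence is a count of degrees: L preserves the degree, X raises it
-- by one, S* lowers it by one. Setting t = -1 loses nothing because the exponent of t equals the
-- degree in p. It is the value for which Σ (-X)^i y⁰ lies in the kernel of L + u + S*, and this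
-- closes the commutator of C_ℓ with I⁺_k. Eigenvalues are never computed: the constants c are
-- solved for from whatever eigenvalues a Jack function has. That Jack functions are eigenvectors
-- follows from an argument of Gram-Schmidt type, which needs a definite form over ℚ(α); hence the
-- cone in the scalars, realised by the order in which α is a positive infinitesimal. The partial
-- dominance order is refined to a numerical height Σ ((n+2)^k - 1) over the parts k, whose
-- convexity is what makes L triangular.

-- A ring solver with integer coefficients.

module IntSolver (R : CommutativeRing 0ℓ 0ℓ) where
 open import Algebra.Bundles using (RawRing)
 open import Data.Product using (_×_; _,_)
 open import Data.Maybe using (Maybe; just; nothing)
 open import Relation.Nullary using (yes; no)
 open CommutativeRing R
 open import Algebra.Properties.Ring ring using (-‿+-comm; -‿distribˡ-*; -‿distribʳ-*; -0#≈0#; -‿involutive)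
 open import Algebra.Properties.Semiring.Mult semiring using (×-homo-+; ×1-homo-*) renaming (_×_ to _⊗_)
 open import Algebra.Properties.Semiring.Mult.TCOptimised semiring using (×ᵤ≈×) renaming (_×_ to _⊗o_)
 open import Algebra.Solver.Ring.AlmostCommutativeRing using (_-Raw-AlmostCommutative⟶_; fromCommutativeRing)
 import Algebra.Solver.Ring
 import Algebra.Solver.Ring.NaturalCoefficients.Default as NatSolver
 open import Relation.Binary.Reasoning.Setoid setoid
 private
  module NS = NatSolver commutativeSemiring

  -- The pair (a , b) stands for the integer a - b. Sums and products are normalised by `reduce`,
  -- which makes one of the two entries zero.
  C : Set
  C = ℕ × ℕ

  reduce : ℕ → ℕ → C
  reduce a b = a ℕ.∸ b , b ℕ.∸ a

  reduce-eq : ∀ a b → a ℕ.+ (b ℕ.∸ a) ≡ (a ℕ.∸ b) ℕ.+ b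
  reduce-eq ℕ.zero ℕ.zero = P.refl
  reduce-eq ℕ.zero (ℕ.suc b) = P.refl
  reduce-eq (ℕ.suc a) ℕ.zero = P.refl
  reduce-eq (ℕ.suc a) (ℕ.suc b) = P.trans (P.cong ℕ.suc (reduce-eq a b)) (P.sym (NP.+-suc (a ℕ.∸ b) b))

  coeffs : RawRing 0ℓ 0ℓ
  coeffs = record
   { Carrier = C ; _≈_ = _≡_
   ; _+_ = λ { (a , b) (c , d) → reduce (a ℕ.+ c) (b ℕ.+ d) }
   ; _*_ = λ { (a , b) (c , d) → reduce (a ℕ.* c ℕ.+ b ℕ.* d) (a ℕ.* d ℕ.+ b ℕ.* c) }
   ; -_ = λ { (a , b) → b , a } ; 0# = 0 , 0 ; 1# = 1 , 0 }

  ⟦_⟧c : C → Carrier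
  ⟦ a , b ⟧c = a ⊗ 1# - b ⊗ 1#

  -- Evaluates the constants 0 and 1 to 0# and 1# on the nose.
  ⟦_⟧o : C → Carrier
  ⟦ a , ℕ.zero ⟧o = a ⊗o 1#
  ⟦ a , ℕ.suc b ⟧o = a ⊗ 1# - ℕ.suc b ⊗ 1#

  o≈c : ∀ x → ⟦ x ⟧o ≈ ⟦ x ⟧c
  o≈c (a , ℕ.zero) = trans (sym (×ᵤ≈× a 1#)) (sym (trans (+-congˡ -0#≈0#) (+-identityʳ _)))
  o≈c (a , ℕ.suc b) = refl

  shuffle : ∀ x y z w → (x + y) + (z + w) ≈ (x + z) + (y + w)
  shuffle = NS.solve 4 (λ x y z w → (x NS.:+ y) NS.:+ (z NS.:+ w) NS.:= (x NS.:+ z) NS.:+ (y NS.:+ w)) refl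

  eqv : ∀ a b c d → a ℕ.+ d ≡ c ℕ.+ b → ⟦ a , b ⟧c ≈ ⟦ c , d ⟧c
  eqv a b c d eq = begin
    a ⊗ 1# - b ⊗ 1# ≈⟨ sym (+-identityʳ _) ⟩
    (a ⊗ 1# - b ⊗ 1#) + 0# ≈⟨ +-congˡ (sym (-‿inverseʳ (d ⊗ 1#))) ⟩
    (a ⊗ 1# - b ⊗ 1#) + (d ⊗ 1# - d ⊗ 1#) ≈⟨ shuffle _ _ _ _ ⟩
    (a ⊗ 1# + d ⊗ 1#) + (- (b ⊗ 1#) - d ⊗ 1#) ≈⟨ +-congʳ (trans (sym (×-homo-+ 1# a d)) (trans (reflexive (P.cong (_⊗ 1#) eq)) (×-homo-+ 1# c b))) ⟩
    (c ⊗ 1# + b ⊗ 1#) + (- (b ⊗ 1#) - d ⊗ 1#) ≈⟨ +-congˡ (+-comm _ _) ⟩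
    (c ⊗ 1# + b ⊗ 1#) + (- (d ⊗ 1#) - b ⊗ 1#) ≈⟨ shuffle _ _ _ _ ⟩
    (c ⊗ 1# - d ⊗ 1#) + (b ⊗ 1# - b ⊗ 1#) ≈⟨ +-congˡ (-‿inverseʳ _) ⟩
    (c ⊗ 1# - d ⊗ 1#) + 0# ≈⟨ +-identityʳ _ ⟩
    c ⊗ 1# - d ⊗ 1# ∎

  reduce≈ : ∀ a b → ⟦ reduce a b ⟧c ≈ ⟦ a , b ⟧c
  reduce≈ a b = sym (eqv a b (a ℕ.∸ b) (b ℕ.∸ a) (reduce-eq a b))

  foil : ∀ x y z w → x * z + y * w + (x * w + y * z) ≈ (x + y) * (z + w)
  foil = NS.solve 4 (λ x y z w → x NS.:* z NS.:+ y NS.:* w NS.:+ (x NS.:* w NS.:+ y NS.:* z) NS.:= (x NS.:+ y) NS.:* (z NS.:+ w)) refl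

  neg*neg : ∀ x y → - x * - y ≈ x * y
  neg*neg x y = trans (sym (-‿distribˡ-* x (- y))) (trans (-‿cong (sym (-‿distribʳ-* x y))) (-‿involutive _))

  +-homo : ∀ x y → ⟦ RawRing._+_ coeffs x y ⟧c ≈ ⟦ x ⟧c + ⟦ y ⟧c
  +-homo (a , b) (c , d) = begin
   ⟦ reduce (a ℕ.+ c) (b ℕ.+ d) ⟧c ≈⟨ reduce≈ (a ℕ.+ c) (b ℕ.+ d) ⟩
   (a ℕ.+ c) ⊗ 1# - (b ℕ.+ d) ⊗ 1# ≈⟨ +-cong (×-homo-+ 1# a c) (trans (-‿cong (×-homo-+ 1# b d)) (sym (-‿+-comm _ _))) ⟩
   (a ⊗ 1# + c ⊗ 1#) + (- (b ⊗ 1#) + - (d ⊗ 1#)) ≈⟨ shuffle _ _ _ _ ⟩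
   ⟦ a , b ⟧c + ⟦ c , d ⟧c ∎

  *-homo : ∀ x y → ⟦ RawRing._*_ coeffs x y ⟧c ≈ ⟦ x ⟧c * ⟦ y ⟧c
  *-homo (a , b) (c , d) = begin
   ⟦ reduce (a ℕ.* c ℕ.+ b ℕ.* d) (a ℕ.* d ℕ.+ b ℕ.* c) ⟧c ≈⟨ reduce≈ (a ℕ.* c ℕ.+ b ℕ.* d) (a ℕ.* d ℕ.+ b ℕ.* c) ⟩
   (a ℕ.* c ℕ.+ b ℕ.* d) ⊗ 1# - (a ℕ.* d ℕ.+ b ℕ.* c) ⊗ 1#
    ≈⟨ +-cong (trans (×-homo-+ 1# (a ℕ.* c) (b ℕ.* d)) (+-cong (×1-homo-* a c) (trans (×1-homo-* b d) (sym (neg*neg _ _)))))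
     (trans (-‿cong (trans (×-homo-+ 1# (a ℕ.* d) (b ℕ.* c)) (+-cong (×1-homo-* a d) (×1-homo-* b c))))
      (trans (sym (-‿+-comm _ _)) (+-cong (-‿distribʳ-* _ _) (-‿distribˡ-* _ _)))) ⟩
   a ⊗ 1# * (c ⊗ 1#) + - (b ⊗ 1#) * - (d ⊗ 1#) + (a ⊗ 1# * - (d ⊗ 1#) + - (b ⊗ 1#) * (c ⊗ 1#)) ≈⟨ foil _ _ _ _ ⟩
   ⟦ a , b ⟧c * ⟦ c , d ⟧c ∎

  -‿homo : ∀ x → ⟦ RawRing.-_ coeffs x ⟧c ≈ - ⟦ x ⟧c
  -‿homo (a , b) = begin
   b ⊗ 1# - a ⊗ 1# ≈⟨ +-comm _ _ ⟩
   - (a ⊗ 1#) + b ⊗ 1# ≈⟨ +-congˡ (sym (-‿involutive _)) ⟩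
   - (a ⊗ 1#) + - - (b ⊗ 1#) ≈⟨ -‿+-comm _ _ ⟩
   - ⟦ a , b ⟧c ∎

  morphism : coeffs -Raw-AlmostCommutative⟶ fromCommutativeRing R
  morphism = record
   { ⟦_⟧ = ⟦_⟧o
   ; +-homo = λ x y → trans (o≈c (RawRing._+_ coeffs x y)) (trans (+-homo x y) (sym (+-cong (o≈c x) (o≈c y))))
   ; *-homo = λ x y → trans (o≈c (RawRing._*_ coeffs x y)) (trans (*-homo x y) (sym (*-cong (o≈c x) (o≈c y))))
   ; -‿homo = λ x → trans (o≈c (RawRing.-_ coeffs x)) (trans (-‿homo x) (sym (-‿cong (o≈c x))))
   ; 0-homo = refl ; 1-homo = refl }

  dec : ∀ x y → Maybe (⟦ x ⟧o ≈ ⟦ y ⟧o)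
  dec (a , b) (c , d) with a ℕ.+ d ℕ.≟ c ℕ.+ b
  ... | no _ = nothing
  ... | yes eq = just (trans (o≈c (a , b)) (trans (eqv a b c d eq) (sym (o≈c (c , d)))))

 open Algebra.Solver.Ring coeffs (fromCommutativeRing R) morphism dec public

-- The abstract field of scalars.

module Scal where
 natural : (R : CommutativeRing 0ℓ 0ℓ) → ℕ → CommutativeRing.Carrier R
 natural R zero = CommutativeRing.0# R
 natural R (suc n) = CommutativeRing._+_ R (CommutativeRing.1# R) (natural R n)

 -- A field containing ℚ and α, with a cone of "nonnegative" elements making it formally real with α ≥ 0.
 record Scalars : Set₁ where
  field
   cring : CommutativeRing 0ℓ 0ℓ
  open CommutativeRing cring
  field
   α α⁻¹ : Carrier
   α⁻¹*α : α⁻¹ * α ≈ 1#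
  nat : ℕ → Carrier
  nat = natural cring
  field
   inv : ℕ → Carrier
   inv* : ∀ n → inv n * nat (suc n) ≈ 1#
   zero⊎unit : ∀ x → (x ≈ 0#) ⊎ Σ Carrier (λ y → y * x ≈ 1#)
   Pos : Carrier → Set
   Pos-cong : ∀ {x y} → x ≈ y → Pos x → Pos y
   Pos-+ : ∀ {x y} → Pos x → Pos y → Pos (x + y)
   Pos-* : ∀ {x y} → Pos x → Pos y → Pos (x * y)
   Pos-square : ∀ x → Pos (x * x)
   Pos-α : Pos α
   Pos-zero-sum : ∀ {x y} → Pos x → Pos y → x + y ≈ 0# → x ≈ 0#

open Scal

-- Rational functions in α as an ordered field.

module RationalFunctions where
 open import Defs hiding (_≈_)
 open import Data.Integer using (+_)
 open import Data.Rational as Q using (0ℚ; 1ℚ)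
 import Data.Rational.Properties as QP
 open import Relation.Binary.Definitions using (tri<; tri≈; tri>)
 import Data.Rational.Unnormalised as ℚᵘ
 import Data.Rational.Unnormalised.Properties as ℚᵘP

 module QS = IntSolver QP.+-*-commutativeRing

 infix 4 _≈ᴾ_
 -- A record around `≈P`, which unfolds to a function type from which p and q could not be inferred.
 record _≈ᴾ_ (p q : PolyQ) : Set where
  constructor pw
  field at : p ≈P q
 open _≈ᴾ_ public

 reflᴾ : ∀ {p} → p ≈ᴾ p
 reflᴾ = pw λ i → P.refl
 symᴾ : ∀ {p q} → p ≈ᴾ q → q ≈ᴾ p
 symᴾ e = pw λ i → P.sym (at e i)
 transᴾ : ∀ {p q r} → p ≈ᴾ q → q ≈ᴾ r → p ≈ᴾ r
 transᴾ e f = pw λ i → P.trans (at e i) (at f i)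

 coeff-add : ∀ p q i → coeffP (addP p q) i ≡ coeffP p i Q.+ coeffP q i
 coeff-add [] q i = P.sym (QP.+-identityˡ _)
 coeff-add (a ∷ p) [] i = P.sym (QP.+-identityʳ _)
 coeff-add (a ∷ p) (b ∷ q) zero = P.refl
 coeff-add (a ∷ p) (b ∷ q) (suc i) = coeff-add p q i

 coeff-scale : ∀ c p i → coeffP (scaleP c p) i ≡ c Q.* coeffP p i
 coeff-scale c [] i = P.sym (QP.*-zeroʳ c)
 coeff-scale c (a ∷ p) zero = P.refl
 coeff-scale c (a ∷ p) (suc i) = coeff-scale c p i

 negP : PolyQ → PolyQ
 negP = scaleP (Q.- 1ℚ)

 coeff-neg : ∀ p i → coeffP (negP p) i ≡ Q.- coeffP p i
 coeff-neg p i = P.trans (coeff-scale (Q.- 1ℚ) p i) (QS.solve 1 (λ x → QS.:- QS.con (1 , 0) QS.:* x QS.:= QS.:- x) P.refl (coeffP p i))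

 add-cong : ∀ {p p′ q q′} → p ≈ᴾ p′ → q ≈ᴾ q′ → addP p q ≈ᴾ addP p′ q′
 add-cong {p} {p′} {q} {q′} e f = pw λ i → P.trans (coeff-add p q i) (P.trans (P.cong₂ Q._+_ (at e i) (at f i)) (P.sym (coeff-add p′ q′ i)))

 scale-cong : ∀ c {p q} → p ≈ᴾ q → scaleP c p ≈ᴾ scaleP c q
 scale-cong c {p} {q} e = pw λ i → P.trans (coeff-scale c p i) (P.trans (P.cong (c Q.*_) (at e i)) (P.sym (coeff-scale c q i)))

 neg-cong : ∀ {p q} → p ≈ᴾ q → negP p ≈ᴾ negP q
 neg-cong = scale-cong (Q.- 1ℚ)

 cons-cong : ∀ {a b p q} → a ≡ b → p ≈ᴾ q → (a ∷ p) ≈ᴾ (b ∷ q)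
 cons-cong e f = pw λ { zero → e ; (suc i) → at f i }

 add-comm : ∀ p q → addP p q ≈ᴾ addP q p
 add-comm p q = pw λ i → P.trans (coeff-add p q i) (P.trans (QP.+-comm (coeffP p i) _) (P.sym (coeff-add q p i)))

 add-assoc : ∀ p q r → addP (addP p q) r ≈ᴾ addP p (addP q r)
 add-assoc p q r = pw λ i → P.trans (P.trans (coeff-add (addP p q) r i) (P.cong (Q._+ coeffP r i) (coeff-add p q i)))
  (P.trans (QP.+-assoc (coeffP p i) _ _) (P.sym (P.trans (coeff-add p (addP q r) i) (P.cong (coeffP p i Q.+_) (coeff-add q r i)))))

 add-identityʳ : ∀ p → addP p [] ≈ᴾ p
 add-identityʳ p = pw λ i → P.trans (coeff-add p [] i) (QP.+-identityʳ _)

 add-inverseʳ : ∀ p → addP p (negP p) ≈ᴾ []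
 add-inverseʳ p = pw λ i → P.trans (coeff-add p (negP p) i) (P.trans (P.cong (coeffP p i Q.+_) (coeff-neg p i)) (QP.+-inverseʳ (coeffP p i)))

 add-interchange : ∀ p q r s → addP (addP p q) (addP r s) ≈ᴾ addP (addP p r) (addP q s)
 add-interchange p q r s = pw λ i → P.trans (ex p q r s i) (P.trans
  (QS.solve 4 (λ x y z w → (x QS.:+ y) QS.:+ (z QS.:+ w) QS.:= (x QS.:+ z) QS.:+ (y QS.:+ w)) P.refl (coeffP p i) (coeffP q i) (coeffP r i) (coeffP s i))
  (P.sym (ex p r q s i)))
  where
  ex : ∀ p q r s i → coeffP (addP (addP p q) (addP r s)) i ≡ (coeffP p i Q.+ coeffP q i) Q.+ (coeffP r i Q.+ coeffP s i)
  ex p q r s i = P.trans (coeff-add (addP p q) (addP r s) i) (P.cong₂ Q._+_ (coeff-add p q i) (coeff-add r s i))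

 scale-add : ∀ c p q → scaleP c (addP p q) ≈ᴾ addP (scaleP c p) (scaleP c q)
 scale-add c p q = pw λ i → P.trans (coeff-scale c (addP p q) i) (P.trans (P.cong (c Q.*_) (coeff-add p q i))
  (P.trans (QP.*-distribˡ-+ c _ _) (P.sym (P.trans (coeff-add (scaleP c p) (scaleP c q) i) (P.cong₂ Q._+_ (coeff-scale c p i) (coeff-scale c q i))))))

 scale-scale : ∀ c d p → scaleP (c Q.* d) p ≈ᴾ scaleP c (scaleP d p)
 scale-scale c d p = pw λ i → P.trans (coeff-scale (c Q.* d) p i) (P.trans (QP.*-assoc c d _) (P.sym (P.trans (coeff-scale c (scaleP d p) i) (P.cong (c Q.*_) (coeff-scale d p i)))))

 scale-0 : ∀ p → scaleP 0ℚ p ≈ᴾ []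
 scale-0 p = pw λ i → P.trans (coeff-scale 0ℚ p i) (QP.*-zeroˡ (coeffP p i))

 scale-1 : ∀ p → scaleP 1ℚ p ≈ᴾ p
 scale-1 p = pw λ i → P.trans (coeff-scale 1ℚ p i) (QP.*-identityˡ _)

 cons-0 : ∀ {p} → p ≈ᴾ [] → (0ℚ ∷ p) ≈ᴾ []
 cons-0 e = pw λ { zero → P.refl ; (suc i) → at e i }

 mul-zeroʳ : ∀ p → mulP p [] ≈ᴾ []
 mul-zeroʳ [] = reflᴾ
 mul-zeroʳ (a ∷ p) = cons-0 (mul-zeroʳ p)

 mul-congʳ : ∀ p {q q′} → q ≈ᴾ q′ → mulP p q ≈ᴾ mulP p q′
 mul-congʳ [] e = reflᴾ
 mul-congʳ (a ∷ p) e = add-cong (scale-cong a e) (cons-cong P.refl (mul-congʳ p e))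

 mul-consʳ : ∀ p b q → mulP p (b ∷ q) ≈ᴾ addP (scaleP b p) (0ℚ ∷ mulP p q)
 mul-consʳ [] b q = symᴾ (cons-0 reflᴾ)
 mul-consʳ (a ∷ p) b q = cons-cong (P.cong (Q._+ 0ℚ) (QP.*-comm a b))
  (transᴾ (add-cong (reflᴾ {scaleP a q}) (mul-consʳ p b q))
  (transᴾ (symᴾ (add-assoc (scaleP a q) (scaleP b p) _))
  (transᴾ (add-cong (add-comm (scaleP a q) (scaleP b p)) reflᴾ) (add-assoc (scaleP b p) (scaleP a q) _))))

 mul-comm : ∀ p q → mulP p q ≈ᴾ mulP q p
 mul-comm [] q = symᴾ (mul-zeroʳ q)
 mul-comm (a ∷ p) q = transᴾ (add-cong (reflᴾ {scaleP a q}) (cons-cong P.refl (mul-comm p q))) (symᴾ (mul-consʳ q a p))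

 mul-cong : ∀ {p p′ q q′} → p ≈ᴾ p′ → q ≈ᴾ q′ → mulP p q ≈ᴾ mulP p′ q′
 mul-cong {p} {p′} {q} {q′} e f = transᴾ (mul-congʳ p f) (transᴾ (mul-comm p q′) (transᴾ (mul-congʳ q′ e) (mul-comm q′ p′)))

 mul-distribˡ : ∀ p q r → mulP p (addP q r) ≈ᴾ addP (mulP p q) (mulP p r)
 mul-distribˡ [] q r = reflᴾ
 mul-distribˡ (a ∷ p) q r = transᴾ (add-cong (scale-add a q r) (cons-cong (P.sym (QP.+-identityˡ 0ℚ)) (mul-distribˡ p q r)))
  (add-interchange (scaleP a q) (scaleP a r) (0ℚ ∷ mulP p q) (0ℚ ∷ mulP p r))

 mul-distribʳ : ∀ p q r → mulP (addP q r) p ≈ᴾ addP (mulP q p) (mulP r p)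
 mul-distribʳ p q r = transᴾ (mul-comm (addP q r) p) (transᴾ (mul-distribˡ p q r) (add-cong (mul-comm p q) (mul-comm p r)))

 mul-scale : ∀ c p q → mulP (scaleP c p) q ≈ᴾ scaleP c (mulP p q)
 mul-scale c [] q = reflᴾ
 mul-scale c (a ∷ p) q = transᴾ (add-cong (scale-scale c a q) (cons-cong (P.sym (QP.*-zeroʳ c)) (mul-scale c p q))) (symᴾ (scale-add c (scaleP a q) (0ℚ ∷ mulP p q)))

 mul-shift : ∀ p q → mulP (0ℚ ∷ p) q ≈ᴾ (0ℚ ∷ mulP p q)
 mul-shift p q = transᴾ (add-cong (scale-0 q) reflᴾ) reflᴾ

 mul-assoc : ∀ p q r → mulP (mulP p q) r ≈ᴾ mulP p (mulP q r)
 mul-assoc [] q r = reflᴾ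
 mul-assoc (a ∷ p) q r = transᴾ (mul-distribʳ r (scaleP a q) (0ℚ ∷ mulP p q))
  (add-cong (mul-scale a q r) (transᴾ (mul-shift (mulP p q) r) (cons-cong P.refl (mul-assoc p q r))))

 oneP : PolyQ
 oneP = 1ℚ ∷ []

 mul-identityˡ : ∀ p → mulP oneP p ≈ᴾ p
 mul-identityˡ p = transᴾ (add-cong (scale-1 p) (cons-0 reflᴾ)) (add-identityʳ p)

 polyRing : CommutativeRing 0ℓ 0ℓ
 polyRing = record
  { Carrier = PolyQ ; _≈_ = _≈ᴾ_ ; _+_ = addP ; _*_ = mulP ; -_ = negP ; 0# = [] ; 1# = oneP
  ; isCommutativeRing = record
   { isRing = record
     { +-isAbelianGroup = record
      { isGroup = record
       { isMonoid = record
        { isSemigroup = record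
         { isMagma = record { isEquivalence = record { refl = reflᴾ ; sym = symᴾ ; trans = transᴾ } ; ∙-cong = add-cong }
         ; assoc = add-assoc }
        ; identity = (λ p → reflᴾ) , add-identityʳ }
       ; inverse = (λ p → transᴾ (add-comm (negP p) p) (add-inverseʳ p)) , add-inverseʳ
       ; ⁻¹-cong = neg-cong }
      ; comm = add-comm }
     ; *-cong = mul-cong ; *-assoc = mul-assoc
     ; *-identity = mul-identityˡ , (λ p → transᴾ (mul-comm p oneP) (mul-identityˡ p))
     ; distrib = mul-distribˡ , mul-distribʳ }
   ; *-comm = mul-comm } }

 module PS = IntSolver polyRing

 ℚ-integral : ∀ {a b} → a ≢ 0ℚ → b ≢ 0ℚ → a Q.* b ≢ 0ℚ
 ℚ-integral {a} {b} a≢0 b≢0 eq = b≢0 (P.trans (P.sym (QP.*-identityˡ b)) (P.trans (P.cong (Q._* b) (P.sym (QP.*-inverseˡ a)))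
  (P.trans (QP.*-assoc (Q.1/ a) a b) (P.trans (P.cong (Q.1/ a Q.*_) eq) (QP.*-zeroʳ (Q.1/ a))))))
  where instance _ = Q.≢-nonZero a≢0

 nonZeroP-cong : ∀ {p q} → p ≈ᴾ q → NonZeroP p → NonZeroP q
 nonZeroP-cong e (i , ne) = i , λ z → ne (P.trans (at e i) z)

 tail-nonZero : ∀ {a p} → a ≡ 0ℚ → NonZeroP (a ∷ p) → NonZeroP p
 tail-nonZero z (zero , ne) = contradiction z ne
 tail-nonZero z (suc i , ne) = i , ne

 shift-nonZero : ∀ {p} → NonZeroP p → NonZeroP (0ℚ ∷ p)
 shift-nonZero (i , ne) = suc i , ne

 -- Zero low coefficients of q are shifted away until its lowest coefficient b is nonzero; then a b
 -- is the lowest coefficient of the product.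
 mul-nonZero-lead : ∀ a p q → a ≢ 0ℚ → NonZeroP q → NonZeroP (mulP (a ∷ p) q)
 mul-nonZero-lead a p [] a≢0 (j , ne) = contradiction P.refl ne
 mul-nonZero-lead a p (b ∷ q) a≢0 nq with b Q.≟ 0ℚ
 ... | yes b0 = nonZeroP-cong (symᴾ (transᴾ (mul-comm (a ∷ p) (b ∷ q)) (transᴾ (mul-cong (cons-cong {p = q} b0 reflᴾ) (reflᴾ {a ∷ p})) (transᴾ (mul-shift q (a ∷ p)) (cons-cong P.refl (mul-comm q (a ∷ p)))))))
  (shift-nonZero (mul-nonZero-lead a p q a≢0 (tail-nonZero b0 nq)))
 ... | no b≢0 = 0 , λ z → ℚ-integral a≢0 b≢0 (P.trans (P.sym (QP.+-identityʳ _)) z)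

 mul-nonZero : ∀ p q → NonZeroP p → NonZeroP q → NonZeroP (mulP p q)
 mul-nonZero [] q (i , ne) _ = contradiction P.refl ne
 mul-nonZero (a ∷ p) q np nq with a Q.≟ 0ℚ
 ... | yes a0 = nonZeroP-cong (symᴾ (transᴾ (mul-cong {q = q} (cons-cong {p = p} a0 reflᴾ) reflᴾ) (mul-shift p q)))
  (shift-nonZero (mul-nonZero p q (tail-nonZero a0 np) nq))
 ... | no a≢0 = mul-nonZero-lead a p q a≢0 nq

 zero? : ∀ p → (p ≈ᴾ []) ⊎ NonZeroP p
 zero? [] = inj₁ reflᴾ
 zero? (a ∷ p) with a Q.≟ 0ℚ | zero? p
 ... | no a≢0 | _ = inj₂ (0 , a≢0)
 ... | yes a0 | inj₁ e = inj₁ (transᴾ (cons-cong {p = p} a0 reflᴾ) (cons-0 e))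
 ... | yes a0 | inj₂ (i , ne) = inj₂ (suc i , ne)

 mul-cancelʳ : ∀ p q r → NonZeroP r → mulP p r ≈ᴾ mulP q r → p ≈ᴾ q
 mul-cancelʳ p q r nz e with zero? (addP p (negP q))
 ... | inj₁ z = transᴾ (PS.solve 2 (λ p q → p PS.:= (p PS.:+ PS.:- q) PS.:+ q) reflᴾ p q) (add-cong z reflᴾ)
 ... | inj₂ nz′ = contradiction (at (transᴾ (PS.solve 3 (λ p q r → (p PS.:+ PS.:- q) PS.:* r PS.:= p PS.:* r PS.:+ PS.:- (q PS.:* r)) reflᴾ p q r)
    (transᴾ (add-cong e reflᴾ) (add-inverseʳ (mulP q r)))) (proj₁ n)) (proj₂ n)
  where n = mul-nonZero (addP p (negP q)) r nz′ nz

 denOf : List (Σ PolyQ NonZeroP) → PolyQ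
 denOf = foldr (λ d acc → mulP (proj₁ d) acc) (1ℚ ∷ [])

 den-++ : ∀ ds es → denOf (ds ++ es) ≈ᴾ mulP (denOf ds) (denOf es)
 den-++ [] es = symᴾ (mul-identityˡ (denOf es))
 den-++ (d ∷ ds) es = transᴾ (mul-congʳ (proj₁ d) (den-++ ds es)) (symᴾ (mul-assoc (proj₁ d) (denOf ds) (denOf es)))

 oneP-nonZero : NonZeroP oneP
 oneP-nonZero = 0 , λ ()

 den-nonZero : ∀ ds → NonZeroP (denOf ds)
 den-nonZero [] = oneP-nonZero
 den-nonZero (d ∷ ds) = mul-nonZero (proj₁ d) (denOf ds) (proj₂ d) (den-nonZero ds)

 infix 4 _≃_
 record _≃_ (x y : Qα) : Set where
  constructor cross
  field uncross : mulP (num x) (den y) ≈ᴾ mulP (num y) (den x)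
 open _≃_ public

 ≃⇒≈ : ∀ {x y} → x ≃ y → x D.≈ y
 ≃⇒≈ e = at (uncross e)
 ≈⇒≃ : ∀ {x y} → x D.≈ y → x ≃ y
 ≈⇒≃ e = cross (pw e)

 ≃-refl : ∀ {x} → x ≃ x
 ≃-refl = cross reflᴾ
 ≃-sym : ∀ {x y} → x ≃ y → y ≃ x
 ≃-sym e = cross (symᴾ (uncross e))

 -- The denominator of the middle fraction has to be cancelled, and this is where polynomials must
 -- form an integral domain.
 ≃-trans : ∀ {x y z} → x ≃ y → y ≃ z → x ≃ z
 ≃-trans {x} {y} {z} (cross e) (cross f) = cross (mul-cancelʳ _ _ (den y) (den-nonZero (dens y)) (transᴾ
  (PS.solve 3 (λ a b c → (a PS.:* b) PS.:* c PS.:= (a PS.:* c) PS.:* b) reflᴾ (num x) (den z) (den y)) (transᴾ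
  (mul-cong e (reflᴾ {den z})) (transᴾ
  (PS.solve 3 (λ a b c → (a PS.:* b) PS.:* c PS.:= (a PS.:* c) PS.:* b) reflᴾ (num y) (den x) (den z)) (transᴾ
  (mul-cong f (reflᴾ {den x}))
  (PS.solve 3 (λ a b c → (a PS.:* b) PS.:* c PS.:= (a PS.:* c) PS.:* b) reflᴾ (num z) (den y) (den x)))))))

 open PS using (_:+_; _:*_; :-_; _:=_)

 +-cong≃ : ∀ {x x′ y y′} → x ≃ x′ → y ≃ y′ → (x +q y) ≃ (x′ +q y′)
 +-cong≃ {x} {x′} {y} {y′} (cross e) (cross f) = cross (transᴾ (mul-congʳ (num (x +q y)) (den-++ (dens x′) (dens y′))) (transᴾ
  (PS.solve 6 (λ a b c d p q → (a :* d :+ c :* b) :* (p :* q) := (a :* p) :* (d :* q) :+ (c :* q) :* (b :* p)) reflᴾ (num x) (den x) (num y) (den y) (den x′) (den y′)) (transᴾ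
  (add-cong (mul-cong e reflᴾ) (mul-cong f reflᴾ)) (transᴾ
  (PS.solve 6 (λ a b c d p q → (a :* p) :* (d :* q) :+ (c :* d) :* (p :* b) := (a :* q :+ c :* b) :* (p :* d)) reflᴾ (num x′) (den x′) (num y′) (den y) (den x) (den y′))
  (symᴾ (mul-congʳ (num (x′ +q y′)) (den-++ (dens x) (dens y))))))))

 *-cong≃ : ∀ {x x′ y y′} → x ≃ x′ → y ≃ y′ → (x *q y) ≃ (x′ *q y′)
 *-cong≃ {x} {x′} {y} {y′} (cross e) (cross f) = cross (transᴾ (mul-congʳ (num (x *q y)) (den-++ (dens x′) (dens y′))) (transᴾ
  (PS.solve 4 (λ a c p q → (a :* c) :* (p :* q) := (a :* p) :* (c :* q)) reflᴾ (num x) (num y) (den x′) (den y′)) (transᴾ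
  (mul-cong e f) (transᴾ
  (PS.solve 4 (λ a p c q → (a :* p) :* (c :* q) := (a :* c) :* (p :* q)) reflᴾ (num x′) (den x) (num y′) (den y))
  (symᴾ (mul-congʳ (num (x′ *q y′)) (den-++ (dens x) (dens y))))))))

 neg-cong≃ : ∀ {x y} → x ≃ y → (-q x) ≃ (-q y)
 neg-cong≃ {x} {y} (cross e) = cross (transᴾ (mul-scale (Q.- 1ℚ) (num x) (den y)) (transᴾ (neg-cong e) (symᴾ (mul-scale (Q.- 1ℚ) (num y) (den x)))))

 -- All field identities below become identities of numerators once denominators of products are expanded.
 via : ∀ x y {dx dy} → den x ≈ᴾ dx → den y ≈ᴾ dy → mulP (num x) dy ≈ᴾ mulP (num y) dx → x ≃ y
 via x y ex ey e = cross (transᴾ (mul-congʳ (num x) ey) (transᴾ e (symᴾ (mul-congʳ (num y) ex))))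

 den₂ : ∀ (x y : Qα) → denOf (dens x ++ dens y) ≈ᴾ mulP (den x) (den y)
 den₂ x y = den-++ (dens x) (dens y)

 den₃ˡ : ∀ (x y z : Qα) → denOf ((dens x ++ dens y) ++ dens z) ≈ᴾ mulP (mulP (den x) (den y)) (den z)
 den₃ˡ x y z = transᴾ (den-++ (dens x ++ dens y) (dens z)) (mul-cong (den₂ x y) reflᴾ)

 den₃ʳ : ∀ (x y z : Qα) → denOf (dens x ++ (dens y ++ dens z)) ≈ᴾ mulP (den x) (mulP (den y) (den z))
 den₃ʳ x y z = transᴾ (den-++ (dens x) (dens y ++ dens z)) (mul-congʳ (den x) (den₂ y z))

 qα-ring : CommutativeRing 0ℓ 0ℓ
 qα-ring = record
  { Carrier = Qα ; _≈_ = _≃_ ; _+_ = _+q_ ; _*_ = _*q_ ; -_ = -q_ ; 0# = 0q ; 1# = 1q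
  ; isCommutativeRing = record
   { isRing = record
     { +-isAbelianGroup = record
      { isGroup = record
       { isMonoid = record
        { isSemigroup = record
         { isMagma = record { isEquivalence = record { refl = ≃-refl ; sym = ≃-sym ; trans = ≃-trans } ; ∙-cong = +-cong≃ }
         ; assoc = λ x y z → via _ _ (den₃ˡ x y z) (den₃ʳ x y z) (transᴾ
          (mul-cong {q = mulP (den x) (mulP (den y) (den z))} (add-cong {p = mulP (num (x +q y)) (den z)} reflᴾ (mul-congʳ (num z) (den₂ x y))) reflᴾ) (transᴾ
          (PS.solve 6 (λ a b c d e f → ((a :* d :+ c :* b) :* f :+ e :* (b :* d)) :* (b :* (d :* f)) := (a :* (d :* f) :+ (c :* f :+ e :* d) :* b) :* ((b :* d) :* f)) reflᴾ (num x) (den x) (num y) (den y) (num z) (den z))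
          (symᴾ (mul-cong (add-cong (mul-congʳ (num x) (den₂ y z)) reflᴾ) reflᴾ)))) }
        ; identity = identˡ , λ x → ≃-trans (+-comm≃ x 0q) (identˡ x) }
       ; inverse = (λ x → ≃-trans (+-comm≃ (-q x) x) (invʳ x)) , invʳ
       ; ⁻¹-cong = neg-cong≃ }
      ; comm = +-comm≃ }
     ; *-cong = *-cong≃
     ; *-assoc = λ x y z → via _ _ (den₃ˡ x y z) (den₃ʳ x y z)
       (PS.solve 6 (λ a b c d e f → ((a :* c) :* e) :* (b :* (d :* f)) := (a :* (c :* e)) :* ((b :* d) :* f)) reflᴾ (num x) (den x) (num y) (den y) (num z) (den z))
     ; *-identity = *-identˡ , λ x → ≃-trans (*-comm≃ x 1q) (*-identˡ x)
     ; distrib = distˡ , λ x y z → ≃-trans (*-comm≃ (y +q z) x) (≃-trans (distˡ x y z) (+-cong≃ (*-comm≃ x y) (*-comm≃ x z))) }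
   ; *-comm = *-comm≃ } }
  where
  +-comm≃ : ∀ x y → (x +q y) ≃ (y +q x)
  +-comm≃ x y = via _ _ (den₂ x y) (den₂ y x) (PS.solve 4 (λ a b c d → (a :* d :+ c :* b) :* (d :* b) := (c :* b :+ a :* d) :* (b :* d)) reflᴾ (num x) (den x) (num y) (den y))
  *-comm≃ : ∀ x y → (x *q y) ≃ (y *q x)
  *-comm≃ x y = via _ _ (den₂ x y) (den₂ y x) (PS.solve 4 (λ a b c d → (a :* c) :* (d :* b) := (c :* a) :* (b :* d)) reflᴾ (num x) (den x) (num y) (den y))
  zeroNum : (0ℚ ∷ []) ≈ᴾ []
  zeroNum = cons-0 reflᴾ
  identˡ : ∀ x → (0q +q x) ≃ x
  identˡ x = cross (mul-cong (transᴾ (add-cong (mul-cong zeroNum (reflᴾ {den x})) (transᴾ (mul-comm (num x) oneP) (mul-identityˡ (num x)))) reflᴾ) reflᴾ)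
  invʳ : ∀ x → (x +q (-q x)) ≃ 0q
  invʳ x = cross (transᴾ (mul-cong (transᴾ (add-cong reflᴾ (mul-scale (Q.- 1ℚ) (num x) (den x))) (add-inverseʳ (mulP (num x) (den x)))) reflᴾ) (symᴾ (mul-cong zeroNum reflᴾ)))
  *-identˡ : ∀ x → (1q *q x) ≃ x
  *-identˡ x = cross (mul-cong (mul-identityˡ (num x)) reflᴾ)
  distˡ : ∀ x y z → (x *q (y +q z)) ≃ ((x *q y) +q (x *q z))
  distˡ x y z = via (x *q (y +q z)) ((x *q y) +q (x *q z)) (den₃ʳ x y z) (transᴾ (den-++ (dens x ++ dens y) (dens x ++ dens z)) (mul-cong (den₂ x y) (den₂ x z)))
   (transᴾ (PS.solve 6 (λ a b c d e f → (a :* (c :* f :+ e :* d)) :* ((b :* d) :* (b :* f)) := ((a :* c) :* (b :* f) :+ (a :* e) :* (b :* d)) :* (b :* (d :* f))) reflᴾ (num x) (den x) (num y) (den y) (num z) (den z))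
   (symᴾ (mul-cong (add-cong (mul-congʳ (mulP (num x) (num y)) (den₂ x z)) (mul-congʳ (mulP (num x) (num z)) (den₂ x y))) reflᴾ)))

 -- The lowest nonzero coefficient decides the sign. This orders polynomials by their germs to the
 -- right of α = 0, so α is a positive infinitesimal.
 data NonNeg : PolyQ → Set where
  nil : NonNeg []
  lead : ∀ {a p} → 0ℚ Q.< a → NonNeg (a ∷ p)
  skip : ∀ {a p} → a ≡ 0ℚ → NonNeg p → NonNeg (a ∷ p)

 nonNeg-zero : ∀ q → q ≈ᴾ [] → NonNeg q
 nonNeg-zero [] e = nil
 nonNeg-zero (b ∷ q) e = skip (at e 0) (nonNeg-zero q (pw λ i → at e (suc i)))

 nonNeg-cong : ∀ {p q} → p ≈ᴾ q → NonNeg p → NonNeg q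
 nonNeg-cong {p} {[]} e n = nil
 nonNeg-cong {[]} {b ∷ q} e nil = nonNeg-zero (b ∷ q) (symᴾ e)
 nonNeg-cong {a ∷ p} {b ∷ q} e (lead h) = lead (P.subst (0ℚ Q.<_) (at e 0) h)
 nonNeg-cong {a ∷ p} {b ∷ q} e (skip z n) = skip (P.trans (P.sym (at e 0)) z) (nonNeg-cong (pw λ i → at e (suc i)) n)

 nonNeg-add : ∀ {p q} → NonNeg p → NonNeg q → NonNeg (addP p q)
 nonNeg-add nil n = n
 nonNeg-add (lead h) nil = lead h
 nonNeg-add (skip z n) nil = skip z n
 nonNeg-add (lead h) (lead k) = lead (QP.+-mono-< h k)
 nonNeg-add {a ∷ p} (lead h) (skip z n) = lead (P.subst (0ℚ Q.<_) (P.sym (P.trans (P.cong (a Q.+_) z) (QP.+-identityʳ a))) h)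
 nonNeg-add {_} {b ∷ q} (skip z n) (lead h) = lead (P.subst (0ℚ Q.<_) (P.sym (P.trans (P.cong (Q._+ b) z) (QP.+-identityˡ b))) h)
 nonNeg-add (skip z n) (skip z′ n′) = skip (P.trans (P.cong₂ Q._+_ z z′) (QP.+-identityˡ 0ℚ)) (nonNeg-add n n′)

 *-positive : ∀ {a b} → 0ℚ Q.< a → 0ℚ Q.< b → 0ℚ Q.< a Q.* b
 *-positive {a} {b} h k = QP.positive⁻¹ (a Q.* b) {{QP.pos*pos⇒pos a {{Q.positive h}} b {{Q.positive k}}}}

 nonNeg-mul : ∀ {p q} → NonNeg p → NonNeg q → NonNeg (mulP p q)
 nonNeg-mul nil n = nil
 nonNeg-mul {a ∷ p} {q} (skip z m) n = nonNeg-cong (symᴾ (transᴾ (mul-cong (cons-cong {p = p} z reflᴾ) (reflᴾ {q})) (mul-shift p q))) (skip P.refl (nonNeg-mul m n))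
 nonNeg-mul {a ∷ p} (lead h) nil = nonNeg-cong (symᴾ (mul-zeroʳ (a ∷ p))) nil
 nonNeg-mul {a ∷ p} {b ∷ q} (lead h) (lead k) = lead (P.subst (0ℚ Q.<_) (P.sym (QP.+-identityʳ (a Q.* b))) (*-positive h k))
 nonNeg-mul {a ∷ p} {b ∷ q} (lead h) (skip z n) = nonNeg-cong (symᴾ (transᴾ (mul-congʳ (a ∷ p) (cons-cong {p = q} z reflᴾ))
  (transᴾ (mul-comm (a ∷ p) (0ℚ ∷ q)) (transᴾ (mul-shift q (a ∷ p)) (cons-cong P.refl (mul-comm q (a ∷ p))))))) (skip P.refl (nonNeg-mul {a ∷ p} (lead h) n))

 nonNeg-total : ∀ p → NonNeg p ⊎ NonNeg (negP p)
 nonNeg-total [] = inj₁ nil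
 nonNeg-total (a ∷ p) with QP.<-cmp 0ℚ a
 ... | tri< h _ _ = inj₁ (lead h)
 ... | tri> _ _ h = inj₂ (lead (P.subst (0ℚ Q.<_) (P.sym (coeff-neg (a ∷ []) 0)) (QP.neg-antimono-< h)))
 ... | tri≈ _ z _ with nonNeg-total p
 ...   | inj₁ n = inj₁ (skip (P.sym z) n)
 ...   | inj₂ n = inj₂ (skip (P.cong ((Q.- 1ℚ) Q.*_) (P.sym z)) n)

 nonNeg-square : ∀ p → NonNeg (mulP p p)
 nonNeg-square p with nonNeg-total p
 ... | inj₁ n = nonNeg-mul n n
 ... | inj₂ n = nonNeg-cong (PS.solve 1 (λ p → (:- p) :* (:- p) := p :* p) reflᴾ p) (nonNeg-mul n n)

 nonNeg-zero-sum : ∀ {p q} → NonNeg p → NonNeg q → addP p q ≈ᴾ [] → p ≈ᴾ []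
 nonNeg-zero-sum nil n e = reflᴾ
 nonNeg-zero-sum (lead h) nil e = contradiction (P.subst (0ℚ Q.<_) (at e 0) h) (QP.<-irrefl P.refl)
 nonNeg-zero-sum (skip z n) nil e = e
 nonNeg-zero-sum (lead h) (lead k) e = contradiction (P.subst (0ℚ Q.<_) (at e 0) (QP.+-mono-< h k)) (QP.<-irrefl P.refl)
 nonNeg-zero-sum {a ∷ p} (lead h) (skip z n) e = contradiction (P.subst (0ℚ Q.<_) (P.trans (P.sym (P.trans (P.cong (a Q.+_) z) (QP.+-identityʳ a))) (at e 0)) h) (QP.<-irrefl P.refl)
 nonNeg-zero-sum {_} {b ∷ q} (skip z n) (lead h) e = contradiction (P.subst (0ℚ Q.<_) (P.trans (P.sym (P.trans (P.cong (Q._+ b) z) (QP.+-identityˡ b))) (at e 0)) h) (QP.<-irrefl P.refl)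
 nonNeg-zero-sum {a ∷ p} (skip z n) (skip z′ n′) e = transᴾ (cons-cong {p = p} z reflᴾ) (cons-0 (nonNeg-zero-sum n n′ (pw λ i → at e (suc i))))

 -- The order is total: if -p were the nonnegative one, p r² and its negative would both be
 -- nonnegative, hence zero, and p = 0 after cancelling r².
 nonNeg-cancel : ∀ p r → NonZeroP r → NonNeg (mulP p (mulP r r)) → NonNeg p
 nonNeg-cancel p r nz n with nonNeg-total p
 ... | inj₁ m = m
 ... | inj₂ m = nonNeg-cong (symᴾ (mul-cancelʳ p [] (mulP r r) (mul-nonZero r r nz nz) z)) nil
  where
  z : mulP p (mulP r r) ≈ᴾ []
  z = nonNeg-zero-sum n (nonNeg-mul {negP p} {mulP r r} m (nonNeg-square r)) (PS.solve 2 (λ p s → p :* s :+ (:- p) :* s := PS.con (0 , 0)) reflᴾ p (mulP r r))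

 isZero : ∀ {x} → num x ≈ᴾ [] → x ≃ 0q
 isZero {x} e = cross (transᴾ (mul-cong e reflᴾ) (symᴾ (mul-cong {0ℚ ∷ []} {[]} (cons-0 reflᴾ) (reflᴾ {den x}))))

 zero⇒num : ∀ {x} → x ≃ 0q → num x ≈ᴾ []
 zero⇒num {x} (cross e) = transᴾ (symᴾ (mul-identityˡ (num x))) (transᴾ (mul-comm oneP (num x)) (transᴾ e (mul-cong {0ℚ ∷ []} {[]} (cons-0 reflᴾ) (reflᴾ {den x}))))

 invq-inverse : ∀ x nz → (invq x nz *q x) ≃ 1q
 invq-inverse x nz = cross (transᴾ (transᴾ (mul-comm (mulP (den x) (num x)) oneP) (mul-identityˡ _))
  (transᴾ (PS.solve 2 (λ d n → d :* n := n :* d) reflᴾ (den x) (num x)) (symᴾ (mul-identityˡ (mulP (num x) (den x))))))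

 -- A fraction and num · den differ by the square of the denominator, so they have the same sign.
 PosQ : Qα → Set
 PosQ x = NonNeg (mulP (num x) (den x))

 module QR = CommutativeRing qα-ring

 natQ : ℕ → Qα
 natQ = natural qα-ring

 ℚ-suc : ∀ n → (+ suc n Q./ 1) ≡ 1ℚ Q.+ (+ n Q./ 1)
 ℚ-suc n = QP.toℚᵘ-injective (ℚᵘP.≃-trans (QP.toℚᵘ-fromℚᵘ (ℚᵘ.mkℚᵘ (+ suc n) 0)) (ℚᵘP.≃-sym (ℚᵘP.≃-trans (QP.toℚᵘ-homo-+ 1ℚ (+ n Q./ 1))
  (ℚᵘP.≃-trans (ℚᵘP.+-congʳ ℚᵘ.1ℚᵘ (QP.toℚᵘ-fromℚᵘ (ℚᵘ.mkℚᵘ (+ n) 0))) (ℚᵘ.*≡* (P.cong (ℤ._* + 1) (P.cong (λ z → + 1 ℤ.+ z) (ℤP.*-identityʳ (+ n)))))))))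

 cross₁ : ∀ n → (1 ℕ.* suc n) ℕ.* 1 ≡ 1 ℕ.* (suc n ℕ.* 1)
 cross₁ n = NP.*-assoc 1 (suc n) 1

 ℚ-recip : ∀ n → (+ 1 Q./ suc n) Q.* (+ suc n Q./ 1) ≡ 1ℚ
 ℚ-recip n = QP.toℚᵘ-injective (ℚᵘP.≃-trans (QP.toℚᵘ-homo-* (+ 1 Q./ suc n) (+ suc n Q./ 1))
  (ℚᵘP.≃-trans (ℚᵘP.*-cong (QP.toℚᵘ-fromℚᵘ (ℚᵘ.mkℚᵘ (+ 1) n)) (QP.toℚᵘ-fromℚᵘ (ℚᵘ.mkℚᵘ (+ suc n) 0)))
   (ℚᵘ.*≡* (P.cong +_ (cross₁ n)))))

 fromQ-+ : ∀ a b → fromQ (a Q.+ b) ≃ (fromQ a +q fromQ b)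
 fromQ-+ a b = cross (mul-cong {q = oneP} (symᴾ (add-cong {q = mulP (b ∷ []) oneP} (transᴾ (mul-comm (a ∷ []) oneP) (mul-identityˡ (a ∷ []))) (transᴾ (mul-comm (b ∷ []) oneP) (mul-identityˡ (b ∷ []))))) reflᴾ)

 fromQ-* : ∀ a b → fromQ (a Q.* b) ≃ (fromQ a *q fromQ b)
 fromQ-* a b = cross (mul-cong {p = a Q.* b ∷ []} {q = oneP} (cons-cong (P.sym (QP.+-identityʳ (a Q.* b))) reflᴾ) (reflᴾ {oneP}))

 fromℕ≃nat : ∀ n → fromℕ n ≃ natQ n
 fromℕ≃nat zero = ≃-refl
 fromℕ≃nat (suc n) = ≃-trans (P.subst (λ c → fromQ (+ suc n Q./ 1) ≃ fromQ c) (ℚ-suc n) ≃-refl) (≃-trans (fromQ-+ 1ℚ (+ n Q./ 1)) (+-cong≃ (≃-refl {1q}) (fromℕ≃nat n)))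

 recipSuc-inverse : ∀ n → (recipSuc n *q natQ (suc n)) ≃ 1q
 recipSuc-inverse n = ≃-trans (*-cong≃ (≃-refl {recipSuc n}) (≃-sym (fromℕ≃nat (suc n)))) (≃-trans (≃-sym (fromQ-* (+ 1 Q./ suc n) (+ suc n Q./ 1)))
  (P.subst (λ c → fromQ ((+ 1 Q./ suc n) Q.* (+ suc n Q./ 1)) ≃ fromQ c) (ℚ-recip n) ≃-refl))

 1+b≃α : (1q +q bq) ≃ αq
 1+b≃α = QKS.solve 2 (λ x a → x QKS.:+ (a QKS.:+ QKS.:- x) QKS.:= a) ≃-refl 1q αq
  where module QKS = IntSolver qα-ring

 Qα-scalars : Scalars
 Qα-scalars = record
  { cring = qα-ring
  ; α = αq ; α⁻¹ = inv1+b
  ; α⁻¹*α = ≃-trans (*-cong≃ (≃-refl {inv1+b}) (≃-sym 1+b≃α)) (invq-inverse (1q +q bq) _)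
  ; inv = recipSuc
  ; inv* = recipSuc-inverse
  ; zero⊎unit = z⊎u
  ; Pos = PosQ
  -- Multiplication by the squares of both denominators makes the two sign conditions comparable;
  -- `nonNeg-cancel` then removes the square of `den x`.
  ; Pos-cong = λ {x} {y} e p → nonNeg-cancel (mulP (num y) (den y)) (den x) (den-nonZero (dens x)) (nonNeg-cong (transᴾ
     (PS.solve 3 (λ a b d → (a :* b) :* (d :* d) := (a :* d) :* (b :* d)) reflᴾ (num x) (den x) (den y)) (transᴾ
     (mul-cong (uncross e) (reflᴾ {mulP (den x) (den y)}))
     (PS.solve 3 (λ c b d → (c :* b) :* (b :* d) := (c :* d) :* (b :* b)) reflᴾ (num y) (den x) (den y))))
     (nonNeg-mul p (nonNeg-square (den y))))
  ; Pos-+ = λ {x} {y} p q → nonNeg-cong (transᴾ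
     (PS.solve 4 (λ a b c d → (a :* b) :* (d :* d) :+ (c :* d) :* (b :* b) := (a :* d :+ c :* b) :* (b :* d)) reflᴾ (num x) (den x) (num y) (den y))
     (mul-congʳ (num (x +q y)) (symᴾ (den₂ x y)))) (nonNeg-add (nonNeg-mul p (nonNeg-square (den y))) (nonNeg-mul q (nonNeg-square (den x))))
  ; Pos-* = λ {x} {y} → pos* {x} {y}
  ; Pos-square = λ x → nonNeg-cong (transᴾ
     (PS.solve 2 (λ a b → (a :* b) :* (a :* b) := (a :* a) :* (b :* b)) reflᴾ (num x) (den x))
     (mul-congʳ (mulP (num x) (num x)) (symᴾ (den₂ x x)))) (nonNeg-square (mulP (num x) (den x)))
  ; Pos-α = nonNeg-mul {0ℚ ∷ 1ℚ ∷ []} {oneP} (skip P.refl (lead (QP.positive⁻¹ 1ℚ))) (lead (QP.positive⁻¹ 1ℚ))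
  ; Pos-zero-sum = λ {x} {y} p q e → isZero {x} (cancel₂ x (mul-cancelʳ (mulP (num x) (den x)) [] (mulP (den y) (den y)) (mul-nonZero (den y) (den y) (den-nonZero (dens y)) (den-nonZero (dens y)))
     (nonNeg-zero-sum (nonNeg-mul p (nonNeg-square (den y))) (nonNeg-mul q (nonNeg-square (den x))) (transᴾ
      (PS.solve 4 (λ a b c d → (a :* b) :* (d :* d) :+ (c :* d) :* (b :* b) := (a :* d :+ c :* b) :* (b :* d)) reflᴾ (num x) (den x) (num y) (den y))
      (mul-cong (zero⇒num {x +q y} e) (reflᴾ {mulP (den x) (den y)}))))))
  }
  where
  z⊎u : ∀ x → (x ≃ 0q) ⊎ Σ Qα (λ y → (y *q x) ≃ 1q)
  z⊎u x with zero? (num x)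
  ... | inj₁ z = inj₁ (isZero z)
  ... | inj₂ nz = inj₂ (invq x nz , invq-inverse x nz)
  pos* : ∀ {x y} → PosQ x → PosQ y → PosQ (x *q y)
  pos* {x} {y} p q = nonNeg-cong (transᴾ
     (PS.solve 4 (λ a b c d → (a :* b) :* (c :* d) := (a :* c) :* (b :* d)) reflᴾ (num x) (den x) (num y) (den y))
     (mul-congʳ (mulP (num x) (num y)) (symᴾ (den₂ x y)))) (nonNeg-mul p q)
  cancel₂ : ∀ x → mulP (num x) (den x) ≈ᴾ [] → num x ≈ᴾ []
  cancel₂ x = mul-cancelʳ (num x) [] (den x) (den-nonZero (dens x))

-- Modules, sequences and linear maps over the scalars.

module Linear (K : Scalars) where
 open Scalars K public
 open CommutativeRing cring public
  using (Carrier; _≈_; _+_; _*_; -_; _-_; 0#; 1#; refl; sym; trans; reflexive; setoid; +-cong; +-congˡ; +-congʳ; *-cong; *-congˡ; *-congʳ; -‿cong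
     ; +-comm; +-assoc; +-identityˡ; +-identityʳ; *-comm; *-assoc; *-identityˡ; *-identityʳ; zeroˡ; zeroʳ; distribˡ; distribʳ; -‿inverseˡ; -‿inverseʳ; ring)

 module KS = IntSolver cring
 open KS public using (solve; _:+_; _:*_; :-_; _:-_; _:=_; con)
 open import Relation.Binary.Reasoning.Setoid setoid public
 open import Algebra.Properties.CommutativeSemigroup (CommutativeRing.+-commutativeSemigroup cring) public using () renaming (interchange to +-interchange)
 open import Algebra.Properties.CommutativeSemigroup (CommutativeRing.*-commutativeSemigroup cring) public using () renaming (x∙yz≈y∙xz to *-left-comm)

 :0 :1 : ∀ {n} → KS.Polynomial n
 :0 = con (0 , 0)
 :1 = con (1 , 0)

 *-zeroʳ′ : ∀ {x y} → y ≈ 0# → x * y ≈ 0#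
 *-zeroʳ′ e = trans (*-congˡ e) (zeroʳ _)

 *-zeroˡ′ : ∀ {x y} → x ≈ 0# → x * y ≈ 0#
 *-zeroˡ′ e = trans (*-congʳ e) (zeroˡ _)

 cancelˡ : ∀ {x y z} → x * y ≈ 1# → x * (y * z) ≈ z
 cancelˡ e = trans (sym (*-assoc _ _ _)) (trans (*-congʳ e) (*-identityˡ _))

 Space : Set₁
 Space = LeftModule ring 0ℓ 0ℓ

 module _ (M : Space) where
  open LeftModule M
  El : Set
  El = Carrierᴹ

 -- Permutation-invariant functions on words: the word w₁…w_r records the coefficient ε ∂_{w₁} ⋯ ∂_{w_r} f,
 -- and the letter i stands for the variable p_{i+1}.
 record Sym : Set where
  constructor symf
  field
   fn : List ℕ → Carrier
   resp : ∀ {v w} → v ↭ w → fn v ≈ fn w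
 open Sym public

 infix 4 _≈ₛ_
 record _≈ₛ_ (f g : Sym) : Set where
  constructor pt
  field at : ∀ w → fn f w ≈ fn g w
 open _≈ₛ_ public

 V : Space
 V = record
  { Carrierᴹ = Sym ; _≈ᴹ_ = _≈ₛ_
  ; _+ᴹ_ = λ f g → symf (λ w → fn f w + fn g w) (λ p → +-cong (resp f p) (resp g p))
  ; _*ₗ_ = λ c f → symf (λ w → c * fn f w) (λ p → *-congˡ (resp f p))
  ; 0ᴹ = symf (λ _ → 0#) (λ _ → refl)
  ; -ᴹ_ = λ f → symf (λ w → - fn f w) (λ p → -‿cong (resp f p))
  ; isLeftModule = record
   { isLeftSemimodule = record
    { +ᴹ-isCommutativeMonoid = record
     { isMonoid = record
      { isSemigroup = record
       { isMagma = record
        { isEquivalence = record { refl = pt λ _ → refl ; sym = λ e → pt λ w → sym (at e w) ; trans = λ e e′ → pt λ w → trans (at e w) (at e′ w) }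
        ; ∙-cong = λ e e′ → pt λ w → +-cong (at e w) (at e′ w) }
       ; assoc = λ f g h → pt λ w → +-assoc _ _ _ }
      ; identity = (λ f → pt λ w → +-identityˡ _) , (λ f → pt λ w → +-identityʳ _) }
     ; comm = λ f g → pt λ w → +-comm _ _ }
    ; isPreleftSemimodule = record
     { *ₗ-cong = λ e e′ → pt λ w → *-cong e (at e′ w)
     ; *ₗ-zeroˡ = λ f → pt λ w → zeroˡ _
     ; *ₗ-distribʳ = λ f c d → pt λ w → distribʳ _ _ _
     ; *ₗ-identityˡ = λ f → pt λ w → *-identityˡ _
     ; *ₗ-assoc = λ c d f → pt λ w → *-assoc _ _ _
     ; *ₗ-zeroʳ = λ c → pt λ w → zeroʳ _
     ; *ₗ-distribˡ = λ c f g → pt λ w → distribˡ _ _ _ } }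
   ; -ᴹ‿cong = λ e → pt λ w → -‿cong (at e w)
   ; -ᴹ‿inverse = (λ f → pt λ w → -‿inverseˡ _) , (λ f → pt λ w → -‿inverseʳ _) } }

 module _ (M : Space) where
  open LeftModule M
  infix 4 _≈ₙ_
  record _≈ₙ_ (F G : ℕ → Carrierᴹ) : Set where
   constructor ptₙ
   field atₙ : ∀ i → F i ≈ᴹ G i
 open _≈ₙ_ public

 Seq : Space → Space
 Seq M = record
  { Carrierᴹ = ℕ → Carrierᴹ ; _≈ᴹ_ = _≈ₙ_ M
  ; _+ᴹ_ = λ F G i → F i +ᴹ G i
  ; _*ₗ_ = λ c F i → c *ₗ F i
  ; 0ᴹ = λ i → 0ᴹ
  ; -ᴹ_ = λ F i → -ᴹ F i
  ; isLeftModule = record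
   { isLeftSemimodule = record
    { +ᴹ-isCommutativeMonoid = record
     { isMonoid = record
      { isSemigroup = record
       { isMagma = record
        { isEquivalence = record { refl = ptₙ λ _ → ≈ᴹ-refl ; sym = λ e → ptₙ λ i → ≈ᴹ-sym (atₙ e i) ; trans = λ e e′ → ptₙ λ i → ≈ᴹ-trans (atₙ e i) (atₙ e′ i) }
        ; ∙-cong = λ e e′ → ptₙ λ i → +ᴹ-cong (atₙ e i) (atₙ e′ i) }
       ; assoc = λ F G H → ptₙ λ i → +ᴹ-assoc _ _ _ }
      ; identity = (λ F → ptₙ λ i → +ᴹ-identityˡ _) , (λ F → ptₙ λ i → +ᴹ-identityʳ _) }
     ; comm = λ F G → ptₙ λ i → +ᴹ-comm _ _ }
    ; isPreleftSemimodule = record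
     { *ₗ-cong = λ e e′ → ptₙ λ i → *ₗ-cong e (atₙ e′ i)
     ; *ₗ-zeroˡ = λ F → ptₙ λ i → *ₗ-zeroˡ _
     ; *ₗ-distribʳ = λ F c d → ptₙ λ i → *ₗ-distribʳ _ _ _
     ; *ₗ-identityˡ = λ F → ptₙ λ i → *ₗ-identityˡ _
     ; *ₗ-assoc = λ c d F → ptₙ λ i → *ₗ-assoc _ _ _
     ; *ₗ-zeroʳ = λ c → ptₙ λ i → *ₗ-zeroʳ _
     ; *ₗ-distribˡ = λ c F G → ptₙ λ i → *ₗ-distribˡ _ _ _ } }
   ; -ᴹ‿cong = λ e → ptₙ λ i → -ᴹ‿cong (atₙ e i)
   ; -ᴹ‿inverse = (λ F → ptₙ λ i → -ᴹ‿inverseˡ _) , (λ F → ptₙ λ i → -ᴹ‿inverseʳ _) } }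
  where open LeftModule M

 record Lin (M N : Space) : Set where
  private
   module M = LeftModule M
   module N = LeftModule N
  field
   _$_ : El M → El N
   cong : ∀ {x y} → x M.≈ᴹ y → (_$_ x) N.≈ᴹ (_$_ y)
   add : ∀ x y → _$_ (x M.+ᴹ y) N.≈ᴹ (_$_ x N.+ᴹ _$_ y)
   scal : ∀ c x → _$_ (c M.*ₗ x) N.≈ᴹ (c N.*ₗ _$_ x)
  infixr 5 _$_
  zer : _$_ M.0ᴹ N.≈ᴹ N.0ᴹ
  zer = N.≈ᴹ-trans (cong (M.≈ᴹ-sym (M.*ₗ-zeroˡ M.0ᴹ))) (N.≈ᴹ-trans (scal 0# M.0ᴹ) (N.*ₗ-zeroˡ _))
  private
   neg1 : ∀ x → (- 1#) N.*ₗ x N.≈ᴹ N.-ᴹ x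
   neg1 x = uniqueʳ-⁻¹ x _ (N.≈ᴹ-trans (N.+ᴹ-cong (N.≈ᴹ-sym (N.*ₗ-identityˡ x)) N.≈ᴹ-refl)
    (N.≈ᴹ-trans (N.≈ᴹ-sym (N.*ₗ-distribʳ x 1# (- 1#))) (N.≈ᴹ-trans (N.*ₗ-cong (-‿inverseʳ 1#) N.≈ᴹ-refl) (N.*ₗ-zeroˡ x))))
    where open import Algebra.Properties.Group N.+ᴹ-group using () renaming (inverseʳ-unique to uniqueʳ-⁻¹)
   neg1M : ∀ x → (- 1#) M.*ₗ x M.≈ᴹ M.-ᴹ x
   neg1M x = uniqueʳ-⁻¹ x _ (M.≈ᴹ-trans (M.+ᴹ-cong (M.≈ᴹ-sym (M.*ₗ-identityˡ x)) M.≈ᴹ-refl)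
    (M.≈ᴹ-trans (M.≈ᴹ-sym (M.*ₗ-distribʳ x 1# (- 1#))) (M.≈ᴹ-trans (M.*ₗ-cong (-‿inverseʳ 1#) M.≈ᴹ-refl) (M.*ₗ-zeroˡ x))))
    where open import Algebra.Properties.Group M.+ᴹ-group using () renaming (inverseʳ-unique to uniqueʳ-⁻¹)
  neg : ∀ x → _$_ (M.-ᴹ x) N.≈ᴹ (N.-ᴹ _$_ x)
  neg x = N.≈ᴹ-trans (cong (M.≈ᴹ-sym (neg1M x))) (N.≈ᴹ-trans (scal (- 1#) x) (neg1 _))
 open Lin public using (_$_)

 infix 4 _≈ˡ_
 record _≈ˡ_ {M N : Space} (S T : Lin M N) : Set where
  constructor ptˡ
  field atˡ : ∀ x → LeftModule._≈ᴹ_ N (S $ x) (T $ x)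
 open _≈ˡ_ public

 infixr 6 _∘ˡ_
 _∘ˡ_ : ∀ {M N O} → Lin N O → Lin M N → Lin M O
 _∘ˡ_ {M} {N} {O} S T = record
  { _$_ = λ x → S $ (T $ x)
  ; cong = λ e → Lin.cong S (Lin.cong T e)
  ; add = λ x y → O.≈ᴹ-trans (Lin.cong S (Lin.add T x y)) (Lin.add S _ _)
  ; scal = λ c x → O.≈ᴹ-trans (Lin.cong S (Lin.scal T c x)) (Lin.scal S _ _) }
  where module O = LeftModule O

 idˡ : ∀ {M} → Lin M M
 idˡ {M} = record { _$_ = λ x → x ; cong = λ e → e ; add = λ _ _ → ≈ᴹ-refl ; scal = λ _ _ → ≈ᴹ-refl }
  where open LeftModule M

 module _ {M N : Space} where
  private
   module M = LeftModule M
   module N = LeftModule N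
   open import Algebra.Properties.CommutativeSemigroup (CommutativeMonoid.commutativeSemigroup N.+ᴹ-commutativeMonoid) using (interchange)

  infixl 6 _+ˡ_
  _+ˡ_ : Lin M N → Lin M N → Lin M N
  S +ˡ T = record
   { _$_ = λ x → (S $ x) N.+ᴹ (T $ x)
   ; cong = λ e → N.+ᴹ-cong (Lin.cong S e) (Lin.cong T e)
   ; add = λ x y → N.≈ᴹ-trans (N.+ᴹ-cong (Lin.add S x y) (Lin.add T x y)) (interchange _ _ _ _)
   ; scal = λ c x → N.≈ᴹ-trans (N.+ᴹ-cong (Lin.scal S c x) (Lin.scal T c x)) (N.≈ᴹ-sym (N.*ₗ-distribˡ c _ _)) }

  0ˡ : Lin M N
  0ˡ = record { _$_ = λ _ → N.0ᴹ ; cong = λ _ → N.≈ᴹ-refl ; add = λ _ _ → N.≈ᴹ-sym (N.+ᴹ-identityˡ _) ; scal = λ c _ → N.≈ᴹ-sym (N.*ₗ-zeroʳ c) }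

  infixr 7 _·ˡ_
  _·ˡ_ : Carrier → Lin M N → Lin M N
  k ·ˡ T = record
   { _$_ = λ x → k N.*ₗ (T $ x)
   ; cong = λ e → N.*ₗ-cong refl (Lin.cong T e)
   ; add = λ x y → N.≈ᴹ-trans (N.*ₗ-cong refl (Lin.add T x y)) (N.*ₗ-distribˡ k _ _)
   ; scal = λ c x → N.≈ᴹ-trans (N.*ₗ-cong refl (Lin.scal T c x))
     (N.≈ᴹ-trans (N.≈ᴹ-sym (N.*ₗ-assoc k c _)) (N.≈ᴹ-trans (N.*ₗ-cong (*-comm k c) N.≈ᴹ-refl) (N.*ₗ-assoc c k _))) }

  -ˡ_ : Lin M N → Lin M N
  -ˡ T = record
   { _$_ = λ x → N.-ᴹ (T $ x)
   ; cong = λ e → N.-ᴹ‿cong (Lin.cong T e)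
   ; add = λ x y → N.≈ᴹ-trans (N.-ᴹ‿cong (Lin.add T x y)) (N.≈ᴹ-sym (-‿+-comm _ _))
   ; scal = λ c x → N.≈ᴹ-trans (N.-ᴹ‿cong (Lin.scal T c x)) (N.≈ᴹ-sym (Lin.neg (mult c) _)) }
   where
   open import Algebra.Properties.AbelianGroup N.+ᴹ-abelianGroup using () renaming (⁻¹-∙-comm to -‿+-comm)
   mult : Carrier → Lin N N
   mult c = record { _$_ = c N.*ₗ_ ; cong = N.*ₗ-cong refl ; add = N.*ₗ-distribˡ c
    ; scal = λ d x → N.≈ᴹ-trans (N.≈ᴹ-sym (N.*ₗ-assoc c d x)) (N.≈ᴹ-trans (N.*ₗ-cong (*-comm c d) N.≈ᴹ-refl) (N.*ₗ-assoc d c x)) }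

 -- Packaged as a ring because the commutator calculus below is carried out in an arbitrary
 -- noncommutative ring.
 End : Space → Ring 0ℓ 0ℓ
 End M = record
  { Carrier = Lin M M ; _≈_ = _≈ˡ_ ; _+_ = _+ˡ_ ; _*_ = _∘ˡ_ ; -_ = -ˡ_ ; 0# = 0ˡ ; 1# = idˡ
  ; isRing = record
   { +-isAbelianGroup = record
    { isGroup = record
     { isMonoid = record
      { isSemigroup = record
       { isMagma = record
        { isEquivalence = record { refl = ptˡ λ _ → ≈ᴹ-refl ; sym = λ e → ptˡ λ x → ≈ᴹ-sym (atˡ e x) ; trans = λ e f → ptˡ λ x → ≈ᴹ-trans (atˡ e x) (atˡ f x) }
        ; ∙-cong = λ e f → ptˡ λ x → +ᴹ-cong (atˡ e x) (atˡ f x) }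
       ; assoc = λ S T U → ptˡ λ x → +ᴹ-assoc _ _ _ }
      ; identity = (λ S → ptˡ λ x → +ᴹ-identityˡ _) , (λ S → ptˡ λ x → +ᴹ-identityʳ _) }
     ; inverse = (λ S → ptˡ λ x → -ᴹ‿inverseˡ _) , (λ S → ptˡ λ x → -ᴹ‿inverseʳ _)
     ; ⁻¹-cong = λ e → ptˡ λ x → -ᴹ‿cong (atˡ e x) }
    ; comm = λ S T → ptˡ λ x → +ᴹ-comm _ _ }
   ; *-cong = λ {S} {S′} {T} {T′} e f → ptˡ λ x → ≈ᴹ-trans (Lin.cong S (atˡ f x)) (atˡ e (T′ $ x))
   ; *-assoc = λ S T U → ptˡ λ x → ≈ᴹ-refl
   ; *-identity = (λ S → ptˡ λ x → ≈ᴹ-refl) , (λ S → ptˡ λ x → ≈ᴹ-refl)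
   ; distrib = (λ S T U → ptˡ λ x → Lin.add S _ _) , (λ S T U → ptˡ λ x → ≈ᴹ-refl) } }
  where open LeftModule M

-- The Lax operator on series in y with symmetric coefficients.

module Lax (K : Scalars) where
 open Linear K
 import Algebra.Module.Construct.TensorUnit as TensorUnit

 lift : ∀ {M N} → Lin M N → Lin (Seq M) (Seq N)
 lift T = record
  { _$_ = λ F i → T $ F i
  ; cong = λ e → ptₙ λ i → Lin.cong T (atₙ e i)
  ; add = λ F G → ptₙ λ i → Lin.add T _ _
  ; scal = λ c F → ptₙ λ i → Lin.scal T _ _ }

 module SeqOps (M : Space) where
  open LeftModule M

  up : (ℕ → Carrierᴹ) → ℕ → Carrierᴹ
  up F zero = 0ᴹ
  up F (suc i) = F i

  S : Lin (Seq M) (Seq M)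
  S = record
   { _$_ = up
   ; cong = λ e → ptₙ λ { zero → ≈ᴹ-refl ; (suc i) → atₙ e i }
   ; add = λ F G → ptₙ λ { zero → ≈ᴹ-sym (+ᴹ-identityˡ _) ; (suc i) → ≈ᴹ-refl }
   ; scal = λ c F → ptₙ λ { zero → ≈ᴹ-sym (*ₗ-zeroʳ c) ; (suc i) → ≈ᴹ-refl } }

  S* : Lin (Seq M) (Seq M)
  S* = record { _$_ = λ F i → F (suc i) ; cong = λ e → ptₙ λ i → atₙ e (suc i) ; add = λ _ _ → ptₙ λ _ → ≈ᴹ-refl ; scal = λ _ _ → ptₙ λ _ → ≈ᴹ-refl }

  comp : ℕ → Lin (Seq M) M
  comp i = record { _$_ = λ F → F i ; cong = λ e → atₙ e i ; add = λ _ _ → ≈ᴹ-refl ; scal = λ _ _ → ≈ᴹ-refl }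

  bra : Lin (Seq M) M
  bra = comp 0

  vac : Lin M (Seq M)
  vac = record
   { _$_ = λ f → λ { zero → f ; (suc i) → 0ᴹ }
   ; cong = λ e → ptₙ λ { zero → e ; (suc i) → ≈ᴹ-refl }
   ; add = λ F G → ptₙ λ { zero → ≈ᴹ-refl ; (suc i) → ≈ᴹ-sym (+ᴹ-identityˡ _) }
   ; scal = λ c F → ptₙ λ { zero → ≈ᴹ-refl ; (suc i) → ≈ᴹ-sym (*ₗ-zeroʳ c) } }

  diag : (ℕ → Carrier) → Lin (Seq M) (Seq M)
  diag d = record
   { _$_ = λ F i → d i *ₗ F i
   ; cong = λ e → ptₙ λ i → *ₗ-cong refl (atₙ e i)
   ; add = λ F G → ptₙ λ i → *ₗ-distribˡ _ _ _
   ; scal = λ c F → ptₙ λ i → ≈ᴹ-trans (≈ᴹ-sym (*ₗ-assoc _ _ _)) (≈ᴹ-trans (*ₗ-cong (*-comm _ _) ≈ᴹ-refl) (*ₗ-assoc _ _ _)) }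

  split : ∀ F → _≈ₙ_ M F (LeftModule._+ᴹ_ (Seq M) (vac $ (bra $ F)) (S $ (S* $ F)))
  split F = ptₙ λ { zero → ≈ᴹ-sym (+ᴹ-identityʳ _) ; (suc i) → ≈ᴹ-sym (+ᴹ-identityˡ _) }

 -- The sequence F stands for Σ y^i F_i: the catalytic operators act on expressions linear in the
 -- variables y_i, so a power of one variable y can replace y_i.
 H : Space
 H = Seq V

 module V = LeftModule V
 open V public using () renaming (*ₗ-assoc to *ₛ-assoc; *ₗ-cong to *ₛ-cong; *ₗ-distribʳ to *ₛ-distribʳ; *ₗ-distribˡ to *ₛ-distribˡ; *ₗ-identityˡ to *ₛ-identityˡ; *ₗ-zeroʳ to *ₛ-zeroʳ; *ₗ-zeroˡ to *ₛ-zeroˡ; +ᴹ-comm to +ₛ-comm; +ᴹ-cong to +ₛ-cong; +ᴹ-congʳ to +ₛ-congʳ; +ᴹ-congˡ to +ₛ-congˡ; +ᴹ-identityʳ to +ₛ-identityʳ; +ᴹ-identityˡ to +ₛ-identityˡ; -ᴹ_ to -ₛ_; -ᴹ‿cong to -ₛ‿cong; 0ᴹ to 0ₛ; _*ₗ_ to _*ₛ_; _+ᴹ_ to _+ₛ_; ≈ᴹ-refl to reflₛ; ≈ᴹ-reflexive to reflexiveₛ; ≈ᴹ-sym to symₛ; ≈ᴹ-trans to transₛ)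
 open SeqOps V public
 module H = LeftModule H
 open H public using () renaming (*ₗ-assoc to *ₕ-assoc; *ₗ-cong to *ₕ-cong; *ₗ-zeroʳ to *ₕ-zeroʳ; *ₗ-zeroˡ to *ₕ-zeroˡ; +ᴹ-assoc to +ₕ-assoc; +ᴹ-comm to +ₕ-comm; +ᴹ-cong to +ₕ-cong; +ᴹ-congˡ to +ₕ-congˡ; +ᴹ-identityʳ to +ₕ-identityʳ; +ᴹ-identityˡ to +ₕ-identityˡ; 0ᴹ to 0ₕ; _*ₗ_ to _*ₕ_; _+ᴹ_ to _+ₕ_; ≈ᴹ-refl to reflₕ; ≈ᴹ-reflexive to reflexiveₕ; ≈ᴹ-sym to symₕ; ≈ᴹ-trans to transₕ)

 infix 4 _≈ₕ_
 _≈ₕ_ : El H → El H → Set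
 _≈ₕ_ = _≈ₙ_ V

 -- In the encoding by words, ∂/∂p_{i+1} just prepends the letter i.
 δ : ℕ → Lin V V
 δ i = record
  { _$_ = λ f → symf (λ w → fn f (i ∷ w)) (λ p → resp f (prep i p))
  ; cong = λ e → pt λ w → at e (i ∷ w)
  ; add = λ _ _ → pt λ _ → refl ; scal = λ _ _ → pt λ _ → refl }

 δ-comm : ∀ i j f → (δ i $ (δ j $ f)) ≈ₛ (δ j $ (δ i $ f))
 δ-comm i j f = pt λ w → resp f (swap j i ↭-refl)

 shift : ℕ → El H → El H
 shift i F j = δ i $ F j

 -- Leibniz rule along the word: exactly one letter i is spent on the factor p_{i+1}, and the
 -- remaining letters differentiate F_{i+1}. No finiteness of F is involved.
 θfn : El H → List ℕ → Carrier
 θfn F [] = 0#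
 θfn F (i ∷ w) = fn (F (suc i)) w + θfn (shift i F) w

 θfn-cong : ∀ {F G : El H} → (∀ j → F (suc j) ≈ₛ G (suc j)) → ∀ w → θfn F w ≈ θfn G w
 θfn-cong e [] = refl
 θfn-cong e (i ∷ w) = +-cong (at (e i) w) (θfn-cong (λ j → Lin.cong (δ i) (e j)) w)

 θfn-resp : ∀ (F : El H) {v w} → v ↭ w → θfn F v ≈ θfn F w
 θfn-resp F Perm.refl = refl
 θfn-resp F (prep i p) = +-cong (resp (F (suc i)) p) (θfn-resp (shift i F) p)
 θfn-resp F (swap {v} {w} i j p) = begin
  fn (F (suc i)) (j ∷ v) + (fn (F (suc j)) (i ∷ v) + θfn (shift j (shift i F)) v)
   ≈⟨ solve 3 (λ x y z → x :+ (y :+ z) := y :+ (x :+ z)) refl _ _ _ ⟩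
  fn (F (suc j)) (i ∷ v) + (fn (F (suc i)) (j ∷ v) + θfn (shift j (shift i F)) v)
   ≈⟨ +-cong (resp (F (suc j)) (prep i p)) (+-cong (resp (F (suc i)) (prep j p))
     (trans (θfn-cong (λ k → δ-comm j i (F (suc k))) v) (θfn-resp (shift i (shift j F)) p))) ⟩
  fn (F (suc j)) (i ∷ w) + (fn (F (suc i)) (j ∷ w) + θfn (shift i (shift j F)) w) ∎
 θfn-resp F (Perm.trans p q) = trans (θfn-resp F p) (θfn-resp F q)

 θfn-add : ∀ F G w → θfn (F +ₕ G) w ≈ θfn F w + θfn G w
 θfn-add F G [] = sym (+-identityˡ _)
 θfn-add F G (i ∷ w) = trans (+-congˡ (trans (θfn-cong (λ j → pt λ _ → refl) w) (θfn-add (shift i F) (shift i G) w)))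
  (+-interchange _ _ _ _)

 θfn-scal : ∀ c F w → θfn (c *ₕ F) w ≈ c * θfn F w
 θfn-scal c F [] = sym (zeroʳ c)
 θfn-scal c F (i ∷ w) = trans (+-congˡ (trans (θfn-cong (λ j → pt λ _ → refl) w) (θfn-scal c (shift i F) w))) (sym (distribˡ _ _ _))

 -- Θ = Σ_{j≥1} p_j [y^j]
 Θ : Lin H V
 Θ = record
  { _$_ = λ F → symf (θfn F) (θfn-resp F)
  ; cong = λ e → pt (θfn-cong λ j → atₙ e (suc j))
  ; add = λ F G → pt (θfn-add F G) ; scal = λ c F → pt (θfn-scal c F) }

 Θ-cong₊ : ∀ {F G : El H} → (∀ j → F (suc j) ≈ₛ G (suc j)) → (Θ $ F) ≈ₛ (Θ $ G)
 Θ-cong₊ e = pt (θfn-cong e)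

 δΘ : ∀ i F → (δ i $ (Θ $ F)) ≈ₛ ((Θ $ (lift (δ i) $ F)) +ₛ F (suc i))
 δΘ i F = pt λ w → +-comm _ _

 Θ-vac : ∀ f → (Θ $ (vac $ f)) ≈ₛ 0ₛ
 Θ-vac f = transₛ (Θ-cong₊ {vac $ f} {0ₕ} (λ j → reflₛ)) (Lin.zer Θ)

 -- Both sides are Σ p_j p_l G_{jl}. The infinite double sum is compared letter by letter, the two
 -- ways of spending a letter changing places.
 Θ-swap : ∀ (G : ℕ → ℕ → Sym) → (Θ $ (λ j → Θ $ G j)) ≈ₛ (Θ $ (λ l → Θ $ (λ j → G j l)))
 Θ-swap G = pt (go G)
  where
  step : ∀ (G : ℕ → ℕ → Sym) i w → θfn (shift i (λ j → Θ $ G j)) w ≈ θfn (λ j → G j (suc i)) w + θfn (λ j → Θ $ (λ l → δ i $ G j l)) w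
  step G i w = trans (θfn-cong (λ j → pt λ v → refl) w) (θfn-add (λ j → G j (suc i)) (λ j → Θ $ (λ l → δ i $ G j l)) w)
  go : ∀ (G : ℕ → ℕ → Sym) w → θfn (λ j → Θ $ G j) w ≈ θfn (λ l → Θ $ (λ j → G j l)) w
  go G [] = refl
  go G (i ∷ w) = begin
   θfn (G (suc i)) w + θfn (shift i (λ j → Θ $ G j)) w ≈⟨ +-congˡ (trans (step G i w) (+-congˡ (go (λ j l → δ i $ G j l) w))) ⟩
   θfn (G (suc i)) w + (θfn (λ j → G j (suc i)) w + θfn (λ l → Θ $ (λ j → δ i $ G j l)) w)
    ≈⟨ solve 3 (λ x y z → x :+ (y :+ z) := y :+ (x :+ z)) refl _ _ _ ⟩
   θfn (λ j → G j (suc i)) w + (θfn (G (suc i)) w + θfn (λ l → Θ $ (λ j → δ i $ G j l)) w)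
    ≈⟨ +-congˡ (sym (step (λ l j → G j l) i w)) ⟩
   θfn (λ j → G j (suc i)) w + θfn (shift i (λ l → Θ $ (λ j → G j l))) w ∎

 afn : Sym → ℕ → Sym
 afn f zero = 0ₛ
 afn f (suc i) = (α * nat (suc i)) *ₛ (δ i $ f)

 -- a f = Σ_{j≥1} α j y^j ∂f/∂p_j
 a : Lin V H
 a = record
  { _$_ = afn
  ; cong = λ e → ptₙ λ { zero → reflₛ ; (suc i) → *ₛ-cong refl (Lin.cong (δ i) e) }
  ; add = λ f g → ptₙ λ { zero → symₛ (+ₛ-identityˡ _) ; (suc i) → pt λ w → distribˡ _ _ _ }
  ; scal = λ c f → ptₙ λ { zero → pt λ w → sym (zeroʳ c) ; (suc i) → pt λ w → *-left-comm _ _ _ } }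

 -- The product of the series Σ y^i F_i with Σ α j y^j ∂_j, computed by peeling off F_0.
 Afn : El H → ℕ → Sym
 Afn F zero = 0ₛ
 Afn F (suc m) = afn (F 0) (suc m) +ₛ Afn (S* $ F) m

 Afn-cong : ∀ {F G : El H} → F ≈ₕ G → ∀ m → Afn F m ≈ₛ Afn G m
 Afn-cong e zero = reflₛ
 Afn-cong e (suc m) = +ₛ-cong (atₙ (Lin.cong a (atₙ e 0)) (suc m)) (Afn-cong (Lin.cong S* e) m)

 Afn-add : ∀ F G m → Afn (F +ₕ G) m ≈ₛ (Afn F m +ₛ Afn G m)
 Afn-add F G zero = symₛ (+ₛ-identityˡ _)
 Afn-add F G (suc m) = pt λ w → trans (+-cong (at (atₙ (Lin.add a (F 0) (G 0)) (suc m)) w) (at (Afn-add (S* $ F) (S* $ G) m) w))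
  (+-interchange _ _ _ _)

 Afn-scal : ∀ c F m → Afn (c *ₕ F) m ≈ₛ (c *ₛ Afn F m)
 Afn-scal c F zero = symₛ (*ₛ-zeroʳ c)
 Afn-scal c F (suc m) = pt λ w → trans (+-cong (at (atₙ (Lin.scal a c (F 0)) (suc m)) w) (at (Afn-scal c (S* $ F) m) w)) (sym (distribˡ _ _ _))

 A : Lin H H
 A = record { _$_ = Afn ; cong = λ e → ptₙ (Afn-cong e) ; add = λ F G → ptₙ (Afn-add F G) ; scal = λ c F → ptₙ (Afn-scal c F) }

 -- The coefficient of y^m in the product of F with Σ p_j y^(-j), negative powers of y being
 -- discarded.
 Bfn : El H → ℕ → Sym
 Bfn F zero = Θ $ F
 Bfn F (suc i) = Bfn (S* $ F) i

 Bfn-cong : ∀ {F G : El H} → F ≈ₕ G → ∀ m → Bfn F m ≈ₛ Bfn G m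
 Bfn-cong e zero = Lin.cong Θ e
 Bfn-cong e (suc m) = Bfn-cong (Lin.cong S* e) m

 Bfn-add : ∀ F G m → Bfn (F +ₕ G) m ≈ₛ (Bfn F m +ₛ Bfn G m)
 Bfn-add F G zero = Lin.add Θ F G
 Bfn-add F G (suc m) = Bfn-add (S* $ F) (S* $ G) m

 Bfn-scal : ∀ c F m → Bfn (c *ₕ F) m ≈ₛ (c *ₛ Bfn F m)
 Bfn-scal c F zero = Lin.scal Θ c F
 Bfn-scal c F (suc m) = Bfn-scal c (S* $ F) m

 B : Lin H H
 B = record { _$_ = Bfn ; cong = λ e → ptₙ (Bfn-cong e) ; add = λ F G → ptₙ (Bfn-add F G) ; scal = λ c F → ptₙ (Bfn-scal c F) }

 b : Carrier
 b = α - 1#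

 N : Lin H H
 N = diag nat

 -- The Nazarov–Sklyanin Lax operator; the operator Γ_Y + u Y_+ of the paper is S ∘ (L + u).
 L : Lin H H
 L = (A +ˡ B) +ˡ (b ·ˡ N)

 AS : ∀ F → (A $ (S $ F)) ≈ₕ (S $ (A $ F))
 AS F = ptₙ λ { zero → reflₛ ; (suc m) → go m }
  where
  go : ∀ m → (afn 0ₛ (suc m) +ₛ Afn (S* $ (S $ F)) m) ≈ₛ Afn F m
  go m = pt λ w → trans (+-cong (zeroʳ _) refl) (+-identityˡ _)

 A-vac : ∀ f → (A $ (vac $ f)) ≈ₕ (a $ f)
 A-vac f = ptₙ λ { zero → reflₛ ; (suc m) → transₛ (+ₛ-congˡ (transₛ (Afn-cong {S* $ (vac $ f)} {0ₕ} (ptₙ λ _ → reflₛ) m) (atₙ (Lin.zer A) m))) (+ₛ-identityʳ _) }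

 δa : ∀ i f → (lift (δ i) $ (a $ f)) ≈ₕ (a $ (δ i $ f))
 δa i f = ptₙ λ { zero → reflₛ ; (suc j) → *ₛ-cong refl (δ-comm i j f) }

 δA : ∀ i F → (lift (δ i) $ (A $ F)) ≈ₕ (A $ (lift (δ i) $ F))
 δA i F = ptₙ λ m → go m F
  where
  go : ∀ m F → (δ i $ Afn F m) ≈ₛ Afn (lift (δ i) $ F) m
  go zero F = reflₛ
  go (suc m) F = +ₛ-cong (atₙ (δa i (F 0)) (suc m)) (go m (S* $ F))

 B-zero : ∀ F → (∀ j → F (suc j) ≈ₛ 0ₛ) → (B $ F) ≈ₕ 0ₕ
 B-zero F e = ptₙ λ { zero → transₛ (Θ-cong₊ {F} {0ₕ} e) (Lin.zer Θ)
  ; (suc i) → transₛ (Bfn-cong {S* $ F} {0ₕ} (ptₙ e) i) (atₙ (Lin.zer B) i) }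

 B-vac : ∀ f → (B $ (vac $ f)) ≈ₕ 0ₕ
 B-vac f = B-zero (vac $ f) (λ _ → reflₛ)

 drop : ℕ → El H → El H
 drop k F i = F (k ℕ.+ i)

 Bfn-drop : ∀ F i → Bfn F i ≈ₛ (Θ $ drop i F)
 Bfn-drop F zero = reflₛ
 Bfn-drop F (suc i) = Bfn-drop (S* $ F) i

 δB : ∀ i F → (lift (δ i) $ (B $ F)) ≈ₕ ((B $ (lift (δ i) $ F)) +ₕ drop (suc i) F)
 δB i F = ptₙ λ m → go m F
  where
  go : ∀ m F → (δ i $ Bfn F m) ≈ₛ (Bfn (lift (δ i) $ F) m +ₛ F (suc i ℕ.+ m))
  go zero F = transₛ (δΘ i F) (+ₛ-congˡ (reflexiveₛ (P.cong (λ k → F (suc k)) (P.sym (NP.+-identityʳ i)))))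
  go (suc m) F = transₛ (go m (S* $ F)) (+ₛ-congˡ (reflexiveₛ (P.cong (λ k → F (suc k)) (P.sym (NP.+-suc i m)))))

 NS : ∀ F → (N $ (S $ F)) ≈ₕ ((S $ (N $ F)) +ₕ (S $ F))
 NS F = ptₙ λ { zero → pt λ w → trans (zeroʳ _) (sym (+-identityʳ _))
  ; (suc i) → pt λ w → solve 2 (λ n x → (:1 :+ n) :* x := n :* x :+ x) refl (nat i) (fn (F i) w) }

 N-vac : ∀ f → (N $ (vac $ f)) ≈ₕ 0ₕ
 N-vac f = ptₙ λ { zero → *ₛ-zeroˡ f ; (suc i) → *ₛ-zeroʳ _ }

 -- In positive powers of y both A and B commute with S, while the counter N grows by one and yields
 -- b S. The last summand restores the y⁰ component, which S cannot reach.
 LS : ∀ F → (L $ (S $ F)) ≈ₕ (((S $ (L $ F)) +ₕ (b *ₕ (S $ F))) +ₕ (vac $ (bra $ (L $ (S $ F)))))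
 LS F = ptₙ λ
  { zero → pt λ w → sym (trans (+-congʳ (trans (+-congˡ (zeroʳ b)) (+-identityˡ 0#))) (+-identityˡ _))
  ; (suc i) → pt λ w → trans (+-cong (+-cong (at (atₙ (AS F) (suc i)) w) refl) (*-congˡ (at (atₙ (NS F) (suc i)) w)))
    (solve 5 (λ x y c z t → (x :+ y) :+ c :* (z :+ t) := ((x :+ y :+ c :* z) :+ c :* t) :+ :0) refl _ _ b _ _) }

 L-vac : ∀ f → (L $ (vac $ f)) ≈ₕ (a $ f)
 L-vac f = ptₙ λ i → pt λ w → trans (+-cong (+-cong (at (atₙ (A-vac f) i) w) (at (atₙ (B-vac f) i) w)) (*-zeroʳ′ (at (atₙ (N-vac f) i) w)))
  (trans (+-identityʳ _) (+-identityʳ _))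

 bra-L : ∀ F → (bra $ (L $ F)) ≈ₛ (Θ $ F)
 bra-L F = pt λ w → trans (+-cong (+-identityˡ _) (*-zeroʳ′ (zeroˡ _))) (+-identityʳ _)

 module Sums (M : Space) where
  open LeftModule M
  open import Algebra.Properties.CommutativeSemigroup (CommutativeMonoid.commutativeSemigroup +ᴹ-commutativeMonoid) using (interchange)

  sum : {X : Set} → List X → (X → Carrierᴹ) → Carrierᴹ
  sum [] g = 0ᴹ
  sum (x ∷ xs) g = g x +ᴹ sum xs g

  sum-cong : ∀ {X : Set} (xs : List X) {g h} → (∀ x → g x ≈ᴹ h x) → sum xs g ≈ᴹ sum xs h
  sum-cong [] e = ≈ᴹ-refl
  sum-cong (x ∷ xs) e = +ᴹ-cong (e x) (sum-cong xs e)

  sum-zero : ∀ {X : Set} (xs : List X) {g} → (∀ x → g x ≈ᴹ 0ᴹ) → sum xs g ≈ᴹ 0ᴹ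
  sum-zero [] e = ≈ᴹ-refl
  sum-zero (x ∷ xs) e = ≈ᴹ-trans (+ᴹ-cong (e x) (sum-zero xs e)) (+ᴹ-identityˡ _)

  sum-++ : ∀ {X : Set} (xs ys : List X) g → sum (xs ++ ys) g ≈ᴹ (sum xs g +ᴹ sum ys g)
  sum-++ [] ys g = ≈ᴹ-sym (+ᴹ-identityˡ _)
  sum-++ (x ∷ xs) ys g = ≈ᴹ-trans (+ᴹ-congˡ (sum-++ xs ys g)) (≈ᴹ-sym (+ᴹ-assoc _ _ _))

  sum-map : ∀ {X Y : Set} (f : X → Y) (xs : List X) g → sum (map f xs) g ≈ᴹ sum xs (λ x → g (f x))
  sum-map f [] g = ≈ᴹ-refl
  sum-map f (x ∷ xs) g = +ᴹ-congˡ (sum-map f xs g)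

  sum-concatMap : ∀ {X Y : Set} (f : X → List Y) (xs : List X) g → sum (concatMap f xs) g ≈ᴹ sum xs (λ x → sum (f x) g)
  sum-concatMap f [] g = ≈ᴹ-refl
  sum-concatMap f (x ∷ xs) g = ≈ᴹ-trans (sum-++ (f x) (concatMap f xs) g) (+ᴹ-congˡ (sum-concatMap f xs g))

  sum-add : ∀ {X : Set} (xs : List X) g h → sum xs (λ x → g x +ᴹ h x) ≈ᴹ (sum xs g +ᴹ sum xs h)
  sum-add [] g h = ≈ᴹ-sym (+ᴹ-identityˡ _)
  sum-add (x ∷ xs) g h = ≈ᴹ-trans (+ᴹ-congˡ (sum-add xs g h)) (interchange _ _ _ _)

  sum-scal : ∀ {X : Set} c (xs : List X) g → sum xs (λ x → c *ₗ g x) ≈ᴹ (c *ₗ sum xs g)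
  sum-scal c [] g = ≈ᴹ-sym (*ₗ-zeroʳ c)
  sum-scal c (x ∷ xs) g = ≈ᴹ-trans (+ᴹ-congˡ (sum-scal c xs g)) (≈ᴹ-sym (*ₗ-distribˡ c _ _))

 sum-Lin : ∀ {M N} {X : Set} (T : Lin M N) (xs : List X) g → LeftModule._≈ᴹ_ N (T $ Sums.sum M xs g) (Sums.sum N xs (λ x → T $ g x))
 sum-Lin T [] g = Lin.zer T
 sum-Lin {M} {N} T (x ∷ xs) g = LeftModule.≈ᴹ-trans N (Lin.add T _ _) (LeftModule.+ᴹ-congˡ N (sum-Lin T xs g))

 module SV = Sums V
 module SH = Sums H

 module Conv (M : Space) where
  open LeftModule M
  open import Algebra.Properties.CommutativeSemigroup (CommutativeMonoid.commutativeSemigroup +ᴹ-commutativeMonoid) using (interchange)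

  conv : (ℕ → ℕ → Carrierᴹ) → ℕ → Carrierᴹ
  conv G zero = G 0 0
  conv G (suc m) = G 0 (suc m) +ᴹ conv (λ l k → G (suc l) k) m

  conv-cong : ∀ {G G′ : ℕ → ℕ → Carrierᴹ} m → (∀ l k → l ℕ.+ k ≡ m → G l k ≈ᴹ G′ l k) → conv G m ≈ᴹ conv G′ m
  conv-cong zero e = e 0 0 P.refl
  conv-cong (suc m) e = +ᴹ-cong (e 0 (suc m) P.refl) (conv-cong m (λ l k h → e (suc l) k (P.cong suc h)))

  conv-last : ∀ G m → conv G (suc m) ≈ᴹ (conv (λ l k → G l (suc k)) m +ᴹ G (suc m) 0)
  conv-last G zero = ≈ᴹ-refl
  conv-last G (suc m) = ≈ᴹ-trans (+ᴹ-congˡ (conv-last (λ l k → G (suc l) k) m)) (≈ᴹ-sym (+ᴹ-assoc _ _ _))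

  conv-swap : ∀ G m → conv G m ≈ᴹ conv (λ l k → G k l) m
  conv-swap G zero = ≈ᴹ-refl
  conv-swap G (suc m) = ≈ᴹ-trans (+ᴹ-congˡ (conv-swap (λ l k → G (suc l) k) m)) (≈ᴹ-trans (+ᴹ-comm _ _) (≈ᴹ-sym (conv-last (λ l k → G k l) m)))

  conv-add : ∀ G G′ m → conv (λ l k → G l k +ᴹ G′ l k) m ≈ᴹ (conv G m +ᴹ conv G′ m)
  conv-add G G′ zero = ≈ᴹ-refl
  conv-add G G′ (suc m) = ≈ᴹ-trans (+ᴹ-congˡ (conv-add (λ l k → G (suc l) k) (λ l k → G′ (suc l) k) m)) (interchange _ _ _ _)

  conv-scal : ∀ c G m → conv (λ l k → c *ₗ G l k) m ≈ᴹ (c *ₗ conv G m)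
  conv-scal c G zero = ≈ᴹ-refl
  conv-scal c G (suc m) = ≈ᴹ-trans (+ᴹ-congˡ (conv-scal c (λ l k → G (suc l) k) m)) (≈ᴹ-sym (*ₗ-distribˡ c _ _))

 scalars : Space
 scalars = TensorUnit.leftModule

 open Sums scalars public renaming (sum to sumK; sum-cong to sumK-cong; sum-zero to sumK-zero; sum-++ to sumK-++; sum-map to sumK-map; sum-add to sumK-add; sum-scal to sumK-scal) using ()

-- The Laplace-Beltrami operator and its lift to series in y.

module Beltrami (K : Scalars) where
 open Linear K
 open Lax K

 nat-+ : ∀ m n → nat (m ℕ.+ n) ≈ nat m + nat n
 nat-+ zero n = sym (+-identityˡ _)
 nat-+ (suc m) n = trans (+-congˡ (nat-+ m n)) (sym (+-assoc _ _ _))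

 open Conv V public

 conv-Θ : ∀ (G : ℕ → ℕ → El H) m → conv (λ l k → Θ $ G l k) m ≈ₛ (Θ $ (λ j → conv (λ l k → G l k j) m))
 conv-Θ G zero = reflₛ
 conv-Θ G (suc m) = transₛ (+ₛ-congˡ (conv-Θ (λ l k → G (suc l) k) m)) (symₛ (Lin.add Θ _ _))

 A-conv : ∀ F m → Afn F m ≈ₛ conv (λ l k → afn (F l) k) m
 A-conv F zero = reflₛ
 A-conv F (suc m) = +ₛ-congˡ (A-conv (S* $ F) m)

 a-comm : ∀ k l f → afn (afn f k) l ≈ₛ afn (afn f l) k
 a-comm zero zero f = reflₛ
 a-comm zero (suc l) f = pt λ w → zeroʳ _
 a-comm (suc k) zero f = pt λ w → sym (zeroʳ _)
 a-comm (suc k) (suc l) f = pt λ w → trans (*-congˡ (*-congˡ (at (δ-comm l k f) w))) (*-left-comm _ _ _)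

 -- The operators a_k and a_l commute, so the weight l may be averaged with k, and l + k = m.
 ANa : ∀ f m → (nat 2 *ₛ Afn (N $ (a $ f)) m) ≈ₛ (nat m *ₛ Afn (a $ f) m)
 ANa f m = pt λ w → begin
  nat 2 * fn (Afn (N $ (a $ f)) m) w ≈⟨ solve 2 (λ z x → (:1 :+ (:1 :+ :0)) :* x := x :+ x) refl 0# _ ⟩
  fn (Afn (N $ (a $ f)) m) w + fn (Afn (N $ (a $ f)) m) w ≈⟨ +-cong (at (A-conv (N $ (a $ f)) m) w) (at (A-conv (N $ (a $ f)) m) w) ⟩
  fn (conv (λ l k → afn (nat l *ₛ afn f l) k) m) w + fn (conv (λ l k → afn (nat l *ₛ afn f l) k) m) w
   ≈⟨ +-cong (at (conv-cong m (λ l k _ → atₙ (Lin.scal a (nat l) _) k)) w)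
       (at (transₛ (conv-swap _ m) (conv-cong m (λ l k _ → transₛ (atₙ (Lin.scal a (nat k) _) l) (*ₛ-cong refl (a-comm k l f))))) w) ⟩
  fn (conv (λ l k → nat l *ₛ afn (afn f l) k) m) w + fn (conv (λ l k → nat k *ₛ afn (afn f l) k) m) w
   ≈⟨ sym (at (conv-add _ _ m) w) ⟩
  fn (conv (λ l k → (nat l *ₛ afn (afn f l) k) +ₛ (nat k *ₛ afn (afn f l) k)) m) w
   ≈⟨ at (conv-cong m (λ l k h → transₛ (symₛ (*ₛ-distribʳ _ _ _)) (*ₛ-cong (trans (sym (nat-+ l k)) (reflexive (P.cong nat h))) reflₛ))) w ⟩
  fn (conv (λ l k → nat m *ₛ afn (afn f l) k) m) w ≈⟨ at (conv-scal (nat m) _ m) w ⟩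
  nat m * fn (conv (λ l k → afn (afn f l) k) m) w ≈⟨ *-congˡ (sym (at (A-conv (a $ f) m) w)) ⟩
  nat m * fn (Afn (a $ f) m) w ∎

 -- This is 1/(2α), since `inv n` is the inverse of n + 1.
 h : Carrier
 h = inv 1 * α⁻¹

 αh2 : α * h * nat 2 ≈ 1#
 αh2 = trans (solve 4 (λ x i y t → x :* (i :* y) :* t := (y :* x) :* (i :* t)) refl α (inv 1) α⁻¹ (nat 2)) (trans (*-cong α⁻¹*α (inv* 1)) (*-identityˡ 1#))

 tri : ℕ → Carrier
 tri zero = 0#
 tri (suc r) = tri r + nat r

 2tri : ∀ r → nat 2 * tri r ≈ nat r * (nat r - 1#)
 2tri zero = trans (zeroʳ _) (sym (zeroˡ _))
 2tri (suc r) = trans (distribˡ _ _ _) (trans (+-congʳ (2tri r))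
  (solve 1 (λ n → n :* (n :- :1) :+ (:1 :+ (:1 :+ :0)) :* n := (:1 :+ n) :* ((:1 :+ n) :- :1)) refl (nat r)))

 -- `E₀` is the Euler operator Σ j p_j ∂_j, and `D₀` is the Laplace-Beltrami operator, both written
 -- as compressions through Θ and a.
 E₀ D₀ : Lin V V
 E₀ = α⁻¹ ·ˡ (Θ ∘ˡ a)
 D₀ = h ·ˡ (Θ ∘ˡ (L +ˡ ((- b) ·ˡ idˡ)) ∘ˡ a)

 -- `Ê` counts the degree in p and y together. The correction `K₀` is the operator that kills y⁰ and
 -- satisfies [K₀, S] = S L, which makes `D̂` commute with L.
 K₀ Ê D̂ : Lin H H
 K₀ = ((A ∘ˡ N) +ˡ (N ∘ˡ B)) +ˡ (b ·ˡ diag tri)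
 Ê = lift E₀ +ˡ N
 D̂ = lift D₀ +ˡ K₀

 -- The derivative falls either on the coefficients of F or on the factor p_j, and the latter leaves
 -- α j F_j.
 aΘ : ∀ F j → afn (Θ $ F) j ≈ₛ ((Θ $ (λ l → afn (F l) j)) +ₛ ((α * nat j) *ₛ F j))
 aΘ F zero = pt λ w → sym (trans (+-cong (at (Lin.zer Θ) w) (*-zeroˡ′ (zeroʳ α))) (+-identityˡ _))
 aΘ F (suc i) = pt λ w → trans (*-congˡ (at (δΘ i F) w)) (trans (distribˡ _ _ _) (+-congʳ (sym (at (Lin.scal Θ _ (lift (δ i) $ F)) w))))

 δE : ∀ i f → (δ i $ (E₀ $ f)) ≈ₛ ((E₀ $ (δ i $ f)) +ₛ (nat (suc i) *ₛ (δ i $ f)))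
 δE i f = pt λ w → begin
  α⁻¹ * fn (δ i $ (Θ $ (a $ f))) w ≈⟨ *-congˡ (at (δΘ i (a $ f)) w) ⟩
  α⁻¹ * (fn (Θ $ (lift (δ i) $ (a $ f))) w + α * nat (suc i) * fn (δ i $ f) w) ≈⟨ *-congˡ (+-congʳ (at (Lin.cong Θ (δa i f)) w)) ⟩
  α⁻¹ * (fn (Θ $ (a $ (δ i $ f))) w + α * nat (suc i) * fn (δ i $ f) w)
   ≈⟨ solve 5 (λ y t x n d → y :* (t :+ x :* n :* d) := y :* t :+ (y :* x) :* (n :* d)) refl α⁻¹ _ α (nat (suc i)) _ ⟩
  α⁻¹ * fn (Θ $ (a $ (δ i $ f))) w + (α⁻¹ * α) * (nat (suc i) * fn (δ i $ f) w) ≈⟨ +-congˡ (trans (*-congʳ α⁻¹*α) (*-identityˡ _)) ⟩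
  α⁻¹ * fn (Θ $ (a $ (δ i $ f))) w + nat (suc i) * fn (δ i $ f) w ∎

 Ê-a : ∀ f → (Ê $ (a $ f)) ≈ₕ (a $ (E₀ $ f))
 Ê-a f = ptₙ λ
  { zero → pt λ w → trans (+-cong (at (Lin.zer E₀) w) (zeroʳ _)) (+-identityˡ _)
  ; (suc i) → pt λ w → trans (+-congʳ (at (Lin.scal E₀ _ _) w)) (trans
    (solve 4 (λ c e n d → c :* e :+ n :* (c :* d) := c :* (e :+ n :* d)) refl _ _ _ _) (*-congˡ (sym (at (δE i f) w)))) }

 Θ-Ê : ∀ F → (Θ $ (Ê $ F)) ≈ₛ (E₀ $ (Θ $ F))
 Θ-Ê F = pt λ w → begin
  fn (Θ $ (Ê $ F)) w ≈⟨ at (Lin.add Θ (lift E₀ $ F) (N $ F)) w ⟩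
  fn (Θ $ (lift E₀ $ F)) w + fn (Θ $ (N $ F)) w ≈⟨ +-cong (at (Lin.scal Θ α⁻¹ (λ l → Θ $ (a $ F l))) w) (sym (cancelˡ α⁻¹*α)) ⟩
  α⁻¹ * fn (Θ $ (λ l → Θ $ (a $ F l))) w + α⁻¹ * (α * fn (Θ $ (N $ F)) w) ≈⟨ sym (distribˡ _ _ _) ⟩
  α⁻¹ * (fn (Θ $ (λ l → Θ $ (a $ F l))) w + α * fn (Θ $ (N $ F)) w) ≈⟨ *-congˡ (+-cong (at (Θ-swap (λ l → a $ F l)) w) (sym (at (Lin.scal Θ α (N $ F)) w))) ⟩
  α⁻¹ * (fn (Θ $ (λ j → Θ $ (λ l → afn (F l) j))) w + fn (Θ $ (α *ₕ (N $ F))) w) ≈⟨ *-congˡ (sym (at (Lin.add Θ (λ j → Θ $ (λ l → afn (F l) j)) _) w)) ⟩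
  α⁻¹ * fn (Θ $ (λ j → (Θ $ (λ l → afn (F l) j)) +ₛ (α *ₛ (nat j *ₛ F j)))) w
   ≈⟨ *-congˡ (at (Lin.cong Θ (ptₙ λ j → transₛ (+ₛ-congˡ (symₛ (*ₛ-assoc α (nat j) (F j)))) (symₛ (aΘ F j)))) w) ⟩
  α⁻¹ * fn (Θ $ (a $ (Θ $ F))) w ∎

 -- D∂ i f = [∂_{i+1}, D₀] f
 D∂ : ℕ → Sym → Sym
 D∂ i f = h *ₛ ((Afn (a $ f) (suc i) +ₛ (nat 2 *ₛ Bfn (a $ f) (suc i))) +ₛ ((b * nat i) *ₛ afn f (suc i)))

 δD : ∀ i f → (δ i $ (D₀ $ f)) ≈ₛ ((D₀ $ (δ i $ f)) +ₛ D∂ i f)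
 δD i f = pt λ w → begin
  h * fn (δ i $ (Θ $ G f)) w ≈⟨ *-congˡ (at (δΘ i (G f)) w) ⟩
  h * (fn (Θ $ (lift (δ i) $ G f)) w + fn (G f (suc i)) w)
   ≈⟨ *-congˡ (+-congʳ (trans (at (Lin.cong Θ δG) w) (trans (at (Lin.add Θ (G (δ i $ f)) (drop (suc i) (a $ f))) w) (+-congˡ (sym (at (Bfn-drop (a $ f) (suc i)) w)))))) ⟩
  h * ((fn (Θ $ G (δ i $ f)) w + fn (Bfn (a $ f) (suc i)) w)
     + (((fn (Afn (a $ f) (suc i)) w + fn (Bfn (a $ f) (suc i)) w) + b * (nat (suc i) * fn (afn f (suc i)) w)) + - b * fn (afn f (suc i)) w))
   ≈⟨ solve 7 (λ h t x y b n z → h :* ((t :+ y) :+ (((x :+ y) :+ b :* ((:1 :+ n) :* z)) :+ (:- b) :* z))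
       := h :* t :+ h :* ((x :+ (:1 :+ (:1 :+ :0)) :* y) :+ (b :* n) :* z)) refl h _ _ _ b (nat i) _ ⟩
  h * fn (Θ $ G (δ i $ f)) w + h * ((fn (Afn (a $ f) (suc i)) w + nat 2 * fn (Bfn (a $ f) (suc i)) w) + b * nat i * fn (afn f (suc i)) w) ∎
  where
  G : Sym → El H
  G f = (L +ˡ ((- b) ·ˡ idˡ)) $ (a $ f)
  δG : (lift (δ i) $ G f) ≈ₕ (G (δ i $ f) +ₕ drop (suc i) (a $ f))
  δG = ptₙ λ j → pt λ w → trans
   (+-cong (+-cong (+-cong (trans (at (atₙ (δA i (a $ f)) j) w) (at (atₙ (Lin.cong A (δa i f)) j) w))
                (trans (at (atₙ (δB i (a $ f)) j) w) (+-congʳ (at (atₙ (Lin.cong B (δa i f)) j) w))))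
              (*-congˡ (*-congˡ (at (atₙ (δa i f) j) w))))
          (*-congˡ (at (atₙ (δa i f) j) w)))
   (solve 5 (λ x y d n z → ((x :+ (y :+ d)) :+ n) :+ z := (((x :+ y) :+ n) :+ z) :+ d) refl _ _ _ _ _)

 half-tri : ∀ i → α * nat (suc i) * (h * (b * nat i)) ≈ b * tri (suc i)
 half-tri i = begin
  α * nat (suc i) * (h * (b * nat i)) ≈⟨ solve 5 (λ x s h b n → x :* s :* (h :* (b :* n)) := x :* h :* (b :* (s :* n))) refl α (nat (suc i)) h b (nat i) ⟩
  α * h * (b * (nat (suc i) * nat i)) ≈⟨ *-congˡ (*-congˡ (trans (*-congˡ (solve 1 (λ n → n := (:1 :+ n) :- :1) refl (nat i))) (sym (2tri (suc i))))) ⟩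
  α * h * (b * (nat 2 * tri (suc i))) ≈⟨ solve 5 (λ x h b t r → x :* h :* (b :* (t :* r)) := x :* h :* t :* (b :* r)) refl α h b (nat 2) (tri (suc i)) ⟩
  α * h * nat 2 * (b * tri (suc i)) ≈⟨ trans (*-congʳ αh2) (*-identityˡ _) ⟩
  b * tri (suc i) ∎

 -- L leaves y⁰ through a and returns to it through Θ. Intertwining with these two maps is the
 -- boundary condition from which commutation with L will follow.
 D̂-a : ∀ f → (D̂ $ (a $ f)) ≈ₕ (a $ (D₀ $ f))
 D̂-a f = ptₙ λ
  { zero → pt λ w → trans (+-cong (at (Lin.zer D₀) w) (trans (+-cong (trans (+-congˡ (zeroˡ _)) (+-identityʳ 0#)) (*-zeroʳ′ (zeroˡ _))) (+-identityˡ 0#))) (+-identityˡ 0#)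
  ; (suc i) → pt λ w → comp₊ i w }
  where
  comp₊ : ∀ i w → fn ((D̂ $ (a $ f)) (suc i)) w ≈ fn (afn (D₀ $ f) (suc i)) w
  comp₊ i w = let m = nat (suc i) in begin
   fn (D₀ $ ((α * m) *ₛ (δ i $ f))) w + ((fn (Afn (N $ (a $ f)) (suc i)) w + m * fn (Bfn (a $ f) (suc i)) w) + b * (tri (suc i) * fn (afn f (suc i)) w))
    ≈⟨ +-cong (at (Lin.scal D₀ _ _) w) (+-cong (+-congʳ AN) (trans (sym (*-assoc _ _ _)) (*-congʳ (sym (half-tri i))))) ⟩
   α * m * fn (D₀ $ (δ i $ f)) w + ((α * m * (h * fn (Afn (a $ f) (suc i)) w) + m * fn (Bfn (a $ f) (suc i)) w) + α * m * (h * (b * nat i)) * fn (afn f (suc i)) w)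
    ≈⟨ +-congˡ (+-congʳ (+-congˡ (sym (trans (*-congʳ αh2) (*-identityˡ _))))) ⟩
   α * m * fn (D₀ $ (δ i $ f)) w + ((α * m * (h * fn (Afn (a $ f) (suc i)) w) + α * h * nat 2 * (m * fn (Bfn (a $ f) (suc i)) w)) + α * m * (h * (b * nat i)) * fn (afn f (suc i)) w)
    ≈⟨ solve 9 (λ x m d h p t q b z → x :* m :* d :+ ((x :* m :* (h :* p) :+ x :* h :* t :* (m :* q)) :+ x :* m :* (h :* b) :* z)
          := x :* m :* (d :+ h :* ((p :+ t :* q) :+ b :* z))) refl α m _ h _ (nat 2) _ (b * nat i) _ ⟩
   α * m * (fn (D₀ $ (δ i $ f)) w + fn (D∂ i f) w) ≈⟨ *-congˡ (sym (at (δD i f) w)) ⟩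
   α * m * fn (δ i $ (D₀ $ f)) w ∎
   where
   AN : fn (Afn (N $ (a $ f)) (suc i)) w ≈ α * nat (suc i) * (h * fn (Afn (a $ f) (suc i)) w)
   AN = begin
    fn (Afn (N $ (a $ f)) (suc i)) w ≈⟨ sym (trans (*-congʳ αh2) (*-identityˡ _)) ⟩
    α * h * nat 2 * fn (Afn (N $ (a $ f)) (suc i)) w ≈⟨ *-assoc _ _ _ ⟩
    α * h * (nat 2 * fn (Afn (N $ (a $ f)) (suc i)) w) ≈⟨ *-congˡ (at (ANa f (suc i)) w) ⟩
    α * h * (nat (suc i) * fn (Afn (a $ f) (suc i)) w) ≈⟨ solve 4 (λ x h m p → x :* h :* (m :* p) := x :* m :* (h :* p)) refl _ _ _ _ ⟩
    α * nat (suc i) * (h * fn (Afn (a $ f) (suc i)) w) ∎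

 δK : ∀ i F → (lift (δ i) $ (K₀ $ F)) ≈ₕ ((K₀ $ (lift (δ i) $ F)) +ₕ (N $ drop (suc i) F))
 δK i F = ptₙ λ j → pt λ w → trans
  (+-congʳ (+-cong (trans (at (atₙ (δA i (N $ F)) j) w) (at (Afn-cong {lift (δ i) $ (N $ F)} {N $ (lift (δ i) $ F)} (ptₙ λ k → reflₛ) j) w)) (*-congˡ (at (atₙ (δB i F) j) w))))
  (solve 5 (λ x n y d z → (x :+ n :* (y :+ d)) :+ z := ((x :+ n :* y) :+ z) :+ n :* d) refl _ _ _ _ _)

 -- What remains of Θ D̂ = D₀ Θ after differentiating by p_{i+1} and removing the same identity for
 -- the derivative of F. The factors 2 α h = 1 match the quadratic part of D₀ with the linear
 -- corrections in K₀.
 D∂Θ : ∀ i F → (((Θ $ (λ l → D∂ i (F l))) +ₛ (Θ $ (N $ drop (suc i) F))) +ₛ (K₀ $ F) (suc i)) ≈ₛ D∂ i (Θ $ F)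
 D∂Θ i F = pt λ w → sym (begin
  h * ((fn (Afn (a $ (Θ $ F)) m) w + nat 2 * fn (Bfn (a $ (Θ $ F)) m) w) + b * nat i * fn (afn (Θ $ F) m) w)
   ≈⟨ *-congˡ (+-cong (+-cong (at first w) (*-congˡ (at second w))) (*-congˡ (at (aΘ F m) w))) ⟩
  h * (((fn (Θ $ (λ l → Afn (a $ F l) m)) w + nat 2 * (α * fn (Afn (N $ F) m) w))
      + nat 2 * (fn (Θ $ (λ l → Bfn (a $ F l) m)) w + α * (fn (Θ $ (N $ drop m F)) w + nat m * fn (Bfn F m) w)))
     + b * nat i * (fn (Θ $ (λ l → afn (F l) m)) w + α * nat m * fn (F m) w))
   ≈⟨ solve 14 (λ h t x ta an tb tn m bf b i tz fm u →
        h :* (((ta :+ t :* (x :* an)) :+ t :* (tb :+ x :* (tn :+ m :* bf))) :+ b :* i :* (tz :+ x :* m :* fm))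
        := (h :* ((ta :+ t :* tb) :+ b :* i :* tz) :+ (x :* h :* t) :* tn) :+ (((x :* h :* t) :* an :+ (x :* h :* t) :* (m :* bf)) :+ (x :* m :* (h :* (b :* i))) :* fm))
       refl h (nat 2) α _ _ _ _ (nat m) _ b (nat i) _ _ 0# ⟩
  (h * ((fn (Θ $ (λ l → Afn (a $ F l) m)) w + nat 2 * fn (Θ $ (λ l → Bfn (a $ F l) m)) w) + b * nat i * fn (Θ $ (λ l → afn (F l) m)) w) + (α * h * nat 2) * fn (Θ $ (N $ drop m F)) w)
   + (((α * h * nat 2) * fn (Afn (N $ F) m) w + (α * h * nat 2) * (nat m * fn (Bfn F m) w)) + (α * nat m * (h * (b * nat i))) * fn (F m) w)
   ≈⟨ +-cong (+-cong (sym (at ΘD∂ w)) one) (+-cong (+-cong one one) (trans (*-congʳ (half-tri i)) (*-assoc _ _ _))) ⟩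
  (fn (Θ $ (λ l → D∂ i (F l))) w + fn (Θ $ (N $ drop m F)) w) + ((fn (Afn (N $ F) m) w + nat m * fn (Bfn F m) w) + b * (tri m * fn (F m) w)) ∎)
  where
  m = suc i
  one : ∀ {x} → α * h * nat 2 * x ≈ x
  one = trans (*-congʳ αh2) (*-identityˡ _)
  ΘD∂ : (Θ $ (λ l → D∂ i (F l))) ≈ₛ (h *ₛ (((Θ $ (λ l → Afn (a $ F l) m)) +ₛ (nat 2 *ₛ (Θ $ (λ l → Bfn (a $ F l) m)))) +ₛ ((b * nat i) *ₛ (Θ $ (λ l → afn (F l) m)))))
  ΘD∂ = pt λ w → trans (at (Lin.scal Θ h (λ l → (Afn (a $ F l) m +ₛ (nat 2 *ₛ Bfn (a $ F l) m)) +ₛ ((b * nat i) *ₛ afn (F l) m))) w)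
   (*-congˡ (trans (at (Lin.add Θ (λ l → Afn (a $ F l) m +ₛ (nat 2 *ₛ Bfn (a $ F l) m)) (λ l → (b * nat i) *ₛ afn (F l) m)) w)
    (+-cong (trans (at (Lin.add Θ (λ l → Afn (a $ F l) m) (λ l → nat 2 *ₛ Bfn (a $ F l) m)) w) (+-congˡ (at (Lin.scal Θ (nat 2) (λ l → Bfn (a $ F l) m)) w)))
           (at (Lin.scal Θ (b * nat i) (λ l → afn (F l) m)) w))))
  first : Afn (a $ (Θ $ F)) m ≈ₛ ((Θ $ (λ l → Afn (a $ F l) m)) +ₛ (nat 2 *ₛ (α *ₛ Afn (N $ F) m)))
  first = pt λ w → begin
   fn (Afn (a $ (Θ $ F)) m) w ≈⟨ at (transₛ (A-conv (a $ (Θ $ F)) m) (conv-cong m (λ l k _ → inner l k))) w ⟩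
   fn (conv (λ l k → ((Θ $ (λ j → afn (afn (F j) l) k)) +ₛ (α *ₛ (nat k *ₛ afn (F k) l))) +ₛ (α *ₛ afn (nat l *ₛ F l) k)) m) w
    ≈⟨ trans (at (conv-add (λ l k → (Θ $ (λ j → afn (afn (F j) l) k)) +ₛ (α *ₛ (nat k *ₛ afn (F k) l))) (λ l k → α *ₛ afn (nat l *ₛ F l) k) m) w) (+-congʳ (at (conv-add (λ l k → Θ $ (λ j → afn (afn (F j) l) k)) (λ l k → α *ₛ (nat k *ₛ afn (F k) l)) m) w)) ⟩
   (fn (conv (λ l k → Θ $ (λ j → afn (afn (F j) l) k)) m) w + fn (conv (λ l k → α *ₛ (nat k *ₛ afn (F k) l)) m) w) + fn (conv (λ l k → α *ₛ afn (nat l *ₛ F l) k) m) w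
    ≈⟨ +-cong (+-cong (at (transₛ (conv-Θ (λ l k j → afn (afn (F j) l) k) m) (Lin.cong Θ (ptₙ λ j → symₛ (A-conv (a $ F j) m)))) w)
               (at (transₛ (conv-swap (λ l k → α *ₛ (nat k *ₛ afn (F k) l)) m) (transₛ (conv-cong m (λ l k _ → *ₛ-cong (refl {α}) (symₛ (atₙ (Lin.scal a (nat l) (F l)) k)))) αAN)) w))
            (at αAN w) ⟩
   (fn (Θ $ (λ l → Afn (a $ F l) m)) w + α * fn (Afn (N $ F) m) w) + α * fn (Afn (N $ F) m) w
    ≈⟨ solve 2 (λ x y → (x :+ y) :+ y := x :+ (:1 :+ (:1 :+ :0)) :* y) refl _ _ ⟩
   fn (Θ $ (λ l → Afn (a $ F l) m)) w + nat 2 * (α * fn (Afn (N $ F) m) w) ∎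
   where
   αAN : conv (λ l k → α *ₛ afn (nat l *ₛ F l) k) m ≈ₛ (α *ₛ Afn (N $ F) m)
   αAN = transₛ (conv-scal α (λ l k → afn (nat l *ₛ F l) k) m) (*ₛ-cong refl (symₛ (A-conv (N $ F) m)))
   inner : ∀ l k → afn (afn (Θ $ F) l) k ≈ₛ (((Θ $ (λ j → afn (afn (F j) l) k)) +ₛ (α *ₛ (nat k *ₛ afn (F k) l))) +ₛ (α *ₛ afn (nat l *ₛ F l) k))
   inner l k = transₛ (atₙ (Lin.cong a (aΘ F l)) k) (transₛ (atₙ (Lin.add a (Θ $ (λ j → afn (F j) l)) _) k)
    (+ₛ-cong (transₛ (aΘ (λ j → afn (F j) l) k) (+ₛ-congˡ (*ₛ-assoc _ _ _)))
             (transₛ (atₙ (Lin.cong a (*ₛ-assoc α (nat l) (F l))) k) (atₙ (Lin.scal a α _) k))))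
  second : Bfn (a $ (Θ $ F)) m ≈ₛ ((Θ $ (λ l → Bfn (a $ F l) m)) +ₛ (α *ₛ ((Θ $ (N $ drop m F)) +ₛ (nat m *ₛ Bfn F m))))
  second = pt λ w → begin
   fn (Bfn (a $ (Θ $ F)) m) w ≈⟨ at (Bfn-drop (a $ (Θ $ F)) m) w ⟩
   fn (Θ $ drop m (a $ (Θ $ F))) w ≈⟨ at (Lin.cong Θ (ptₙ λ j → transₛ (aΘ F (m ℕ.+ j)) (+ₛ-congˡ (pt λ v → split-nat j v)))) w ⟩
   fn (Θ $ (λ j → (Θ $ (λ l → afn (F l) (m ℕ.+ j))) +ₛ (α *ₛ ((nat j *ₛ F (m ℕ.+ j)) +ₛ (nat m *ₛ F (m ℕ.+ j)))))) w
    ≈⟨ at (Lin.add Θ (λ j → Θ $ (λ l → afn (F l) (m ℕ.+ j))) _) w ⟩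
   fn (Θ $ (λ j → Θ $ (λ l → afn (F l) (m ℕ.+ j)))) w + fn (Θ $ (α *ₕ ((N $ drop m F) +ₕ (nat m *ₕ drop m F)))) w
    ≈⟨ +-cong (trans (at (Θ-swap (λ j l → afn (F l) (m ℕ.+ j))) w) (at (Lin.cong Θ (ptₙ λ l → symₛ (Bfn-drop (a $ F l) m))) w))
         (trans (at (Lin.scal Θ α _) w) (*-congˡ (trans (at (Lin.add Θ (N $ drop m F) _) w) (+-congˡ (trans (at (Lin.scal Θ (nat m) (drop m F)) w) (*-congˡ (sym (at (Bfn-drop F m) w)))))))) ⟩
   fn (Θ $ (λ l → Bfn (a $ F l) m)) w + α * (fn (Θ $ (N $ drop m F)) w + nat m * fn (Bfn F m) w) ∎
   where
   split-nat : ∀ j v → α * nat (m ℕ.+ j) * fn (F (m ℕ.+ j)) v ≈ α * (nat j * fn (F (m ℕ.+ j)) v + nat m * fn (F (m ℕ.+ j)) v)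
   split-nat j v = trans (*-congʳ (*-congˡ (nat-+ m j))) (solve 4 (λ x m j y → x :* (m :+ j) :* y := x :* (j :* y :+ m :* y)) refl α (nat m) (nat j) _)

 -- Induction along the word: both sides vanish at p = 0, and their derivatives agree by `D∂Θ`.
 Θ-D̂ : ∀ F → (Θ $ (D̂ $ F)) ≈ₛ (D₀ $ (Θ $ F))
 Θ-D̂ F = pt λ w → go w F
  where
  go : ∀ w F → fn (Θ $ (D̂ $ F)) w ≈ fn (D₀ $ (Θ $ F)) w
  go [] F = sym (zeroʳ h)
  go (i ∷ w) F = begin
   fn (δ i $ (Θ $ (D̂ $ F))) w ≈⟨ at (δΘ i (D̂ $ F)) w ⟩
   fn (Θ $ (lift (δ i) $ (D̂ $ F))) w + (fn (D₀ $ F (suc i)) w + fn ((K₀ $ F) (suc i)) w)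
    ≈⟨ +-congʳ (trans (at (Lin.cong Θ δD̂) w) (trans (at (Lin.add Θ (D̂ $ (lift (δ i) $ F)) _) w) (+-cong (go w (lift (δ i) $ F)) (at (Lin.add Θ (λ l → D∂ i (F l)) (N $ drop (suc i) F)) w)))) ⟩
   (fn (D₀ $ (Θ $ (lift (δ i) $ F))) w + (fn (Θ $ (λ l → D∂ i (F l))) w + fn (Θ $ (N $ drop (suc i) F)) w)) + (fn (D₀ $ F (suc i)) w + fn ((K₀ $ F) (suc i)) w)
    ≈⟨ solve 5 (λ x y z t k → (x :+ (y :+ z)) :+ (t :+ k) := (x :+ t) :+ ((y :+ z) :+ k)) refl _ _ _ _ _ ⟩
   (fn (D₀ $ (Θ $ (lift (δ i) $ F))) w + fn (D₀ $ F (suc i)) w) + ((fn (Θ $ (λ l → D∂ i (F l))) w + fn (Θ $ (N $ drop (suc i) F)) w) + fn ((K₀ $ F) (suc i)) w)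
    ≈⟨ +-cong (trans (sym (at (Lin.add D₀ (Θ $ (lift (δ i) $ F)) (F (suc i))) w)) (at (Lin.cong D₀ (symₛ (δΘ i F))) w)) (at (D∂Θ i F) w) ⟩
   fn (D₀ $ (δ i $ (Θ $ F))) w + fn (D∂ i (Θ $ F)) w ≈⟨ sym (at (δD i (Θ $ F)) w) ⟩
   fn (δ i $ (D₀ $ (Θ $ F))) w ∎
   where
   δD̂ : (lift (δ i) $ (D̂ $ F)) ≈ₕ ((D̂ $ (lift (δ i) $ F)) +ₕ ((λ l → D∂ i (F l)) +ₕ (N $ drop (suc i) F)))
   δD̂ = ptₙ λ j → pt λ v → trans (+-cong (at (δD i (F j)) v) (at (atₙ (δK i F) j) v))
    (+-interchange _ _ _ _)

-- Operators that commute with L, and multiplication by p₁.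

module LaxCommutation (K : Scalars) where
 open Linear K
 open Lax K
 open Beltrami K

 lift-S : ∀ (T : Lin V V) F → (lift T $ (S $ F)) ≈ₕ (S $ (lift T $ F))
 lift-S T F = ptₙ λ { zero → Lin.zer T ; (suc i) → reflₛ }

 lift-vac : ∀ (T : Lin V V) f → (lift T $ (vac $ f)) ≈ₕ (vac $ (T $ f))
 lift-vac T f = ptₙ λ { zero → reflₛ ; (suc i) → Lin.zer T }

 -- An operator W with [W,S] = SC that is block diagonal for the splitting off of y⁰ commutes with L
 -- as soon as it does so on the boundary.
 commutes-with-L : ∀ (W C : Lin H H) (w : Lin V V) →
  (∀ F → (W $ (S $ F)) ≈ₕ ((S $ (W $ F)) +ₕ (S $ (C $ F)))) →
  (∀ F → (bra $ (W $ F)) ≈ₛ (w $ (bra $ F))) →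
  (∀ f → (W $ (vac $ f)) ≈ₕ (vac $ (w $ f))) →
  (∀ F → (Θ $ (W $ F)) ≈ₛ (w $ (Θ $ F))) →
  (∀ f → (W $ (a $ f)) ≈ₕ (a $ (w $ f))) →
  (∀ F → (L $ (C $ F)) ≈ₕ (C $ (L $ F))) →
  ∀ F → (L $ (W $ F)) ≈ₕ (W $ (L $ F))
 commutes-with-L W C w WS bW Wv ΘW Wa LC F = ptₙ λ i → go i F
  where
  go : ∀ i F → (L $ (W $ F)) i ≈ₛ (W $ (L $ F)) i
  go zero F = transₛ (bra-L (W $ F)) (transₛ (ΘW F) (transₛ (Lin.cong w (symₛ (bra-L F))) (symₛ (bW (L $ F)))))
  -- F is split into its y⁰ part, covered by the hypotheses on a and vac, and a multiple of y, where
  -- `LS` lowers the index to i.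
  go (suc i) F = transₛ (atₙ (decomp (L ∘ˡ W)) (suc i)) (transₛ (+ₛ-cong (atₙ vacpart (suc i)) Spart) (symₛ (atₙ (decomp (W ∘ˡ L)) (suc i))))
   where
   f = bra $ F
   G = S* $ F
   decomp : ∀ (T : Lin H H) → (T $ F) ≈ₕ ((T $ (vac $ f)) +ₕ (T $ (S $ G)))
   decomp T = transₕ (Lin.cong T (split F)) (Lin.add T (vac $ f) (S $ G))
   vacpart : (L $ (W $ (vac $ f))) ≈ₕ (W $ (L $ (vac $ f)))
   vacpart = transₕ (Lin.cong L (Wv f)) (transₕ (L-vac (w $ f)) (transₕ (symₕ (Wa f)) (Lin.cong W (symₕ (L-vac f)))))
   G′ = (W $ G) +ₕ (C $ G)
   Spart : (L $ (W $ (S $ G))) (suc i) ≈ₛ (W $ (L $ (S $ G))) (suc i)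
   Spart = pt λ v → begin
    fn ((L $ (W $ (S $ G))) (suc i)) v ≈⟨ at (atₙ (Lin.cong L (transₕ (WS G) (symₕ (Lin.add S (W $ G) (C $ G))))) (suc i)) v ⟩
    fn ((L $ (S $ G′)) (suc i)) v ≈⟨ at (atₙ (LS G′) (suc i)) v ⟩
    (fn ((L $ G′) i) v + b * (fn ((W $ G) i) v + fn ((C $ G) i) v)) + 0#
     ≈⟨ +-congʳ (+-congʳ (trans (at (atₙ (Lin.add L (W $ G) (C $ G)) i) v) (+-cong (at (go i G) v) (at (atₙ (LC G) i) v)))) ⟩
    ((fn ((W $ (L $ G)) i) v + fn ((C $ (L $ G)) i) v) + b * (fn ((W $ G) i) v + fn ((C $ G) i) v)) + 0#
     ≈⟨ sym (+-congʳ (+-cong (at (atₙ (WS (L $ G)) (suc i)) v) (*-congˡ (at (atₙ (WS G) (suc i)) v)))) ⟩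
    (fn ((W $ (S $ (L $ G))) (suc i)) v + b * fn ((W $ (S $ G)) (suc i)) v) + 0#
     ≈⟨ sym (+-cong (+-congˡ (at (atₙ (Lin.scal W b (S $ G)) (suc i)) v)) (at (atₙ (Wv (bra $ (L $ (S $ G)))) (suc i)) v)) ⟩
    (fn ((W $ (S $ (L $ G))) (suc i)) v + fn ((W $ (b *ₕ (S $ G))) (suc i)) v) + fn ((W $ (vac $ (bra $ (L $ (S $ G))))) (suc i)) v
     ≈⟨ sym (trans (at (atₙ (Lin.add W ((S $ (L $ G)) +ₕ (b *ₕ (S $ G))) (vac $ (bra $ (L $ (S $ G))))) (suc i)) v) (+-congʳ (at (atₙ (Lin.add W (S $ (L $ G)) (b *ₕ (S $ G))) (suc i)) v))) ⟩
    fn ((W $ (((S $ (L $ G)) +ₕ (b *ₕ (S $ G))) +ₕ (vac $ (bra $ (L $ (S $ G)))))) (suc i)) v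
     ≈⟨ sym (at (atₙ (Lin.cong W (LS G)) (suc i)) v) ⟩
    fn ((W $ (L $ (S $ G))) (suc i)) v ∎

 ÊS : ∀ F → (Ê $ (S $ F)) ≈ₕ ((S $ (Ê $ F)) +ₕ (S $ F))
 ÊS F = ptₙ λ i → pt λ w → trans (+-cong (at (atₙ (lift-S E₀ F) i) w) (at (atₙ (NS F) i) w)) (trans (sym (+-assoc _ _ _)) (+-congʳ (sym (at (atₙ (Lin.add S (lift E₀ $ F) (N $ F)) i) w))))

 bra-Ê : ∀ F → (bra $ (Ê $ F)) ≈ₛ (E₀ $ (bra $ F))
 bra-Ê F = pt λ w → trans (+-congˡ (zeroˡ _)) (+-identityʳ _)

 Ê-vac : ∀ f → (Ê $ (vac $ f)) ≈ₕ (vac $ (E₀ $ f))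
 Ê-vac f = ptₙ λ i → pt λ w → trans (+-cong (at (atₙ (lift-vac E₀ f) i) w) (at (atₙ (N-vac f) i) w)) (+-identityʳ _)

 L-Ê : ∀ F → (L $ (Ê $ F)) ≈ₕ (Ê $ (L $ F))
 L-Ê = commutes-with-L Ê idˡ E₀ ÊS bra-Ê Ê-vac Θ-Ê Ê-a (λ F → reflₕ)

 -- Under S the counter N grows by 1 and `tri` grows by N, so A N, N B and b tri contribute A, B and
 -- b N, the three summands of L.
 K₀S : ∀ F i w → fn ((K₀ $ (S $ F)) (suc i)) w ≈ fn ((K₀ $ F) i) w + fn ((L $ F) i) w
 K₀S F i w = begin
  (fn (Afn (N $ (S $ F)) (suc i)) w + nat (suc i) * fn (Bfn F i) w) + b * ((tri i + nat i) * fn (F i) w)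
   ≈⟨ +-congʳ (+-congʳ (at (atₙ (transₕ (Lin.cong A (transₕ (NS F) (symₕ (Lin.add S (N $ F) F)))) (transₕ (AS ((N $ F) +ₕ F)) (Lin.cong S (Lin.add A (N $ F) F)))) (suc i)) w)) ⟩
  ((fn (Afn (N $ F) i) w + fn (Afn F i) w) + nat (suc i) * fn (Bfn F i) w) + b * ((tri i + nat i) * fn (F i) w)
   ≈⟨ solve 7 (λ x y n z b t f → ((x :+ y) :+ (:1 :+ n) :* z) :+ b :* ((t :+ n) :* f) := ((x :+ n :* z) :+ b :* (t :* f)) :+ ((y :+ z) :+ b :* (n :* f))) refl _ _ (nat i) _ b (tri i) _ ⟩
  fn ((K₀ $ F) i) w + fn ((L $ F) i) w ∎

 bra-K₀ : ∀ F → (bra $ (K₀ $ F)) ≈ₛ 0ₛ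
 bra-K₀ F = pt λ w → trans (+-cong (trans (+-identityˡ _) (zeroˡ _)) (*-zeroʳ′ (zeroˡ _))) (+-identityˡ 0#)

 D̂S : ∀ F → (D̂ $ (S $ F)) ≈ₕ ((S $ (D̂ $ F)) +ₕ (S $ (L $ F)))
 D̂S F = ptₙ λ { zero → pt λ w → +-cong (at (Lin.zer D₀) w) (at (bra-K₀ (S $ F)) w)
  ; (suc i) → pt λ w → trans (+-congˡ (K₀S F i w)) (sym (+-assoc _ _ _)) }

 bra-D̂ : ∀ F → (bra $ (D̂ $ F)) ≈ₛ (D₀ $ (bra $ F))
 bra-D̂ F = pt λ w → trans (+-congˡ (at (bra-K₀ F) w)) (+-identityʳ _)

 K₀-vac : ∀ f → (K₀ $ (vac $ f)) ≈ₕ 0ₕ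
 K₀-vac f = ptₙ λ i → pt λ w → trans (+-cong (trans (+-cong (at (atₙ (transₕ (Lin.cong A (N-vac f)) (Lin.zer A)) i) w) (*-zeroʳ′ (at (atₙ (B-vac f) i) w))) (+-identityˡ 0#))
  (*-zeroʳ′ (tri0 i w))) (+-identityˡ 0#)
  where
  tri0 : ∀ i w → tri i * fn ((vac $ f) i) w ≈ 0#
  tri0 zero w = zeroˡ _
  tri0 (suc i) w = zeroʳ _

 D̂-vac : ∀ f → (D̂ $ (vac $ f)) ≈ₕ (vac $ (D₀ $ f))
 D̂-vac f = ptₙ λ i → pt λ w → trans (+-cong (at (atₙ (lift-vac D₀ f) i) w) (at (atₙ (K₀-vac f) i) w)) (+-identityʳ _)

 L-D̂ : ∀ F → (L $ (D̂ $ F)) ≈ₕ (D̂ $ (L $ F))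
 L-D̂ = commutes-with-L D̂ L D₀ D̂S bra-D̂ D̂-vac Θ-D̂ D̂-a (λ F → reflₕ)

 p₁ q₁ : Lin V V
 p₁ = Θ ∘ˡ S ∘ˡ vac
 q₁ = α⁻¹ ·ˡ p₁

 Svac-Θ : ∀ (F : ℕ → Sym) j → (S $ (vac $ (Θ $ F))) j ≈ₛ (Θ $ (λ l → (S $ (vac $ F l)) j))
 Svac-Θ F zero = symₛ (Lin.zer Θ)
 Svac-Θ F (suc zero) = reflₛ
 Svac-Θ F (suc (suc j)) = symₛ (Lin.zer Θ)

 p₁-Θ : ∀ F → (Θ $ (lift p₁ $ F)) ≈ₛ (p₁ $ (Θ $ F))
 p₁-Θ F = transₛ (Θ-swap (λ l → S $ (vac $ F l))) (Lin.cong Θ (ptₙ λ j → symₛ (Svac-Θ F j)))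

 a-p₁ : ∀ f j → afn (p₁ $ f) j ≈ₛ ((p₁ $ afn f j) +ₛ (α *ₛ (S $ (vac $ f)) j))
 a-p₁ f j = transₛ (aΘ (S $ (vac $ f)) j) (+ₛ-cong (Lin.cong Θ (ptₙ l-part)) (j-part j))
  where
  l-part : ∀ l → afn ((S $ (vac $ f)) l) j ≈ₛ (S $ (vac $ afn f j)) l
  l-part zero = atₙ (Lin.zer a) j
  l-part (suc zero) = reflₛ
  l-part (suc (suc l)) = atₙ (Lin.zer a) j
  j-part : ∀ j → ((α * nat j) *ₛ (S $ (vac $ f)) j) ≈ₛ (α *ₛ (S $ (vac $ f)) j)
  j-part zero = pt λ w → trans (zeroʳ _) (sym (zeroʳ _))
  j-part (suc zero) = pt λ w → *-congʳ (trans (*-congˡ (+-identityʳ 1#)) (*-identityʳ α))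
  j-part (suc (suc j)) = pt λ w → trans (zeroʳ _) (sym (zeroʳ _))

 A-p₁ : ∀ F m → Afn (lift p₁ $ F) m ≈ₛ ((p₁ $ Afn F m) +ₛ (α *ₛ (S $ F) m))
 A-p₁ F zero = pt λ w → sym (trans (+-cong (at (Lin.zer p₁) w) (zeroʳ α)) (+-identityʳ 0#))
 A-p₁ F (suc m) = pt λ w → begin
  fn (afn (p₁ $ F 0) (suc m)) w + fn (Afn (lift p₁ $ (S* $ F)) m) w ≈⟨ +-cong (at (a-p₁ (F 0) (suc m)) w) (at (A-p₁ (S* $ F) m) w) ⟩
  (fn (p₁ $ afn (F 0) (suc m)) w + α * fn ((vac $ F 0) m) w) + (fn (p₁ $ Afn (S* $ F) m) w + α * fn ((S $ (S* $ F)) m) w)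
   ≈⟨ solve 5 (λ x c y z t → (x :+ c :* y) :+ (z :+ c :* t) := (x :+ z) :+ c :* (y :+ t)) refl _ α _ _ _ ⟩
  (fn (p₁ $ afn (F 0) (suc m)) w + fn (p₁ $ Afn (S* $ F) m) w) + α * (fn ((vac $ F 0) m) w + fn ((S $ (S* $ F)) m) w)
   ≈⟨ +-cong (sym (at (Lin.add p₁ (afn (F 0) (suc m)) (Afn (S* $ F) m)) w)) (*-congˡ (sym (at (atₙ (split F) m) w))) ⟩
  fn (p₁ $ Afn F (suc m)) w + α * fn (F m) w ∎

 B-p₁ : ∀ F m → Bfn (lift p₁ $ F) m ≈ₛ (p₁ $ Bfn F m)
 B-p₁ F zero = p₁-Θ F
 B-p₁ F (suc m) = B-p₁ (S* $ F) m

 -- Only A differentiates, and p₁ is seen only by its term α y ∂/∂p₁; the commutator is therefore α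
 -- times multiplication by y.
 L-p₁ : ∀ F → (L $ (lift p₁ $ F)) ≈ₕ ((lift p₁ $ (L $ F)) +ₕ (α *ₕ (S $ F)))
 L-p₁ F = ptₙ λ m → pt λ w → begin
  (fn (Afn (lift p₁ $ F) m) w + fn (Bfn (lift p₁ $ F) m) w) + b * (nat m * fn (p₁ $ F m) w)
   ≈⟨ +-cong (+-cong (at (A-p₁ F m) w) (at (B-p₁ F m) w)) (sym (trans (at (Lin.scal p₁ b (nat m *ₛ F m)) w) (*-congˡ (at (Lin.scal p₁ (nat m) (F m)) w)))) ⟩
  ((fn (p₁ $ Afn F m) w + α * fn ((S $ F) m) w) + fn (p₁ $ Bfn F m) w) + fn (p₁ $ (b *ₛ (nat m *ₛ F m))) w
   ≈⟨ solve 4 (λ x y z t → ((x :+ y) :+ z) :+ t := ((x :+ z) :+ t) :+ y) refl _ _ _ _ ⟩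
  ((fn (p₁ $ Afn F m) w + fn (p₁ $ Bfn F m) w) + fn (p₁ $ (b *ₛ (nat m *ₛ F m))) w) + α * fn ((S $ F) m) w
   ≈⟨ +-congʳ (sym (trans (at (Lin.add p₁ (Afn F m +ₛ Bfn F m) (b *ₛ (nat m *ₛ F m))) w) (+-congʳ (at (Lin.add p₁ (Afn F m) (Bfn F m)) w)))) ⟩
  fn (p₁ $ (L $ F) m) w + α * fn ((S $ F) m) w ∎

 L-q₁ : ∀ F → (L $ (lift q₁ $ F)) ≈ₕ ((lift q₁ $ (L $ F)) +ₕ (S $ F))
 L-q₁ F = ptₙ λ m → pt λ w → trans (at (atₙ (Lin.scal L α⁻¹ (lift p₁ $ F)) m) w) (trans (*-congˡ (at (atₙ (L-p₁ F) m) w))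
  (trans (distribˡ _ _ _) (+-congˡ (cancelˡ α⁻¹*α))))

-- Commutator calculus in a noncommutative ring.

module NC (R : Ring 0ℓ 0ℓ) where
 open Ring R
 open import Algebra.Properties.Ring R
 open import Relation.Binary.Reasoning.Setoid setoid
 open import Algebra.Properties.CommutativeSemigroup (CommutativeMonoid.commutativeSemigroup +-commutativeMonoid) using (interchange; x∙yz≈y∙xz; xy∙z≈xz∙y)

 *-zeroʳ′ : ∀ {x y} → y ≈ 0# → x * y ≈ 0#
 *-zeroʳ′ e = trans (*-congˡ e) (zeroʳ _)

 *-zeroˡ′ : ∀ {x y} → x ≈ 0# → x * y ≈ 0#
 *-zeroˡ′ e = trans (*-congʳ e) (zeroˡ _)

 cancelˡ : ∀ {x y z} → x * y ≈ 1# → x * (y * z) ≈ z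
 cancelˡ e = trans (sym (*-assoc _ _ _)) (trans (*-congʳ e) (*-identityˡ _))

 infixl 8 [_,_]
 [_,_] : Carrier → Carrier → Carrier
 [ x , y ] = x * y - y * x

 ad-cong : ∀ {x x′ y y′} → x ≈ x′ → y ≈ y′ → [ x , y ] ≈ [ x′ , y′ ]
 ad-cong e f = +-cong (*-cong e f) (-‿cong (*-cong f e))

 minus-interchange : ∀ x y z w → (x + y) - (z + w) ≈ (x - z) + (y - w)
 minus-interchange x y z w = trans (+-congˡ (sym (-‿+-comm z w))) (interchange x y (- z) (- w))

 ad-+ʳ : ∀ x y z → [ x , y + z ] ≈ [ x , y ] + [ x , z ]
 ad-+ʳ x y z = trans (+-cong (distribˡ x y z) (-‿cong (distribʳ x y z))) (minus-interchange _ _ _ _)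

 ad-+ˡ : ∀ x y z → [ x + y , z ] ≈ [ x , z ] + [ y , z ]
 ad-+ˡ x y z = trans (+-cong (distribʳ z x y) (-‿cong (distribˡ z x y))) (minus-interchange _ _ _ _)

 ad-antisym : ∀ x y → [ x , y ] ≈ - [ y , x ]
 ad-antisym x y = trans (+-comm _ _) (trans (+-congˡ (sym (-‿involutive _))) (-‿+-comm _ _))

 ad-negʳ : ∀ x y → [ x , - y ] ≈ - [ x , y ]
 ad-negʳ x y = trans (+-cong (sym (-‿distribʳ-* x y)) (-‿cong (sym (-‿distribˡ-* y x)))) (-‿+-comm _ _)

 telescope : ∀ x y z → (x - y) + (y - z) ≈ x - z
 telescope x y z = trans (+-assoc x (- y) (y - z)) (+-congˡ (trans (sym (+-assoc (- y) y (- z))) (trans (+-congʳ (-‿inverseˡ y)) (+-identityˡ _))))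

 ad-* : ∀ x y z → [ x , y * z ] ≈ [ x , y ] * z + y * [ x , z ]
 ad-* x y z = sym (begin
  (x * y - y * x) * z + y * (x * z - z * x) ≈⟨ +-cong ([y-z]x≈yx-zx z (x * y) (y * x)) (x[y-z]≈xy-xz y (x * z) (z * x)) ⟩
  (x * y * z - y * x * z) + (y * (x * z) - y * (z * x)) ≈⟨ +-congˡ (+-cong (sym (*-assoc y x z)) (-‿cong (sym (*-assoc y z x)))) ⟩
  (x * y * z - y * x * z) + (y * x * z - y * z * x) ≈⟨ telescope _ _ _ ⟩
  x * y * z - y * z * x ≈⟨ +-congʳ (*-assoc x y z) ⟩
  x * (y * z) - y * z * x ∎)

 jacobi : ∀ x y z → [ x , [ y , z ] ] ≈ [ [ x , y ] , z ] + [ y , [ x , z ] ]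
 jacobi x y z = begin
  [ x , y * z - z * y ] ≈⟨ trans (ad-+ʳ x (y * z) (- (z * y))) (+-congˡ (ad-negʳ x (z * y))) ⟩
  [ x , y * z ] - [ x , z * y ] ≈⟨ +-cong (ad-* x y z) (-‿cong (trans (ad-* x z y) (+-comm _ _))) ⟩
  ([ x , y ] * z + y * [ x , z ]) - (z * [ x , y ] + [ x , z ] * y) ≈⟨ minus-interchange _ _ _ _ ⟩
  [ [ x , y ] , z ] + [ y , [ x , z ] ] ∎

 jacobi′ : ∀ x y z → [ [ x , y ] , z ] ≈ [ x , [ y , z ] ] - [ y , [ x , z ] ]
 jacobi′ x y z = sym (trans (+-congʳ (jacobi x y z)) (trans (+-assoc _ _ _) (trans (+-congˡ (-‿inverseʳ _)) (+-identityʳ _))))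

 comm⇒ad0 : ∀ {x y} → x * y ≈ y * x → [ x , y ] ≈ 0#
 comm⇒ad0 e = trans (+-congʳ e) (-‿inverseʳ _)

 ad0⇒comm : ∀ {x y} → [ x , y ] ≈ 0# → x * y ≈ y * x
 ad0⇒comm {x} {y} e = trans (sym (trans (+-assoc _ _ _) (trans (+-congˡ (-‿inverseˡ _)) (+-identityʳ _)))) (trans (+-congʳ e) (+-identityˡ _))

 ad-def : ∀ {x y z} → x * y ≈ y * x + z → [ x , y ] ≈ z
 ad-def e = trans (+-congʳ e) (trans (+-congʳ (+-comm _ _)) (trans (+-assoc _ _ _) (trans (+-congˡ (-‿inverseʳ _)) (+-identityʳ _))))

 ad-undef : ∀ {x y z} → [ x , y ] ≈ z → x * y ≈ y * x + z
 ad-undef {x} {y} {z} e = trans (sym (trans (+-assoc _ _ _) (trans (+-congˡ (-‿inverseˡ _)) (+-identityʳ _)))) (trans (+-congʳ e) (+-comm _ _))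

 -0-unit : ∀ x → x - 0# ≈ x
 -0-unit x = trans (+-congˡ -0#≈0#) (+-identityʳ x)

 commutes-[] : ∀ {x y z} → [ x , z ] ≈ 0# → [ y , z ] ≈ 0# → [ [ x , y ] , z ] ≈ 0#
 commutes-[] {x} {y} {z} e f = trans (jacobi′ x y z) (trans (+-cong (trans (ad-cong refl f) (ad-0ʳ x)) (-‿cong (trans (ad-cong refl e) (ad-0ʳ y)))) (-0-unit 0#))
  where
  ad-0ʳ : ∀ x → [ x , 0# ] ≈ 0#
  ad-0ʳ x = comm⇒ad0 (trans (zeroʳ x) (sym (zeroˡ x)))

 ad-0 : ∀ x → [ x , 0# ] ≈ 0#
 ad-0 x = comm⇒ad0 (trans (zeroʳ x) (sym (zeroˡ x)))

 num : ℕ → Carrier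
 num zero = 0#
 num (suc n) = 1# + num n

 pow : Carrier → ℕ → Carrier
 pow x zero = 1#
 pow x (suc n) = x * pow x n

 pow-comm : ∀ x n → x * pow x n ≈ pow x n * x
 pow-comm x zero = trans (*-identityʳ x) (sym (*-identityˡ x))
 pow-comm x (suc n) = trans (*-congˡ (pow-comm x n)) (sym (*-assoc _ _ _))

 num-* : ∀ n x → num (suc n) * x ≈ x + num n * x
 num-* n x = trans (distribʳ x 1# (num n)) (+-congʳ (*-identityˡ x))

 num-central : ∀ n x → num n * x ≈ x * num n
 num-central zero x = trans (zeroˡ x) (sym (zeroʳ x))
 num-central (suc n) x = trans (num-* n x) (trans (+-cong (sym (*-identityʳ x)) (num-central n x)) (sym (distribˡ x 1# (num n))))

 central-pull : ∀ {c x} y → c * x ≈ x * c → x * (c * y) ≈ c * (x * y)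
 central-pull y e = trans (sym (*-assoc _ _ _)) (trans (*-congʳ (sym e)) (*-assoc _ _ _))

 ad-centralʳ : ∀ {c x} y → c * x ≈ x * c → [ x , c * y ] ≈ c * [ x , y ]
 ad-centralʳ {c} {x} y e = trans (+-cong (central-pull y e) (-‿cong (*-assoc c y x))) (sym (x[y-z]≈xy-xz c (x * y) (y * x)))

 -- The dictionary: Λ is L + u, S is multiplication by y with left inverse S′, P is the projection
 -- onto y⁰, D is the lifted Laplace-Beltrami operator plus u times the lifted Euler operator, q is
 -- p₁/α, U is u, A is α and r n is 1/(n+1).
 record Relations : Set where
  field
   Λ S S′ P D q U A : Carrier
   r : ℕ → Carrier
   DΛ : D * Λ ≈ Λ * D
   DS : D * S ≈ S * D + S * Λ
   DP : D * P ≈ P * D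
   qΛ : Λ * q ≈ q * Λ + S
   qS : q * S ≈ S * q
   qP : q * P ≈ P * q
   S′S : S′ * S ≈ 1#
   SS′ : S * S′ + P ≈ 1#
   PS : P * S ≈ 0#
   S′P : S′ * P ≈ 0#
   PP : P * P ≈ P
   UΛ : U * Λ ≈ Λ * U
   US : U * S ≈ S * U
   UP : U * P ≈ P * U
   UD : U * D ≈ D * U
   Uq : U * q ≈ q * U
   ΛSP : P * (Λ * (S * P)) ≈ A * (q * P)
   A-central : ∀ x → A * x ≈ x * A
   r-central : ∀ n x → r n * x ≈ x * r n
   r-inv : ∀ n → r n * num (suc n) ≈ 1#

 module Lifts (rel : Relations) where
  open Relations rel

  X : Carrier
  X = S * Λ

  -- B₁ is the lift of the first operator of the family, and Z is the raising operator: bracketing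
  -- with Z leads from each lift to the next.
  B₁ Z : Carrier
  B₁ = [ D , q ]
  Z = [ D , B₁ ]

  [D,Λ] : [ D , Λ ] ≈ 0#
  [D,Λ] = comm⇒ad0 DΛ

  [Λ,D] : [ Λ , D ] ≈ 0#
  [Λ,D] = comm⇒ad0 (sym DΛ)

  [D,S] : [ D , S ] ≈ X
  [D,S] = ad-def DS

  [D,X] : [ D , X ] ≈ X * Λ
  [D,X] = trans (ad-* D S Λ) (trans (+-cong (*-congʳ [D,S]) (*-zeroʳ′ [D,Λ])) (+-identityʳ _))

  [Λ,B₁] : [ Λ , B₁ ] ≈ X
  [Λ,B₁] = trans (jacobi Λ D q) (trans (+-cong (trans (ad-cong [Λ,D] refl) (comm⇒ad0 (trans (zeroˡ q) (sym (zeroʳ q))))) (trans (ad-cong refl (ad-def qΛ)) [D,S])) (+-identityˡ X))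

  [q,X] : [ q , X ] ≈ - (S * S)
  [q,X] = trans (ad-* q S Λ) (trans (+-cong (*-zeroˡ′ (comm⇒ad0 qS)) (trans (*-congˡ (trans (ad-antisym q Λ) (-‿cong (ad-def qΛ)))) (sym (-‿distribʳ-* S S)))) (+-identityˡ _))

  [B₁,S] : [ B₁ , S ] ≈ S * S
  [B₁,S] = trans (jacobi′ D q S) (trans (+-cong (trans (ad-cong refl (comm⇒ad0 qS)) (ad-0 D)) (-‿cong (trans (ad-cong refl [D,S]) [q,X]))) (trans (+-identityˡ _) (-‿involutive _)))

  [B₁,P] : [ B₁ , P ] ≈ 0#
  [B₁,P] = commutes-[] (comm⇒ad0 DP) (comm⇒ad0 qP)

  adX : ∀ {y s l} → [ y , S ] ≈ s → [ Λ , y ] ≈ l → [ y , X ] ≈ s * Λ - S * l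
  adX {y} {s} {l} e f = trans (ad-* y S Λ) (+-cong (*-congʳ e) (trans (*-congˡ (trans (ad-antisym y Λ) (-‿cong f))) (sym (-‿distribʳ-* S l))))

  [B₁,X] : [ B₁ , X ] ≈ 0#
  [B₁,X] = trans (adX [B₁,S] [Λ,B₁]) (trans (+-congʳ (*-assoc S S Λ)) (-‿inverseʳ _))

  [Λ,Z] : [ Λ , Z ] ≈ X * Λ
  [Λ,Z] = trans (jacobi Λ D B₁) (trans (+-cong (trans (ad-cong [Λ,D] refl) (comm⇒ad0 (trans (zeroˡ B₁) (sym (zeroʳ B₁))))) (trans (ad-cong refl [Λ,B₁]) [D,X])) (+-identityˡ _))

  [Z,S] : [ Z , S ] ≈ X * S + S * X
  [Z,S] = trans (jacobi′ D B₁ S) (trans (+-cong (trans (ad-cong refl [B₁,S]) (trans (ad-* D S S) (+-cong (*-congʳ [D,S]) (*-congˡ [D,S])))) (-‿cong (trans (ad-cong refl [D,S]) [B₁,X]))) (-0-unit _))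

  [Z,X] : [ Z , X ] ≈ X * X
  [Z,X] = trans (adX [Z,S] [Λ,Z]) (trans (+-cong (distribʳ Λ (X * S) (S * X)) (-‿cong (sym (*-assoc S X Λ))))
   (trans (+-assoc _ _ _) (trans (+-congˡ (-‿inverseʳ _)) (trans (+-identityʳ _) (*-assoc X S Λ)))))

  [Z,P] : [ Z , P ] ≈ 0#
  [Z,P] = commutes-[] (comm⇒ad0 DP) [B₁,P]

  -- Since [Z , X] = X², bracketing with Z acts on powers of X as the derivation X² d/dX.
  [Z,Xⁿ] : ∀ n → [ Z , pow X n ] ≈ num n * pow X (suc n)
  [Z,Xⁿ] zero = trans (comm⇒ad0 (trans (*-identityʳ Z) (sym (*-identityˡ Z)))) (sym (zeroˡ _))
  [Z,Xⁿ] (suc n) = begin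
   [ Z , X * pow X n ] ≈⟨ ad-* Z X (pow X n) ⟩
   [ Z , X ] * pow X n + X * [ Z , pow X n ] ≈⟨ +-cong (trans (*-congʳ [Z,X]) (*-assoc _ _ _)) (trans (*-congˡ ([Z,Xⁿ] n)) (central-pull _ (num-central n X))) ⟩
   X * (X * pow X n) + num n * (X * (X * pow X n)) ≈⟨ sym (num-* n _) ⟩
   num (suc n) * (X * (X * pow X n)) ∎

  -- lifts B̂_{n+1} of the operators B_{n+1}(u)
  B̂ : ℕ → Carrier
  B̂ zero = B₁
  B̂ (suc n) = r n * [ Z , B̂ n ]

  [B̂,P] : ∀ n → [ B̂ n , P ] ≈ 0#
  [B̂,P] zero = [B₁,P]
  [B̂,P] (suc n) = trans (ad-antisym _ _) (trans (-‿cong (trans (ad-centralʳ _ (r-central n P)) (*-zeroʳ′ (trans (ad-antisym _ _) (trans (-‿cong (commutes-[] [Z,P] ([B̂,P] n))) -0#≈0#))))) -0#≈0#)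

  cancel-r : ∀ n x → r n * (num (suc n) * x) ≈ x
  cancel-r n x = cancelˡ (r-inv n)

  -- Proved together with `[B̂,S]`, because the Jacobi identity for [Z , B̂ n] also involves
  -- [B̂ n , X], in which the contributions of the two formulas cancel.
  [Λ,B̂] : ∀ n → [ Λ , B̂ n ] ≈ num (suc n) * pow X (suc n)
  [B̂,S] : ∀ n → [ B̂ n , S ] ≈ num (suc n) * (S * (pow X n * S))

  [B̂,X] : ∀ n → [ B̂ n , X ] ≈ 0#
  [B̂,X] n = trans (adX ([B̂,S] n) ([Λ,B̂] n)) (trans (+-cong (trans (*-assoc _ _ _) (*-congˡ (trans (*-assoc _ _ _) (*-congˡ (trans (*-assoc _ _ _) (sym (pow-comm X n)))))))
   (-‿cong (central-pull _ (num-central (suc n) S)))) (-‿inverseʳ _))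

  [Λ,B̂] zero = trans [Λ,B₁] (sym (trans (*-congʳ (+-identityʳ 1#)) (trans (*-identityˡ _) (*-identityʳ X))))
  [Λ,B̂] (suc n) = begin
   [ Λ , r n * [ Z , B̂ n ] ] ≈⟨ ad-centralʳ _ (r-central n Λ) ⟩
   r n * [ Λ , [ Z , B̂ n ] ] ≈⟨ *-congˡ (jacobi Λ Z (B̂ n)) ⟩
   r n * ([ [ Λ , Z ] , B̂ n ] + [ Z , [ Λ , B̂ n ] ]) ≈⟨ *-congˡ (+-cong first second) ⟩
   r n * (num (suc n) * pow X (suc (suc n)) + num (suc n) * (num (suc n) * pow X (suc (suc n)))) ≈⟨ *-congˡ (sym (distribˡ _ _ _)) ⟩
   r n * (num (suc n) * (pow X (suc (suc n)) + num (suc n) * pow X (suc (suc n)))) ≈⟨ cancel-r n _ ⟩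
   pow X (suc (suc n)) + num (suc n) * pow X (suc (suc n)) ≈⟨ sym (num-* (suc n) _) ⟩
   num (suc (suc n)) * pow X (suc (suc n)) ∎
   where
   first : [ [ Λ , Z ] , B̂ n ] ≈ num (suc n) * pow X (suc (suc n))
   first = begin
    [ [ Λ , Z ] , B̂ n ] ≈⟨ ad-cong [Λ,Z] refl ⟩
    [ X * Λ , B̂ n ] ≈⟨ trans (ad-antisym _ _) (-‿cong (ad-* (B̂ n) X Λ)) ⟩
    - ([ B̂ n , X ] * Λ + X * [ B̂ n , Λ ]) ≈⟨ -‿cong (+-cong (*-zeroˡ′ ([B̂,X] n)) (*-congˡ (trans (ad-antisym _ _) (-‿cong ([Λ,B̂] n))))) ⟩
    - (0# + X * - (num (suc n) * pow X (suc n))) ≈⟨ trans (-‿cong (trans (+-identityˡ _) (sym (-‿distribʳ-* _ _)))) (-‿involutive _) ⟩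
    X * (num (suc n) * pow X (suc n)) ≈⟨ central-pull _ (num-central (suc n) X) ⟩
    num (suc n) * pow X (suc (suc n)) ∎
   second : [ Z , [ Λ , B̂ n ] ] ≈ num (suc n) * (num (suc n) * pow X (suc (suc n)))
   second = trans (ad-cong refl ([Λ,B̂] n)) (trans (ad-centralʳ _ (num-central (suc n) Z)) (*-congˡ ([Z,Xⁿ] (suc n))))

  [B̂,S] zero = trans [B₁,S] (sym (trans (*-congʳ (+-identityʳ 1#)) (trans (*-identityˡ _) (*-congˡ (*-identityˡ S)))))
  [B̂,S] (suc n) = begin
   [ r n * [ Z , B̂ n ] , S ] ≈⟨ trans (ad-antisym _ _) (trans (-‿cong (ad-centralʳ _ (r-central n S))) (trans (-‿distribʳ-* _ _) (*-congˡ (sym (ad-antisym _ _))))) ⟩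
   r n * [ [ Z , B̂ n ] , S ] ≈⟨ *-congˡ (jacobi′ Z (B̂ n) S) ⟩
   r n * ([ Z , [ B̂ n , S ] ] - [ B̂ n , [ Z , S ] ]) ≈⟨ *-congˡ (+-cong first (-‿cong second)) ⟩
   r n * (N₁ * ((A₁ + A₂) + (num n * M + M + A₃)) - N₁ * (A₁ + A₃)) ≈⟨ *-congˡ (sym (x[y-z]≈xy-xz N₁ _ _)) ⟩
   r n * (N₁ * (((A₁ + A₂) + (num n * M + M + A₃)) - (A₁ + A₃))) ≈⟨ cancel-r n _ ⟩
   ((A₁ + A₂) + (num n * M + M + A₃)) - (A₁ + A₃) ≈⟨ +-congʳ (trans (+-assoc _ _ _) (+-congˡ (trans (sym (+-assoc _ _ _)) refl))) ⟩
   (A₁ + ((A₂ + (num n * M + M)) + A₃)) - (A₁ + A₃) ≈⟨ +-congʳ (x∙yz≈y∙xz A₁ _ A₃) ⟩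
   ((A₂ + (num n * M + M)) + (A₁ + A₃)) - (A₁ + A₃) ≈⟨ trans (+-assoc _ _ _) (trans (+-congˡ (-‿inverseʳ _)) (+-identityʳ _)) ⟩
   A₂ + (num n * M + M) ≈⟨ +-cong A₂≈M (trans (+-comm _ _) (sym (num-* n M))) ⟩
   M + num (suc n) * M ≈⟨ sym (num-* (suc n) M) ⟩
   num (suc (suc n)) * M ∎
   where
   N₁ = num (suc n)
   M = S * (pow X (suc n) * S)
   A₁ = (X * S) * (pow X n * S)
   A₂ = (S * X) * (pow X n * S)
   A₃ = S * (pow X n * (S * X))
   A₂≈M : A₂ ≈ M
   A₂≈M = trans (*-assoc _ _ _) (*-congˡ (sym (*-assoc _ _ _)))
   first : [ Z , [ B̂ n , S ] ] ≈ N₁ * ((A₁ + A₂) + (num n * M + M + A₃))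
   first = begin
    [ Z , [ B̂ n , S ] ] ≈⟨ trans (ad-cong refl ([B̂,S] n)) (ad-centralʳ _ (num-central (suc n) Z)) ⟩
    N₁ * [ Z , S * (pow X n * S) ] ≈⟨ *-congˡ (trans (ad-* Z S _) (+-cong (trans (*-congʳ [Z,S]) (distribʳ _ _ _)) (*-congˡ (ad-* Z (pow X n) S)))) ⟩
    N₁ * ((A₁ + A₂) + S * ([ Z , pow X n ] * S + pow X n * [ Z , S ]))
     ≈⟨ *-congˡ (+-congˡ (trans (distribˡ S _ _) (trans (+-cong (trans (*-congˡ (trans (*-congʳ ([Z,Xⁿ] n)) (*-assoc _ _ _))) (central-pull _ (num-central n S)))
       (trans (*-congˡ (trans (*-congˡ [Z,S]) (trans (distribˡ _ _ _) (+-congʳ (trans (sym (*-assoc _ _ _)) (*-congʳ (sym (pow-comm X n)))))))) (distribˡ S _ _))) (sym (+-assoc _ _ _))))) ⟩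
    N₁ * ((A₁ + A₂) + (num n * M + M + A₃)) ∎
   second : [ B̂ n , [ Z , S ] ] ≈ N₁ * (A₁ + A₃)
   second = begin
    [ B̂ n , [ Z , S ] ] ≈⟨ trans (ad-cong refl [Z,S]) (ad-+ʳ _ _ _) ⟩
    [ B̂ n , X * S ] + [ B̂ n , S * X ] ≈⟨ +-cong (trans (ad-* _ X S) (+-cong (*-zeroˡ′ ([B̂,X] n)) (*-congˡ ([B̂,S] n)))) (trans (ad-* _ S X) (+-cong (*-congʳ ([B̂,S] n)) (*-zeroʳ′ ([B̂,X] n)))) ⟩
    (0# + X * (N₁ * (S * (pow X n * S)))) + (N₁ * (S * (pow X n * S)) * X + 0#)
     ≈⟨ +-cong (trans (+-identityˡ _) (trans (central-pull _ (num-central (suc n) X)) (*-congˡ (sym (*-assoc _ _ _)))))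
       (trans (+-identityʳ _) (trans (*-assoc _ _ _) (*-congˡ (trans (*-assoc _ _ _) (*-congˡ (*-assoc _ _ _)))))) ⟩
    N₁ * A₁ + N₁ * A₃ ≈⟨ sym (distribˡ _ _ _) ⟩
    N₁ * (A₁ + A₃) ∎

  -- Obtained by multiplying [B̂ n , S] with S′ on both sides. The defect P of S S′ = 1 - P drops
  -- out since B̂ n commutes with P and S′ P = 0.
  [S′,B̂] : ∀ n → [ S′ , B̂ n ] ≈ num (suc n) * (pow X n * (S * S′))
  [S′,B̂] n = sym (begin
   num (suc n) * (pow X n * (S * S′)) ≈⟨ sym (trans (*-congʳ (trans (*-congˡ ([B̂,S] n)) (central-pull _ (num-central (suc n) S′)))) (trans (*-assoc _ _ _) (*-congˡ (trans (*-congʳ (trans (sym (*-assoc S′ S _)) (trans (*-congʳ S′S) (*-identityˡ _)))) (*-assoc _ _ _))))) ⟩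
   S′ * [ B̂ n , S ] * S′ ≈⟨ trans (*-congʳ (x[y-z]≈xy-xz S′ _ _)) ([y-z]x≈yx-zx S′ _ _) ⟩
   S′ * (B̂ n * S) * S′ - S′ * (S * B̂ n) * S′ ≈⟨ +-cong (trans (*-congʳ (sym (*-assoc _ _ _))) (trans (*-assoc _ _ _) (*-congˡ SS′≈))) (-‿cong (*-congʳ (cancelˡ S′S))) ⟩
   S′ * B̂ n * (1# - P) - B̂ n * S′ ≈⟨ +-congʳ (trans (x[y-z]≈xy-xz _ 1# P) (trans (+-cong (*-identityʳ _) (-‿cong BP0)) (-0-unit _))) ⟩
   S′ * B̂ n - B̂ n * S′ ∎)
   where
   SS′≈ : S * S′ ≈ 1# - P
   SS′≈ = trans (sym (trans (+-assoc _ _ _) (trans (+-congˡ (-‿inverseʳ P)) (+-identityʳ _)))) (+-congʳ SS′)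
   BP0 : S′ * B̂ n * P ≈ 0#
   BP0 = trans (*-assoc _ _ _) (trans (*-congˡ (ad0⇒comm ([B̂,P] n))) (trans (sym (*-assoc _ _ _)) (*-zeroˡ′ S′P)))

  PX : P * X ≈ 0#
  PX = trans (sym (*-assoc P S Λ)) (*-zeroˡ′ PS)

  -- On y⁰ this is α times the Euler operator, up to the central u², so a commutator with it
  -- measures the degree.
  I : Carrier
  I = P * (Λ * (Λ * P))

  -- Compressing to the range of P: ad I y = P (ad Λ² y) P for y commuting with P.
  ad-I : ∀ {y} → [ y , P ] ≈ 0# → [ I , y ] ≈ P * ((Λ * [ Λ , y ] + [ Λ , y ] * Λ) * P)
  ad-I {y} e = begin
   [ P * (Λ * (Λ * P)) , y ] ≈⟨ trans (ad-antisym _ y) (-‿cong (trans (ad-* y P _) (trans (+-cong (*-zeroˡ′ e) (*-congˡ (trans (ad-cong refl (sym (*-assoc Λ Λ P))) (ad-* y (Λ * Λ) P)))) (+-identityˡ _)))) ⟩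
   - (P * ([ y , Λ * Λ ] * P + Λ * Λ * [ y , P ])) ≈⟨ -‿cong (*-congˡ (trans (+-congˡ (*-zeroʳ′ e)) (+-identityʳ _))) ⟩
   - (P * ([ y , Λ * Λ ] * P)) ≈⟨ trans (-‿distribʳ-* _ _) (*-congˡ (trans (-‿distribˡ-* _ _) (*-congʳ (sym (ad-antisym (Λ * Λ) y))))) ⟩
   P * ([ Λ * Λ , y ] * P) ≈⟨ *-congˡ (*-congʳ (trans (ad-antisym _ y) (trans (-‿cong (ad-* y Λ Λ)) (trans (sym (-‿+-comm _ _)) (trans (+-cong (trans (-‿distribˡ-* _ _) (*-congʳ (sym (ad-antisym Λ y)))) (trans (-‿distribʳ-* _ _) (*-congˡ (sym (ad-antisym Λ y))))) (+-comm _ _)))))) ⟩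
   P * ((Λ * [ Λ , y ] + [ Λ , y ] * Λ) * P) ∎

  [I,D] : [ I , D ] ≈ 0#
  [I,D] = trans (ad-I (comm⇒ad0 DP)) (*-zeroʳ′ (*-zeroˡ′ (trans (+-cong (*-zeroʳ′ [Λ,D]) (*-zeroˡ′ [Λ,D])) (+-identityʳ 0#))))

  [I,q] : [ I , q ] ≈ A * (q * P)
  [I,q] = trans (ad-I (comm⇒ad0 qP)) (trans (*-congˡ (trans (*-congʳ (+-cong (*-congˡ (ad-def qΛ)) (*-congʳ (ad-def qΛ)))) (distribʳ P _ _)))
   (trans (distribˡ P _ _) (trans (+-cong (trans (*-congˡ (*-assoc Λ S P)) ΛSP) (trans (sym (*-assoc P X P)) (*-zeroˡ′ PX))) (+-identityʳ _))))

  -- degrees: y has degree d when [I,y] = A d y P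
  bracket-degree : ∀ {x y c d} → (∀ z → c * z ≈ z * c) → (∀ z → d * z ≈ z * d) → [ x , P ] ≈ 0# → [ y , P ] ≈ 0# →
   [ I , x ] ≈ A * (c * (x * P)) → [ I , y ] ≈ A * (d * (y * P)) → [ I , [ x , y ] ] ≈ A * ((c + d) * ([ x , y ] * P))
  bracket-degree {x} {y} {c} {d} cc dc xP yP ex ey = begin
   [ I , [ x , y ] ] ≈⟨ jacobi I x y ⟩
   [ [ I , x ] , y ] + [ x , [ I , y ] ] ≈⟨ +-cong (trans (ad-antisym _ y) (-‿cong (trans (ad-cong refl ex) (trans (ad-centralʳ _ (A-central y)) (*-congˡ (trans (ad-centralʳ _ (cc y)) (*-congˡ (times-P x yP))))))))
      (trans (ad-cong refl ey) (trans (ad-centralʳ _ (A-central x)) (*-congˡ (trans (ad-centralʳ _ (dc x)) (*-congˡ (times-P y xP)))))) ⟩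
   - (A * (c * ([ y , x ] * P))) + A * (d * ([ x , y ] * P))
    ≈⟨ +-congʳ (trans (-‿distribʳ-* _ _) (*-congˡ (trans (-‿distribʳ-* _ _) (*-congˡ (trans (-‿distribˡ-* _ _) (*-congʳ (sym (ad-antisym x y)))))))) ⟩
   A * (c * ([ x , y ] * P)) + A * (d * ([ x , y ] * P)) ≈⟨ sym (distribˡ A _ _) ⟩
   A * (c * ([ x , y ] * P) + d * ([ x , y ] * P)) ≈⟨ *-congˡ (sym (distribʳ _ c d)) ⟩
   A * ((c + d) * ([ x , y ] * P)) ∎
   where
   times-P : ∀ {x} y → [ x , P ] ≈ 0# → [ x , y * P ] ≈ [ x , y ] * P
   times-P {x} y e = trans (ad-* x y P) (trans (+-congˡ (*-zeroʳ′ e)) (+-identityʳ _))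

  0-central : ∀ z → 0# * z ≈ z * 0#
  0-central z = trans (zeroˡ z) (sym (zeroʳ z))

  1-central : ∀ z → 1# * z ≈ z * 1#
  1-central z = trans (*-identityˡ z) (sym (*-identityʳ z))

  degree-D : [ I , D ] ≈ A * (0# * (D * P))
  degree-D = trans [I,D] (sym (*-zeroʳ′ (zeroˡ _)))

  degree-B₁ : [ I , B₁ ] ≈ A * (1# * (B₁ * P))
  degree-B₁ = trans (bracket-degree 0-central 1-central (comm⇒ad0 DP) (comm⇒ad0 qP) degree-D (trans [I,q] (*-congˡ (sym (*-identityˡ _))))) (*-congˡ (*-congʳ (+-identityˡ 1#)))

  degree-Z : [ I , Z ] ≈ A * (1# * (Z * P))
  degree-Z = trans (bracket-degree 0-central 1-central (comm⇒ad0 DP) [B₁,P] degree-D degree-B₁) (*-congˡ (*-congʳ (+-identityˡ 1#)))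

  degree-B̂ : ∀ n → [ I , B̂ n ] ≈ A * (num (suc n) * (B̂ n * P))
  degree-B̂ zero = trans degree-B₁ (*-congˡ (*-congʳ (sym (+-identityʳ 1#))))
  degree-B̂ (suc n) = trans (ad-centralʳ _ (r-central n I)) (trans (*-congˡ (bracket-degree 1-central (num-central (suc n)) [Z,P] ([B̂,P] n) degree-Z (degree-B̂ n)))
   (trans (central-pull′ A) (*-congˡ (trans (central-pull′ (num (suc (suc n)))) (*-congˡ (sym (*-assoc _ _ _)))))))
   where
   central-pull′ : ∀ c {y} → r n * (c * y) ≈ c * (r n * y)
   central-pull′ c {y} = trans (sym (*-assoc _ _ _)) (trans (*-congʳ (r-central n c)) (*-assoc _ _ _))

  -- [I , B̂ n] is computed twice: as a degree, which gives n + 1 times the left side, and through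
  -- [Λ , B̂ n], which gives n + 1 times the right side. Thus the abstract lift restricts to the
  -- given operator on y⁰.
  B̂-formula : ∀ n → A * (B̂ n * P) ≈ P * (Λ * (pow X (suc n) * P))
  B̂-formula n = trans (sym (cancel-r n _)) (trans (*-congˡ eq) (cancel-r n _))
   where
   eq : num (suc n) * (A * (B̂ n * P)) ≈ num (suc n) * (P * (Λ * (pow X (suc n) * P)))
   eq = begin
    num (suc n) * (A * (B̂ n * P)) ≈⟨ trans (sym (*-assoc _ _ _)) (trans (*-congʳ (num-central (suc n) A)) (*-assoc _ _ _)) ⟩
    A * (num (suc n) * (B̂ n * P)) ≈⟨ sym (degree-B̂ n) ⟩
    [ I , B̂ n ] ≈⟨ ad-I ([B̂,P] n) ⟩
    P * ((Λ * [ Λ , B̂ n ] + [ Λ , B̂ n ] * Λ) * P) ≈⟨ trans (*-congˡ (distribʳ P _ _)) (distribˡ P _ _) ⟩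
    P * (Λ * [ Λ , B̂ n ] * P) + P * ([ Λ , B̂ n ] * Λ * P)
     ≈⟨ +-cong (*-congˡ (trans (*-congʳ (trans (*-congˡ ([Λ,B̂] n)) (central-pull _ (num-central (suc n) Λ)))) (trans (*-assoc _ _ _) (*-congˡ (*-assoc _ _ _)))))
       (trans (sym (*-assoc P _ P)) (*-zeroˡ′ (trans (sym (*-assoc P _ Λ)) (*-zeroˡ′ (trans (*-congˡ ([Λ,B̂] n)) (trans (central-pull _ (num-central (suc n) P)) (*-zeroʳ′ (trans (sym (*-assoc P X _)) (*-zeroˡ′ PX))))))))) ⟩
    P * (num (suc n) * (Λ * (pow X (suc n) * P))) + 0# ≈⟨ trans (+-identityʳ _) (central-pull _ (num-central (suc n) P)) ⟩
    num (suc n) * (P * (Λ * (pow X (suc n) * P))) ∎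

  U-commutes : ∀ {x y} → [ U , x ] ≈ 0# → [ U , y ] ≈ 0# → [ U , [ x , y ] ] ≈ 0#
  U-commutes {x} {y} e f = trans (ad-antisym _ _) (trans (-‿cong (commutes-[] (trans (ad-antisym _ _) (trans (-‿cong e) -0#≈0#)) (trans (ad-antisym _ _) (trans (-‿cong f) -0#≈0#)))) -0#≈0#)

  [U,B₁] : [ U , B₁ ] ≈ 0#
  [U,B₁] = U-commutes (comm⇒ad0 UD) (comm⇒ad0 Uq)

  [U,B̂] : ∀ n → [ U , B̂ n ] ≈ 0#
  [U,B̂] zero = [U,B₁]
  [U,B̂] (suc n) = trans (ad-centralʳ _ (r-central n U)) (*-zeroʳ′ (U-commutes (U-commutes (comm⇒ad0 UD) [U,B₁]) ([U,B̂] n)))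

  sgn : ℕ → Carrier
  sgn zero = 1#
  sgn (suc n) = - sgn n

  sgn-central : ∀ n x → sgn n * x ≈ x * sgn n
  sgn-central zero x = 1-central x
  sgn-central (suc n) x = trans (sym (-‿distribˡ-* _ _)) (trans (-‿cong (sgn-central n x)) (-‿distribʳ-* _ _))

  -- Truncations at t = -1: B n is Σ (-1)^i/i times the lift of B_i over 1 ≤ i ≤ n (`B̂ i` lifts
  -- B_{i+1}), v n is the geometric series of -X, and ε n = (-X)^n is the first neglected term.
  B v ε : ℕ → Carrier
  B zero = 0#
  B (suc n) = B n + sgn (suc n) * (r n * B̂ n)
  v zero = 0#
  v (suc n) = v n + sgn n * pow X n
  ε n = sgn n * pow X n

  [B,P] : ∀ n → [ P , B n ] ≈ 0#
  [B,P] zero = ad-0 P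
  [B,P] (suc n) = trans (ad-+ʳ P _ _) (trans (+-cong ([B,P] n) (trans (ad-centralʳ _ (sgn-central (suc n) P)) (*-zeroʳ′ (trans (ad-centralʳ _ (r-central n P))
   (*-zeroʳ′ (trans (ad-antisym _ _) (trans (-‿cong ([B̂,P] n)) -0#≈0#))))))) (+-identityʳ 0#))

  [U,B] : ∀ n → [ U , B n ] ≈ 0#
  [U,B] zero = ad-0 U
  [U,B] (suc n) = trans (ad-+ʳ U _ _) (trans (+-cong ([U,B] n) (trans (ad-centralʳ _ (sgn-central (suc n) U)) (*-zeroʳ′ (trans (ad-centralʳ _ (r-central n U))
   (*-zeroʳ′ ([U,B̂] n)))))) (+-identityʳ 0#))

  SS′≈1-P : S * S′ ≈ 1# - P
  SS′≈1-P = trans (sym (trans (+-assoc _ _ _) (trans (+-congˡ (-‿inverseʳ P)) (+-identityʳ _)))) (+-congʳ SS′)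

  -- The summands X^{i+1} + X^i with alternating signs telescope to -1 + ε n. The projection in S S′
  -- = 1 - P leaves each X^i P once, and these add up to v n P.
  [Λ+S′,B] : ∀ n → [ Λ + S′ , B n ] ≈ (- 1# + ε n) + v n * P
  [Λ+S′,B] zero = trans (ad-0 _) (sym (trans (+-cong (trans (+-congˡ (*-identityˡ 1#)) (-‿inverseˡ 1#)) (zeroˡ P)) (+-identityʳ 0#)))
  [Λ+S′,B] (suc n) = begin
   [ Λ + S′ , B n + sgn (suc n) * (r n * B̂ n) ] ≈⟨ trans (ad-+ʳ _ _ _) (+-cong ([Λ+S′,B] n) (trans (ad-centralʳ _ (sgn-central (suc n) _)) (*-congˡ (trans (ad-centralʳ _ (r-central n _)) (*-congˡ step))))) ⟩
   (- 1# + ε n + v n * P) + sgn (suc n) * (r n * (num (suc n) * (pow X (suc n) + pow X n * (1# - P)))) ≈⟨ +-congˡ (*-congˡ (cancel-r n _)) ⟩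
   (- 1# + ε n + v n * P) + sgn (suc n) * (pow X (suc n) + pow X n * (1# - P)) ≈⟨ +-congˡ (trans (distribˡ _ _ _) (+-congˡ last)) ⟩
   (- 1# + ε n + v n * P) + (ε (suc n) + (- ε n + ε n * P)) ≈⟨ rearr (- 1#) (ε n) (v n * P) (ε (suc n)) (ε n * P) ⟩
   (- 1# + ε (suc n)) + (v n * P + ε n * P) ≈⟨ +-congˡ (sym (distribʳ P _ _)) ⟩
   (- 1# + ε (suc n)) + v (suc n) * P ∎
   where
   step : [ Λ + S′ , B̂ n ] ≈ num (suc n) * (pow X (suc n) + pow X n * (1# - P))
   step = trans (ad-+ˡ _ _ _) (trans (+-cong ([Λ,B̂] n) (trans ([S′,B̂] n) (*-congˡ (*-congˡ SS′≈1-P)))) (sym (distribˡ _ _ _)))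
   last : sgn (suc n) * (pow X n * (1# - P)) ≈ - ε n + ε n * P
   last = trans (sym (-‿distribˡ-* _ _)) (trans (-‿cong (trans (sym (*-assoc _ _ _)) (trans (x[y-z]≈xy-xz _ 1# P) (+-congʳ (*-identityʳ _))))) (trans (sym (-‿+-comm _ _)) (+-congˡ (-‿involutive _))))
   rearr : ∀ x e y e′ z → ((x + e) + y) + (e′ + (- e + z)) ≈ (x + e′) + (y + z)
   rearr x e y e′ z = begin
    ((x + e) + y) + (e′ + (- e + z)) ≈⟨ +-cong (xy∙z≈xz∙y x e y) (x∙yz≈y∙xz e′ (- e) z) ⟩
    ((x + y) + e) + (- e + (e′ + z)) ≈⟨ trans (+-assoc _ _ _) (+-congˡ (trans (sym (+-assoc _ _ _)) (trans (+-congʳ (-‿inverseʳ e)) (+-identityˡ _)))) ⟩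
    (x + y) + (e′ + z) ≈⟨ interchange x y e′ z ⟩
    (x + e′) + (y + z) ∎

  Pv : ∀ n → P * v (suc n) ≈ P
  Pv zero = trans (*-congˡ (trans (+-identityˡ _) (*-identityˡ 1#))) (*-identityʳ P)
  Pv (suc n) = trans (distribˡ P _ _) (trans (+-cong (Pv n) (trans (central-pull _ (sgn-central (suc n) P)) (*-zeroʳ′ (trans (sym (*-assoc P X _)) (*-zeroˡ′ PX))))) (+-identityʳ P))

  Xv : ∀ n → X * v n + v n ≈ 1# - ε n
  Xv zero = trans (+-congʳ (zeroʳ X)) (trans (+-identityʳ 0#) (sym (trans (+-congˡ (-‿cong (*-identityˡ 1#))) (-‿inverseʳ 1#))))
  Xv (suc n) = begin
   X * (v n + ε n) + (v n + ε n) ≈⟨ trans (+-congʳ (distribˡ X _ _)) (interchange _ _ _ _) ⟩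
   (X * v n + v n) + (X * ε n + ε n) ≈⟨ +-cong (Xv n) (trans (+-comm _ _) (+-congˡ (central-pull _ (sgn-central n X)))) ⟩
   (1# - ε n) + (ε n + sgn n * pow X (suc n)) ≈⟨ trans (+-assoc _ _ _) (+-congˡ (trans (sym (+-assoc _ _ _)) (trans (+-congʳ (-‿inverseˡ _)) (+-identityˡ _)))) ⟩
   1# + sgn n * pow X (suc n) ≈⟨ +-congˡ (trans (sym (-‿involutive _)) (-‿cong (-‿distribˡ-* _ _))) ⟩
   1# - ε (suc n) ∎

  -- v n P is, up to small terms, the eigenvector of Λ + S′ with eigenvalue 0.
  [Λ+S′]v : ∀ n → (Λ + S′) * (v (suc n) * P) ≈ - (S′ * (ε (suc n) * P))
  [Λ+S′]v n = begin
   (Λ + S′) * w ≈⟨ sym (cancelˡ S′S) ⟩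
   S′ * (S * ((Λ + S′) * w)) ≈⟨ *-congˡ (trans (sym (*-assoc _ _ _)) (trans (*-congʳ (trans (distribˡ S Λ S′) (+-congˡ SS′≈1-P))) (trans (distribʳ w _ _) (+-congˡ (trans ([y-z]x≈yx-zx w 1# P) (+-cong (*-identityˡ w) (-‿cong (trans (sym (*-assoc _ _ _)) (trans (*-congʳ (Pv n)) PP))))))))) ⟩
   S′ * (X * w + (w - P)) ≈⟨ *-congˡ (trans (sym (+-assoc _ _ _)) (+-congʳ (trans (+-cong (sym (*-assoc X _ P)) refl) (trans (sym (distribʳ P _ _)) (*-congʳ (Xv (suc n))))))) ⟩
   S′ * ((1# - ε (suc n)) * P - P) ≈⟨ *-congˡ (trans (+-congʳ (trans ([y-z]x≈yx-zx P 1# _) (+-congʳ (*-identityˡ P)))) (trans (+-congʳ (+-comm _ _)) (trans (+-assoc _ _ _) (trans (+-congˡ (-‿inverseʳ P)) (+-identityʳ _))))) ⟩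
   S′ * - (ε (suc n) * P) ≈⟨ sym (-‿distribʳ-* _ _) ⟩
   - (S′ * (ε (suc n) * P)) ∎
   where w = v (suc n) * P

  -- Subtracting U cancels the u contained in Λ, so that L + S* itself remains.
  L′ : Carrier
  L′ = (Λ + S′) - U

  Y W : ℕ → Carrier
  Y zero = 0#
  Y (suc k) = pow L′ k + L′ * Y k
  W zero = 0#
  W (suc k) = P * (pow L′ k * P) - U * W k

  T : ℕ → ℕ → Carrier
  T n k = [ pow L′ k , B n ] * P

  [L′,B] : ∀ n → [ L′ , B n ] ≈ (- 1# + ε n) + v n * P
  [L′,B] n = trans (ad-+ˡ _ _ _) (trans (+-cong ([Λ+S′,B] n) (trans (ad-antisym _ _) (trans (-‿cong (trans (ad-negʳ _ _) (trans (-‿cong (trans (ad-antisym _ _) (trans (-‿cong ([U,B] n)) -0#≈0#))) -0#≈0#))) -0#≈0#))) (+-identityʳ _))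

  [pow,B] : ∀ n k → [ pow L′ (suc k) , B n ] ≈ [ L′ , B n ] * pow L′ k + L′ * [ pow L′ k , B n ]
  [pow,B] n k = trans (ad-antisym _ _) (trans (-‿cong (ad-* (B n) L′ (pow L′ k))) (trans (sym (-‿+-comm _ _)) (+-cong (trans (-‿distribˡ-* _ _) (*-congʳ (sym (ad-antisym _ _)))) (trans (-‿distribʳ-* _ _) (*-congˡ (sym (ad-antisym _ _)))))))

  -- `Small d x` abstracts the statement that x produces only terms of degree at least d. L′ and S′
  -- cost one degree each, so k factors L′ are affordable when the truncation order exceeds the
  -- wanted degree by k.
  module Remainders
   (Small : ℕ → Carrier → Set)
   (small-cong : ∀ {d x y} → x ≈ y → Small d x → Small d y)
   (small-0 : ∀ {d} → Small d 0#)
   (small-+ : ∀ {d x y} → Small d x → Small d y → Small d (x + y))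
   (small-neg : ∀ {d x} → Small d x → Small d (- x))
   (small-*ʳ : ∀ {d x} y → Small d x → Small d (x * y))
   (small-L′ : ∀ {d x} → Small (suc d) x → Small d (L′ * x))
   (small-S′ : ∀ {d x} → Small (suc d) x → Small d (S′ * x))
   (small-≤ : ∀ {d d′ x} → d ℕ.≤ d′ → Small d′ x → Small d x)
   (small-P : ∀ {d x} → Small d x → Small d (P * x))
   (small-ε : ∀ n → Small n (ε n))
   where

   PW : ∀ k → P * W k ≈ W k
   PW zero = zeroʳ P
   PW (suc k) = trans (x[y-z]≈xy-xz P _ _) (+-cong (trans (sym (*-assoc _ _ _)) (*-congʳ PP)) (-‿cong (trans (sym (*-assoc _ _ _)) (trans (*-congʳ (sym UP)) (trans (*-assoc _ _ _) (*-congˡ (PW k)))))))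

   Uv : ∀ n → U * v n ≈ v n * U
   Uv zero = trans (zeroʳ U) (sym (zeroˡ U))
   Uv (suc n) = trans (distribˡ U _ _) (trans (+-cong (Uv n) (trans (central-pull _ (sgn-central n U)) (trans (*-congˡ (UX n)) (sym (*-assoc _ _ _))))) (sym (distribʳ U _ _)))
    where
    UX1 : U * X ≈ X * U
    UX1 = trans (sym (*-assoc _ _ _)) (trans (*-congʳ US) (trans (*-assoc _ _ _) (trans (*-congˡ UΛ) (sym (*-assoc _ _ _)))))
    UX : ∀ n → U * pow X n ≈ pow X n * U
    UX zero = sym (1-central U)
    UX (suc n) = trans (sym (*-assoc _ _ _)) (trans (*-congʳ UX1) (trans (*-assoc _ _ _) (trans (*-congˡ (UX n)) (sym (*-assoc _ _ _)))))

   -- Each further factor L′ brings in [L′ , B n] = -1 + ε + v P. The factor v is carried through L′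
   -- by the kernel relation, at the price of -U; this is the recursion of W. Everything containing
   -- ε goes into the remainder.
   T-formula : ∀ m k d → k ℕ.+ d ℕ.≤ suc m → Σ Carrier λ e → Small d e × (T (suc m) k ≈ (- (Y k * P) + v (suc m) * W k) + e)
   T-formula m zero d _ = 0# , small-0 , trans (*-zeroˡ′ (comm⇒ad0 (1-central _)))
    (sym (trans (+-identityʳ _) (trans (+-cong (trans (-‿cong (zeroˡ P)) -0#≈0#) (zeroʳ _)) (+-identityʳ 0#))))
   T-formula m (suc k) d le with T-formula m k (suc d) (NP.≤-trans (NP.≤-reflexive (NP.+-suc k d)) le)
   ... | e , se , eq = e′ , se′ , (begin
    T n (suc k) ≈⟨ trans (*-congʳ ([pow,B] n k)) (trans (distribʳ P _ _) (+-cong (trans (*-assoc _ _ _) (*-congʳ ([L′,B] n))) (*-assoc _ _ _))) ⟩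
    ((- 1# + ε n) + v n * P) * Q + L′ * T n k ≈⟨ +-cong (trans (distribʳ Q _ _) (+-cong (trans (distribʳ Q _ _) (+-congʳ (-1*x≈-x Q))) (*-assoc _ _ _))) (trans (*-congˡ eq) (trans (distribˡ L′ _ _) (+-congʳ (trans (distribˡ L′ _ _) (+-cong (trans (sym (-‿distribʳ-* _ _)) (-‿cong (sym (*-assoc _ _ _)))) L′vW))))) ⟩
    ((- Q + ε n * Q) + v n * (P * Q)) + ((- (L′ * Y k * P) + (- (S′ * (ε n * W k)) + - (v n * (U * W k)))) + L′ * e)
     ≈⟨ regroup (- Q) (ε n * Q) (v n * (P * Q)) (- (L′ * Y k * P)) (- (S′ * (ε n * W k))) (- (v n * (U * W k))) (L′ * e) ⟩
    ((- Q + - (L′ * Y k * P)) + (v n * (P * Q) + - (v n * (U * W k)))) + e′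
     ≈⟨ +-congʳ (+-cong (trans (-‿+-comm _ _) (-‿cong (sym (distribʳ P _ _)))) (sym (x[y-z]≈xy-xz (v n) _ _))) ⟩
    (- (Y (suc k) * P) + v n * W (suc k)) + e′ ∎)
    where
    n = suc m
    Q = pow L′ k * P
    e′ = (ε n * Q + - (S′ * (ε n * W k))) + L′ * e
    le′ : d ℕ.≤ m
    le′ = NP.≤-trans (NP.m≤n+m d k) (NP.≤-pred le)
    se′ : Small d e′
    se′ = small-+ (small-+ (small-*ʳ Q (small-≤ (NP.m≤n⇒m≤1+n le′) (small-ε n))) (small-neg (small-S′ (small-*ʳ (W k) (small-≤ (ℕ.s≤s le′) (small-ε n)))))) (small-L′ se)
    -- W k = P W k supplies the projection that the kernel relation for v P requires.
    L′vW : L′ * (v n * W k) ≈ - (S′ * (ε n * W k)) + - (v n * (U * W k))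
    L′vW = begin
     L′ * (v n * W k) ≈⟨ [y-z]x≈yx-zx _ (Λ + S′) U ⟩
     (Λ + S′) * (v n * W k) - U * (v n * W k) ≈⟨ +-cong (trans (*-congˡ (trans (*-congˡ (sym (PW k))) (sym (*-assoc _ _ _)))) (trans (sym (*-assoc _ _ _)) (trans (*-congʳ ([Λ+S′]v m)) (trans (sym (-‿distribˡ-* _ _)) (-‿cong (trans (*-assoc _ _ _) (*-congˡ (trans (*-assoc _ _ _) (*-congˡ (PW k)))))))))) (-‿cong (trans (sym (*-assoc _ _ _)) (trans (*-congʳ (Uv n)) (*-assoc _ _ _)))) ⟩
     - (S′ * (ε n * W k)) + - (v n * (U * W k)) ∎
    regroup : ∀ q e₁ x y s z l → ((q + e₁) + x) + ((y + (s + z)) + l) ≈ ((q + y) + (x + z)) + ((e₁ + s) + l)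
    regroup q e₁ x y s z l = begin
     ((q + e₁) + x) + ((y + (s + z)) + l) ≈⟨ sym (+-assoc _ _ l) ⟩
     (((q + e₁) + x) + (y + (s + z))) + l ≈⟨ +-congʳ (+-cong (xy∙z≈xz∙y q e₁ x) (trans (+-congˡ (+-comm s z)) (sym (+-assoc y z s)))) ⟩
     (((q + x) + e₁) + ((y + z) + s)) + l ≈⟨ +-congʳ (interchange _ _ _ _) ⟩
     (((q + x) + (y + z)) + (e₁ + s)) + l ≈⟨ +-assoc _ _ _ ⟩
     ((q + x) + (y + z)) + ((e₁ + s) + l) ≈⟨ +-congʳ (interchange _ _ _ _) ⟩
     ((q + y) + (x + z)) + ((e₁ + s) + l) ∎

   -- [P L′ᵏ P, B] = -P Y_k P + W_k up to a small remainder, where Y_k = k L′ᵏ⁻¹ and W_k = Σ_{i<k} (-U)ⁱ P L′ᵏ⁻¹⁻ⁱ P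
   commutator : ∀ n k d → 1 ℕ.≤ n → k ℕ.+ d ℕ.≤ n → Σ Carrier λ e → Small d e ×
    (P * (pow L′ k * (B n * P)) ≈ ((B n * (P * (pow L′ k * P)) + - (P * (Y k * P))) + W k) + e)
   commutator (suc m) k d _ le with T-formula m k d le
   ... | e , se , eq = P * e , small-P se , (begin
    P * (pow L′ k * (B n * P)) ≈⟨ *-congˡ (trans (sym (*-assoc _ _ _)) (trans (*-congʳ (ad-undef {z = [ pow L′ k , B n ]} refl)) (distribʳ P _ _))) ⟩
    P * (B n * pow L′ k * P + T n k) ≈⟨ trans (distribˡ P _ _) (+-cong (trans (*-congˡ (*-assoc _ _ _)) (trans (sym (*-assoc _ _ _)) (trans (*-congʳ (ad0⇒comm ([B,P] n))) (*-assoc _ _ _)))) (*-congˡ eq)) ⟩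
    B n * (P * (pow L′ k * P)) + P * ((- (Y k * P) + v n * W k) + e)
     ≈⟨ +-congˡ (trans (distribˡ P _ _) (+-congʳ (trans (distribˡ P _ _) (+-cong (sym (-‿distribʳ-* _ _)) (trans (*-congˡ (*-congˡ (sym (PW k)))) (trans (sym (*-assoc _ _ _)) (trans (*-congʳ (Pv m)) (trans (sym (*-assoc P P _)) (trans (*-congʳ PP) (PW k)))))))))) ⟩
    B n * (P * (pow L′ k * P)) + ((- (P * (Y k * P)) + W k) + P * e) ≈⟨ trans (sym (+-assoc _ _ _)) (+-congʳ (sym (+-assoc _ _ _))) ⟩
    ((B n * (P * (pow L′ k * P)) + - (P * (Y k * P))) + W k) + P * e ∎)
    where n = suc m

-- The concrete operators and the filtration by degree.

module Series (K : Scalars) where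
 open Linear K
 open Lax K
 open Beltrami K
 open LaxCommutation K

 wt : List ℕ → ℕ
 wt [] = 0
 wt (i ∷ w) = suc i ℕ.+ wt w

 -- The part that is homogeneous of degree d vanishes; in `Van` the variable y counts as degree one.
 record Vanₛ (d : ℕ) (f : Sym) : Set where
  constructor vanₛ
  field vatₛ : ∀ w → wt w ≡ d → fn f w ≈ 0#
 open Vanₛ public

 record Van (d : ℕ) (F : El H) : Set where
  constructor van
  field vat : ∀ i w → i ℕ.+ wt w ≡ d → fn (F i) w ≈ 0#
 open Van public

 Θ-van : ∀ {d F} → Van d F → Vanₛ d (Θ $ F)
 Θ-van {d} {F} h = vanₛ λ w e → go w F d h e
  where
  swap+ : ∀ j i n → j ℕ.+ (suc i ℕ.+ n) ≡ suc i ℕ.+ (j ℕ.+ n)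
  swap+ j i n = P.trans (P.sym (NP.+-assoc j (suc i) n)) (P.trans (P.cong (ℕ._+ n) (NP.+-comm j (suc i))) (NP.+-assoc (suc i) j n))
  go : ∀ w F d → Van d F → wt w ≡ d → θfn F w ≈ 0#
  go [] F d h e = refl
  go (i ∷ w) F d h e = trans (+-cong (vat h (suc i) w e) (go w (shift i F) (wt w) (van λ j v e′ → vat h j (i ∷ v) (P.trans (swap+ j i (wt v)) (P.trans (P.cong (suc i ℕ.+_) e′) e))) P.refl)) (+-identityˡ 0#)

 a-van : ∀ {d f} → Vanₛ d f → Van d (a $ f)
 a-van h = van λ { zero w e → refl ; (suc i) w e → *-zeroʳ′ (vatₛ h (i ∷ w) e) }

 comp-van : ∀ {d F} → Van d F → Vanₛ d (bra $ F)
 comp-van h = vanₛ (vat h 0)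

 vac-van : ∀ {d f} → Vanₛ d f → Van d (vac $ f)
 vac-van h = van λ { zero w e → vatₛ h w e ; (suc i) w e → refl }

 S*-van : ∀ {d F} → Van (suc d) F → Van d (S* $ F)
 S*-van h = van λ i w e → vat h (suc i) w (P.cong suc e)

 private
  pos : ∀ {n d} → suc n ≡ d → d ≡ suc (ℕ.pred d)
  pos P.refl = P.refl

 A-van : ∀ {d F} → Van d F → Van d (A $ F)
 A-van {d} {F} h = van λ m w e → go m w F d h e
  where
  go : ∀ m w F d → Van d F → m ℕ.+ wt w ≡ d → fn (Afn F m) w ≈ 0#
  go zero w F d h e = refl
  go (suc m) w F d h e = trans (+-cong (vat (a-van (comp-van h)) (suc m) w e) (go m w (S* $ F) (ℕ.pred d) (S*-van (P.subst (λ d → Van d F) (pos e) h)) (P.cong ℕ.pred e))) (+-identityˡ 0#)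

 B-van : ∀ {d F} → Van d F → Van d (B $ F)
 B-van {d} {F} h = van λ m w e → go m w F d h e
  where
  go : ∀ m w F d → Van d F → m ℕ.+ wt w ≡ d → fn (Bfn F m) w ≈ 0#
  go zero w F d h e = vatₛ (Θ-van h) w e
  go (suc m) w F d h e = go m w (S* $ F) (ℕ.pred d) (S*-van (P.subst (λ d → Van d F) (pos e) h)) (P.cong ℕ.pred e)

 van-+ : ∀ {d} {F G : El H} → Van d F → Van d G → Van d (F +ₕ G)
 van-+ h k = van λ i w e → trans (+-cong (vat h i w e) (vat k i w e)) (+-identityˡ 0#)

 van-scal : ∀ {d} c {F : El H} → Van d F → Van d (c *ₕ F)
 van-scal c h = van λ i w e → *-zeroʳ′ (vat h i w e)

 van-0 : ∀ {d} → Van d 0ₕ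
 van-0 = van λ i w e → refl

 L-van : ∀ {d F} → Van d F → Van d (L $ F)
 L-van h = van-+ (van-+ (A-van h) (B-van h)) (van-scal b (van λ i w e → *-zeroʳ′ (vat h i w e)))

 S-van : ∀ {d F} → Van d F → Van (suc d) (S $ F)
 S-van h = van λ { zero w e → refl ; (suc i) w e → vat h i w (P.cong ℕ.pred e) }

 S-van0 : ∀ F → Van 0 (S $ F)
 S-van0 F = van λ { zero w e → refl ; (suc i) w () }

 -- The outer index is the exponent of u, the inner one that of y.
 Hᵤ : Space
 Hᵤ = Seq H

 module HU = LeftModule Hᵤ
 open HU public using () renaming (*ₗ-assoc to *ᵤ-assoc; *ₗ-cong to *ᵤ-cong; *ₗ-distribʳ to *ᵤ-distribʳ; *ₗ-identityˡ to *ᵤ-identityˡ; *ₗ-zeroʳ to *ᵤ-zeroʳ; *ₗ-zeroˡ to *ᵤ-zeroˡ; +ᴹ-assoc to +ᵤ-assoc; +ᴹ-comm to +ᵤ-comm; +ᴹ-commutativeMonoid to +ᵤ-commutativeMonoid; +ᴹ-cong to +ᵤ-cong; +ᴹ-congʳ to +ᵤ-congʳ; +ᴹ-congˡ to +ᵤ-congˡ; -ᴹ‿cong to -ᵤ‿cong; 0ᴹ to 0ᵤ; _*ₗ_ to _*ᵤ_; _+ᴹ_ to _+ᵤ_; _≈ᴹ_ to _≈ᵤ_; ≈ᴹ-refl to reflᵤ; ≈ᴹ-reflexive to reflexiveᵤ; ≈ᴹ-sym to symᵤ; ≈ᴹ-trans to transᵤ)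
 module UO = SeqOps H

 U : Lin Hᵤ Hᵤ
 U = UO.S

 lift-U : ∀ (T : Lin H H) (G : El Hᵤ) → _≈ₙ_ H (lift T $ (U $ G)) (U $ (lift T $ G))
 lift-U T G = ptₙ λ { zero → Lin.zer T ; (suc e) → reflₕ }

 End-Hᵤ : Ring _ _
 End-Hᵤ = End Hᵤ

 module N = NC End-Hᵤ
 module E = Ring End-Hᵤ

 num-nat : ∀ n (G : El Hᵤ) → _≈ₙ_ H (N.num n $ G) (nat n *ᵤ G)
 num-nat zero G = symᵤ (*ᵤ-zeroˡ G)
 num-nat (suc n) G = transᵤ (+ᵤ-cong (symᵤ (*ᵤ-identityˡ G)) (num-nat n G)) (symᵤ (*ᵤ-distribʳ G 1# (nat n)))

 scalar : Carrier → Lin Hᵤ Hᵤ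
 scalar c = c ·ˡ idˡ

 scalar-central : ∀ c (T : Lin Hᵤ Hᵤ) → (scalar c ∘ˡ T) ≈ˡ (T ∘ˡ scalar c)
 scalar-central c T = ptˡ λ G → symᵤ (Lin.scal T c G)

 P : Lin H H
 P = vac ∘ˡ bra

 lift-comm : ∀ (S T : Lin H H) → (∀ F → (S $ (T $ F)) ≈ₕ (T $ (S $ F))) → (lift S ∘ˡ lift T) ≈ˡ (lift T ∘ˡ lift S)
 lift-comm S T e = ptˡ λ G → ptₙ λ i → e (G i)

 L-U-comm : ∀ (T : Lin H H) → (∀ F → (L $ (T $ F)) ≈ₕ (T $ (L $ F))) → ((lift L +ˡ U) ∘ˡ lift T) ≈ˡ (lift T ∘ˡ (lift L +ˡ U))
 L-U-comm T e = ptˡ λ G → transᵤ (+ᵤ-cong (atˡ (lift-comm L T e) G) (symᵤ (lift-U T G))) (symᵤ (Lin.add (lift T) _ _))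

 -- The summand u Ê turns [D̂ , S] = S L into S (L + u), the relation with Λ that the commutator
 -- calculus asks for.
 Dᵤ : Lin Hᵤ Hᵤ
 Dᵤ = lift D̂ +ˡ (U ∘ˡ lift Ê)

 relations : N.Relations
 relations = record
  { Λ = lift L +ˡ U ; S = lift S ; S′ = lift S* ; P = lift P ; D = Dᵤ ; q = lift (lift q₁) ; U = U ; A = scalar α
  ; r = λ n → scalar (inv n)
  ; DΛ = ptˡ λ G → transᵤ (+ᵤ-cong (symᵤ (atˡ (L-U-comm D̂ L-D̂) G)) (transᵤ (Lin.cong U (symᵤ (atˡ (L-U-comm Ê L-Ê) G))) (U-Λ (lift Ê $ G)))) (symᵤ (Lin.add (lift L +ˡ U) (lift D̂ $ G) (U $ (lift Ê $ G))))
  ; DS = ptˡ DS′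
  ; DP = ptˡ λ G → transᵤ (+ᵤ-cong (atˡ (lift-comm D̂ P D̂P) G) (transᵤ (Lin.cong U (atˡ (lift-comm Ê P ÊP) G)) (symᵤ (lift-U P (lift Ê $ G))))) (symᵤ (Lin.add (lift P) (lift D̂ $ G) (U $ (lift Ê $ G))))
  ; qΛ = ptˡ qΛ′
  ; qS = lift-comm (lift q₁) S (lift-S q₁)
  ; qP = lift-comm (lift q₁) P (λ F → transₕ (lift-vac q₁ _) reflₕ)
  ; S′S = ptˡ λ G → ptₙ λ i → ptₙ λ j → reflₛ
  ; SS′ = ptˡ λ G → ptₙ λ i → transₕ (+ₕ-comm _ _) (symₕ (split (G i)))
  ; PS = ptˡ λ G → ptₙ λ i → ptₙ λ { zero → reflₛ ; (suc j) → reflₛ }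
  ; S′P = ptˡ λ G → ptₙ λ i → ptₙ λ j → reflₛ
  ; PP = ptˡ λ G → ptₙ λ i → reflₕ
  ; UΛ = ptˡ U-Λ
  ; US = ptˡ λ G → symᵤ (lift-U S G)
  ; UP = ptˡ λ G → symᵤ (lift-U P G)
  ; UD = ptˡ λ G → transᵤ (Lin.add U _ _) (+ᵤ-cong (symᵤ (lift-U D̂ G)) (Lin.cong U (symᵤ (lift-U Ê G))))
  ; Uq = ptˡ λ G → symᵤ (lift-U (lift q₁) G)
  ; ΛSP = ptˡ ΛSP′
  ; A-central = scalar-central α
  ; r-central = λ n → scalar-central (inv n)
  ; r-inv = λ n → ptˡ λ G → transᵤ (*ᵤ-cong refl (num-nat (suc n) G)) (transᵤ (symᵤ (*ᵤ-assoc _ _ G)) (transᵤ (*ᵤ-cong (inv* n) reflᵤ) (*ᵤ-identityˡ G)))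
  }
  where
  U-Λ : ∀ G → (U $ ((lift L +ˡ U) $ G)) ≈ᵤ ((lift L +ˡ U) $ (U $ G))
  U-Λ G = transᵤ (Lin.add U (lift L $ G) (U $ G)) (+ᵤ-cong (symᵤ (lift-U L G)) reflᵤ)
  D̂P : ∀ F → (D̂ $ (P $ F)) ≈ₕ (P $ (D̂ $ F))
  D̂P F = transₕ (D̂-vac (bra $ F)) (Lin.cong vac (symₛ (bra-D̂ F)))
  ÊP : ∀ F → (Ê $ (P $ F)) ≈ₕ (P $ (Ê $ F))
  ÊP F = transₕ (Ê-vac (bra $ F)) (Lin.cong vac (symₛ (bra-Ê F)))
  DS′ : ∀ G → (Dᵤ $ (lift S $ G)) ≈ᵤ ((lift S $ (Dᵤ $ G)) +ᵤ (lift S $ ((lift L +ˡ U) $ G)))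
  DS′ G = transᵤ (+ᵤ-cong d̂ (transᵤ (Lin.cong U ê) (transᵤ (Lin.add U (lift S $ (lift Ê $ G)) (lift S $ G)) (+ᵤ-cong (symᵤ (lift-U S (lift Ê $ G))) (symᵤ (lift-U S G))))))
   (transᵤ (interchange _ _ _ _) (+ᵤ-cong (symᵤ (Lin.add (lift S) (lift D̂ $ G) _)) (symᵤ (Lin.add (lift S) (lift L $ G) (U $ G)))))
   where
   open import Algebra.Properties.CommutativeSemigroup (CommutativeMonoid.commutativeSemigroup +ᵤ-commutativeMonoid) using (interchange)
   d̂ : (lift D̂ $ (lift S $ G)) ≈ᵤ ((lift S $ (lift D̂ $ G)) +ᵤ (lift S $ (lift L $ G)))
   d̂ = ptₙ λ i → D̂S (G i)
   ê : (lift Ê $ (lift S $ G)) ≈ᵤ ((lift S $ (lift Ê $ G)) +ᵤ (lift S $ G))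
   ê = ptₙ λ i → ÊS (G i)
  qΛ′ : ∀ G → ((lift L +ˡ U) $ (lift (lift q₁) $ G)) ≈ᵤ ((lift (lift q₁) $ ((lift L +ˡ U) $ G)) +ᵤ (lift S $ G))
  qΛ′ G = transᵤ (+ᵤ-cong lq (symᵤ (lift-U (lift q₁) G)))
   (transᵤ (+ᵤ-assoc _ _ _) (transᵤ (+ᵤ-congˡ (+ᵤ-comm _ _)) (transᵤ (symᵤ (+ᵤ-assoc _ _ _)) (+ᵤ-congʳ (symᵤ (Lin.add (lift (lift q₁)) (lift L $ G) (U $ G)))))))
   where
   lq : (lift L $ (lift (lift q₁) $ G)) ≈ᵤ ((lift (lift q₁) $ (lift L $ G)) +ᵤ (lift S $ G))
   lq = ptₙ λ i → L-q₁ (G i)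
  ΛSP′ : ∀ G → (lift P $ ((lift L +ˡ U) $ (lift S $ (lift P $ G)))) ≈ᵤ (scalar α $ (lift (lift q₁) $ (lift P $ G)))
  ΛSP′ G = ptₙ λ e → ptₙ λ { zero → pt λ w → trans (+-cong (at (bra-L (S $ (P $ G e))) w) (u0 e w)) (trans (+-identityʳ _) (sym (cancelˡ (trans (*-comm α α⁻¹) α⁻¹*α))))
   ; (suc j) → pt λ w → sym (*-zeroʳ′ (at (Lin.zer q₁) w)) }
   where
   u0 : ∀ e w → fn ((U $ (lift S $ (lift P $ G))) e 0) w ≈ 0#
   u0 zero w = refl
   u0 (suc e) w = refl

 module W = N.Lifts relations

 -- L′ = e^{∂/∂p₁} L e^{-∂/∂p₁}
 L⁺ : Lin H H
 L⁺ = L +ˡ S*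

 powˡ : ∀ {M} → Lin M M → ℕ → Lin M M
 powˡ T zero = idˡ
 powˡ T (suc n) = T ∘ˡ powˡ T n

 I⁺ : ℕ → Lin V V
 I⁺ k = bra ∘ˡ powˡ L⁺ k ∘ˡ vac

 L′-lift : ∀ (G : El Hᵤ) → (W.L′ $ G) ≈ᵤ (lift L⁺ $ G)
 L′-lift G = ptₙ λ e → ptₙ λ i → pt λ w → solve 3 (λ x u s → ((x :+ u) :+ s) :- u := x :+ s) refl _ _ _

 pow-lift : ∀ k (G : El Hᵤ) → (N.pow W.L′ k $ G) ≈ᵤ (lift (powˡ L⁺ k) $ G)
 pow-lift zero G = ptₙ λ e → reflₕ
 pow-lift (suc k) G = transᵤ (Lin.cong W.L′ (pow-lift k G)) (L′-lift (lift (powˡ L⁺ k) $ G))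

 -- Degree at least d in p and y together, uniformly in the power of u: the variable u has degree
 -- zero, so X gains a degree only through its factor S.
 Fil : ℕ → El Hᵤ → Set
 Fil d G = ∀ e {d′} → d′ ℕ.< d → Van d′ (G e)

 Small : ℕ → Lin Hᵤ Hᵤ → Set
 Small d T = ∀ G → Fil d (T $ G)

 van-cong : ∀ {d} {F G : El H} → F ≈ₕ G → Van d F → Van d G
 van-cong e h = van λ i w eq → trans (sym (at (atₙ e i) w)) (vat h i w eq)

 L⁺-fil : ∀ {d} {F : El H} → (∀ {d′} → d′ ℕ.< suc d → Van d′ F) → ∀ {d′} → d′ ℕ.< d → Van d′ (L⁺ $ F)
 L⁺-fil h lt = van-+ (L-van (h (NP.m<n⇒m<1+n lt))) (S*-van (h (ℕ.s≤s lt)))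

 X-fil : ∀ {d} {G : El Hᵤ} → Fil d G → Fil (suc d) (W.X $ G)
 X-fil {d} {G} h e {zero} lt = S-van0 _
 X-fil {d} {G} h zero {suc d′} lt = S-van (van-+ (L-van (h 0 (NP.≤-pred lt))) van-0)
 X-fil {d} {G} h (suc e) {suc d′} lt = S-van (van-+ (L-van (h (suc e) (NP.≤-pred lt))) (h e (NP.≤-pred lt)))

 Xⁿ-fil : ∀ n G → Fil n (N.pow W.X n $ G)
 Xⁿ-fil zero G e ()
 Xⁿ-fil (suc n) G = X-fil (Xⁿ-fil n G)

 sgnK : ℕ → Carrier
 sgnK zero = 1#
 sgnK (suc n) = - sgnK n

 sgn-scalar : ∀ n (G : El Hᵤ) → (W.sgn n $ G) ≈ᵤ (sgnK n *ᵤ G)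
 sgn-scalar zero G = symᵤ (*ᵤ-identityˡ G)
 sgn-scalar (suc n) G = transᵤ (-ᵤ‿cong (sgn-scalar n G)) (ptₙ λ e → ptₙ λ i → pt λ w → solve 2 (λ x y → :- (x :* y) := (:- x) :* y) refl _ _)

 fil-cong : ∀ {d} {F G : El Hᵤ} → F ≈ᵤ G → Fil d F → Fil d G
 fil-cong eq h e lt = van-cong (atₙ eq e) (h e lt)

 -0≈0 : - 0# ≈ 0#
 -0≈0 = solve 0 (:- :0 := :0) refl

 open W.Remainders Small
  (λ eq s G → fil-cong (atˡ eq G) (s G))
  (λ G e lt → van-0)
  (λ s t G e lt → van-+ (s G e lt) (t G e lt))
  (λ s G e lt → van λ i w eq → trans (-‿cong (vat (s G e lt) i w eq)) -0≈0)
  (λ y s G → s (y $ G))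
  (λ {d} {x} s G → fil-cong (symᵤ (L′-lift (x $ G))) (λ e → L⁺-fil (s G e)))
  (λ s G e lt → S*-van (s G e (ℕ.s≤s lt)))
  (λ le s G e lt → s G e (NP.≤-trans lt le))
  (λ s G e lt → vac-van (comp-van (s G e lt)))
  (λ n G → fil-cong (symᵤ (sgn-scalar n (N.pow W.X n $ G))) (λ e lt → van-scal _ (Xⁿ-fil n G e lt)))
  using (commutator)
  public


-- The operators C_ℓ and their commutators with I⁺_k.

module COperators (K : Scalars) where
 open Linear K
 open Lax K
 open Beltrami K
 open LaxCommutation K
 open Series K

 wt-resp : ∀ {v w} → v ↭ w → wt v ≡ wt w
 wt-resp Perm.refl = P.refl
 wt-resp (prep i p) = P.cong (suc i ℕ.+_) (wt-resp p)
 wt-resp (swap {v} {w} i j p) = P.trans (P.cong (λ z → suc i ℕ.+ (suc j ℕ.+ z)) (wt-resp p))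
  (P.trans (P.sym (NP.+-assoc (suc i) (suc j) (wt w))) (P.trans (P.cong (ℕ._+ wt w) (NP.+-comm (suc i) (suc j))) (NP.+-assoc (suc j) (suc i) (wt w))))
 wt-resp (Perm.trans p q) = P.trans (wt-resp p) (wt-resp q)

 record Filₛ (d : ℕ) (f : Sym) : Set where
  constructor filₛ
  field fatₛ : ∀ {d′} → d′ ℕ.< d → Vanₛ d′ f
 open Filₛ public

 record Filₕ (d : ℕ) (F : El H) : Set where
  constructor filₕ
  field fatₕ : ∀ {d′} → d′ ℕ.< d → Van d′ F
 open Filₕ public

 vanₛ-cong : ∀ {d f g} → f ≈ₛ g → Vanₛ d f → Vanₛ d g
 vanₛ-cong e h = vanₛ λ w eq → trans (sym (at e w)) (vatₛ h w eq)

 filₛ-cong : ∀ {d f g} → f ≈ₛ g → Filₛ d f → Filₛ d g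
 filₛ-cong e h = filₛ λ lt → vanₛ-cong e (fatₛ h lt)

 filₛ-≤ : ∀ {d d′ f} → d ℕ.≤ d′ → Filₛ d′ f → Filₛ d f
 filₛ-≤ le h = filₛ λ lt → fatₛ h (NP.≤-trans lt le)

 filₛ-+ : ∀ {d f g} → Filₛ d f → Filₛ d g → Filₛ d (f +ₛ g)
 filₛ-+ h k = filₛ λ lt → vanₛ λ w e → trans (+-cong (vatₛ (fatₛ h lt) w e) (vatₛ (fatₛ k lt) w e)) (+-identityˡ 0#)

 filₛ-scal : ∀ {d f} c → Filₛ d f → Filₛ d (c *ₛ f)
 filₛ-scal c h = filₛ λ lt → vanₛ λ w e → *-zeroʳ′ (vatₛ (fatₛ h lt) w e)

 filₛ-0 : ∀ {d} → Filₛ d 0ₛ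
 filₛ-0 = filₛ λ lt → vanₛ λ w e → refl

 infixl 6 _⊖_
 _⊖_ : Sym → Sym → Sym
 f ⊖ g = f +ₛ ((- 1#) *ₛ g)

 fil-agree : ∀ {d f g} → Filₛ d (f ⊖ g) → ∀ w → wt w ℕ.< d → fn f w ≈ fn g w
 fil-agree {d} {f} {g} h w lt = trans (solve 2 (λ x y → x := (x :+ (:- :1) :* y) :+ y) refl (fn f w) (fn g w)) (trans (+-congʳ (vatₛ (fatₛ h lt) w P.refl)) (+-identityˡ _))

 agree-fil : ∀ {d f g} → (∀ w → wt w ℕ.< d → fn f w ≈ fn g w) → Filₛ d (f ⊖ g)
 agree-fil {d} {f} {g} h = filₛ λ lt → vanₛ λ { w P.refl → trans (+-congʳ (h w lt)) (solve 1 (λ x → x :+ (:- :1) :* x := :0) refl (fn g w)) }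

 -- Apply T to f - g. This is the continuity that allows a series to be replaced by a truncation
 -- inside an operator.
 local : ∀ {d₁ d₂ f g} (T : Lin V V) → (∀ {f} → Filₛ d₁ f → Filₛ d₂ (T $ f)) →
  (∀ w → wt w ℕ.< d₁ → fn f w ≈ fn g w) → ∀ w → wt w ℕ.< d₂ → fn (T $ f) w ≈ fn (T $ g) w
 local {f = f} {g} T h e = fil-agree (filₛ-cong (transₛ (Lin.add T f _) (+ₛ-congˡ (Lin.scal T (- 1#) g))) (h (agree-fil e)))

 L⁺ᵏ-fil : ∀ k {d F} → Filₕ (k ℕ.+ d) F → Filₕ d (powˡ L⁺ k $ F)
 L⁺ᵏ-fil zero h = h
 L⁺ᵏ-fil (suc k) {d} {F} h = filₕ (L⁺-fil (fatₕ (L⁺ᵏ-fil k {suc d} (P.subst (λ n → Filₕ n F) (P.sym (NP.+-suc k d)) h))))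

 I⁺-fil : ∀ k {d f} → Filₛ (k ℕ.+ d) f → Filₛ d (I⁺ k $ f)
 I⁺-fil k {d} {f} h = filₛ λ lt → comp-van (fatₕ (L⁺ᵏ-fil k {d} {vac $ f} (filₕ λ lt′ → vac-van (fatₛ h lt′))) lt)

 ι : Lin V Hᵤ
 ι = UO.vac ∘ˡ vac

 Xᵏ : ℕ → Lin V Hᵤ
 Xᵏ n = N.pow W.X n ∘ˡ ι

 -- β n ℓ = [u^ℓ] B_{n+1}(u)
 β : ℕ → ℕ → Lin V V
 β n ℓ = α⁻¹ ·ˡ (Θ ∘ˡ UO.comp ℓ ∘ˡ Xᵏ (suc n))

 -- truncation of Σ_{n≥1} ((-1)ⁿ/n) [u^ℓ] B_n(u)
 Cᵗ : ℕ → ℕ → Lin V V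
 Cᵗ zero ℓ = 0ˡ
 Cᵗ (suc n) ℓ = Cᵗ n ℓ +ˡ ((sgnK (suc n) * inv n) ·ˡ β n ℓ)

 P-ι : ∀ g → (lift P $ (ι $ g)) ≈ᵤ (ι $ g)
 P-ι g = ptₙ λ { zero → ptₙ λ { zero → reflₛ ; (suc i) → reflₛ } ; (suc e) → ptₙ λ { zero → reflₛ ; (suc i) → reflₛ } }

 -- This is `B̂-formula` divided by α. The u in Λ adds nothing, since X begins with S and has no y⁰
 -- component.
 B̂-β : ∀ n ℓ g → (W.B̂ n $ (ι $ g)) ℓ 0 ≈ₛ (β n ℓ $ g)
 B̂-β n ℓ g = pt λ w → begin
  fn ((W.B̂ n $ (ι $ g)) ℓ 0) w ≈⟨ sym (cancelˡ α⁻¹*α) ⟩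
  α⁻¹ * (α * fn ((W.B̂ n $ (ι $ g)) ℓ 0) w) ≈⟨ *-congˡ (*-congˡ (at (atₙ (atₙ (Lin.cong (W.B̂ n) (symᵤ (P-ι g))) ℓ) 0) w)) ⟩
  α⁻¹ * (α * fn ((W.B̂ n $ (lift P $ (ι $ g))) ℓ 0) w) ≈⟨ *-congˡ (at (atₙ (atₙ (atˡ (W.B̂-formula n) (ι $ g)) ℓ) 0) w) ⟩
  α⁻¹ * fn (((lift L +ˡ U) $ (N.pow W.X (suc n) $ (lift P $ (ι $ g)))) ℓ 0) w ≈⟨ *-congˡ (at (atₙ (atₙ (Lin.cong ((lift L +ˡ U) ∘ˡ N.pow W.X (suc n)) (P-ι g)) ℓ) 0) w) ⟩
  α⁻¹ * (fn (bra $ (L $ (Xᵏ (suc n) $ g) ℓ)) w + fn ((U $ (Xᵏ (suc n) $ g)) ℓ 0) w) ≈⟨ *-congˡ (trans (+-cong (at (bra-L ((Xᵏ (suc n) $ g) ℓ)) w) (u0 ℓ)) (+-identityʳ _)) ⟩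
  α⁻¹ * fn (Θ $ (Xᵏ (suc n) $ g) ℓ) w ∎
  where
  u0 : ∀ ℓ {w} → fn ((U $ (Xᵏ (suc n) $ g)) ℓ 0) w ≈ 0#
  u0 zero = refl
  u0 (suc ℓ) = refl

 B-C : ∀ n ℓ g → (W.B n $ (ι $ g)) ℓ 0 ≈ₛ (Cᵗ n ℓ $ g)
 B-C zero ℓ g = reflₛ
 B-C (suc n) ℓ g = +ₛ-cong (B-C n ℓ g) (pt λ w → trans (at (atₙ (atₙ (sgn-scalar (suc n) (inv n *ᵤ (W.B̂ n $ (ι $ g)))) ℓ) 0) w)
  (trans (sym (*-assoc _ _ _)) (*-congˡ (at (B̂-β n ℓ g) w))))

 BP-comm : ∀ n g → (W.B n $ (lift P $ (ι $ g))) ≈ᵤ (lift P $ (W.B n $ (ι $ g)))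
 BP-comm n g = symᵤ (atˡ (N.ad0⇒comm {lift P} {W.B n} (W.[B,P] n)) (ι $ g))

 Bι-P : ∀ n g → (W.B n $ (ι $ g)) ≈ᵤ (lift P $ (W.B n $ (ι $ g)))
 Bι-P n g = transᵤ {j = W.B n $ (lift P $ (ι $ g))} (Lin.cong (W.B n) (symᵤ (P-ι g))) (BP-comm n g)

 Bι-vac : ∀ n ℓ g → (W.B n $ (ι $ g)) ℓ ≈ₕ (vac $ (Cᵗ n ℓ $ g))
 Bι-vac n ℓ g = transₕ (atₙ (Bι-P n g) ℓ) (Lin.cong vac (B-C n ℓ g))

 -- The coefficient of u^ℓ of W k on y⁰, that is, (-1)^ℓ I⁺_{k-1-ℓ}, or zero if ℓ ≥ k.
 Wc : ℕ → ℕ → Lin V V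
 Wc zero ℓ = 0ˡ
 Wc (suc k) zero = I⁺ k
 Wc (suc k) (suc ℓ) = -ˡ Wc k ℓ

 PL-ι : ∀ k g → (lift P $ (N.pow W.L′ k $ (lift P $ (ι $ g)))) ≈ᵤ (ι $ (I⁺ k $ g))
 PL-ι k g = transᵤ (Lin.cong (lift P) (transᵤ (Lin.cong (N.pow W.L′ k) (P-ι g)) (pow-lift k (ι $ g))))
  (ptₙ λ { zero → ptₙ λ { zero → reflₛ ; (suc i) → reflₛ } ; (suc e) → ptₙ λ { zero → atₙ (Lin.zer (powˡ L⁺ k)) 0 ; (suc i) → reflₛ } })

 W-ι : ∀ k ℓ g → (W.W k $ (ι $ g)) ℓ 0 ≈ₛ (Wc k ℓ $ g)
 W-ι zero ℓ g = reflₛ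
 W-ι (suc k) zero g = transₛ (+ₛ-cong (atₙ (atₙ (PL-ι k g) 0) 0) (pt λ w → -0≈0)) (+ₛ-identityʳ _)
 W-ι (suc k) (suc ℓ) g = transₛ (+ₛ-cong (atₙ (atₙ (PL-ι k g) (suc ℓ)) 0) (-ₛ‿cong (W-ι k ℓ g))) (+ₛ-identityˡ _)

 Yl : ℕ → Lin H H
 Yl zero = 0ˡ
 Yl (suc k) = powˡ L⁺ k +ˡ (L⁺ ∘ˡ Yl k)

 Y-lift : ∀ k (G : El Hᵤ) → (W.Y k $ G) ≈ᵤ (lift (Yl k) $ G)
 Y-lift zero G = reflᵤ
 Y-lift (suc k) G = +ᵤ-cong (pow-lift k G) (transᵤ (Lin.cong W.L′ (Y-lift k G)) (L′-lift (lift (Yl k) $ G)))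

 -- The coefficient of a positive power of u in `commutator`. The term with Y is free of u and
 -- disappears, and the remainder lies in degrees above the weight of w.
 star : ∀ n k ℓ g w → k ℕ.+ suc (wt w) ℕ.≤ n →
  fn (I⁺ k $ (Cᵗ n (suc ℓ) $ g)) w ≈ fn (Cᵗ n (suc ℓ) $ (I⁺ k $ g)) w + fn (Wc k (suc ℓ) $ g) w
 star n k ℓ g w le = begin
  fn (I⁺ k $ (Cᵗ n ℓ′ $ g)) w ≈⟨ sym (at lhs w) ⟩
  fn (left ℓ′ 0) w ≈⟨ at (atₙ (atₙ (atˡ eq (ι $ g)) ℓ′) 0) w ⟩
  ((fn (right₁ ℓ′ 0) w + - fn (right₂ ℓ′ 0) w) + fn ((W.W k $ (ι $ g)) ℓ′ 0) w) + fn ((e $ (ι $ g)) ℓ′ 0) w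
   ≈⟨ +-cong (+-cong (+-cong (at r₁ w) (trans (-‿cong (at y0 w)) -0≈0)) (at (W-ι k ℓ′ g) w)) (vat (se (ι $ g) ℓ′ {wt w} (NP.n<1+n (wt w))) 0 w P.refl) ⟩
  ((fn (Cᵗ n ℓ′ $ (I⁺ k $ g)) w + 0#) + fn (Wc k ℓ′ $ g) w) + 0# ≈⟨ trans (+-identityʳ _) (+-congʳ (+-identityʳ _)) ⟩
  fn (Cᵗ n ℓ′ $ (I⁺ k $ g)) w + fn (Wc k ℓ′ $ g) w ∎
  where
  com = commutator n k (suc (wt w)) (NP.≤-trans (NP.≤-trans (ℕ.s≤s ℕ.z≤n) (NP.m≤n+m (suc (wt w)) k)) le) le
  e = proj₁ com
  se = proj₁ (proj₂ com)
  eq = proj₂ (proj₂ com)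
  ℓ′ = suc ℓ
  left right₁ right₂ : El Hᵤ
  left = lift P $ (N.pow W.L′ k $ (W.B n $ (lift P $ (ι $ g))))
  right₁ = W.B n $ (lift P $ (N.pow W.L′ k $ (lift P $ (ι $ g))))
  right₂ = lift P $ (W.Y k $ (lift P $ (ι $ g)))
  lhs : left ℓ′ 0 ≈ₛ (I⁺ k $ (Cᵗ n ℓ′ $ g))
  lhs = transₛ (atₙ (atₙ (Lin.cong (N.pow W.L′ k ∘ˡ W.B n) (P-ι g)) ℓ′) 0) (transₛ (atₙ (atₙ (pow-lift k (W.B n $ (ι $ g))) ℓ′) 0) (Lin.cong (bra ∘ˡ powˡ L⁺ k) (Bι-vac n ℓ′ g)))
  r₁ : right₁ ℓ′ 0 ≈ₛ (Cᵗ n ℓ′ $ (I⁺ k $ g))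
  r₁ = transₛ (atₙ (atₙ (Lin.cong (W.B n) (PL-ι k g)) ℓ′) 0) (B-C n ℓ′ (I⁺ k $ g))
  y0 : right₂ ℓ′ 0 ≈ₛ 0ₛ
  y0 = transₛ (atₙ (atₙ (Lin.cong (W.Y k) (P-ι g)) ℓ′) 0) (transₛ (atₙ (atₙ (Y-lift k (ι $ g)) ℓ′) 0) (atₙ (Lin.zer (Yl k)) 0))

 Xᵏ-fil : ∀ n {d g} → Filₛ d g → Fil (n ℕ.+ d) (Xᵏ n $ g)
 Xᵏ-fil zero h zero lt = vac-van (fatₛ h lt)
 Xᵏ-fil zero h (suc e) lt = van-0
 Xᵏ-fil (suc n) h = X-fil (Xᵏ-fil n h)

 β-fil : ∀ n ℓ {d g} → Filₛ d g → Filₛ (suc n ℕ.+ d) (β n ℓ $ g)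
 β-fil n ℓ h = filₛ-scal α⁻¹ (filₛ λ lt → Θ-van (Xᵏ-fil (suc n) h ℓ lt))

 X-top : ∀ n ℓ → n ℕ.< ℓ → ∀ g → (Xᵏ n $ g) ℓ ≈ₕ 0ₕ
 X-top zero (suc ℓ) lt g = reflₕ
 X-top (suc n) (suc ℓ) lt g = transₕ (Lin.cong S (transₕ (+ₕ-cong (transₕ (Lin.cong L (X-top n (suc ℓ) (NP.m<n⇒m<1+n (NP.≤-pred lt)) g)) (Lin.zer L)) (X-top n ℓ (NP.≤-pred lt) g)) (+ₕ-identityˡ _))) (Lin.zer S)

 X-lead : ∀ n g → (Xᵏ n $ g) n ≈ₕ (powˡ S n $ (vac $ g))
 X-lead zero g = reflₕ
 X-lead (suc n) g = Lin.cong S (transₕ (+ₕ-cong (transₕ (Lin.cong L (X-top n (suc n) (NP.n<1+n n) g)) (Lin.zer L)) (X-lead n g)) (+ₕ-identityˡ _))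

 -- multiplication by p_{i+1}
 pₘ : ℕ → Lin V V
 pₘ i = Θ ∘ˡ powˡ S (suc i) ∘ˡ vac

 β-top : ∀ n ℓ → suc n ℕ.< ℓ → ∀ g → (β n ℓ $ g) ≈ₛ 0ₛ
 β-top n ℓ lt g = transₛ (*ₛ-cong refl (transₛ (Lin.cong Θ (X-top (suc n) ℓ lt g)) (Lin.zer Θ))) (*ₛ-zeroʳ _)

 β-lead : ∀ n g → (β n (suc n) $ g) ≈ₛ (α⁻¹ *ₛ (pₘ n $ g))
 β-lead n g = *ₛ-cong refl (Lin.cong Θ (X-lead (suc n) g))

 -- B_n raises the degree by n, so the later summands do not reach a word of weight at most n.
 -- Truncating at the weight of the word therefore gives a well-defined C.
 Cᵗ-stable : ∀ n k ℓ g w → wt w ℕ.≤ n → fn (Cᵗ (k ℕ.+ n) ℓ $ g) w ≈ fn (Cᵗ n ℓ $ g) w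
 Cᵗ-stable n zero ℓ g w le = refl
 Cᵗ-stable n (suc k) ℓ g w le = trans (+-cong (Cᵗ-stable n k ℓ g w le) (*-zeroʳ′ (vatₛ (fatₛ (β-fil (k ℕ.+ n) ℓ {0} {g} (filₛ λ ())) (ℕ.s≤s (NP.≤-trans le (NP.≤-trans (NP.m≤n+m n k) (NP.m≤m+n _ 0))))) w P.refl))) (+-identityʳ _)

 Cᵗ-stable′ : ∀ N ℓ g w → wt w ℕ.≤ N → fn (Cᵗ N ℓ $ g) w ≈ fn (Cᵗ (wt w) ℓ $ g) w
 Cᵗ-stable′ N ℓ g w le = trans (reflexive (P.cong (λ n → fn (Cᵗ n ℓ $ g) w) (P.sym (NP.m∸n+n≡m le)))) (Cᵗ-stable (wt w) (N ℕ.∸ wt w) ℓ g w NP.≤-refl)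

 -- C ℓ = [u^ℓ] B_∞(-1, p, u)
 C : ℕ → Lin V V
 C ℓ = record
  { _$_ = λ g → symf (λ w → fn (Cᵗ (wt w) ℓ $ g) w) (λ {v} {w} p → trans (resp (Cᵗ (wt v) ℓ $ g) p) (reflexive (P.cong (λ n → fn (Cᵗ n ℓ $ g) w) (wt-resp p))))
  ; cong = λ e → pt λ w → at (Lin.cong (Cᵗ (wt w) ℓ) e) w
  ; add = λ f g → pt λ w → at (Lin.add (Cᵗ (wt w) ℓ) f g) w
  ; scal = λ c f → pt λ w → at (Lin.scal (Cᵗ (wt w) ℓ) c f) w }

 -- B_n has degree at most n in u and raises the degree by n; a summand that contains u^ℓ thus has n
 -- ≥ ℓ.
 Cᵗ-fil : ∀ N ℓ {d g} → Filₛ d g → Filₛ (ℓ ℕ.+ d) (Cᵗ N ℓ $ g)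
 Cᵗ-fil zero ℓ h = filₛ-0
 Cᵗ-fil (suc n) ℓ {d} {g} h = filₛ-+ (Cᵗ-fil n ℓ h) (filₛ-scal _ (β-part (NP.<-≤-connex (suc n) ℓ)))
  where
  β-part : (suc n ℕ.< ℓ) ⊎ (ℓ ℕ.≤ suc n) → Filₛ (ℓ ℕ.+ d) (β n ℓ $ g)
  β-part (inj₁ lt) = filₛ-cong (symₛ (β-top n ℓ lt g)) filₛ-0
  β-part (inj₂ le) = filₛ-≤ (NP.+-monoˡ-≤ d le) (β-fil n ℓ h)

 C-fil : ∀ ℓ {d g} → Filₛ d g → Filₛ (ℓ ℕ.+ d) (C ℓ $ g)
 C-fil ℓ h = filₛ λ lt → vanₛ λ w e → vatₛ (fatₛ (Cᵗ-fil (wt w) ℓ h) lt) w e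

 C-agree : ∀ N ℓ g w → wt w ℕ.≤ N → fn (C ℓ $ g) w ≈ fn (Cᵗ N ℓ $ g) w
 C-agree N ℓ g w le = sym (Cᵗ-stable′ N ℓ g w le)

 -- I⁺_k lowers the degree by at most k, so at a word w the truncation at k + wt w + 1 can replace C
 -- on both sides.
 C-star : ∀ k ℓ g → (I⁺ k $ (C (suc ℓ) $ g)) ≈ₛ ((C (suc ℓ) $ (I⁺ k $ g)) +ₛ (Wc k (suc ℓ) $ g))
 C-star k ℓ g = pt λ w → go w (k ℕ.+ suc (wt w)) NP.≤-refl
  where
  go : ∀ w n → k ℕ.+ suc (wt w) ℕ.≤ n → fn (I⁺ k $ (C (suc ℓ) $ g)) w ≈ fn (C (suc ℓ) $ (I⁺ k $ g)) w + fn (Wc k (suc ℓ) $ g) w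
  go w n le = begin
   fn (I⁺ k $ (C (suc ℓ) $ g)) w ≈⟨ local (I⁺ k) (I⁺-fil k {suc (wt w)}) (λ v lt → C-agree n (suc ℓ) g v (NP.≤-trans (NP.<⇒≤ lt) le)) w (NP.n<1+n (wt w)) ⟩
   fn (I⁺ k $ (Cᵗ n (suc ℓ) $ g)) w ≈⟨ star n k ℓ g w le ⟩
   fn (Cᵗ n (suc ℓ) $ (I⁺ k $ g)) w + fn (Wc k (suc ℓ) $ g) w ≈⟨ +-congʳ (sym (C-agree n (suc ℓ) (I⁺ k $ g) w (NP.≤-trans (NP.n≤1+n (wt w)) (NP.≤-trans (NP.m≤n+m (suc (wt w)) k) le)))) ⟩
   fn (C (suc ℓ) $ (I⁺ k $ g)) w + fn (Wc k (suc ℓ) $ g) w ∎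

 -- Only B_{ℓ+1} contributes: its predecessors do not contain u^{ℓ+1}, and its successors raise the
 -- degree too far. Its top coefficient in u is multiplication by p_{ℓ+1}/α.
 C-lead : ∀ ℓ {d g} → Filₛ d g → ∀ w → wt w ≡ suc ℓ ℕ.+ d → fn (C (suc ℓ) $ g) w ≈ sgnK (suc ℓ) * inv ℓ * (α⁻¹ * fn (pₘ ℓ $ g) w)
 C-lead ℓ {d} {g} h w e = trans (reflexive (P.cong (λ n → fn (Cᵗ n (suc ℓ) $ g) w) (P.trans e (NP.+-comm (suc ℓ) d)))) (go d NP.≤-refl)
  where
  below : ∀ n → n ℕ.≤ ℓ → fn (Cᵗ n (suc ℓ) $ g) w ≈ 0#
  below zero le = refl
  below (suc n) le = trans (+-cong (below n (NP.<⇒≤ le)) (*-zeroʳ′ (at (β-top n (suc ℓ) (ℕ.s≤s le) g) w))) (+-identityʳ 0#)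
  go : ∀ j → j ℕ.≤ d → fn (Cᵗ (j ℕ.+ suc ℓ) (suc ℓ) $ g) w ≈ sgnK (suc ℓ) * inv ℓ * (α⁻¹ * fn (pₘ ℓ $ g) w)
  go zero le = trans (+-cong (below ℓ NP.≤-refl) (*-congˡ (at (β-lead ℓ g) w))) (+-identityˡ _)
  go (suc j) le = trans (+-cong (go j (NP.<⇒≤ le)) (*-zeroʳ′ (vatₛ (fatₛ (β-fil (j ℕ.+ suc ℓ) (suc ℓ) h) big) w e))) (+-identityʳ _)
   where
   big : suc ℓ ℕ.+ d ℕ.< suc (j ℕ.+ suc ℓ) ℕ.+ d
   big = NP.+-monoˡ-< d (ℕ.s≤s (NP.m≤n+m (suc ℓ) j))

-- Uniqueness of joint eigenvectors, and the substitution p₁ ↦ p₁ + 1.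

module Translation (K : Scalars) where
 open Linear K
 open Lax K
 open Beltrami K
 open LaxCommutation K
 open Series K
 open COperators K

 powˡ-comm : ∀ {M} (T : Lin M M) k → (powˡ T (suc k)) ≈ˡ (powˡ T k ∘ˡ T)
 powˡ-comm {M} T zero = ptˡ λ x → LeftModule.≈ᴹ-refl M
  where open import Algebra.Module.Bundles using (LeftModule)
 powˡ-comm T (suc k) = ptˡ λ x → Lin.cong T (atˡ (powˡ-comm T k) x)

 L⁺-vac : ∀ f → (L⁺ $ (vac $ f)) ≈ₕ (a $ f)
 L⁺-vac f = transₕ (+ₕ-cong (L-vac f) (ptₙ λ i → reflₛ)) (+ₕ-identityʳ _)

 L⁺ᵏ-lead : ∀ k d F → Filₕ (k ℕ.+ d) F → ∀ i v → i ℕ.+ wt v ≡ d → fn ((powˡ L⁺ k $ F) i) v ≈ fn (F (k ℕ.+ i)) v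
 L⁺ᵏ-lead zero d F h i v e = refl
 L⁺ᵏ-lead (suc k) d F h i v e = trans (+-cong (vat (L-van (fatₕ (L⁺ᵏ-fil k {suc d} h′) (NP.n<1+n d))) i v e) (L⁺ᵏ-lead k (suc d) F h′ (suc i) v (P.cong suc e)))
  (trans (+-identityˡ _) (reflexive (P.cong (λ n → fn (F n) v) (NP.+-suc k i))))
  where
  h′ : Filₕ (k ℕ.+ suc d) F
  h′ = P.subst (λ n → Filₕ n F) (P.sym (NP.+-suc k d)) h

 -- The first factor L + S* turns f into a f. To reach the lowest possible degree each of the other
 -- i + 1 factors has to be S*, and together they pick the coefficient α (i+1) ∂_{i+1} f of y^{i+1}.
 I⁺-lead : ∀ i v f → Filₛ (suc i ℕ.+ wt v) f → fn (I⁺ (suc (suc i)) $ f) v ≈ α * nat (suc i) * fn f (i ∷ v)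
 I⁺-lead i v f h = trans (at (atₙ (transₕ (atˡ (powˡ-comm L⁺ (suc i)) (vac $ f)) (Lin.cong (powˡ L⁺ (suc i)) (L⁺-vac f))) 0) v)
  (trans (L⁺ᵏ-lead (suc i) (wt v) (a $ f) (filₕ λ lt → a-van (fatₛ h lt)) 0 v P.refl) (reflexive (P.cong (λ n → fn (afn f n) v) (NP.+-identityʳ (suc i)))))

 cancel-αn : ∀ i x → α * nat (suc i) * x ≈ 0# → x ≈ 0#
 cancel-αn i x e = begin
  x ≈⟨ sym (trans (*-congʳ (trans (*-cong α⁻¹*α (inv* i)) (*-identityˡ 1#))) (*-identityˡ x)) ⟩
  (α⁻¹ * α) * (inv i * nat (suc i)) * x ≈⟨ solve 5 (λ y x i n z → (y :* x) :* (i :* n) :* z := (y :* i) :* (x :* n :* z)) refl α⁻¹ α (inv i) (nat (suc i)) x ⟩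
  (α⁻¹ * inv i) * (α * nat (suc i) * x) ≈⟨ *-zeroʳ′ e ⟩
  0# ∎

 -- By `I⁺-lead`, each derivative of the lowest-degree part of f is an eigenvalue times a component
 -- of lower degree, which is already zero. For a word i ∷ v the index k is i + 2, so k + wt v is
 -- the weight plus one; hence the bound suc D.
 eigenvector-zero : ∀ D (e : ℕ → Carrier) f → fn f [] ≈ 0# →
  (∀ k v → k ℕ.+ wt v ℕ.≤ suc D → fn (I⁺ k $ f) v ≈ e k * fn f v) → ∀ w → wt w ℕ.≤ D → fn f w ≈ 0#
 eigenvector-zero D e f ε0 eig w le = vatₛ (fatₛ (go (wt w) le) (NP.n<1+n (wt w))) w P.refl
  where
  zero-degree : ∀ w → wt w ≡ 0 → fn f w ≈ 0#
  zero-degree [] _ = ε0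
  go : ∀ n → n ℕ.≤ D → Filₛ (suc n) f
  top : ∀ n → suc n ℕ.≤ D → ∀ w → wt w ≡ suc n → fn f w ≈ 0#
  top n le (i ∷ v) eq = cancel-αn i _ (trans (sym (I⁺-lead i v f (P.subst (λ m → Filₛ m f) (P.sym eq) (go n (NP.<⇒≤ le)))))
   (trans (eig (suc (suc i)) v (ℕ.s≤s (NP.≤-trans (NP.≤-reflexive eq) le))) (*-zeroʳ′ (vatₛ (fatₛ (go n (NP.<⇒≤ le)) (NP.≤-trans (ℕ.s≤s (NP.m≤n+m (wt v) i)) (NP.≤-reflexive eq))) v P.refl))))
  go zero le = filₛ λ { {zero} lt → vanₛ zero-degree ; {suc d} (ℕ.s≤s ()) }
  go (suc n) le = filₛ λ {d} lt → vanₛ λ w eq → split′ d lt w eq (NP.m≤n⇒m<n∨m≡n (NP.≤-pred lt))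
   where
   split′ : ∀ d → d ℕ.< suc (suc n) → ∀ w → wt w ≡ d → (d ℕ.< suc n) ⊎ (d ≡ suc n) → fn f w ≈ 0#
   split′ d lt w eq (inj₁ lt′) = vatₛ (fatₛ (go n (NP.<⇒≤ le)) lt′) w eq
   split′ d lt w eq (inj₂ P.refl) = top n le w eq

 ifact : ℕ → Carrier
 ifact zero = 1#
 ifact (suc n) = inv n * ifact n

 zeros : ℕ → List ℕ → List ℕ
 zeros zero w = w
 zeros (suc r) w = 0 ∷ zeros r w

 zeros-resp : ∀ r {v w} → v ↭ w → zeros r v ↭ zeros r w
 zeros-resp zero p = p
 zeros-resp (suc r) p = prep 0 (zeros-resp r p)

 zeros-∷ : ∀ r i w → zeros r (i ∷ w) ↭ i ∷ zeros r w
 zeros-∷ zero i w = ↭-refl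
 zeros-∷ (suc r) i w = ↭-trans (prep 0 (zeros-∷ r i w)) (swap 0 i ↭-refl)

 -- cut n t h = h (n - t) if t ≤ n, and 0 otherwise
 cut : ℕ → ℕ → (ℕ → Carrier) → Carrier
 cut n zero h = h n
 cut zero (suc t) h = 0#
 cut (suc n) (suc t) h = cut n t h

 cut-cong : ∀ n t {h h′} → (∀ r → h r ≈ h′ r) → cut n t h ≈ cut n t h′
 cut-cong n zero e = e n
 cut-cong zero (suc t) e = refl
 cut-cong (suc n) (suc t) e = cut-cong n t e

 cut-add : ∀ n t h h′ → cut n t (λ r → h r + h′ r) ≈ cut n t h + cut n t h′
 cut-add n zero h h′ = refl
 cut-add zero (suc t) h h′ = sym (+-identityˡ 0#)
 cut-add (suc n) (suc t) h h′ = cut-add n t h h′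

 cut-scal : ∀ n t c h → cut n t (λ r → c * h r) ≈ c * cut n t h
 cut-scal n zero c h = refl
 cut-scal zero (suc t) c h = sym (zeroʳ c)
 cut-scal (suc n) (suc t) c h = cut-scal n t c h

 cut-shift : ∀ n t h h′ → h 0 ≈ 0# → (∀ r → h (suc r) ≈ h′ r) → cut n t h ≈ cut n (suc t) h′
 cut-shift zero zero h h′ e₀ e = e₀
 cut-shift (suc n) zero h h′ e₀ e = e n
 cut-shift zero (suc t) h h′ e₀ e = refl
 cut-shift (suc n) (suc t) h h′ e₀ e = cut-shift n t h h′ e₀ e

 module Translate (n : ℕ) where

  -- T 0 is f ↦ f(p₁+1, p₂, …) on the part of degree n
  T : ℕ → Lin V V
  T s = record
   -- Of the Taylor sum Σ ∂₁^r f / r! only the term with r = n - s - wt w is kept. It is the only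
   -- one that can be nonzero when f is homogeneous of degree n - s.
   { _$_ = λ f → symf (λ w → val f (s ℕ.+ wt w) w) (λ {v} {w} p → trans (cut-cong n (s ℕ.+ wt v) (λ r → *-congˡ (resp f (zeros-resp r p)))) (reflexive (P.cong (λ t → val f (s ℕ.+ t) w) (wt-resp p))))
   ; cong = λ e → pt λ w → cut-cong n (s ℕ.+ wt w) (λ r → *-congˡ (at e (zeros r w)))
   ; add = λ f g → pt λ w → trans (cut-cong n (s ℕ.+ wt w) (λ r → distribˡ _ _ _)) (cut-add n (s ℕ.+ wt w) _ _)
   ; scal = λ c f → pt λ w → trans (cut-cong n (s ℕ.+ wt w) (λ r → *-left-comm _ _ _)) (cut-scal n (s ℕ.+ wt w) c _) }
   where
   val : Sym → ℕ → List ℕ → Carrier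
   val f t w = cut n t (λ r → ifact r * fn f (zeros r w))

  T-≡ : ∀ {s s′} → s ≡ s′ → ∀ f → (T s $ f) ≈ₛ (T s′ $ f)
  T-≡ P.refl f = reflₛ

  δT : ∀ i s f → (δ i $ (T s $ f)) ≈ₛ (T (s ℕ.+ suc i) $ (δ i $ f))
  δT i s f = pt λ w → trans (reflexive (P.cong (λ t → cut n t (λ r → ifact r * fn f (zeros r (i ∷ w)))) (P.sym (NP.+-assoc s (suc i) (wt w)))))
   (cut-cong n (s ℕ.+ suc i ℕ.+ wt w) (λ r → *-congˡ (resp f (zeros-∷ r i w))))

  -- The index grows with j because y^j counts as degree j.
  T̂ : ℕ → Lin H H
  T̂ s = record
   { _$_ = λ F j → T (s ℕ.+ j) $ F j
   ; cong = λ e → ptₙ λ j → Lin.cong (T (s ℕ.+ j)) (atₙ e j)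
   ; add = λ F G → ptₙ λ j → Lin.add (T (s ℕ.+ j)) (F j) (G j)
   ; scal = λ c F → ptₙ λ j → Lin.scal (T (s ℕ.+ j)) c (F j) }

  Θ-zeros : ∀ F r → fn (Θ $ F) (zeros (suc r) []) ≈ nat (suc r) * fn (F 1) (zeros r [])
  Θ-zeros F zero = trans (+-identityʳ _) (sym (trans (*-congʳ (+-identityʳ 1#)) (*-identityˡ _)))
  Θ-zeros F (suc r) = trans (+-congˡ (Θ-zeros (shift 0 F) r)) (sym (trans (distribʳ _ _ _) (+-congʳ (*-identityˡ _))))

  -- The summand p₁ F_1 becomes (p₁ + 1) F_1, which leaves the additional F_1. At the empty word
  -- this is the Taylor term of order r + 1, where 1/(r+1)! meets the factor r + 1 of `Θ-zeros`.
  TΘ : ∀ s F → (T s $ (Θ $ F)) ≈ₛ ((Θ $ (T̂ s $ F)) +ₛ (T̂ s $ F) 1)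
  TΘ s F = pt λ w → go w s F
   where
   go : ∀ w s F → fn (T s $ (Θ $ F)) w ≈ fn (Θ $ (T̂ s $ F)) w + fn ((T̂ s $ F) 1) w
   go [] s F = trans (cut-shift n (s ℕ.+ 0) _ (λ r → ifact r * fn (F 1) (zeros r [])) (zeroʳ _) (λ r → trans (*-congˡ (Θ-zeros F r))
     (trans (solve 4 (λ i f m x → (i :* f) :* (m :* x) := (i :* m) :* (f :* x)) refl _ _ _ _) (trans (*-congʳ (inv* r)) (*-identityˡ _)))))
    (trans (reflexive (P.cong (λ t → cut n t (λ r → ifact r * fn (F 1) (zeros r []))) (P.trans (P.cong suc (NP.+-identityʳ s)) (P.trans (NP.+-comm 1 s) (P.sym (NP.+-identityʳ (s ℕ.+ 1))))))) (sym (+-identityˡ _)))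
   go (i ∷ w) s F = begin
    fn (δ i $ (T s $ (Θ $ F))) w ≈⟨ at (transₛ (δT i s (Θ $ F)) (Lin.cong (T s′) (δΘ i F))) w ⟩
    fn (T s′ $ ((Θ $ (lift (δ i) $ F)) +ₛ F (suc i))) w ≈⟨ at (Lin.add (T s′) (Θ $ (lift (δ i) $ F)) (F (suc i))) w ⟩
    fn (T s′ $ (Θ $ (lift (δ i) $ F))) w + fn (T s′ $ F (suc i)) w ≈⟨ +-congʳ (go w s′ (lift (δ i) $ F)) ⟩
    (fn (Θ $ (T̂ s′ $ (lift (δ i) $ F))) w + fn ((T̂ s′ $ (lift (δ i) $ F)) 1) w) + fn (T s′ $ F (suc i)) w
     ≈⟨ solve 3 (λ x y z → (x :+ y) :+ z := (z :+ x) :+ y) refl _ _ _ ⟩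
    (fn (T s′ $ F (suc i)) w + fn (Θ $ (T̂ s′ $ (lift (δ i) $ F))) w) + fn ((T̂ s′ $ (lift (δ i) $ F)) 1) w
     ≈⟨ +-cong (+-congˡ (at (Lin.cong Θ (ptₙ λ j → symₛ (idx j))) w)) (sym (at (idx 1) w)) ⟩
    (fn (T s′ $ F (suc i)) w + fn (Θ $ (lift (δ i) $ (T̂ s $ F))) w) + fn (δ i $ (T̂ s $ F) 1) w ∎
    where
    s′ = s ℕ.+ suc i
    idx : ∀ j → (δ i $ (T (s ℕ.+ j) $ F j)) ≈ₛ (T (s′ ℕ.+ j) $ (δ i $ F j))
    idx j = transₛ (δT i (s ℕ.+ j) (F j)) (T-≡ (P.trans (NP.+-assoc s j (suc i)) (P.trans (P.cong (s ℕ.+_) (NP.+-comm j (suc i))) (P.sym (NP.+-assoc s (suc i) j)))) (δ i $ F j))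

  Ta : ∀ s f j → (T (s ℕ.+ j) $ afn f j) ≈ₛ afn (T s $ f) j
  Ta s f zero = Lin.zer (T (s ℕ.+ 0))
  Ta s f (suc i) = transₛ (Lin.scal (T (s ℕ.+ suc i)) _ (δ i $ f)) (*ₛ-cong refl (symₛ (δT i s f)))

  T̂S* : ∀ s F → (T̂ (suc s) $ (S* $ F)) ≈ₕ (S* $ (T̂ s $ F))
  T̂S* s F = ptₙ λ j → T-≡ (P.sym (NP.+-suc s j)) (F (suc j))

  TA : ∀ m s F → (T (s ℕ.+ m) $ Afn F m) ≈ₛ Afn (T̂ s $ F) m
  TA zero s F = Lin.zer (T (s ℕ.+ 0))
  TA (suc m) s F = transₛ (Lin.add (T (s ℕ.+ suc m)) (afn (F 0) (suc m)) (Afn (S* $ F) m))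
   (+ₛ-cong (transₛ (Ta s (F 0) (suc m)) (atₙ (Lin.cong a (T-≡ (P.sym (NP.+-identityʳ s)) (F 0))) (suc m)))
    (transₛ (T-≡ (NP.+-suc s m) (Afn (S* $ F) m)) (transₛ (TA m (suc s) (S* $ F)) (Afn-cong (T̂S* s F) m))))

  TB : ∀ m s F → (T (s ℕ.+ m) $ Bfn F m) ≈ₛ (Bfn (T̂ s $ F) m +ₛ (T̂ s $ F) (suc m))
  TB zero s F = transₛ (T-≡ (NP.+-identityʳ s) (Θ $ F)) (TΘ s F)
  TB (suc m) s F = transₛ (T-≡ (NP.+-suc s m) (Bfn (S* $ F) m)) (transₛ (TB m (suc s) (S* $ F)) (+ₛ-cong (Bfn-cong (T̂S* s F) m) (atₙ (T̂S* s F) (suc m))))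

  -- A and N do not contain p₁ as a factor. In B the shift of p₁ adds F_{m+1} to the coefficient of
  -- y^m, and this is S*.
  T̂L : ∀ s F → (T̂ s $ (L $ F)) ≈ₕ (L⁺ $ (T̂ s $ F))
  T̂L s F = ptₙ λ m → pt λ w → begin
   fn (T (s ℕ.+ m) $ ((Afn F m +ₛ Bfn F m) +ₛ (b *ₛ (nat m *ₛ F m)))) w
    ≈⟨ trans (at (Lin.add (T (s ℕ.+ m)) (Afn F m +ₛ Bfn F m) (b *ₛ (nat m *ₛ F m))) w) (+-cong (at (Lin.add (T (s ℕ.+ m)) (Afn F m) (Bfn F m)) w)
      (trans (at (Lin.scal (T (s ℕ.+ m)) b (nat m *ₛ F m)) w) (*-congˡ (at (Lin.scal (T (s ℕ.+ m)) (nat m) (F m)) w)))) ⟩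
   (fn (T (s ℕ.+ m) $ Afn F m) w + fn (T (s ℕ.+ m) $ Bfn F m) w) + b * (nat m * fn ((T̂ s $ F) m) w)
    ≈⟨ +-congʳ (+-cong (at (TA m s F) w) (at (TB m s F) w)) ⟩
   (fn (Afn (T̂ s $ F) m) w + (fn (Bfn (T̂ s $ F) m) w + fn ((T̂ s $ F) (suc m)) w)) + b * (nat m * fn ((T̂ s $ F) m) w)
    ≈⟨ solve 4 (λ x y z t → (x :+ (y :+ z)) :+ t := ((x :+ y) :+ t) :+ z) refl _ _ _ _ ⟩
   ((fn (Afn (T̂ s $ F) m) w + fn (Bfn (T̂ s $ F) m) w) + b * (nat m * fn ((T̂ s $ F) m) w)) + fn ((T̂ s $ F) (suc m)) w ∎

  T̂Lᵏ : ∀ k F → (T̂ 0 $ (powˡ L k $ F)) ≈ₕ (powˡ L⁺ k $ (T̂ 0 $ F))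
  T̂Lᵏ zero F = reflₕ
  T̂Lᵏ (suc k) F = transₕ (T̂L 0 (powˡ L k $ F)) (Lin.cong L⁺ (T̂Lᵏ k F))

  T-I : ∀ k f → (T 0 $ (bra $ (powˡ L k $ (vac $ f)))) ≈ₛ (I⁺ k $ (T 0 $ f))
  T-I k f = transₛ (atₙ (T̂Lᵏ k (vac $ f)) 0) (atₙ (Lin.cong (powˡ L⁺ k) (ptₙ λ { zero → reflₛ ; (suc j) → Lin.zer (T (suc j)) })) 0)

-- Adding a variable: the substitution p_k ↦ p_k + y^k.

module Tau (K : Scalars) where
 open Linear K
 open Lax K
 open Beltrami K
 open Series K using (powˡ)

 sing : ℕ → Lin V H
 sing k = powˡ S k ∘ˡ vac

 sing-same : ∀ k f → (sing k $ f) k ≈ₛ f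
 sing-same zero f = reflₛ
 sing-same (suc k) f = sing-same k f

 sing-below : ∀ k j f → j ℕ.< k → (sing k $ f) j ≈ₛ 0ₛ
 sing-below (suc k) zero f lt = reflₛ
 sing-below (suc k) (suc j) f (ℕ.s≤s lt) = sing-below k j f lt

 sing-above : ∀ k j f → k ℕ.< j → (sing k $ f) j ≈ₛ 0ₛ
 sing-above zero (suc j) f lt = reflₛ
 sing-above (suc k) (suc j) f (ℕ.s≤s lt) = sing-above k j f lt

 A-below : ∀ m F G → (∀ j → j ℕ.< m → F j ≈ₛ G j) → Afn F m ≈ₛ Afn G m
 A-below zero F G e = reflₛ
 A-below (suc m) F G e = +ₛ-cong (atₙ (Lin.cong a (e 0 (ℕ.s≤s ℕ.z≤n))) (suc m)) (A-below m (S* $ F) (S* $ G) (λ j lt → e (suc j) (ℕ.s≤s lt)))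

 -- τ n f = [xⁿ] f(p₁ + x, p₂ + x², …); tauN n collects the first n+1 of them.
 tauN : ℕ → Lin V H
 tauN zero = vac
 tauN (suc n) = tauN n +ˡ ((inv n * α⁻¹) ·ˡ (sing (suc n) ∘ˡ comp (suc n) ∘ˡ A ∘ˡ tauN n))

 tauN-above : ∀ n j f → n ℕ.< j → (tauN n $ f) j ≈ₛ 0ₛ
 tauN-above zero (suc j) f lt = reflₛ
 tauN-above (suc n) j f lt = pt λ w → trans (+-cong (at (tauN-above n j f (NP.<-trans (NP.n<1+n n) lt)) w) (*-zeroʳ′ (at (sing-above (suc n) j ((A $ (tauN n $ f)) (suc n)) lt) w))) (+-identityʳ 0#)

 τ : ℕ → Lin V V
 τ n = comp n ∘ˡ tauN n

 tauN-τ′ : ∀ d j f → (tauN (d ℕ.+ j) $ f) j ≈ₛ (τ j $ f)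
 tauN-τ′ zero j f = reflₛ
 tauN-τ′ (suc d) j f = pt λ w → trans (+-cong (at (tauN-τ′ d j f) w) (*-zeroʳ′ (at (sing-below (suc (d ℕ.+ j)) j ((A $ (tauN (d ℕ.+ j) $ f)) (suc (d ℕ.+ j))) (ℕ.s≤s (NP.m≤n+m j d))) w))) (+-identityʳ _)

 tauN-τ : ∀ n j f → j ℕ.≤ n → (tauN n $ f) j ≈ₛ (τ j $ f)
 tauN-τ n j f le = P.subst (λ m → (tauN m $ f) j ≈ₛ (τ j $ f)) (NP.m∸n+n≡m le) (tauN-τ′ (n ℕ.∸ j) j f)

 τ̃ : Lin V H
 τ̃ = record
  { _$_ = λ f n → τ n $ f
  ; cong = λ e → ptₙ λ n → Lin.cong (τ n) e
  ; add = λ f g → ptₙ λ n → Lin.add (τ n) f g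
  ; scal = λ c f → ptₙ λ n → Lin.scal (τ n) c f }

 τ-suc : ∀ n f → (τ (suc n) $ f) ≈ₛ ((inv n * α⁻¹) *ₛ Afn (τ̃ $ f) (suc n))
 τ-suc n f = pt λ w → trans (+-cong (at (tauN-above n (suc n) f (NP.n<1+n n)) w)
   (*-congˡ (trans (at (sing-same (suc n) (Afn (tauN n $ f) (suc n))) w) (at (A-below (suc n) (tauN n $ f) (τ̃ $ f) (λ j lt → tauN-τ n j f (NP.≤-pred lt))) w)))) (+-identityˡ _)

 -- The logarithmic derivative of exp(Σ y^k ∂_k): y d/dy acts on it as Σ k y^k ∂_k, which is A/α.
 ατ : ∀ n f → (α *ₛ (nat n *ₛ (τ n $ f))) ≈ₛ Afn (τ̃ $ f) n
 ατ zero f = pt λ w → *-zeroʳ′ (zeroˡ _)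
 ατ (suc n) f = pt λ w → trans (*-congˡ (*-congˡ (at (τ-suc n f) w))) (trans
  (solve 5 (λ x m i y z → x :* (m :* ((i :* y) :* z)) := (y :* x) :* ((i :* m) :* z)) refl α (nat (suc n)) (inv n) α⁻¹ _)
  (trans (*-cong α⁻¹*α (trans (*-congʳ (inv* n)) (*-identityˡ _))) (*-identityˡ _)))

 Commutesδ : Lin V V → Set
 Commutesδ T = ∀ i f → (T $ (δ i $ f)) ≈ₛ (δ i $ (T $ f))

 module _ (T : Lin V V) (c : Commutesδ T) where
  T-a : ∀ f j → (T $ afn f j) ≈ₛ afn (T $ f) j
  T-a f zero = Lin.zer T
  T-a f (suc j) = transₛ (Lin.scal T _ _) (*ₛ-cong refl (c j f))

  T-A : ∀ m F → (T $ Afn F m) ≈ₛ Afn (lift T $ F) m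
  T-A zero F = Lin.zer T
  T-A (suc m) F = transₛ (Lin.add T _ _) (+ₛ-cong (T-a (F 0) (suc m)) (T-A m (S* $ F)))

  T-sing : ∀ k f j → (T $ (sing k $ f) j) ≈ₛ (sing k $ (T $ f)) j
  T-sing zero f zero = reflₛ
  T-sing zero f (suc j) = Lin.zer T
  T-sing (suc k) f zero = Lin.zer T
  T-sing (suc k) f (suc j) = T-sing k f j

  T-tauN : ∀ n f → (lift T $ (tauN n $ f)) ≈ₕ (tauN n $ (T $ f))
  T-tauN zero f = ptₙ λ { zero → reflₛ ; (suc i) → Lin.zer T }
  T-tauN (suc n) f = ptₙ λ j → transₛ (Lin.add T ((tauN n $ f) j) _) (+ₛ-cong (atₙ (T-tauN n f) j)
   (transₛ (Lin.scal T _ _) (*ₛ-cong refl (transₛ (T-sing (suc n) _ j)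
    (atₙ (Lin.cong (sing (suc n)) (transₛ (T-A (suc n) (tauN n $ f)) (Afn-cong (T-tauN n f) (suc n)))) j)))))

  T-τ : ∀ n f → (T $ (τ n $ f)) ≈ₛ (τ n $ (T $ f))
  T-τ n f = atₙ (T-tauN n f) n

 τ-δ : ∀ n → Commutesδ (τ n)
 τ-δ n i f = symₛ (T-τ (δ i) (λ j g → δ-comm i j g) n f)

 τ-comm : ∀ m n f → (τ m $ (τ n $ f)) ≈ₛ (τ n $ (τ m $ f))
 τ-comm m n f = T-τ (τ m) (τ-δ m) n f

 τ-conv : ∀ n f → (nat (suc n) *ₛ (τ (suc n) $ f)) ≈ₛ conv (λ l j → nat (suc j) *ₛ (δ j $ (τ l $ f))) n
 τ-conv n f = pt λ w → begin
  nat (suc n) * fn (τ (suc n) $ f) w ≈⟨ sym (cancelˡ α⁻¹*α) ⟩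
  α⁻¹ * (α * (nat (suc n) * fn (τ (suc n) $ f) w)) ≈⟨ *-congˡ (at (transₛ (ατ (suc n) f) (transₛ (A-conv (τ̃ $ f) (suc n)) (conv-last (λ l k → afn (τ l $ f) k) n))) w) ⟩
  α⁻¹ * (fn (conv (λ l j → afn (τ l $ f) (suc j)) n) w + 0#) ≈⟨ *-congˡ (trans (+-identityʳ _) (at (transₛ (conv-cong n (λ l j _ → *ₛ-assoc α (nat (suc j)) (δ j $ (τ l $ f)))) (conv-scal α (λ l j → nat (suc j) *ₛ (δ j $ (τ l $ f))) n)) w)) ⟩
  α⁻¹ * (α * fn (conv (λ l j → nat (suc j) *ₛ (δ j $ (τ l $ f))) n) w) ≈⟨ cancelˡ α⁻¹*α ⟩
  fn (conv (λ l j → nat (suc j) *ₛ (δ j $ (τ l $ f))) n) w ∎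

 -- σ F = Σ_i y^i τ̃(F_i): substitute y for the new variable.
 σfn : El H → ℕ → Sym
 σfn F zero = F 0
 σfn F (suc m) = (τ (suc m) $ F 0) +ₛ σfn (S* $ F) m

 σfn-cong : ∀ {F G} → F ≈ₕ G → ∀ m → σfn F m ≈ₛ σfn G m
 σfn-cong e zero = atₙ e 0
 σfn-cong e (suc m) = +ₛ-cong (Lin.cong (τ (suc m)) (atₙ e 0)) (σfn-cong (Lin.cong S* e) m)

 σfn-add : ∀ F G m → σfn (F +ₕ G) m ≈ₛ (σfn F m +ₛ σfn G m)
 σfn-add F G zero = reflₛ
 σfn-add F G (suc m) = transₛ (+ₛ-cong (Lin.add (τ (suc m)) (F 0) (G 0)) (σfn-add (S* $ F) (S* $ G) m))
  (pt λ w → +-interchange _ _ _ _)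

 σfn-scal : ∀ c F m → σfn (c *ₕ F) m ≈ₛ (c *ₛ σfn F m)
 σfn-scal c F zero = reflₛ
 σfn-scal c F (suc m) = transₛ (+ₛ-cong (Lin.scal (τ (suc m)) c (F 0)) (σfn-scal c (S* $ F) m)) (symₛ (*ₛ-distribˡ c _ _))

 σ : Lin H H
 σ = record { _$_ = σfn ; cong = λ e → ptₙ (σfn-cong e) ; add = λ F G → ptₙ (σfn-add F G) ; scal = λ c F → ptₙ (σfn-scal c F) }

 τ0 : ∀ f → (τ 0 $ f) ≈ₛ f
 τ0 f = reflₛ

 σ-unfold : ∀ F → (σ $ F) ≈ₕ ((τ̃ $ F 0) +ₕ (S $ (σ $ (S* $ F))))
 σ-unfold F = ptₙ λ { zero → symₛ (+ₛ-identityʳ _) ; (suc m) → reflₛ }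

 σ-conv : ∀ F m → σfn F m ≈ₛ conv (λ i l → τ l $ F i) m
 σ-conv F zero = reflₛ
 σ-conv F (suc m) = +ₛ-congˡ (σ-conv (S* $ F) m)

 σN-suc : ∀ m F → σfn (N $ F) (suc m) ≈ₛ (σfn (N $ (S* $ F)) m +ₛ σfn (S* $ F) m)
 σN-suc m F = transₛ (+ₛ-cong (transₛ (Lin.cong (τ (suc m)) (*ₛ-zeroˡ (F 0))) (Lin.zer (τ (suc m)))) (transₛ (σfn-cong {S* $ (N $ F)} {(N $ (S* $ F)) +ₕ (S* $ F)} (ptₙ λ j → pt λ w → solve 2 (λ n x → (:1 :+ n) :* x := n :* x :+ x) refl (nat j) _) m) (σfn-add (N $ (S* $ F)) (S* $ F) m))) (+ₛ-identityˡ _)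

 -- Apply α y d/dy to Σ y^i τ̃(F_i): it falls on τ̃, where it acts as A, or on y^i, where it acts as
 -- α N.
 ANσ : ∀ m F → (α *ₛ (nat m *ₛ σfn F m)) ≈ₛ (Afn (σ $ F) m +ₛ (α *ₛ σfn (N $ F) m))
 ANσ zero F = pt λ w → trans (*-congˡ (zeroˡ _)) (trans (zeroʳ α) (sym (trans (+-identityˡ _) (*-zeroʳ′ (zeroˡ _)))))
 ANσ (suc m) F = pt λ w → begin
  α * (nat (suc m) * (fn (τ (suc m) $ F 0) w + fn (σfn (S* $ F) m) w))
   ≈⟨ solve 4 (λ x n t s → x :* ((:1 :+ n) :* (t :+ s)) := x :* ((:1 :+ n) :* t) :+ (x :* (n :* s) :+ x :* s)) refl α (nat m) _ _ ⟩
  α * (nat (suc m) * fn (τ (suc m) $ F 0) w) + (α * (nat m * fn (σfn (S* $ F) m) w) + α * fn (σfn (S* $ F) m) w)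
   ≈⟨ +-cong (at (ατ (suc m) (F 0)) w) (+-congʳ (at (ANσ m (S* $ F)) w)) ⟩
  fn (Afn (τ̃ $ F 0) (suc m)) w + ((fn (Afn (σ $ (S* $ F)) m) w + α * fn (σfn (N $ (S* $ F)) m) w) + α * fn (σfn (S* $ F) m) w)
   ≈⟨ solve 5 (λ x y a z t → x :+ ((y :+ a :* z) :+ a :* t) := (x :+ y) :+ a :* (z :+ t)) refl _ _ α _ _ ⟩
  (fn (Afn (τ̃ $ F 0) (suc m)) w + fn (Afn (σ $ (S* $ F)) m) w) + α * (fn (σfn (N $ (S* $ F)) m) w + fn (σfn (S* $ F) m) w)
   ≈⟨ +-cong (sym (trans (at (atₙ (transₕ (Lin.cong A (σ-unfold F)) (Lin.add A (τ̃ $ F 0) (S $ (σ $ (S* $ F))))) (suc m)) w) (+-congˡ (at (atₙ (AS (σ $ (S* $ F))) (suc m)) w)))) (*-congˡ (sym (at (σN-suc m F) w))) ⟩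
  fn (Afn (σ $ F) (suc m)) w + α * fn (σfn (N $ F) (suc m)) w ∎

 -- The coefficient of y^m in Σ y^j τ̃(F_j) over j ≥ 1: what Θ F gains when y^j is added to p_j.
 R : ℕ → El H → Sym
 R zero F = 0ₛ
 R (suc m) F = σfn (S* $ F) m

 AΘ : ∀ (M : ℕ → El H) m → Afn (λ l → Θ $ M l) m ≈ₛ ((Θ $ (λ j → Afn (λ l → M l j) m)) +ₛ (α *ₛ conv (λ k l → nat k *ₛ M l k) m))
 AΘ M m = transₛ (A-conv (λ l → Θ $ M l) m) (transₛ (conv-cong m (λ l k _ → transₛ (aΘ (M l) k) (+ₛ-congˡ (*ₛ-assoc α (nat k) (M l k)))))
  (transₛ (conv-add (λ l k → Θ $ (λ j → afn (M l j) k)) (λ l k → α *ₛ (nat k *ₛ M l k)) m)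
   (+ₛ-cong (transₛ (conv-Θ (λ l k j → afn (M l j) k) m) (Lin.cong Θ (ptₙ λ j → symₛ (A-conv (λ l → M l j) m))))
    (transₛ (conv-scal α (λ l k → nat k *ₛ M l k) m) (*ₛ-cong refl (conv-swap (λ l k → nat k *ₛ M l k) m))))))

 -- The right-hand side G satisfies the recursion α n G_n = (A G)_n that determines the coefficients
 -- τ_n from their predecessors, and both sides agree for n = 0.
 τΘ : ∀ n F → (τ n $ (Θ $ F)) ≈ₛ ((Θ $ (lift (τ n) $ F)) +ₛ R n F)
 τΘ n F = below (suc n) n (NP.n<1+n n)
  where
  G : El H
  G j = (Θ $ (lift (τ j) $ F)) +ₛ R j F
  AG : ∀ n → Afn G (suc n) ≈ₛ (α *ₛ (nat (suc n) *ₛ G (suc n)))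
  AG n = pt λ w → begin
   fn (Afn G m) w ≈⟨ at (atₙ (Lin.add A (λ j → Θ $ (lift (τ j) $ F)) (λ j → R j F)) m) w ⟩
   fn (Afn (λ j → Θ $ (lift (τ j) $ F)) m) w + fn (Afn (λ j → R j F) m) w
    ≈⟨ +-cong (trans (at (AΘ (λ l → lift (τ l) $ F) m) w) (+-cong (trans (at (Lin.cong Θ (ptₙ λ j → symₛ (ατ m (F j)))) w) (trans (at (Lin.scal Θ α (λ j → nat m *ₛ (τ m $ F j))) w) (*-congˡ (at (Lin.scal Θ (nat m) (lift (τ m) $ F)) w))))
      (*-congˡ (trans (at (conv-cong m (λ k l _ → symₛ (Lin.scal (τ l) (nat k) (F k)))) w) (trans (sym (at (σ-conv (N $ F) m) w)) (at (σN-suc n F) w))))))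
     (trans (at (Afn-cong {λ j → R j F} {S $ (σ $ (S* $ F))} (ptₙ λ { zero → reflₛ ; (suc j) → reflₛ }) m) w) (at (atₙ (AS (σ $ (S* $ F))) m) w)) ⟩
   (α * (nat m * t w) + α * (sN w + s w)) + fn (Afn (σ $ (S* $ F)) n) w
    ≈⟨ solve 6 (λ x m t y s z → (x :* (m :* t) :+ x :* (y :+ s)) :+ z := (x :* (m :* t) :+ x :* s) :+ (z :+ x :* y)) refl α (nat m) (t w) (sN w) (s w) _ ⟩
   (α * (nat m * t w) + α * s w) + (fn (Afn (σ $ (S* $ F)) n) w + α * sN w) ≈⟨ +-congˡ (sym (at (ANσ n (S* $ F)) w)) ⟩
   (α * (nat m * t w) + α * s w) + α * (nat n * s w) ≈⟨ solve 4 (λ x n t s → (x :* ((:1 :+ n) :* t) :+ x :* s) :+ x :* (n :* s) := x :* ((:1 :+ n) :* (t :+ s))) refl α (nat n) (t w) (s w) ⟩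
   α * (nat m * (t w + s w)) ∎
   where
   m = suc n
   t s sN : List ℕ → Carrier
   t = fn (Θ $ (lift (τ m) $ F))
   s = fn (σfn (S* $ F) n)
   sN = fn (σfn (N $ (S* $ F)) n)
  below : ∀ m n → n ℕ.< m → (τ n $ (Θ $ F)) ≈ₛ G n
  below (suc m) zero lt = symₛ (+ₛ-identityʳ _)
  below (suc m) (suc n) (ℕ.s≤s lt) = pt λ w → begin
   fn (τ (suc n) $ (Θ $ F)) w ≈⟨ at (τ-suc n (Θ $ F)) w ⟩
   inv n * α⁻¹ * fn (Afn (τ̃ $ (Θ $ F)) (suc n)) w ≈⟨ *-congˡ (at (transₛ (A-below (suc n) (τ̃ $ (Θ $ F)) G (λ j lt′ → below m j (NP.<-≤-trans lt′ lt))) (AG n)) w) ⟩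
   inv n * α⁻¹ * (α * (nat (suc n) * fn (G (suc n)) w)) ≈⟨ solve 5 (λ i y x m z → i :* y :* (x :* (m :* z)) := (y :* x) :* ((i :* m) :* z)) refl _ _ _ _ _ ⟩
   (α⁻¹ * α) * ((inv n * nat (suc n)) * fn (G (suc n)) w) ≈⟨ trans (*-cong α⁻¹*α (trans (*-congʳ (inv* n)) (*-identityˡ _))) (*-identityˡ _) ⟩
   fn (G (suc n)) w ∎

 σa : ∀ f → (σ $ (a $ f)) ≈ₕ (A $ (τ̃ $ f))
 σa f = ptₙ λ m → transₛ (σ-conv (a $ f) m) (transₛ (conv-cong m (λ i l _ → T-a (τ l) (τ-δ l) f i)) (transₛ (conv-swap _ m) (symₛ (A-conv (τ̃ $ f) m))))

 σA : ∀ m F → σfn (A $ F) m ≈ₛ Afn (σ $ F) m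
 σA zero F = reflₛ
 σA (suc m) F = transₛ (σfn-cong A-unfold (suc m)) (transₛ (σfn-add (a $ F 0) (S $ (A $ (S* $ F))) (suc m))
  (transₛ (+ₛ-cong (atₙ (σa (F 0)) (suc m)) (transₛ (+ₛ-cong (Lin.zer (τ (suc m))) (σA m (S* $ F))) (+ₛ-identityˡ _)))
   (symₛ (transₛ (atₙ (transₕ (Lin.cong A (σ-unfold F)) (Lin.add A (τ̃ $ F 0) (S $ (σ $ (S* $ F))))) (suc m)) (+ₛ-congˡ (atₙ (AS (σ $ (S* $ F))) (suc m)))))))
  where
  A-unfold : (A $ F) ≈ₕ ((a $ F 0) +ₕ (S $ (A $ (S* $ F))))
  A-unfold = ptₙ λ { zero → symₛ (+ₛ-identityˡ _) ; (suc j) → reflₛ }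

 σB : ∀ m F → σfn (B $ F) m ≈ₛ ((Θ $ (λ j → σfn (drop j F) m)) +ₛ σfn (N $ F) m)
 σB zero F = pt λ w → sym (trans (+-cong (at (Lin.cong Θ (ptₙ λ j → reflexiveₛ (P.cong F (NP.+-identityʳ j)))) w) (zeroˡ _)) (+-identityʳ _))
 σB (suc m) F = pt λ w → begin
  fn (τ (suc m) $ (Θ $ F)) w + fn (σfn (B $ (S* $ F)) m) w ≈⟨ +-cong (at (τΘ (suc m) F) w) (at (σB m (S* $ F)) w) ⟩
  (fn (Θ $ (lift (τ (suc m)) $ F)) w + fn (σfn (S* $ F) m) w) + (fn (Θ $ (λ j → σfn (drop j (S* $ F)) m)) w + fn (σfn (N $ (S* $ F)) m) w)
   ≈⟨ solve 4 (λ x y z t → (x :+ y) :+ (z :+ t) := (x :+ z) :+ (t :+ y)) refl _ _ _ _ ⟩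
  (fn (Θ $ (lift (τ (suc m)) $ F)) w + fn (Θ $ (λ j → σfn (drop j (S* $ F)) m)) w) + (fn (σfn (N $ (S* $ F)) m) w + fn (σfn (S* $ F) m) w)
   ≈⟨ +-cong (trans (sym (at (Lin.add Θ (lift (τ (suc m)) $ F) (λ j → σfn (drop j (S* $ F)) m)) w)) (at (Lin.cong Θ (ptₙ idx)) w)) (sym (at (σN-suc m F) w)) ⟩
  fn (Θ $ (λ j → σfn (drop j F) (suc m))) w + fn (σfn (N $ F) (suc m)) w ∎
  where
  idx : ∀ j → ((τ (suc m) $ F j) +ₛ σfn (drop j (S* $ F)) m) ≈ₛ σfn (drop j F) (suc m)
  idx j = +ₛ-cong (Lin.cong (τ (suc m)) (reflexiveₛ (P.cong F (P.sym (NP.+-identityʳ j))))) (σfn-cong (ptₙ λ i → reflexiveₛ (P.cong F (P.sym (NP.+-suc j i)))) m)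

 -- The term σ(N F) arises from A with factor -α, from B with factor 1 and from b N with factor α -
 -- 1; these cancel. What is left is the degree in y and a sum in which no derivative occurs.
 σL : ∀ m F → σfn (L $ F) m ≈ₛ ((α *ₛ (nat m *ₛ σfn F m)) +ₛ (Θ $ (λ j → σfn (drop j F) m)))
 σL m F = pt λ w → begin
  fn (σfn (L $ F) m) w ≈⟨ trans (at (σfn-add ((A +ˡ B) $ F) (b *ₕ (N $ F)) m) w) (+-cong (at (σfn-add (A $ F) (B $ F) m) w) (at (σfn-scal b (N $ F) m) w)) ⟩
  (fn (σfn (A $ F) m) w + fn (σfn (B $ F) m) w) + b * fn (σfn (N $ F) m) w ≈⟨ +-congʳ (+-cong (at (σA m F) w) (at (σB m F) w)) ⟩
  (fn (Afn (σ $ F) m) w + (fn (Θ $ (λ j → σfn (drop j F) m)) w + fn (σfn (N $ F) m) w)) + b * fn (σfn (N $ F) m) w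
   ≈⟨ solve 4 (λ x t s a → (x :+ (t :+ s)) :+ (a :- :1) :* s := (x :+ a :* s) :+ t) refl _ _ _ α ⟩
  (fn (Afn (σ $ F) m) w + α * fn (σfn (N $ F) m) w) + fn (Θ $ (λ j → σfn (drop j F) m)) w ≈⟨ +-congʳ (sym (at (ANσ m F) w)) ⟩
  α * (nat m * fn (σfn F m) w) + fn (Θ $ (λ j → σfn (drop j F) m)) w ∎

-- Triangularity of L and I_k on monomials in the variables x.

module Triangularity (K : Scalars) where
 open Linear K
 open Lax K
 open Beltrami K
 open Series K
 open Tau K

 open Conv scalars public renaming (conv to convK; conv-cong to convK-cong; conv-last to convK-last; conv-swap to convK-swap; conv-add to convK-add; conv-scal to convK-scal)

 convK-0 : ∀ m → convK (λ _ _ → 0#) m ≈ 0#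
 convK-0 zero = refl
 convK-0 (suc m) = trans (+-identityˡ _) (convK-0 m)

 convK-zero : ∀ {G : ℕ → ℕ → Carrier} m → (∀ l k → l ℕ.+ k ≡ m → G l k ≈ 0#) → convK G m ≈ 0#
 convK-zero m e = trans (convK-cong m e) (convK-0 m)

 convK-drop : ∀ d e (G : ℕ → ℕ → Carrier) → (∀ i l → i ℕ.< d → i ℕ.+ l ≡ d ℕ.+ e → G i l ≈ 0#) → convK G (d ℕ.+ e) ≈ convK (λ i l → G (d ℕ.+ i) l) e
 convK-drop zero e G z = refl
 convK-drop (suc d) e G z = trans (+-cong (z 0 _ (ℕ.s≤s ℕ.z≤n) P.refl) (convK-drop d e (λ i l → G (suc i) l) (λ i l lt h → z (suc i) l (ℕ.s≤s lt) (P.cong suc h)))) (+-identityˡ _)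

 -- Both sides run over i + j + l = n. The terms with i = 0 or j = 0 are split off, and the rest is
 -- the same claim in degree n - 1.
 convK-exchange : ∀ (G : ℕ → ℕ → ℕ → Carrier) n → convK (λ i m → convK (λ j l → G i j l) m) n ≈ convK (λ j m → convK (λ i l → G i j l) m) n
 convK-exchange G zero = refl
 convK-exchange G (suc n) = begin
  (G 0 0 (suc n) + convK (λ j l → G 0 (suc j) l) n) + convK (λ i m → convK (λ j l → G (suc i) j l) m) n
   ≈⟨ +-congˡ (peel (λ i j l → G (suc i) j l) n) ⟩
  (G 0 0 (suc n) + convK (λ j l → G 0 (suc j) l) n) + (convK (λ i l → G (suc i) 0 l) n + rest (λ i j l → G (suc i) (suc j) l) n)
   ≈⟨ +-interchange _ _ _ _ ⟩
  (G 0 0 (suc n) + convK (λ i l → G (suc i) 0 l) n) + (convK (λ j l → G 0 (suc j) l) n + rest (λ i j l → G (suc i) (suc j) l) n)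
   ≈⟨ +-congˡ (trans (+-congˡ (rest-sym (λ i j l → G (suc i) (suc j) l) n)) (sym (peel (λ j i l → G i (suc j) l) n))) ⟩
  (G 0 0 (suc n) + convK (λ i l → G (suc i) 0 l) n) + convK (λ j m → convK (λ i l → G i (suc j) l) m) n ∎
  where
  rest : (ℕ → ℕ → ℕ → Carrier) → ℕ → Carrier
  rest G zero = 0#
  rest G (suc n) = convK (λ i m → convK (λ j l → G i j l) m) n
  rest-sym : ∀ G n → rest G n ≈ rest (λ j i l → G i j l) n
  rest-sym G zero = refl
  rest-sym G (suc n) = convK-exchange G n
  peel : ∀ (G : ℕ → ℕ → ℕ → Carrier) n → convK (λ i m → convK (λ j l → G i j l) m) n ≈ convK (λ i l → G i 0 l) n + rest (λ i j l → G i (suc j) l) n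
  peel G zero = sym (+-identityʳ _)
  peel G (suc n) = trans (+-congˡ (peel (λ i j l → G (suc i) j l) n)) (trans
   (+-interchange _ _ _ _)
   (+-congˡ (unrest G n)))
   where
   unrest : ∀ (G : ℕ → ℕ → ℕ → Carrier) n → convK (λ j l → G 0 (suc j) l) n + rest (λ i j l → G (suc i) (suc j) l) n ≈ convK (λ i m → convK (λ j l → G i (suc j) l) m) n
   unrest G zero = +-identityʳ _
   unrest G (suc n) = refl

 fn-conv : ∀ (T : Lin V V) G n w → fn (T $ conv G n) w ≈ convK (λ l k → fn (T $ G l k) w) n
 fn-conv T G zero w = refl
 fn-conv T G (suc n) w = trans (at (Lin.add T _ _) w) (+-congˡ (fn-conv T (λ l k → G (suc l) k) n w))

 size : List ℕ → ℕ
 size [] = 0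
 size (k ∷ η) = k ℕ.+ size η

 tt : List ℕ → Lin V V
 tt [] = idˡ
 tt (k ∷ η) = tt η ∘ˡ τ k

 -- cf η f = [x^η] f
 cf : List ℕ → Sym → Carrier
 cf η f = fn (tt η $ f) []

 cf-perm : ∀ {η ζ} → η ↭ ζ → ∀ f → cf η f ≈ cf ζ f
 cf-perm Perm.refl f = refl
 cf-perm (prep k p) f = cf-perm p (τ k $ f)
 cf-perm {_} {_ ∷ _ ∷ ζ} (swap j k p) f = trans (cf-perm p (τ k $ (τ j $ f))) (at (Lin.cong (tt ζ) (τ-comm k j f)) [])
 cf-perm (Perm.trans p q) f = trans (cf-perm p f) (cf-perm q f)

 Null : ℕ → Sym → Set
 Null s f = ∀ η → size η ≡ s → cf η f ≈ 0#

 cancel-nat : ∀ i x → nat (suc i) * x ≈ 0# → x ≈ 0#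
 cancel-nat i x e = trans (sym (cancelˡ (inv* i))) (*-zeroʳ′ e)

 -- `τ-conv` solved for its term l = 0 expresses ∂_{k+1} through τ_{k+1} and the ∂_{j+1} τ_l with j
 -- < k and l ≥ 1. The bound K makes this recursion structural.
 δ-null : ∀ K k → k ℕ.< K → ∀ s f → Null (suc k ℕ.+ s) f → Null s (δ k $ f)
 δ-null (suc K) k (ℕ.s≤s lt) s f h η e = cancel-nat k _ (go k lt h)
  where
  base : ∀ k → Null (suc k ℕ.+ s) f → nat (suc k) * cf η (τ (suc k) $ f) ≈ 0#
  base k h = *-zeroʳ′ (h (suc k ∷ η) (P.cong (suc k ℕ.+_) e))
  go : ∀ k → k ℕ.≤ K → Null (suc k ℕ.+ s) f → nat (suc k) * cf η (δ k $ f) ≈ 0#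
  go zero le h = trans (sym (trans (sym (at (Lin.scal (tt η) (nat 1) _) [])) (trans (at (Lin.cong (tt η) (τ-conv 0 f)) []) (at (Lin.scal (tt η) (nat 1) _) [])))) (base 0 h)
  go (suc k) le h = begin
   nat (suc (suc k)) * cf η (δ (suc k) $ f) ≈⟨ sym (+-identityʳ _) ⟩
   nat (suc (suc k)) * cf η (δ (suc k) $ f) + 0# ≈⟨ +-cong (sym (at (Lin.scal (tt η) (nat (suc (suc k))) _) [])) (sym (convK-zero k lower)) ⟩
   cf η (nat (suc (suc k)) *ₛ (δ (suc k) $ f)) + convK (λ l j → cf η (nat (suc j) *ₛ (δ j $ (τ (suc l) $ f)))) k
    ≈⟨ sym (fn-conv (tt η) (λ l j → nat (suc j) *ₛ (δ j $ (τ l $ f))) (suc k) []) ⟩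
   cf η (conv (λ l j → nat (suc j) *ₛ (δ j $ (τ l $ f))) (suc k)) ≈⟨ at (Lin.cong (tt η) (symₛ (τ-conv (suc k) f))) [] ⟩
   cf η (nat (suc (suc k)) *ₛ (τ (suc (suc k)) $ f)) ≈⟨ trans (at (Lin.scal (tt η) (nat (suc (suc k))) _) []) (base (suc k) h) ⟩
   0# ∎
   where
   lower : ∀ l j → l ℕ.+ j ≡ k → cf η (nat (suc j) *ₛ (δ j $ (τ (suc l) $ f))) ≈ 0#
   lower l j P.refl = trans (at (Lin.scal (tt η) (nat (suc j)) _) []) (*-zeroʳ′ (δ-null K j (NP.≤-trans (ℕ.s≤s (NP.m≤n+m j l)) le) s (τ (suc l) $ f)
    (λ ζ e′ → h (suc l ∷ ζ) (P.trans (P.cong (suc l ℕ.+_) e′) (index l j s))) η e))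
    where
    index : ∀ l j s → suc l ℕ.+ (suc j ℕ.+ s) ≡ suc (suc (l ℕ.+ j)) ℕ.+ s
    index l j s = P.cong suc (P.trans (NP.+-suc l (j ℕ.+ s)) (P.cong suc (P.sym (NP.+-assoc l j s))))

 null-vanishes : ∀ s f → Null s f → Vanₛ s f
 null-vanishes s f h = vanₛ λ w e → go w f (P.subst (λ s → Null s f) (P.sym e) h)
  where
  go : ∀ w f → Null (wt w) f → fn f w ≈ 0#
  go [] f h = h [] P.refl
  go (i ∷ w) f h = go w (δ i $ f) (δ-null (suc i) i (NP.n<1+n i) (wt w) f h)

 data Pick (k : ℕ) : List ℕ → List ℕ → Set where
  here : ∀ {r} → Pick k (k ∷ r) r
  there : ∀ {x r r′} → Pick k r r′ → Pick k (x ∷ r) (x ∷ r′)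

 σ-τ : ∀ k m F → σfn (lift (τ k) $ F) m ≈ₛ (τ k $ σfn F m)
 σ-τ k zero F = reflₛ
 σ-τ k (suc m) F = transₛ (+ₛ-cong (τ-comm (suc m) k (F 0)) (σ-τ k m (S* $ F))) (symₛ (Lin.add (τ k) _ _))

 R-τ : ∀ k m F → R m (lift (τ k) $ F) ≈ₛ (τ k $ R m F)
 R-τ k zero F = symₛ (Lin.zer (τ k))
 R-τ k (suc m) F = σ-τ k m (S* $ F)

 -- Extracting a coefficient sets p = 0 after all substitutions. A factor p_j then survives only if
 -- one of the variables x has replaced it by its j-th power; `R k G` is the contribution of the
 -- variable with exponent k.
 Θ-zero : ∀ rest G → (∀ k r → Pick k rest r → cf r (R k G) ≈ 0#) → cf rest (Θ $ G) ≈ 0#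
 Θ-zero [] G h = refl
 Θ-zero (k ∷ rest) G h = trans (at (Lin.cong (tt rest) (τΘ k G)) []) (trans (at (Lin.add (tt rest) (Θ $ (lift (τ k) $ G)) (R k G)) [])
  (trans (+-cong (Θ-zero rest (lift (τ k) $ G) (λ k′ r p → trans (at (Lin.cong (tt r) (R-τ k k′ G)) []) (h k′ (k ∷ r) (there p)))) (h k rest here)) (+-identityʳ 0#)))

 Gσ : ℕ → El H → El H
 Gσ m F j = σfn (drop j F) m

 -- A divided difference, with its negative part moved to the left: the coefficient of x^m z^(n+1)
 -- in z (f(x,z) - f(z,x)) / (x - z), where f has the coefficient τ l (σfn F i) at x^i z^l.
 R-formula : ∀ m n F → (R (suc n) (Gσ m F) +ₛ conv (λ i l → τ (suc m ℕ.+ l) $ σfn F i) n) ≈ₛ conv (λ j l → τ l $ σfn F (suc m ℕ.+ j)) n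
 R-formula m zero F = pt λ w → trans (+-comm _ _) (trans (+-congʳ (reflexive (P.cong (λ k → fn (τ k $ F 0) w) (P.cong suc (NP.+-identityʳ m)))))
  (reflexive (P.cong (λ k → fn (σfn F (suc k)) w) (P.sym (NP.+-identityʳ m)))))
 R-formula m (suc n) F = pt λ w → begin
  (fn (τ (suc n) $ σfn F′ m) w + fn (R (suc n) (Gσ m F′)) w) + (fn (τ (suc m ℕ.+ suc n) $ F 0) w + fn (conv (λ i l → τ (suc m ℕ.+ l) $ σfn F (suc i)) n) w)
   ≈⟨ +-congˡ (+-congˡ (trans (at (conv-cong n (λ i l _ → Lin.add (τ (suc m ℕ.+ l)) (τ (suc i) $ F 0) (σfn F′ i))) w) (at (conv-add (λ i l → τ (suc m ℕ.+ l) $ (τ (suc i) $ F 0)) (λ i l → τ (suc m ℕ.+ l) $ σfn F′ i) n) w))) ⟩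
  (fn (τ (suc n) $ σfn F′ m) w + fn (R (suc n) (Gσ m F′)) w) + (fn (τ (suc m ℕ.+ suc n) $ F 0) w + (fn (conv (λ i l → τ (suc m ℕ.+ l) $ (τ (suc i) $ F 0)) n) w + fn (conv (λ i l → τ (suc m ℕ.+ l) $ σfn F′ i) n) w))
   ≈⟨ solve 5 (λ x r y z t → (x :+ r) :+ (y :+ (z :+ t)) := x :+ ((y :+ z) :+ (r :+ t))) refl _ _ _ _ _ ⟩
  fn (τ (suc n) $ σfn F′ m) w + (fn (conv (λ i l → τ (suc m ℕ.+ l) $ (τ i $ F 0)) (suc n)) w + (fn (R (suc n) (Gσ m F′)) w + fn (conv (λ i l → τ (suc m ℕ.+ l) $ σfn F′ i) n) w))
   ≈⟨ +-congˡ (+-cong (at (transₛ (conv-swap (λ i l → τ (suc m ℕ.+ l) $ (τ i $ F 0)) (suc n)) (conv-cong (suc n) (λ j l _ → τ-comm (suc m ℕ.+ j) l (F 0)))) w) (at (R-formula m n F′) w)) ⟩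
  fn (τ (suc n) $ σfn F′ m) w + ((fn (τ (suc n) $ (τ (suc m ℕ.+ 0) $ F 0)) w + fn (conv (λ j l → τ l $ (τ (suc m ℕ.+ suc j) $ F 0)) n) w) + fn (conv (λ j l → τ l $ σfn F′ (suc m ℕ.+ j)) n) w)
   ≈⟨ solve 4 (λ x y z t → x :+ ((y :+ z) :+ t) := (y :+ x) :+ (z :+ t)) refl _ _ _ _ ⟩
  (fn (τ (suc n) $ (τ (suc m ℕ.+ 0) $ F 0)) w + fn (τ (suc n) $ σfn F′ m) w) + (fn (conv (λ j l → τ l $ (τ (suc m ℕ.+ suc j) $ F 0)) n) w + fn (conv (λ j l → τ l $ σfn F′ (suc m ℕ.+ j)) n) w)
   ≈⟨ +-cong (trans (sym (at (Lin.add (τ (suc n)) (τ (suc m ℕ.+ 0) $ F 0) (σfn F′ m)) w)) (at (Lin.cong (τ (suc n)) (pt λ v → trans (+-congˡ (reflexive (P.cong (λ k → fn (σfn F′ k) v) (P.sym (NP.+-identityʳ m))))) refl)) w))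
      (trans (sym (at (conv-add (λ j l → τ l $ (τ (suc m ℕ.+ suc j) $ F 0)) (λ j l → τ l $ σfn F′ (suc m ℕ.+ j)) n) w)) (at (conv-cong n (λ j l _ → transₛ (symₛ (Lin.add (τ l) (τ (suc m ℕ.+ suc j) $ F 0) (σfn F′ (suc m ℕ.+ j)))) (Lin.cong (τ l) (idx j)))) w)) ⟩
  fn (τ (suc n) $ σfn F (suc m ℕ.+ 0)) w + fn (conv (λ j l → τ l $ σfn F (suc m ℕ.+ suc j)) n) w ∎
  where
  F′ = S* $ F
  idx : ∀ j → ((τ (suc m ℕ.+ suc j) $ F 0) +ₛ σfn F′ (suc m ℕ.+ j)) ≈ₛ σfn F (suc m ℕ.+ suc j)
  idx j = transₛ (+ₛ-congˡ (reflexiveₛ (P.cong (σfn F′) (P.sym (NP.+-suc m j))))) reflₛ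

 -- The hypothesis is convexity: pulling two exponents apart while keeping their sum does not lower
 -- the height. Heights are numbers, so they give a linearly ordered flag in place of the dominance
 -- order.
 module Triangular (ψ : ℕ → ℕ) (ψ-spread : ∀ m n m′ n′ → m′ ℕ.+ n′ ≡ m ℕ.+ n → m′ ℕ.≤ m → m′ ℕ.≤ n → ψ m ℕ.+ ψ n ℕ.≤ ψ m′ ℕ.+ ψ n′) where

  φ : List ℕ → ℕ
  φ [] = 0
  φ (k ∷ η) = ψ k ℕ.+ φ η

  Tri : ℕ → ℕ → El H → Set
  Tri s v F = ∀ m rest → m ℕ.+ size rest ≡ s → v ℕ.≤ ψ m ℕ.+ φ rest → cf rest (σfn F m) ≈ 0#

  pick-size : ∀ {k rest r} → Pick k rest r → size rest ≡ k ℕ.+ size r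
  pick-size here = P.refl
  pick-size {k} (there {x} {r} {r′} p) = P.trans (P.cong (x ℕ.+_) (pick-size p)) (P.trans (P.sym (NP.+-assoc x k _)) (P.trans (P.cong (ℕ._+ size r′) (NP.+-comm x k)) (NP.+-assoc k x _)))

  pick-φ : ∀ {k rest r} → Pick k rest r → φ rest ≡ ψ k ℕ.+ φ r
  pick-φ here = P.refl
  pick-φ {k} (there {x} {r} {r′} p) = P.trans (P.cong (ψ x ℕ.+_) (pick-φ p)) (P.trans (P.sym (NP.+-assoc (ψ x) (ψ k) _)) (P.trans (P.cong (ℕ._+ φ r′) (NP.+-comm (ψ x) (ψ k))) (NP.+-assoc (ψ k) (ψ x) _)))

  -- By `σL` and `Θ-zero` a coefficient of L F is a multiple of one of F plus, for each picked entry
  -- n + 1, a divided difference. What survives in the latter pairs exponents with sum m + n + 1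
  -- that are at least as far apart as m and n + 1, hence of at least the same height.
  L-tri : ∀ s v F → Tri s v F → Tri s v (L $ F)
  L-tri s v F h m rest e le = begin
   cf rest (σfn (L $ F) m) ≈⟨ at (Lin.cong (tt rest) (σL m F)) [] ⟩
   cf rest ((α *ₛ (nat m *ₛ σfn F m)) +ₛ (Θ $ Gσ m F)) ≈⟨ at (Lin.add (tt rest) (α *ₛ (nat m *ₛ σfn F m)) (Θ $ Gσ m F)) [] ⟩
   cf rest (α *ₛ (nat m *ₛ σfn F m)) + cf rest (Θ $ Gσ m F)
    ≈⟨ +-cong (trans (at (Lin.scal (tt rest) α (nat m *ₛ σfn F m)) []) (*-zeroʳ′ (trans (at (Lin.scal (tt rest) (nat m) (σfn F m)) []) (*-zeroʳ′ (h m rest e le)))))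
       (Θ-zero rest (Gσ m F) pick-zero) ⟩
   0# + 0# ≈⟨ +-identityʳ 0# ⟩
   0# ∎
   where
   pick-zero : ∀ k r → Pick k rest r → cf r (R k (Gσ m F)) ≈ 0#
   pick-zero zero r p = at (Lin.zer (tt r)) []
   pick-zero (suc n) r p = begin
    cf r (R (suc n) (Gσ m F)) ≈⟨ solve 2 (λ x y → x := (x :+ y) :- y) refl _ (convK (λ i l → T i (suc m ℕ.+ l)) n) ⟩
    (cf r (R (suc n) (Gσ m F)) + convK (λ i l → T i (suc m ℕ.+ l)) n) - convK (λ i l → T i (suc m ℕ.+ l)) n
     ≈⟨ +-congʳ (trans (+-congˡ (sym (fn-conv (tt r) (λ i l → τ (suc m ℕ.+ l) $ σfn F i) n []))) (trans (sym (at (Lin.add (tt r) (R (suc n) (Gσ m F)) _) [])) (trans (at (Lin.cong (tt r) (R-formula m n F)) []) (fn-conv (tt r) (λ j l → τ l $ σfn F (suc m ℕ.+ j)) n [])))) ⟩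
    convK (λ j l → T (suc m ℕ.+ j) l) n - convK (λ i l → T i (suc m ℕ.+ l)) n ≈⟨ +-congʳ (cancel (NP.≤-<-connex n m)) ⟩
    convK (λ i l → T i (suc m ℕ.+ l)) n - convK (λ i l → T i (suc m ℕ.+ l)) n ≈⟨ -‿inverseʳ _ ⟩
    0# ∎
    where
    T : ℕ → ℕ → Carrier
    T i l = cf r (τ l $ σfn F i)
    reorder : ∀ i l → i ℕ.+ l ≡ m ℕ.+ suc n → ψ m ℕ.+ ψ (suc n) ℕ.≤ ψ i ℕ.+ ψ l → T i l ≈ 0#
    reorder i l eq wide = h i (l ∷ r)
     (P.trans (P.sym (NP.+-assoc i l _)) (P.trans (P.cong (ℕ._+ size r) eq) (P.trans (NP.+-assoc m (suc n) _) (P.trans (P.cong (m ℕ.+_) (P.sym (pick-size p))) e))))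
     (NP.≤-trans le (NP.≤-trans (NP.≤-reflexive (P.trans (P.cong (ψ m ℕ.+_) (pick-φ p)) (P.sym (NP.+-assoc (ψ m) _ _)))) (NP.≤-trans (NP.+-monoˡ-≤ (φ r) wide) (NP.≤-reflexive (NP.+-assoc (ψ i) _ _)))))
    zeroˡ′ : ∀ i l → i ℕ.+ l ≡ m ℕ.+ suc n → i ℕ.≤ m → i ℕ.≤ suc n → T i l ≈ 0#
    zeroˡ′ i l eq le₁ le₂ = reorder i l eq (ψ-spread m (suc n) i l eq le₁ le₂)
    zeroʳ′ : ∀ i l → i ℕ.+ l ≡ m ℕ.+ suc n → l ℕ.≤ m → l ℕ.≤ suc n → T i l ≈ 0#
    zeroʳ′ i l eq le₁ le₂ = reorder i l eq (NP.≤-trans (ψ-spread m (suc n) l i (P.trans (NP.+-comm l i) eq) le₁ le₂) (NP.≤-reflexive (NP.+-comm (ψ l) (ψ i))))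
    sumˡ : ∀ i l → i ℕ.+ l ≡ n → i ℕ.+ (suc m ℕ.+ l) ≡ m ℕ.+ suc n
    sumˡ i l P.refl = P.trans (NP.+-comm i (suc m ℕ.+ l)) (P.trans (P.cong suc (P.trans (NP.+-assoc m l i) (P.cong (m ℕ.+_) (NP.+-comm l i)))) (P.sym (NP.+-suc m (i ℕ.+ l))))
    sumʳ : ∀ j l → j ℕ.+ l ≡ n → (suc m ℕ.+ j) ℕ.+ l ≡ m ℕ.+ suc n
    sumʳ j l P.refl = P.trans (P.cong suc (NP.+-assoc m j l)) (P.sym (NP.+-suc m (j ℕ.+ l)))
    fst≤ : ∀ {i l} → i ℕ.+ l ≡ n → i ℕ.≤ n
    fst≤ {i} {l} P.refl = NP.m≤m+n i l
    snd≤ : ∀ {i l} → i ℕ.+ l ≡ n → l ℕ.≤ n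
    snd≤ {i} {l} P.refl = NP.m≤n+m l i
    -- For n ≤ m all terms are far apart and both sums vanish. Otherwise the m + 1 terms of each sum
    -- that are far apart are dropped, and both sums reduce to T (suc m + i) (suc m + l) over i + l
    -- = d.
    cancel : (n ℕ.≤ m) ⊎ (m ℕ.< n) → convK (λ j l → T (suc m ℕ.+ j) l) n ≈ convK (λ i l → T i (suc m ℕ.+ l)) n
    cancel (inj₁ n≤m) = trans (convK-zero n (λ j l eq → zeroʳ′ (suc m ℕ.+ j) l (sumʳ j l eq) (NP.≤-trans (snd≤ eq) n≤m) (NP.m≤n⇒m≤1+n (snd≤ eq))))
     (sym (convK-zero n (λ i l eq → zeroˡ′ i (suc m ℕ.+ l) (sumˡ i l eq) (NP.≤-trans (fst≤ eq) n≤m) (NP.m≤n⇒m≤1+n (fst≤ eq)))))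
    cancel (inj₂ m<n) = begin
     convK (λ j l → T (suc m ℕ.+ j) l) n ≈⟨ convK-swap (λ j l → T (suc m ℕ.+ j) l) n ⟩
     convK (λ l j → T (suc m ℕ.+ j) l) n ≈⟨ reflexive (P.cong (convK (λ l j → T (suc m ℕ.+ j) l)) n≡) ⟩
     convK (λ l j → T (suc m ℕ.+ j) l) (suc m ℕ.+ d) ≈⟨ convK-drop (suc m) d _ (λ l j lt eq → zeroʳ′ (suc m ℕ.+ j) l (sumʳ j l (P.trans (NP.+-comm j l) (P.trans eq (P.sym n≡)))) (NP.≤-pred lt) (NP.≤-trans (NP.≤-pred lt) (NP.≤-trans (NP.<⇒≤ m<n) (NP.n≤1+n n)))) ⟩
     convK (λ l j → T (suc m ℕ.+ j) (suc m ℕ.+ l)) d ≈⟨ convK-swap (λ l j → T (suc m ℕ.+ j) (suc m ℕ.+ l)) d ⟩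
     convK (λ i l → T (suc m ℕ.+ i) (suc m ℕ.+ l)) d ≈⟨ sym (convK-drop (suc m) d (λ i l → T i (suc m ℕ.+ l)) (λ i l lt eq → zeroˡ′ i (suc m ℕ.+ l) (sumˡ i l (P.trans eq (P.sym n≡))) (NP.≤-pred lt) (NP.≤-trans (NP.≤-pred lt) (NP.≤-trans (NP.<⇒≤ m<n) (NP.n≤1+n n))))) ⟩
     convK (λ i l → T i (suc m ℕ.+ l)) (suc m ℕ.+ d) ≈⟨ reflexive (P.cong (convK (λ i l → T i (suc m ℕ.+ l))) (P.sym n≡)) ⟩
     convK (λ i l → T i (suc m ℕ.+ l)) n ∎
     where
     d = n ℕ.∸ suc m
     n≡ : n ≡ suc m ℕ.+ d
     n≡ = P.sym (NP.m+[n∸m]≡n m<n)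

  Triₛ : ℕ → ℕ → Sym → Set
  Triₛ s v f = ∀ η → size η ≡ s → v ℕ.≤ φ η → cf η f ≈ 0#

  σ-vac : ∀ m f → σfn (vac $ f) m ≈ₛ (τ m $ f)
  σ-vac zero f = reflₛ
  σ-vac (suc m) f = transₛ (+ₛ-congˡ (transₛ (σfn-cong {S* $ (vac $ f)} {0ₕ} (ptₙ λ _ → reflₛ) m) (atₙ (Lin.zer σ) m))) (+ₛ-identityʳ _)

  vac-tri : ∀ s v f → Triₛ s v f → Tri s v (vac $ f)
  vac-tri s v f h m rest e le = trans (at (Lin.cong (tt rest) (σ-vac m f)) []) (h (m ∷ rest) e le)

  Lᵏ-tri : ∀ k s v F → Tri s v F → Tri s v (powˡ L k $ F)
  Lᵏ-tri zero s v F h = h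
  Lᵏ-tri (suc k) s v F h = L-tri s v (powˡ L k $ F) (Lᵏ-tri k s v F h)

  I : ℕ → Lin V V
  I k = bra ∘ˡ powˡ L k ∘ˡ vac

  I-tri : ψ 0 ≡ 0 → ∀ k s v f → Triₛ s v f → Triₛ s v (I k $ f)
  I-tri ψ0 k s v f h η e le = Lᵏ-tri k s v (vac $ f) (vac-tri s v f h) 0 η e (NP.≤-trans le (NP.≤-reflexive (P.sym (P.cong (ℕ._+ φ η) ψ0))))

-- The scalar product, adjoints and orthogonal eigenbases.

module InnerProduct (K : Scalars) where
 open Linear K
 open Lax K
 open Beltrami K
 open Series K hiding (P)
 open COperators K using (_⊖_)
 open Tau K
 open Triangularity K

 -- ips n j = ⟨·,·⟩ in degree n - j; the form is fixed by n⟨f,g⟩_n = Σ_j α j² ⟨∂_j f, ∂_j g⟩_{n-j}.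
 ips : ℕ → ℕ → Sym → Sym → Carrier
 ips zero j f g = fn f [] * fn g []
 ips (suc n) zero f g = inv n * convK (λ j _ → α * (nat (suc j) * nat (suc j)) * ips n j (δ j $ f) (δ j $ g)) n
 ips (suc n) (suc j) f g = ips n j f g

 ip : ℕ → Sym → Sym → Carrier
 ip n = ips n 0

 ips-ip : ∀ j m f g → ips (j ℕ.+ m) j f g ≡ ip m f g
 ips-ip zero m f g = P.refl
 ips-ip (suc j) m f g = ips-ip j m f g

 ip-suc : ∀ n f g → ip (suc n) f g ≈ inv n * convK (λ j m → α * (nat (suc j) * nat (suc j)) * ip m (δ j $ f) (δ j $ g)) n
 ip-suc n f g = *-congˡ (convK-cong n λ { j m P.refl → *-congˡ (reflexive (ips-ip j m _ _)) })

 n-ip : ∀ n f g → nat (suc n) * ip (suc n) f g ≈ convK (λ j m → α * (nat (suc j) * nat (suc j)) * ip m (δ j $ f) (δ j $ g)) n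
 n-ip n f g = trans (*-congˡ (ip-suc n f g)) (cancelˡ (trans (*-comm _ _) (inv* n)))

 ips-cong : ∀ n j {f f′ g g′} → f ≈ₛ f′ → g ≈ₛ g′ → ips n j f g ≈ ips n j f′ g′
 ips-cong zero j e e′ = *-cong (at e []) (at e′ [])
 ips-cong (suc n) zero e e′ = *-congˡ (convK-cong n (λ j m _ → *-congˡ (ips-cong n j (Lin.cong (δ j) e) (Lin.cong (δ j) e′))))
 ips-cong (suc n) (suc j) e e′ = ips-cong n j e e′

 ips-addˡ : ∀ n j f f′ g → ips n j (f +ₛ f′) g ≈ ips n j f g + ips n j f′ g
 ips-addˡ zero j f f′ g = distribʳ _ _ _
 ips-addˡ (suc n) zero f f′ g = trans (*-congˡ (trans (convK-cong n (λ j m _ → trans (*-congˡ (trans (ips-cong n j {g = δ j $ g} (Lin.add (δ j) f f′) reflₛ) (ips-addˡ n j _ _ _))) (distribˡ _ _ _))) (convK-add _ _ n))) (distribˡ _ _ _)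
 ips-addˡ (suc n) (suc j) f f′ g = ips-addˡ n j f f′ g

 ips-scalˡ : ∀ n j c f g → ips n j (c *ₛ f) g ≈ c * ips n j f g
 ips-scalˡ zero j c f g = *-assoc _ _ _
 ips-scalˡ (suc n) zero c f g = trans (*-congˡ (trans (convK-cong n (λ j m _ → trans (*-congˡ (trans (ips-cong n j {g = δ j $ g} (Lin.scal (δ j) c f) reflₛ) (ips-scalˡ n j c _ _))) (*-left-comm _ _ _))) (convK-scal c _ n))) (*-left-comm _ _ _)
 ips-scalˡ (suc n) (suc j) c f g = ips-scalˡ n j c f g

 ips-sym : ∀ n j f g → ips n j f g ≈ ips n j g f
 ips-sym zero j f g = *-comm _ _
 ips-sym (suc n) zero f g = *-congˡ (convK-cong n (λ j m _ → *-congˡ (ips-sym n j _ _)))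
 ips-sym (suc n) (suc j) f g = ips-sym n j f g

 ip-cong : ∀ n {f f′ g g′} → f ≈ₛ f′ → g ≈ₛ g′ → ip n f g ≈ ip n f′ g′
 ip-cong n = ips-cong n 0

 ip-addˡ : ∀ n f f′ g → ip n (f +ₛ f′) g ≈ ip n f g + ip n f′ g
 ip-addˡ n = ips-addˡ n 0

 ip-scalˡ : ∀ n c f g → ip n (c *ₛ f) g ≈ c * ip n f g
 ip-scalˡ n = ips-scalˡ n 0

 ip-sym : ∀ n f g → ip n f g ≈ ip n g f
 ip-sym n = ips-sym n 0

 ip-scalʳ : ∀ n c f g → ip n f (c *ₛ g) ≈ c * ip n f g
 ip-scalʳ n c f g = trans (ip-sym n f _) (trans (ip-scalˡ n c g f) (*-congˡ (ip-sym n g f)))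

 ip-0ʳ : ∀ n f → ip n f 0ₛ ≈ 0#
 ip-0ʳ n f = trans (ip-cong n {f} reflₛ (symₛ (*ₛ-zeroˡ 0ₛ))) (trans (ip-scalʳ n 0# f 0ₛ) (zeroˡ _))

 ip-0ˡ : ∀ n f → ip n 0ₛ f ≈ 0#
 ip-0ˡ n f = trans (ip-sym n _ f) (ip-0ʳ n f)

 ipH : ℕ → El H → El H → Carrier
 ipH n F G = convK (λ j m → ip m (F j) (G j)) n

 ipH-cong : ∀ n {F F′ G G′} → F ≈ₕ F′ → G ≈ₕ G′ → ipH n F G ≈ ipH n F′ G′
 ipH-cong n e e′ = convK-cong n (λ j m _ → ip-cong m (atₙ e j) (atₙ e′ j))

 ∂₀ : ℕ → Lin V V
 ∂₀ zero = 0ˡ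
 ∂₀ (suc j) = δ j

 square : ℕ → Carrier
 square j = α * (nat j * nat j)

 square-0 : ∀ x → square 0 * x ≈ 0#
 square-0 x = *-zeroˡ′ (*-zeroʳ′ (zeroˡ _))

 euler : ∀ n f g → nat n * ip n f g ≈ convK (λ j m → square j * ip m (∂₀ j $ f) (∂₀ j $ g)) n
 euler zero f g = trans (zeroˡ _) (sym (square-0 _))
 euler (suc n) f g = trans (n-ip n f g) (sym (trans (+-congʳ (square-0 _)) (+-identityˡ _)))

 a-∂₀ : ∀ i j g → afn (∂₀ j $ g) i ≈ₛ (∂₀ j $ afn g i)
 a-∂₀ i zero g = atₙ (Lin.zer a) i
 a-∂₀ i (suc j) g = symₛ (atₙ (δa j g) i)

 -- Multiplication by p_j is adjoint to α j ∂_j. Multiply by the degree: in Euler's formula the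
 -- derivatives that fall on F produce the weight m of the component with index k, those that fall
 -- on p_k produce k, and m + k is the degree.
 Θ-adjoint : ∀ n F g → ip n (Θ $ F) g ≈ ipH n F (a $ g)
 Θ-adjoint n F g = below (suc n) n (NP.n<1+n n) F g
  where
  below : ∀ N n → n ℕ.< N → ∀ F g → ip n (Θ $ F) g ≈ ipH n F (a $ g)
  below (suc N) zero lt F g = trans (zeroˡ _) (sym (zeroʳ _))
  below (suc N) (suc n) (ℕ.s≤s lt) F g = begin
   ip n′ (Θ $ F) g ≈⟨ cancel-n _ ⟩
   inv n * (nat n′ * ip n′ (Θ $ F) g) ≈⟨ *-congˡ (euler n′ (Θ $ F) g) ⟩
   inv n * convK (λ j m → square j * ip m (∂₀ j $ (Θ $ F)) (∂₀ j $ g)) n′ ≈⟨ *-congˡ (trans (convK-cong n′ ind) (convK-add (λ j m → square j * ipH m (lift (∂₀ j) $ F) (a $ (∂₀ j $ g))) (λ j m → nat j * P j m) n′)) ⟩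
   inv n * (convK (λ j m → square j * ipH m (lift (∂₀ j) $ F) (a $ (∂₀ j $ g))) n′ + convK (λ j m → nat j * P j m) n′) ≈⟨ *-congˡ (+-congʳ double) ⟩
   inv n * (convK (λ k m → nat m * P k m) n′ + convK (λ k m → nat k * P k m) n′)
    ≈⟨ *-congˡ (trans (sym (convK-add (λ k m → nat m * P k m) (λ k m → nat k * P k m) n′)) (trans (convK-cong n′ (λ k m eq → trans (sym (distribʳ (P k m) _ _)) (*-congʳ (trans (+-comm _ _) (trans (sym (nat-+ k m)) (reflexive (P.cong nat eq))))))) (convK-scal (nat n′) P n′))) ⟩
   inv n * (nat n′ * convK P n′) ≈⟨ sym (cancel-n _) ⟩
   ipH n′ F (a $ g) ∎
   where
   n′ = suc n
   cancel-n : ∀ x → x ≈ inv n * (nat (suc n) * x)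
   cancel-n x = sym (cancelˡ (inv* n))
   P : ℕ → ℕ → Carrier
   P k m = ip m (F k) (afn g k)
   ind : ∀ j m → j ℕ.+ m ≡ n′ → square j * ip m (∂₀ j $ (Θ $ F)) (∂₀ j $ g) ≈ square j * ipH m (lift (∂₀ j) $ F) (a $ (∂₀ j $ g)) + nat j * P j m
   ind zero m eq = trans (square-0 _) (sym (trans (+-cong (square-0 _) (zeroˡ _)) (+-identityʳ 0#)))
   ind (suc j) m P.refl = trans (*-congˡ (trans (ip-cong m {g = δ j $ g} (δΘ j F) reflₛ) (trans (ip-addˡ m _ _ _) (+-congʳ (below N m (NP.≤-<-trans (NP.m≤n+m m j) lt) (lift (δ j) $ F) (δ j $ g))))))
    (trans (distribˡ _ _ _) (+-congˡ (trans (solve 3 (λ x s y → x :* (s :* s) :* y := s :* (x :* s :* y)) refl α (nat (suc j)) _) (*-congˡ (sym (ip-scalʳ m _ _ _))))))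
   double : convK (λ j m → square j * ipH m (lift (∂₀ j) $ F) (a $ (∂₀ j $ g))) n′ ≈ convK (λ k m → nat m * P k m) n′
   double = trans (convK-cong n′ (λ j m _ → trans (sym (convK-scal (square j) _ m)) (convK-cong m (λ i l _ → *-congˡ (ip-cong l {∂₀ j $ F i} reflₛ (a-∂₀ i j g))))))
    (trans (convK-exchange (λ j i l → square j * ip l (∂₀ j $ F i) (∂₀ j $ afn g i)) n′) (convK-cong n′ (λ i m _ → sym (euler m (F i) (afn g i)))))

 ipH-sym : ∀ n F G → ipH n F G ≈ ipH n G F
 ipH-sym n F G = convK-cong n (λ j m _ → ip-sym m _ _)

 ipH-addˡ : ∀ n F F′ G → ipH n (F +ₕ F′) G ≈ ipH n F G + ipH n F′ G
 ipH-addˡ n F F′ G = trans (convK-cong n (λ j m _ → ip-addˡ m _ _ _)) (convK-add (λ j m → ip m (F j) (G j)) (λ j m → ip m (F′ j) (G j)) n)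

 ipH-scalˡ : ∀ n c F G → ipH n (c *ₕ F) G ≈ c * ipH n F G
 ipH-scalˡ n c F G = trans (convK-cong n (λ j m _ → ip-scalˡ m _ _ _)) (convK-scal c (λ j m → ip m (F j) (G j)) n)

 -- Splitting off y⁰ reduces the claim to `Θ-adjoint`: what a emits from y⁰ is paired with what Θ
 -- returns to y⁰.
 A-adjoint : ∀ n F G → ipH n (A $ F) G ≈ ipH n F (B $ G)
 A-adjoint zero F G = trans (zeroˡ _) (sym (zeroʳ _))
 A-adjoint (suc n) F G = begin
  ip (suc n) 0ₛ (G 0) + ipH n (S* $ (A $ F)) (S* $ G) ≈⟨ +-cong (ip-0ˡ (suc n) (G 0)) (ipH-addˡ n (S* $ (a $ F 0)) (A $ (S* $ F)) (S* $ G)) ⟩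
  0# + (ipH n (S* $ (a $ F 0)) (S* $ G) + ipH n (A $ (S* $ F)) (S* $ G)) ≈⟨ +-congˡ (+-congˡ (A-adjoint n (S* $ F) (S* $ G))) ⟩
  0# + (ipH n (S* $ (a $ F 0)) (S* $ G) + ipH n (S* $ F) (B $ (S* $ G))) ≈⟨ sym (+-assoc _ _ _) ⟩
  (0# + ipH n (S* $ (a $ F 0)) (S* $ G)) + ipH n (S* $ F) (B $ (S* $ G)) ≈⟨ +-congʳ (trans (+-congʳ (sym (ip-0ˡ (suc n) (G 0)))) (trans (ipH-sym (suc n) (a $ F 0) G) (trans (sym (Θ-adjoint (suc n) G (F 0))) (ip-sym (suc n) (Θ $ G) (F 0))))) ⟩
  ip (suc n) (F 0) (Θ $ G) + ipH n (S* $ F) (S* $ (B $ G)) ∎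

 N-adjoint : ∀ n F G → ipH n (N $ F) G ≈ ipH n F (N $ G)
 N-adjoint n F G = convK-cong n (λ j m _ → trans (ip-scalˡ m _ _ _) (sym (ip-scalʳ m _ _ _)))

 L-adjoint : ∀ n F G → ipH n (L $ F) G ≈ ipH n F (L $ G)
 L-adjoint n F G = begin
  ipH n (L $ F) G ≈⟨ expand F G ⟩
  (ipH n (A $ F) G + ipH n (B $ F) G) + b * ipH n (N $ F) G
   ≈⟨ +-cong (+-cong (A-adjoint n F G) (trans (ipH-sym n _ G) (trans (sym (A-adjoint n G F)) (ipH-sym n _ F)))) (*-congˡ (N-adjoint n F G)) ⟩
  (ipH n F (B $ G) + ipH n F (A $ G)) + b * ipH n F (N $ G) ≈⟨ +-cong (trans (+-comm _ _) (+-cong (ipH-sym n F _) (ipH-sym n F _))) (*-congˡ (ipH-sym n F _)) ⟩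
  (ipH n (A $ G) F + ipH n (B $ G) F) + b * ipH n (N $ G) F ≈⟨ sym (expand G F) ⟩
  ipH n (L $ G) F ≈⟨ ipH-sym n _ F ⟩
  ipH n F (L $ G) ∎
  where
  expand : ∀ F G → ipH n (L $ F) G ≈ (ipH n (A $ F) G + ipH n (B $ F) G) + b * ipH n (N $ F) G
  expand F G = trans (ipH-addˡ n ((A +ˡ B) $ F) (b *ₕ (N $ F)) G) (+-cong (ipH-addˡ n (A $ F) (B $ F) G) (ipH-scalˡ n b (N $ F) G))

 Lᵏ-adjoint : ∀ k n F G → ipH n (powˡ L k $ F) G ≈ ipH n F (powˡ L k $ G)
 Lᵏ-adjoint zero n F G = refl
 Lᵏ-adjoint (suc k) n F G = trans (L-adjoint n (powˡ L k $ F) G) (trans (Lᵏ-adjoint k n F (L $ G)) (ipH-cong n {F} reflₕ (comm k G)))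
  where
  comm : ∀ k G → (powˡ L k $ (L $ G)) ≈ₕ (L $ (powˡ L k $ G))
  comm zero G = reflₕ
  comm (suc k) G = Lin.cong L (comm k G)

 ipH-vac : ∀ n F g → ipH n F (vac $ g) ≈ ip n (F 0) g
 ipH-vac zero F g = refl
 ipH-vac (suc n) F g = trans (+-congˡ (convK-zero n (λ j m _ → ip-0ʳ m _))) (+-identityʳ _)

 I-adjoint : ∀ k n f g → ip n (bra $ (powˡ L k $ (vac $ f))) g ≈ ip n f (bra $ (powˡ L k $ (vac $ g)))
 I-adjoint k n f g = trans (sym (ipH-vac n (powˡ L k $ (vac $ f)) g)) (trans (Lᵏ-adjoint k n (vac $ f) (vac $ g)) (trans (ipH-sym n _ _) (trans (ipH-vac n (powˡ L k $ (vac $ g)) f) (ip-sym n _ f))))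

 Pos-1 : Pos 1#
 Pos-1 = Pos-cong (*-identityˡ 1#) (Pos-square 1#)

 Pos-nat : ∀ n → Pos (nat (suc n))
 Pos-nat zero = Pos-cong (sym (+-identityʳ 1#)) Pos-1
 Pos-nat (suc n) = Pos-+ Pos-1 (Pos-nat n)

 Pos-inv : ∀ n → Pos (inv n)
 Pos-inv n = Pos-cong (trans (*-assoc _ _ _) (trans (*-congˡ (inv* n)) (*-identityʳ _))) (Pos-* (Pos-square (inv n)) (Pos-nat n))

 Pos-conv : ∀ (G : ℕ → ℕ → Carrier) n → (∀ l k → Pos (G l k)) → Pos (convK G n)
 Pos-conv G zero h = h 0 0
 Pos-conv G (suc n) h = Pos-+ (h 0 (suc n)) (Pos-conv (λ l k → G (suc l) k) n (λ l k → h (suc l) k))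

 conv-zero-terms : ∀ (G : ℕ → ℕ → Carrier) n → (∀ l k → Pos (G l k)) → convK G n ≈ 0# → ∀ l k → l ℕ.+ k ≡ n → G l k ≈ 0#
 conv-zero-terms G zero h e zero zero _ = e
 conv-zero-terms G (suc n) h e zero k P.refl = Pos-zero-sum (h 0 (suc n)) (Pos-conv _ n (λ l k → h (suc l) k)) e
 conv-zero-terms G (suc n) h e (suc l) k eq = conv-zero-terms (λ l k → G (suc l) k) n (λ l k → h (suc l) k) (Pos-zero-sum (Pos-conv _ n (λ l k → h (suc l) k)) (h 0 (suc n)) (trans (+-comm _ _) e)) l k (P.cong ℕ.pred eq)

 square-zero : ∀ x → x * x ≈ 0# → x ≈ 0#
 square-zero x e with zero⊎unit x
 ... | inj₁ z = z
 ... | inj₂ (y , yx) = trans (sym (trans (*-congʳ yx) (*-identityˡ x))) (trans (*-assoc _ _ _) (*-zeroʳ′ e))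

 ips-pos : ∀ n j f → Pos (ips n j f f)
 ips-pos zero j f = Pos-square _
 ips-pos (suc n) zero f = Pos-* (Pos-inv n) (Pos-conv _ n (λ j m → Pos-* (Pos-* Pos-α (Pos-square _)) (ips-pos n j (δ j $ f))))
 ips-pos (suc n) (suc j) f = ips-pos n j f

 -- The degree times the norm is a sum of terms α j² ⟨∂_j f, ∂_j f⟩ in the cone. If the sum vanishes
 -- so does each term, and the letters of w choose which one to follow.
 ip-definite : ∀ f w → ip (wt w) f f ≈ 0# → fn f w ≈ 0#
 ip-definite f [] e = square-zero _ e
 ip-definite f (i ∷ w) e = ip-definite (δ i $ f) w (cancel-αn² (conv-zero-terms _ (i ℕ.+ wt w) (λ j m → Pos-* (Pos-* Pos-α (Pos-square _)) (ips-pos m 0 (δ j $ f)))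
   (trans (sym (n-ip (i ℕ.+ wt w) f f)) (*-zeroʳ′ e)) i (wt w) P.refl))
  where
  cancel-αn² : ∀ {x} → α * (nat (suc i) * nat (suc i)) * x ≈ 0# → x ≈ 0#
  cancel-αn² {x} e = cancel-nat i x (cancel-nat i _ (trans (sym (trans (*-congʳ α⁻¹*α) (*-identityˡ _))) (trans (solve 4 (λ y a n x → (y :* a) :* (n :* (n :* x)) := y :* (a :* (n :* n) :* x)) refl α⁻¹ α (nat (suc i)) x) (*-zeroʳ′ e))))

 ips-van : ∀ n j f g → (∀ w → wt w ℕ.+ j ≡ n → fn f w ≈ 0#) → j ℕ.≤ n → ips n j f g ≈ 0#
 ips-van zero zero f g h le = *-zeroˡ′ (h [] P.refl)
 ips-van (suc n) zero f g h le = *-zeroʳ′ (convK-zero n (λ { j m P.refl → *-zeroʳ′ (ips-van (j ℕ.+ m) j (δ j $ f) (δ j $ g) (λ w e → h (j ∷ w) (P.trans (NP.+-identityʳ _) (P.cong suc (P.trans (NP.+-comm j (wt w)) e)))) (NP.m≤m+n j m)) }))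
 ips-van (suc n) (suc j) f g h (ℕ.s≤s le) = ips-van n j f g (λ w e → h w (P.trans (NP.+-suc (wt w) j) (P.cong suc e))) le

 ip-van : ∀ {n f} g → Vanₛ n f → ip n f g ≈ 0#
 ip-van {n} {f} g h = ips-van n 0 f g (λ w e → vatₛ h w (P.trans (P.sym (NP.+-identityʳ _)) e)) ℕ.z≤n

 -- Triangular orthogonal families are eigenbases of self-adjoint operators preserving the flag.
 module GramSchmidt
  (ψ : ℕ → ℕ) (ψ0 : ψ 0 ≡ 0)
  (ψ-spread : ∀ m n m′ n′ → m′ ℕ.+ n′ ≡ m ℕ.+ n → m′ ℕ.≤ m → m′ ℕ.≤ n → ψ m ℕ.+ ψ n ℕ.≤ ψ m′ ℕ.+ ψ n′)
  (n : ℕ) (Ix : Set) (parts : Ix → List ℕ) (parts-size : ∀ κ → size (parts κ) ≡ n)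
  where
  open Triangular ψ ψ-spread

  ht : Ix → ℕ
  ht κ = φ (parts κ)

  module _
   (_≟_ : (κ μ : Ix) → Dec (κ ≡ μ))
   (search : ∀ v → Dec (Σ Ix λ κ → ht κ ≡ v))
   (sorted : ∀ η → size η ≡ n → Σ Ix λ κ → (ht κ ≡ φ η) × (∀ f → cf η f ≈ cf (parts κ) f))
   (ht-inj : ∀ κ μ → ht κ ≡ ht μ → κ ≡ μ)
   (J : Ix → Sym)
   (J-tri : ∀ κ → Triₛ n (suc (ht κ)) (J κ))
   (J-orth : ∀ κ μ → κ ≢ μ → ip n (J κ) (J μ) ≈ 0#)
   (J-norm : ∀ κ → ¬ (ip n (J κ) (J κ) ≈ 0#))
   where

   record Functional : Set where
    field
     ψf : Sym → Carrier
     fcong : ∀ {f g} → f ≈ₛ g → ψf f ≈ ψf g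
     fadd : ∀ f g → ψf (f +ₛ g) ≈ ψf f + ψf g
     fscal : ∀ c f → ψf (c *ₛ f) ≈ c * ψf f
     fvan : ∀ f → Vanₛ n f → ψf f ≈ 0#
   open Functional

   pair : Sym → Functional
   pair g = record { ψf = λ f → ip n f g ; fcong = λ e → ip-cong n e reflₛ ; fadd = λ f f′ → ip-addˡ n f f′ g ; fscal = λ c f → ip-scalˡ n c f g ; fvan = λ f h → ip-van g h }

   cf-cong : ∀ η {f g} → f ≈ₛ g → cf η f ≈ cf η g
   cf-cong η e = at (Lin.cong (tt η) e) []

   -- Induction on the height: at each height there is at most one partition κ, and a multiple of J
   -- κ clears the coefficient there. Functionals that kill the J κ take the place of explicit
   -- linear combinations.
   flag-spanned : ∀ v (Ψ : Functional) → (∀ κ → ht κ ℕ.< v → ψf Ψ (J κ) ≈ 0#) → ∀ f → Triₛ n v f → ψf Ψ f ≈ 0#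
   flag-spanned zero Ψ h f t = fvan Ψ f (null-vanishes n f (λ η e → t η e ℕ.z≤n))
   flag-spanned (suc v) Ψ h f t with search v
   ... | no none = flag-spanned v Ψ (λ κ lt → h κ (NP.m<n⇒m<1+n lt)) f (λ η e le → t η e (NP.≤∧≢⇒< le (λ eq → none (proj₁ (sorted η e) , P.trans (proj₁ (proj₂ (sorted η e))) (P.sym eq)))))
   ... | yes (κ , hκ) with zero⊎unit (cf (parts κ) (J κ))
   -- If J κ had no coefficient at κ it would lie in the flag strictly below κ, on which pairing
   -- with J κ vanishes; then its norm would be zero.
   ...   | inj₁ z = contradiction (flag-spanned v (pair (J κ)) (λ μ lt → J-orth μ κ (λ { P.refl → NP.<-irrefl hκ lt })) (J κ) lower) (J-norm κ)
    where
    lower : Triₛ n v (J κ)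
    lower η e le with NP.m≤n⇒m<n∨m≡n le
    ... | inj₁ lt = J-tri κ η e (NP.≤-trans (NP.≤-reflexive (P.cong suc hκ)) lt)
    ... | inj₂ eq with sorted η e
    ...   | κ′ , hκ′ , ceq with ht-inj κ′ κ (P.trans hκ′ (P.trans (P.sym eq) (P.sym hκ)))
    ...     | P.refl = trans (ceq (J κ)) z
   ...   | inj₂ (y , yd) = begin
    ψf Ψ f ≈⟨ fcong Ψ (pt λ w → solve 2 (λ x z → x := (x :+ (:- :1) :* z) :+ z) refl (fn f w) (c * fn (J κ) w)) ⟩
    ψf Ψ (f′ +ₛ (c *ₛ J κ)) ≈⟨ fadd Ψ f′ (c *ₛ J κ) ⟩
    ψf Ψ f′ + ψf Ψ (c *ₛ J κ) ≈⟨ +-cong (flag-spanned v Ψ (λ μ lt → h μ (NP.m<n⇒m<1+n lt)) f′ lower) (trans (fscal Ψ c (J κ)) (*-zeroʳ′ (h κ (NP.≤-reflexive (P.cong suc hκ))))) ⟩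
    0# + 0# ≈⟨ +-identityʳ 0# ⟩
    0# ∎
    where
    c = cf (parts κ) f * y
    f′ = f ⊖ (c *ₛ J κ)
    expand : ∀ η → cf η f′ ≈ cf η f + - 1# * (c * cf η (J κ))
    expand η = trans (at (Lin.add (tt η) f ((- 1#) *ₛ (c *ₛ J κ))) []) (+-congˡ (trans (at (Lin.scal (tt η) (- 1#) (c *ₛ J κ)) []) (*-congˡ (at (Lin.scal (tt η) c (J κ)) []))))
    lower : Triₛ n v f′
    lower η e le with NP.m≤n⇒m<n∨m≡n le
    ... | inj₁ lt = trans (expand η) (trans (+-cong (t η e lt) (*-congˡ (*-congˡ (J-tri κ η e (NP.≤-trans (NP.≤-reflexive (P.cong suc hκ)) lt))))) (solve 1 (λ c → :0 :+ (:- :1) :* (c :* :0) := :0) refl c))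
    ... | inj₂ eq with sorted η e
    ...   | κ′ , hκ′ , ceq with ht-inj κ′ κ (P.trans hκ′ (P.trans (P.sym eq) (P.sym hκ)))
    ...     | P.refl = trans (expand η) (trans (+-cong (ceq f) (*-congˡ (*-congˡ (ceq (J κ)))))
     (trans (solve 3 (λ x y d → x :+ (:- :1) :* (x :* y :* d) := x :+ (:- (x :* (y :* d)))) refl (cf (parts κ) f) y (cf (parts κ) (J κ)))
      (trans (+-congˡ (-‿cong (trans (*-congˡ yd) (*-identityʳ _)))) (-‿inverseʳ _))))

   -- With e the Rayleigh quotient, the residue I J_κ - e J_κ lies in the flag of κ and is
   -- orthogonal to every J_μ of that flag. So it is orthogonal to itself, and definiteness applies.
   eigenvector : ∀ k κ → Σ Carrier λ e → ∀ w → wt w ≡ n → fn (I k $ J κ) w ≈ e * fn (J κ) w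
   eigenvector k κ with zero⊎unit (ip n (J κ) (J κ))
   ... | inj₁ z = contradiction z (J-norm κ)
   ... | inj₂ (y , yd) = e , λ w eq → trans (solve 2 (λ x z → x := (x :+ (:- :1) :* z) :+ z) refl _ (e * fn (J κ) w)) (trans (+-congʳ (ip-definite Rκ w (P.subst (λ m → ip m Rκ Rκ ≈ 0#) (P.sym eq) RR))) (+-identityˡ _))
    where
    e = ip n (I k $ J κ) (J κ) * y
    Rκ = (I k $ J κ) ⊖ (e *ₛ J κ)
    ip-R : ∀ g → ip n Rκ g ≈ ip n (I k $ J κ) g + - 1# * (e * ip n (J κ) g)
    ip-R g = trans (ip-addˡ n _ _ g) (+-congˡ (trans (ip-scalˡ n _ _ g) (*-congˡ (ip-scalˡ n _ _ g))))
    R-tri : Triₛ n (suc (ht κ)) Rκ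
    R-tri η eq le = trans (at (Lin.add (tt η) (I k $ J κ) ((- 1#) *ₛ (e *ₛ J κ))) []) (trans (+-cong (I-tri ψ0 k n (suc (ht κ)) (J κ) (J-tri κ) η eq le)
     (trans (at (Lin.scal (tt η) (- 1#) (e *ₛ J κ)) []) (*-congˡ (trans (at (Lin.scal (tt η) e (J κ)) []) (*-congˡ (J-tri κ η eq le)))))) (solve 1 (λ c → :0 :+ (:- :1) :* (c :* :0) := :0) refl e))
    R-orth : ∀ μ → ht μ ℕ.< suc (ht κ) → ip n (J μ) Rκ ≈ 0#
    R-orth μ lt with μ ≟ κ
    ... | yes P.refl = trans (ip-sym n _ _) (trans (ip-R (J κ)) (trans (solve 3 (λ x y d → x :+ (:- :1) :* (x :* y :* d) := x :+ (:- (x :* (y :* d)))) refl (ip n (I k $ J κ) (J κ)) y (ip n (J κ) (J κ))) (trans (+-congˡ (-‿cong (trans (*-congˡ yd) (*-identityʳ _)))) (-‿inverseʳ _))))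
    ... | no ne = trans (ip-sym n _ _) (trans (ip-R (J μ)) (trans (+-cong (trans (I-adjoint k n (J κ) (J μ)) (trans (ip-sym n _ _) cross)) (*-congˡ (*-congˡ (J-orth κ μ (λ eq → ne (P.sym eq)))))) (solve 1 (λ c → :0 :+ (:- :1) :* (c :* :0) := :0) refl e)))
     where
     smaller : ht μ ℕ.< ht κ
     smaller = NP.≤∧≢⇒< (NP.≤-pred lt) (λ eq → ne (ht-inj μ κ eq))
     -- Self-adjointness has moved I to J μ, and I J μ stays in the flag of μ, which lies below κ.
     cross : ip n (I k $ J μ) (J κ) ≈ 0#
     cross = flag-spanned (suc (ht μ)) (pair (J κ)) (λ ν ltν → J-orth ν κ (λ { P.refl → NP.<-irrefl P.refl (NP.<-≤-trans smaller (NP.≤-pred ltν)) })) (I k $ J μ) (I-tri ψ0 k n (suc (ht μ)) (J μ) (J-tri μ))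
    RR : ip n Rκ Rκ ≈ 0#
    RR = flag-spanned (suc (ht κ)) (pair Rκ) R-orth Rκ R-tri

   spanning : (v : ℕ) → (∀ η → size η ≡ n → φ η ℕ.< v) → (Ψ : Functional) → (∀ κ → ψf Ψ (J κ) ≈ 0#) → ∀ f → ψf Ψ f ≈ 0#
   spanning v bd Ψ h f = flag-spanned v Ψ (λ κ _ → h κ) f (λ η e le → contradiction (bd η e) (NP.≤⇒≯ le))

-- The action of I⁺_k on the vectors A^λ, and sums with multiplicative weights.

module Products (K : Scalars) where
 open Linear K
 open Lax K
 open Beltrami K
 open Series K hiding (P)
 open COperators K
 open Translation K
 open Triangularity K using (convK; convK-cong; convK-last; convK-add; convK-scal; size)
 open import Defs using (splits; IsPartition)

 -- ∑ n g = Σ_{i≤n} g i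
 ∑ : ℕ → (ℕ → Carrier) → Carrier
 ∑ zero g = g 0
 ∑ (suc n) g = g 0 + ∑ n (λ i → g (suc i))

 ∑-cong : ∀ n {g h} → (∀ i → g i ≈ h i) → ∑ n g ≈ ∑ n h
 ∑-cong zero e = e 0
 ∑-cong (suc n) e = +-cong (e 0) (∑-cong n (λ i → e (suc i)))

 ∑-add : ∀ n g h → ∑ n (λ i → g i + h i) ≈ ∑ n g + ∑ n h
 ∑-add zero g h = refl
 ∑-add (suc n) g h = trans (+-congˡ (∑-add n (λ i → g (suc i)) (λ i → h (suc i)))) (+-interchange _ _ _ _)

 ∑-scal : ∀ n c g → ∑ n (λ i → c * g i) ≈ c * ∑ n g
 ∑-scal zero c g = refl
 ∑-scal (suc n) c g = trans (+-congˡ (∑-scal n c (λ i → g (suc i)))) (sym (distribˡ c _ _))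

 ∑-zero : ∀ n {g} → (∀ i → g i ≈ 0#) → ∑ n g ≈ 0#
 ∑-zero zero e = e 0
 ∑-zero (suc n) e = trans (+-cong (e 0) (∑-zero n (λ i → e (suc i)))) (+-identityˡ 0#)

 ∑-truncate : ∀ {m n} g → m ℕ.≤ n → (∀ i → m ℕ.< i → g i ≈ 0#) → ∑ m g ≈ ∑ n g
 ∑-truncate {zero} {zero} g le z = refl
 ∑-truncate {zero} {suc n} g le z = sym (trans (+-congˡ (∑-zero n (λ i → z (suc i) (ℕ.s≤s ℕ.z≤n)))) (+-identityʳ _))
 ∑-truncate {suc m} {suc n} g (ℕ.s≤s le) z = +-congˡ (∑-truncate (λ i → g (suc i)) le (λ i h → z (suc i) (ℕ.s≤s h)))

 triangle-square : ∀ T U (G : ℕ → ℕ → Carrier) → T ℕ.≤ U → (∀ i j → T ℕ.< i ℕ.+ j → G i j ≈ 0#) → ∑ T (convK G) ≈ ∑ T (λ i → ∑ U (G i))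
 triangle-square zero U G le z = ∑-truncate (G 0) le (λ i h → z 0 i h)
 triangle-square (suc T) U G le z = begin
  G 0 0 + ∑ T (λ i → G 0 (suc i) + convK (λ l k → G (suc l) k) i) ≈⟨ +-congˡ (∑-add T (λ i → G 0 (suc i)) (convK (λ l k → G (suc l) k))) ⟩
  G 0 0 + (∑ T (λ i → G 0 (suc i)) + ∑ T (convK (λ l k → G (suc l) k))) ≈⟨ sym (+-assoc _ _ _) ⟩
  ∑ (suc T) (G 0) + ∑ T (convK (λ l k → G (suc l) k))
   ≈⟨ +-cong (∑-truncate (G 0) le (λ i h → z 0 i h)) (triangle-square T U (λ l k → G (suc l) k) (NP.<⇒≤ le) (λ i j h → z (suc i) j (ℕ.s≤s h))) ⟩
  ∑ U (G 0) + ∑ T (λ i → ∑ U (G (suc i))) ∎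

 one : Sym
 one = symf isNil isNil-resp
  where
  isNil : List ℕ → Carrier
  isNil [] = 1#
  isNil (_ ∷ _) = 0#
  isNil-resp : ∀ {v w} → v ↭ w → isNil v ≈ isNil w
  isNil-resp Perm.refl = refl
  isNil-resp (prep x p) = refl
  isNil-resp (swap x y p) = refl
  isNil-resp (Perm.trans p q) = trans (isNil-resp p) (isNil-resp q)

 -- A^λ = Π α λ_i C_{λ_i} · 1 at t = -1
 Avec : List ℕ → Sym
 Avec [] = one
 Avec (l ∷ la) = (α * nat l) *ₛ (C l $ Avec la)

 Avec-fil : ∀ la → Filₛ (size la) (Avec la)
 Avec-fil [] = filₛ λ ()
 Avec-fil (l ∷ la) = filₛ-scal _ (C-fil l (Avec-fil la))

 -- The scalar analogue of `Wc`: (-1)^ℓ h_{k-1-ℓ}, or zero if ℓ ≥ k.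
 wc : (ℕ → Carrier) → ℕ → ℕ → Carrier
 wc h zero ℓ = 0#
 wc h (suc k) zero = h k
 wc h (suc k) (suc ℓ) = - wc h k ℓ

 -- The coefficient with which I⁺_k absorbs the parts σ: each part l contributes α l (-1)^l and uses
 -- up l + 1 of the index k, of which nothing may be left.
 ê : ℕ → List ℕ → Carrier
 ê zero [] = 1#
 ê (suc k) [] = 0#
 ê k (l ∷ σ) = (α * nat l) * wc (λ j → ê j σ) k l

 sumV-fn : ∀ {X : Set} (xs : List X) g w → fn (SV.sum xs g) w ≈ sumK xs (λ x → fn (g x) w)
 sumV-fn [] g w = refl
 sumV-fn (x ∷ xs) g w = +-congˡ (sumV-fn xs g w)

 Wc-sum : ∀ {X : Set} (xs : List X) (h : ℕ → X → Carrier) (v : X → Sym) g → (∀ k → (I⁺ k $ g) ≈ₛ SV.sum xs (λ x → h k x *ₛ v x)) →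
  ∀ k ℓ → (Wc k ℓ $ g) ≈ₛ SV.sum xs (λ x → wc (λ j → h j x) k ℓ *ₛ v x)
 Wc-sum xs h v g e zero ℓ = symₛ (transₛ (SV.sum-scal 0# xs v) (*ₛ-zeroˡ _))
 Wc-sum xs h v g e (suc k) zero = e k
 Wc-sum xs h v g e (suc k) (suc ℓ) = transₛ (-ₛ‿cong (Wc-sum xs h v g e k ℓ)) (transₛ (neg-scal _) (transₛ (symₛ (SV.sum-scal (- 1#) xs _))
  (SV.sum-cong xs (λ x → pt λ w → solve 2 (λ x y → (:- :1) :* (x :* y) := (:- x) :* y) refl _ _))))
  where
  neg-scal : ∀ f → (-ₛ f) ≈ₛ ((- 1#) *ₛ f)
  neg-scal f = pt λ w → solve 1 (λ x → :- x := (:- :1) :* x) refl _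

 I⁺-one : ∀ k → (I⁺ k $ one) ≈ₛ (ê k [] *ₛ one)
 I⁺-one zero = symₛ (*ₛ-identityˡ one)
 I⁺-one (suc k) = transₛ (atₙ (transₕ (atˡ (powˡ-comm L⁺ k) (vac $ one)) (transₕ (Lin.cong (powˡ L⁺ k) (transₕ (L⁺-vac one) a-one)) (Lin.zer (powˡ L⁺ k)))) 0) (symₛ (*ₛ-zeroˡ one))
  where
  a-one : (a $ one) ≈ₕ 0ₕ
  a-one = ptₙ λ { zero → reflₛ ; (suc i) → pt λ w → zeroʳ _ }

 -- I⁺_k is moved to the right through the product of the C_l. At each factor `C-star` lets it
 -- either pass or absorb the factor, so the result is a sum over splittings into absorbed and
 -- remaining parts.
 I⁺-Avec : ∀ la → All (1 ℕ.≤_) la → ∀ k → (I⁺ k $ Avec la) ≈ₛ SV.sum (splits la) (λ s → ê k (proj₁ s) *ₛ Avec (proj₂ s))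
 I⁺-Avec [] _ k = transₛ (I⁺-one k) (symₛ (+ₛ-identityʳ _))
 I⁺-Avec (suc ℓ ∷ la) (_ ∷ pos) k = transₛ (Lin.scal (I⁺ k) c (C l $ Avec la)) (transₛ (*ₛ-cong refl (C-star k ℓ (Avec la))) (transₛ (*ₛ-distribˡ c _ _)
  (transₛ (+ₛ-comm _ _) (transₛ (+ₛ-cong first second) (symₛ (SV.sum-++ (map (λ s → l ∷ proj₁ s , proj₂ s) (splits la)) _ _))))))
  where
  l = suc ℓ
  c = α * nat l
  first : (c *ₛ (Wc k l $ Avec la)) ≈ₛ SV.sum (map (λ s → l ∷ proj₁ s , proj₂ s) (splits la)) (λ s → ê k (proj₁ s) *ₛ Avec (proj₂ s))
  first = transₛ (*ₛ-cong refl (Wc-sum (splits la) (λ j s → ê j (proj₁ s)) (λ s → Avec (proj₂ s)) (Avec la) (I⁺-Avec la pos) k l))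
   (transₛ (symₛ (SV.sum-scal c (splits la) _)) (transₛ (SV.sum-cong (splits la) (λ s → pt λ w → trans (sym (*-assoc _ _ _)) (*-congʳ (sym (ê-∷ k (proj₁ s)))))) (symₛ (SV.sum-map (λ s → l ∷ proj₁ s , proj₂ s) (splits la) _))))
   where
   ê-∷ : ∀ k σ → ê k (l ∷ σ) ≈ c * wc (λ j → ê j σ) k l
   ê-∷ zero σ = refl
   ê-∷ (suc k) σ = refl
  second : (c *ₛ (C l $ (I⁺ k $ Avec la))) ≈ₛ SV.sum (map (λ s → proj₁ s , l ∷ proj₂ s) (splits la)) (λ s → ê k (proj₁ s) *ₛ Avec (proj₂ s))
  second = transₛ (*ₛ-cong refl (transₛ (Lin.cong (C l) (I⁺-Avec la pos k)) (sum-Lin (C l) (splits la) _)))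
   (transₛ (symₛ (SV.sum-scal c (splits la) _)) (transₛ (SV.sum-cong (splits la) (λ s → transₛ (*ₛ-cong refl (Lin.scal (C l) (ê k (proj₁ s)) (Avec (proj₂ s)))) (pt λ w → *-left-comm _ _ _)))
    (symₛ (SV.sum-map (λ s → proj₁ s , l ∷ proj₂ s) (splits la) _))))

 rep : ℕ → ℕ → List ℕ → List ℕ
 rep zero x la = la
 rep (suc i) x la = x ∷ rep i x la

 -- pw c i = cⁱ / i!
 pw : Carrier → ℕ → Carrier
 pw c zero = 1#
 pw c (suc i) = c * inv i * pw c i

 pw-suc : ∀ c i → nat (suc i) * pw c (suc i) ≈ c * pw c i
 pw-suc c i = trans (solve 4 (λ n c i p → n :* (c :* i :* p) := (i :* n) :* (c :* p)) refl (nat (suc i)) c (inv i) (pw c i)) (trans (*-congʳ (inv* i)) (*-identityˡ _))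

 -- 𝔼 cs F = Σ_λ (Π_i c_i^{m_i(λ)} / m_i(λ)!) F(λ) over partitions with parts ≤ M and multiplicities ≤ T;
 -- the head of cs belongs to the largest part.
 module Expectation (T : ℕ) where

  𝔼 : ∀ {M} → Vec Carrier M → (List ℕ → Carrier) → Carrier
  𝔼 [] F = F []
  𝔼 {suc M} (c ∷ cs) F = ∑ T (λ i → pw c i * 𝔼 cs (λ la → F (rep i (suc M) la)))

  Below : ℕ → List ℕ → Set
  Below M la = IsPartition la × All (ℕ._≤ M) la

  rep-below : ∀ M i la → Below M la → Below (suc M) (rep i (suc M) la)
  rep-below M zero la (p , b) = p , weaken b
   where
   weaken : ∀ {la} → All (ℕ._≤ M) la → All (ℕ._≤ suc M) la
   weaken [] = []
   weaken (x ∷ xs) = NP.m≤n⇒m≤1+n x ∷ weaken xs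
  rep-below M (suc i) la h with rep i (suc M) la | rep-below M i la h
  ... | [] | ((pos , lk) , b) = ((ℕ.s≤s ℕ.z≤n ∷ pos) , [-]) , (NP.≤-refl ∷ b)
  ... | (x ∷ xs) | ((pos , lk) , (le ∷ b)) = ((ℕ.s≤s ℕ.z≤n ∷ pos) , (le ∷ lk)) , (NP.≤-refl ∷ le ∷ b)

  𝔼-cong : ∀ {M} (cs : Vec Carrier M) {F G} → (∀ la → Below M la → F la ≈ G la) → 𝔼 cs F ≈ 𝔼 cs G
  𝔼-cong [] e = e [] (([] , []) , [])
  𝔼-cong {suc M} (c ∷ cs) e = ∑-cong T (λ i → *-congˡ (𝔼-cong cs (λ la h → e (rep i (suc M) la) (rep-below M i la h))))

  𝔼-add : ∀ {M} (cs : Vec Carrier M) F G → 𝔼 cs (λ la → F la + G la) ≈ 𝔼 cs F + 𝔼 cs G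
  𝔼-add [] F G = refl
  𝔼-add (c ∷ cs) F G = trans (∑-cong T (λ i → trans (*-congˡ (𝔼-add cs _ _)) (distribˡ _ _ _))) (∑-add T _ _)

  𝔼-scal : ∀ {M} (cs : Vec Carrier M) k F → 𝔼 cs (λ la → k * F la) ≈ k * 𝔼 cs F
  𝔼-scal [] k F = refl
  𝔼-scal (c ∷ cs) k F = trans (∑-cong T (λ i → trans (*-congˡ (𝔼-scal cs k _)) (*-left-comm _ _ _))) (∑-scal T k _)

  𝔼-0 : ∀ {M} (cs : Vec Carrier M) → 𝔼 cs (λ _ → 0#) ≈ 0#
  𝔼-0 [] = refl
  𝔼-0 (c ∷ cs) = ∑-zero T (λ i → *-zeroʳ′ (𝔼-0 cs))

  𝔼-zero : ∀ {M} (cs : Vec Carrier M) {F} → (∀ la → F la ≈ 0#) → 𝔼 cs F ≈ 0#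
  𝔼-zero cs e = trans (𝔼-cong cs (λ la _ → e la)) (𝔼-0 cs)

  𝔼-sumK : ∀ {M} {X : Set} (cs : Vec Carrier M) (xs : List X) (F : X → List ℕ → Carrier) → 𝔼 cs (λ la → sumK xs (λ x → F x la)) ≈ sumK xs (λ x → 𝔼 cs (F x))
  𝔼-sumK cs [] F = 𝔼-0 cs
  𝔼-sumK cs (x ∷ xs) F = trans (𝔼-add cs _ _) (+-congˡ (𝔼-sumK cs xs F))

  𝔼-convK : ∀ {M} (cs : Vec Carrier M) (F : ℕ → ℕ → List ℕ → Carrier) i → 𝔼 cs (λ la → convK (λ a b → F a b la) i) ≈ convK (λ a b → 𝔼 cs (F a b)) i
  𝔼-convK cs F zero = refl
  𝔼-convK cs F (suc i) = trans (𝔼-add cs _ _) (+-congˡ (𝔼-convK cs (λ a b → F (suc a) b) i))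

  module _ (x : ℕ) (c : Carrier) where
   Gs : List ℕ → (List ℕ → List ℕ → Carrier) → ℕ → ℕ → Carrier
   Gs la F a b = sumK (splits la) (λ s → F (rep a x (proj₁ s)) (rep b x (proj₂ s)))

   -- Distributing i equal parts produces binomial multiplicities, which the 1/i! of the weights
   -- turns into a convolution. No binomials are needed for the step: i + 1 = a + b is divided
   -- between the two factors.
   splits-rep : ∀ la i (F : List ℕ → List ℕ → Carrier) → pw c i * sumK (splits (rep i x la)) (λ s → F (proj₁ s) (proj₂ s)) ≈ convK (λ a b → (pw c a * pw c b) * Gs la F a b) i
   splits-rep la zero F = *-congʳ (sym (*-identityˡ 1#))
   splits-rep la (suc i) F = begin
    pw c (suc i) * Q ≈⟨ sym (cancelˡ (inv* i)) ⟩
    inv i * (nat (suc i) * (pw c (suc i) * Q)) ≈⟨ *-congˡ (trans (sym (*-assoc _ _ _)) (*-congʳ (pw-suc c i))) ⟩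
    inv i * (c * pw c i * Q) ≈⟨ *-congˡ (*-congˡ (trans (sumK-++ (map _ (splits (rep i x la))) _ _) (+-cong (sumK-map _ (splits (rep i x la)) _) (sumK-map _ (splits (rep i x la)) _)))) ⟩
    inv i * (c * pw c i * (Q₁ + Q₂)) ≈⟨ *-congˡ (solve 4 (λ c p x y → c :* p :* (x :+ y) := c :* (p :* x) :+ c :* (p :* y)) refl c (pw c i) Q₁ Q₂) ⟩
    inv i * (c * (pw c i * Q₁) + c * (pw c i * Q₂)) ≈⟨ *-congˡ (+-cong (trans (*-congˡ (splits-rep la i (λ σ τ → F (x ∷ σ) τ))) (trans (sym (convK-scal c _ i)) (convK-cong i (λ a b _ → raiseˡ a b))))
      (trans (*-congˡ (splits-rep la i (λ σ τ → F σ (x ∷ τ)))) (trans (sym (convK-scal c _ i)) (convK-cong i (λ a b _ → raiseʳ a b))))) ⟩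
    inv i * (convK (λ a b → nat (suc a) * P (suc a) b) i + convK (λ a b → nat (suc b) * P a (suc b)) i) ≈⟨ *-congˡ (+-cong (sym (trans (+-congʳ (zeroˡ _)) (+-identityˡ _))) (sym (trans (convK-last (λ a b → nat b * P a b) i) (trans (+-congˡ (zeroˡ _)) (+-identityʳ _))))) ⟩
    inv i * (convK (λ a b → nat a * P a b) (suc i) + convK (λ a b → nat b * P a b) (suc i))
     ≈⟨ *-congˡ (trans (sym (convK-add (λ a b → nat a * P a b) (λ a b → nat b * P a b) (suc i))) (trans (convK-cong (suc i) (λ a b eq → trans (sym (distribʳ (P a b) _ _)) (*-congʳ (trans (sym (nat-+ a b)) (reflexive (P.cong nat eq)))))) (convK-scal (nat (suc i)) P (suc i)))) ⟩
    inv i * (nat (suc i) * convK P (suc i)) ≈⟨ cancelˡ (inv* i) ⟩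
    convK P (suc i) ∎
    where
    Q = sumK (splits (rep (suc i) x la)) (λ s → F (proj₁ s) (proj₂ s))
    Q₁ = sumK (splits (rep i x la)) (λ s → F (x ∷ proj₁ s) (proj₂ s))
    Q₂ = sumK (splits (rep i x la)) (λ s → F (proj₁ s) (x ∷ proj₂ s))
    P : ℕ → ℕ → Carrier
    P a b = (pw c a * pw c b) * Gs la F a b
    raiseˡ : ∀ a b → c * ((pw c a * pw c b) * Gs la F (suc a) b) ≈ nat (suc a) * P (suc a) b
    raiseˡ a b = trans (solve 4 (λ c p q g → c :* ((p :* q) :* g) := (c :* p) :* q :* g) refl c (pw c a) (pw c b) _) (trans (*-congʳ (*-congʳ (sym (pw-suc c a)))) (solve 4 (λ n p q g → n :* p :* q :* g := n :* ((p :* q) :* g)) refl _ _ _ _))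
    raiseʳ : ∀ a b → c * ((pw c a * pw c b) * Gs la F a (suc b)) ≈ nat (suc b) * P a (suc b)
    raiseʳ a b = trans (solve 4 (λ c p q g → c :* ((p :* q) :* g) := (c :* q) :* p :* g) refl c (pw c a) (pw c b) _) (trans (*-congʳ (*-congʳ (sym (pw-suc c b)))) (solve 4 (λ n q p g → n :* q :* p :* g := n :* ((p :* q) :* g)) refl _ _ _ _))

  size-rep : ∀ i x la → i ℕ.+ size la ℕ.≤ size (rep i (suc x) la)
  size-rep zero x la = NP.≤-refl
  size-rep (suc i) x la = ℕ.s≤s (NP.≤-trans (size-rep i x la) (NP.m≤n+m _ x))

  -- The weights c^i/i! multiply like exponentials, so the sum over splittings factorises. Cutting
  -- all multiplicities at T is consistent because F vanishes on pairs of total size above T.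
  𝔼-split : ∀ {M} (cs : Vec Carrier M) (F : List ℕ → List ℕ → Carrier) → (∀ σ τ → T ℕ.< size σ ℕ.+ size τ → F σ τ ≈ 0#) →
   𝔼 cs (λ la → sumK (splits la) (λ s → F (proj₁ s) (proj₂ s))) ≈ 𝔼 cs (λ σ → 𝔼 cs (λ τ → F σ τ))
  𝔼-split [] F z = +-identityʳ _
  𝔼-split {suc M} (c ∷ cs) F z = begin
   ∑ T (λ i → pw c i * 𝔼 cs (λ la → sumK (splits (rep i x la)) (λ s → F (proj₁ s) (proj₂ s))))
    ≈⟨ ∑-cong T (λ i → trans (sym (𝔼-scal cs (pw c i) _)) (trans (𝔼-cong cs (λ la _ → splits-rep x c la i F)) (𝔼-convK cs (λ a b la → (pw c a * pw c b) * Gs x c la F a b) i))) ⟩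
   ∑ T (convK (λ a b → 𝔼 cs (λ la → (pw c a * pw c b) * Gs x c la F a b)))
    ≈⟨ ∑-cong T (λ i → convK-cong i (λ a b _ → trans (𝔼-scal cs _ _) (*-congˡ (𝔼-split cs (F′ a b) (λ σ τ lt → z _ _ (NP.<-≤-trans lt (NP.+-mono-≤ (NP.≤-trans (NP.m≤n+m _ a) (size-rep a M σ)) (NP.≤-trans (NP.m≤n+m _ b) (size-rep b M τ))))))))) ⟩
   ∑ T (convK G) ≈⟨ triangle-square T T G NP.≤-refl big ⟩
   ∑ T (λ a → ∑ T (G a))
    ≈⟨ ∑-cong T (λ a → trans (∑-cong T (λ b → trans (*-assoc _ _ _) (*-congˡ (sym (𝔼-scal cs (pw c b) _))))) (trans (∑-scal T (pw c a) _) (*-congˡ (sym (𝔼-∑ T (λ b σ → pw c b * 𝔼 cs (λ τ → F′ a b σ τ))))))) ⟩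
   ∑ T (λ a → pw c a * 𝔼 cs (λ σ → ∑ T (λ b → pw c b * 𝔼 cs (λ τ → F′ a b σ τ)))) ∎
   where
   x = suc M
   F′ : ℕ → ℕ → List ℕ → List ℕ → Carrier
   F′ a b σ τ = F (rep a x σ) (rep b x τ)
   G : ℕ → ℕ → Carrier
   G a b = (pw c a * pw c b) * 𝔼 cs (λ σ → 𝔼 cs (λ τ → F′ a b σ τ))
   big : ∀ a b → T ℕ.< a ℕ.+ b → G a b ≈ 0#
   big a b lt = *-zeroʳ′ (𝔼-zero cs (λ σ → 𝔼-zero cs (λ τ → z _ _ (NP.<-≤-trans lt (NP.+-mono-≤ (NP.≤-trans (NP.m≤m+n a _) (size-rep a M σ)) (NP.≤-trans (NP.m≤m+n b _) (size-rep b M τ)))))))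
   𝔼-∑ : ∀ n (H : ℕ → List ℕ → Carrier) → 𝔼 cs (λ σ → ∑ n (λ b → H b σ)) ≈ ∑ n (λ b → 𝔼 cs (H b))
   𝔼-∑ zero H = refl
   𝔼-∑ (suc n) H = trans (𝔼-add cs _ _) (+-congˡ (𝔼-∑ n (λ b → H (suc b))))

-- Joint eigenvectors as generating functions of the A^λ.

module Expansion (K : Scalars) where
 open Linear K
 open Lax K
 open Series K hiding (P)
 open COperators K
 open Translation K
 open Triangularity K using (size)
 open Products K
 open import Defs using (splits)

 ∑V : ℕ → (ℕ → Sym) → Sym
 ∑V zero g = g 0
 ∑V (suc n) g = g 0 +ₛ ∑V n (λ i → g (suc i))

 ∑V-fn : ∀ n g w → fn (∑V n g) w ≈ ∑ n (λ i → fn (g i) w)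
 ∑V-fn zero g w = refl
 ∑V-fn (suc n) g w = +-congˡ (∑V-fn n (λ i → g (suc i)) w)

 ∑V-Lin : ∀ (S : Lin V V) n g → (S $ ∑V n g) ≈ₛ ∑V n (λ i → S $ g i)
 ∑V-Lin S zero g = reflₛ
 ∑V-Lin S (suc n) g = transₛ (Lin.add S _ _) (+ₛ-congˡ (∑V-Lin S n (λ i → g (suc i))))

 ∑V-cong : ∀ n {g h} → (∀ i → g i ≈ₛ h i) → ∑V n g ≈ₛ ∑V n h
 ∑V-cong zero e = e 0
 ∑V-cong (suc n) e = +ₛ-cong (e 0) (∑V-cong n (λ i → e (suc i)))

 wc-van : ∀ k ℓ h → (∀ j → suc (j ℕ.+ ℓ) ≡ k → h j ≈ 0#) → wc h k ℓ ≈ 0#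
 wc-van zero ℓ h z = refl
 wc-van (suc k) zero h z = z k (P.cong suc (NP.+-identityʳ k))
 wc-van (suc k) (suc ℓ) h z = trans (-‿cong (wc-van k ℓ h (λ j e → z j (P.cong suc (P.trans (NP.+-suc j ℓ) e))))) -0≈0

 wc-top : ∀ ℓ h → wc h (suc ℓ) ℓ ≈ sgnK ℓ * h 0
 wc-top zero h = sym (*-identityˡ _)
 wc-top (suc ℓ) h = trans (-‿cong (wc-top ℓ h)) (solve 2 (λ x y → :- (x :* y) := (:- x) :* y) refl _ _)

 ê-∷ : ∀ k l σ → ê k (l ∷ σ) ≡ (α * nat l) * wc (λ j → ê j σ) k l
 ê-∷ zero l σ = P.refl
 ê-∷ (suc k) l σ = P.refl

 ê-van : ∀ k σ → k ℕ.< size σ → ê k σ ≈ 0#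
 ê-van k (l ∷ σ) lt = trans (reflexive (ê-∷ k l σ)) (*-zeroʳ′ (wc-van k l (λ j → ê j σ) (λ { j P.refl → ê-van j σ (NP.+-cancelˡ-< l j (size σ) (NP.≤-trans (ℕ.s≤s (NP.≤-trans (NP.≤-reflexive (NP.+-comm l j)) (NP.n≤1+n _))) lt)) })))

 sgn² : ∀ n → sgnK n * sgnK n ≈ 1#
 sgn² zero = *-identityˡ 1#
 sgn² (suc n) = trans (solve 1 (λ x → (:- x) :* (:- x) := x :* x) refl (sgnK n)) (sgn² n)

 module Expand (T : ℕ) where
  open Expectation T public

  EV : ∀ {M} → Vec Carrier M → (List ℕ → Sym) → Sym
  EV [] F = F []
  EV {suc M} (c ∷ cs) F = ∑V T (λ i → pw c i *ₛ EV cs (λ la → F (rep i (suc M) la)))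

  EV-fn : ∀ {M} (cs : Vec Carrier M) F w → fn (EV cs F) w ≈ 𝔼 cs (λ la → fn (F la) w)
  EV-fn [] F w = refl
  EV-fn (c ∷ cs) F w = trans (∑V-fn T _ w) (∑-cong T (λ i → *-congˡ (EV-fn cs _ w)))

  EV-Lin : ∀ {M} (S : Lin V V) (cs : Vec Carrier M) F → (S $ EV cs F) ≈ₛ EV cs (λ la → S $ F la)
  EV-Lin S [] F = reflₛ
  EV-Lin S (c ∷ cs) F = transₛ (∑V-Lin S T _) (∑V-cong T (λ i → transₛ (Lin.scal S _ _) (*ₛ-cong refl (EV-Lin S cs _))))

  wv : ∀ {M} → Vec Carrier M → Sym
  wv cs = EV cs Avec

  -- I⁺_k splits λ and the weights are multiplicative, so the absorbed parts separate off as a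
  -- scalar, the eigenvalue. The bound on k + wt ξ ensures that no splitting lost to the truncation
  -- contributes.
  wv-eigen : ∀ {M} (cs : Vec Carrier M) k ξ → k ℕ.+ wt ξ ℕ.≤ T → fn (I⁺ k $ wv cs) ξ ≈ 𝔼 cs (ê k) * fn (wv cs) ξ
  wv-eigen cs k ξ le = begin
   fn (I⁺ k $ wv cs) ξ ≈⟨ trans (at (EV-Lin (I⁺ k) cs Avec) ξ) (EV-fn cs (λ la → I⁺ k $ Avec la) ξ) ⟩
   𝔼 cs (λ la → fn (I⁺ k $ Avec la) ξ) ≈⟨ 𝔼-cong cs (λ la h → trans (at (I⁺-Avec la (proj₁ (proj₁ h)) k) ξ) (sumV-fn (splits la) _ ξ)) ⟩
   𝔼 cs (λ la → sumK (splits la) (λ s → ê k (proj₁ s) * fn (Avec (proj₂ s)) ξ)) ≈⟨ 𝔼-split cs (λ σ τ → ê k σ * fn (Avec τ) ξ) vanish ⟩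
   𝔼 cs (λ σ → 𝔼 cs (λ τ → ê k σ * fn (Avec τ) ξ)) ≈⟨ 𝔼-cong cs (λ σ _ → trans (𝔼-scal cs (ê k σ) _) (trans (*-congˡ (sym (EV-fn cs Avec ξ))) (*-comm _ _))) ⟩
   𝔼 cs (λ σ → fn (wv cs) ξ * ê k σ) ≈⟨ trans (𝔼-scal cs _ _) (*-comm _ _) ⟩
   𝔼 cs (ê k) * fn (wv cs) ξ ∎
   where
   vanish : ∀ σ τ → T ℕ.< size σ ℕ.+ size τ → ê k σ * fn (Avec τ) ξ ≈ 0#
   vanish σ τ lt with NP.<-≤-connex k (size σ) | NP.<-≤-connex (wt ξ) (size τ)
   ... | inj₁ k< | _ = *-zeroˡ′ (ê-van k σ k<)
   ... | inj₂ _ | inj₁ ξ< = *-zeroʳ′ (vatₛ (fatₛ (Avec-fil τ) ξ<) ξ P.refl)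
   ... | inj₂ σ≤ | inj₂ τ≤ = contradiction (NP.<-≤-trans lt (NP.≤-trans (NP.+-mono-≤ σ≤ τ≤) le)) (NP.<-irrefl P.refl)

 module Choose (e : ℕ → Carrier) (e0 : e 0 ≈ 1#) (e1 : e 1 ≈ 0#) (T′ : ℕ) where
  open Expand (suc T′)

  -- Each new constant is fixed by the first eigenvalue that it affects.
  cs : ∀ M → Vec Carrier M
  cs zero = []
  cs (suc M) = ((e (suc (suc M)) - 𝔼 (cs M) (ê (suc (suc M)))) * (inv M * α⁻¹ * sgnK (suc M))) ∷ cs M

  inv0 : inv 0 ≈ 1#
  inv0 = trans (sym (*-identityʳ _)) (trans (*-congˡ (sym (+-identityʳ 1#))) (inv* 0))

  -- A part x = M + 1 affects only eigenvalues with k ≥ x + 1. For k = x + 1 it acts through the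
  -- single partition with one part x, linearly and with the factor α x (-1)^x, which the definition
  -- of the constant divides out.
  matches : ∀ M k → k ℕ.≤ suc M → 𝔼 (cs M) (ê k) ≈ e k
  matches zero zero le = sym e0
  matches zero (suc zero) le = sym e1
  matches zero (suc (suc k)) (ℕ.s≤s ())
  matches (suc M) k le with NP.m≤n⇒m<n∨m≡n le
  ... | inj₁ (ℕ.s≤s lt) = trans (+-cong (*-identityˡ _) (∑-zero T′ (λ i → *-zeroʳ′ (𝔼-zero (cs M) (λ la → trans (reflexive (ê-∷ k (suc M) (rep i (suc M) la)))
    (*-zeroʳ′ (wc-van k (suc M) (λ j → ê j (rep i (suc M) la)) (λ { j P.refl → contradiction lt (NP.<⇒≱ (ℕ.s≤s (NP.m≤n+m (suc M) j))) })))))))) (trans (+-identityʳ _) (matches M k lt))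
  ... | inj₂ P.refl = begin
   1# * G + ∑ T′ (λ i → pw c (suc i) * 𝔼 (cs M) (λ la → ê (suc x) (x ∷ rep i x la))) ≈⟨ +-cong (*-identityˡ G) tail ⟩
   G + c * inv 0 * 1# * ((α * nat x) * (sgnK x * 1#)) ≈⟨ +-congˡ (*-congʳ (*-congʳ (*-congˡ inv0))) ⟩
   G + c * 1# * 1# * ((α * nat x) * (sgnK x * 1#))
    ≈⟨ +-congˡ (solve 7 (λ d i y s a n z → d :* (i :* y :* s) :* :1 :* :1 :* ((a :* n) :* (s :* :1)) := d :* ((i :* n) :* (y :* a) :* (s :* s))) refl (e (suc x) - G) (inv M) α⁻¹ (sgnK x) α (nat x) 0#) ⟩
   G + (e (suc x) - G) * ((inv M * nat x) * (α⁻¹ * α) * (sgnK x * sgnK x)) ≈⟨ +-congˡ (trans (*-congˡ (trans (*-cong (trans (*-cong (inv* M) α⁻¹*α) (*-identityˡ 1#)) (sgn² x)) (*-identityˡ 1#))) (*-identityʳ _)) ⟩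
   G + (e (suc x) - G) ≈⟨ solve 2 (λ g z → g :+ (z :- g) := z) refl G (e (suc x)) ⟩
   e (suc x) ∎
   where
   x = suc M
   G = 𝔼 (cs M) (ê (suc x))
   c = (e (suc x) - G) * (inv M * α⁻¹ * sgnK x)
   head : ∀ σ → ê (suc x) (x ∷ σ) ≈ (α * nat x) * (sgnK x * ê 0 σ)
   head σ = trans (reflexive (ê-∷ (suc x) x σ)) (*-congˡ (wc-top x (λ j → ê j σ)))
   term₀ : 𝔼 (cs M) (λ la → ê (suc x) (x ∷ la)) ≈ (α * nat x) * (sgnK x * 1#)
   term₀ = trans (𝔼-cong (cs M) (λ la _ → head la)) (trans (𝔼-scal (cs M) _ _) (*-congˡ (trans (𝔼-scal (cs M) _ _) (*-congˡ (trans (matches M 0 ℕ.z≤n) e0)))))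
   later : ∀ i → 𝔼 (cs M) (λ la → ê (suc x) (x ∷ x ∷ rep i x la)) ≈ 0#
   later i = 𝔼-zero (cs M) (λ la → trans (head (x ∷ rep i x la)) (*-zeroʳ′ (*-zeroʳ′ (zeroʳ _))))
   drop-later : ∀ T′ → ∑ T′ (λ i → pw c (suc i) * 𝔼 (cs M) (λ la → ê (suc x) (x ∷ rep i x la))) ≈ pw c 1 * 𝔼 (cs M) (λ la → ê (suc x) (x ∷ la))
   drop-later zero = refl
   drop-later (suc T′) = trans (+-congˡ (∑-zero T′ (λ i → *-zeroʳ′ (later i)))) (+-identityʳ _)
   tail : ∑ T′ (λ i → pw c (suc i) * 𝔼 (cs M) (λ la → ê (suc x) (x ∷ rep i x la))) ≈ c * inv 0 * 1# * ((α * nat x) * (sgnK x * 1#))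
   tail = trans (drop-later T′) (*-congˡ term₀)

 -- Joint eigenvectors of the I⁺ k are exponential generating functions of the vectors A^λ.
 expand : ∀ (Kv : Sym) (e : ℕ → Carrier) → fn Kv [] ≈ 1# → (∀ k v → fn (I⁺ k $ Kv) v ≈ e k * fn Kv v) →
  ∀ D → Σ (Vec Carrier D) λ cs → ∀ w → wt w ℕ.≤ D → fn Kv w ≈ Expectation.𝔼 (suc D) cs (λ la → fn (Avec la) w)
 expand Kv e ε1 eig D = cs D , λ w le → trans (trans (solve 2 (λ x y → x := (x :+ (:- :1) :* y) :+ y) refl (fn Kv w) (fn (wv (cs D)) w)) (trans (+-congʳ (diff w le)) (+-identityˡ _))) (EV-fn (cs D) Avec w)
  where
  -- The constants adjust the eigenvalues from k = 2 on; the first two are forced by I⁺_0 = 1 and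
  -- I⁺_1 = 0.
  e0 : e 0 ≈ 1#
  e0 = trans (sym (trans (*-congˡ ε1) (*-identityʳ _))) (trans (sym (eig 0 [])) ε1)
  e1 : e 1 ≈ 0#
  e1 = trans (sym (trans (*-congˡ ε1) (*-identityʳ _))) (trans (sym (eig 1 [])) (at (atₙ (L⁺-vac Kv) 0) []))
  -- Multiplicities go up to suc D because `eigenvector-zero` tests all k and v with k + wt v ≤ suc
  -- D.
  open Expand (suc D)
  open Choose e e0 e1 D
  f = Kv ⊖ wv (cs D)
  wv-ε : ∀ D → fn (wv (cs D)) [] ≈ 1#
  wv-ε M = trans (EV-fn (cs M) Avec []) (trans (𝔼-cong (cs M) (λ la h → ε-Avec la (proj₁ (proj₁ h)))) (trans (matches M 0 ℕ.z≤n) e0))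
   where
   ε-Avec : ∀ la → All (1 ℕ.≤_) la → fn (Avec la) [] ≈ ê 0 la
   ε-Avec [] _ = refl
   ε-Avec (zero ∷ la) (() ∷ _)
   ε-Avec (suc l ∷ la) _ = trans (vatₛ (fatₛ (Avec-fil (suc l ∷ la)) (ℕ.s≤s ℕ.z≤n)) [] P.refl) (sym (zeroʳ _))
  diff : ∀ w → wt w ℕ.≤ D → fn f w ≈ 0#
  diff = eigenvector-zero D e f (trans (+-cong ε1 (*-congˡ (wv-ε D))) (solve 0 (:1 :+ (:- :1) :* :1 := :0) refl))
   (λ k v le → begin
    fn (I⁺ k $ f) v ≈⟨ trans (at (Lin.add (I⁺ k) Kv _) v) (+-congˡ (at (Lin.scal (I⁺ k) (- 1#) (wv (cs D))) v)) ⟩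
    fn (I⁺ k $ Kv) v + - 1# * fn (I⁺ k $ wv (cs D)) v ≈⟨ +-cong (eig k v) (*-congˡ (trans (wv-eigen (cs D) k v le) (*-congʳ (matches D k (NP.≤-trans (NP.m≤m+n k (wt v)) le))))) ⟩
    e k * fn Kv v + - 1# * (e k * fn (wv (cs D)) v) ≈⟨ solve 3 (λ e x y → e :* x :+ (:- :1) :* (e :* y) := e :* (x :+ (:- :1) :* y)) refl (e k) (fn Kv v) (fn (wv (cs D)) v) ⟩
    e k * fn f v ∎)

-- Monomials in the power sums, and finite forms of the operators.

module Monomials (K : Scalars) where
 open Linear K
 open Lax K
 open LaxCommutation K using (lift-S; lift-vac)
 open Series K hiding (P)
 open COperators K
 open Tau K using (sing; sing-same; sing-below; sing-above)
 open Products K using (one)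

 upTo-suc : ∀ n → upTo (suc n) ≡ 0 ∷ map suc (upTo n)
 upTo-suc n = P.cong (0 ∷_) (P.sym (LP.map-applyUpTo (λ x → x) suc n))

 δ-sing : ∀ i k f → (lift (δ i) $ (sing k $ f)) ≈ₕ (sing k $ (δ i $ f))
 δ-sing i zero f = lift-vac (δ i) f
 δ-sing i (suc k) f = transₕ (lift-S (δ i) (sing k $ f)) (Lin.cong S (δ-sing i k f))

 δpₘ-same : ∀ i f → (δ i $ (pₘ i $ f)) ≈ₛ ((pₘ i $ (δ i $ f)) +ₛ f)
 δpₘ-same i f = transₛ (δΘ i (sing (suc i) $ f)) (+ₛ-cong (Lin.cong Θ (δ-sing i (suc i) f)) (sing-same (suc i) f))

 δpₘ-other : ∀ i j f → i ≢ j → (δ i $ (pₘ j $ f)) ≈ₛ (pₘ j $ (δ i $ f))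
 δpₘ-other i j f ne = transₛ (δΘ i (sing (suc j) $ f)) (transₛ (+ₛ-cong (Lin.cong Θ (δ-sing i (suc j) f)) (off (NP.<-cmp i j))) (+ₛ-identityʳ _))
  where
  open import Relation.Binary.Definitions using (Tri; tri<; tri≈; tri>)
  off : Tri (i ℕ.< j) (i ≡ j) (j ℕ.< i) → (sing (suc j) $ f) (suc i) ≈ₛ 0ₛ
  off (tri< lt _ _) = sing-below (suc j) (suc i) f (ℕ.s≤s lt)
  off (tri≈ _ eq _) = contradiction eq ne
  off (tri> _ _ gt) = sing-above (suc j) (suc i) f (ℕ.s≤s gt)

 sing-Θ : ∀ k (G : El H) j → (sing k $ (Θ $ G)) j ≈ₛ (Θ $ (λ l → (sing k $ G l) j))
 sing-Θ zero G zero = reflₛ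
 sing-Θ zero G (suc j) = symₛ (Lin.zer Θ)
 sing-Θ (suc k) G zero = symₛ (Lin.zer Θ)
 sing-Θ (suc k) G (suc j) = sing-Θ k G j

 sing-sing : ∀ k l f i j → (sing k $ (sing l $ f) i) j ≈ₛ (sing l $ (sing k $ f) j) i
 sing-sing zero l f i zero = reflₛ
 sing-sing zero l f i (suc j) = symₛ (atₙ (Lin.zer (sing l)) i)
 sing-sing (suc k) l f i zero = symₛ (atₙ (Lin.zer (sing l)) i)
 sing-sing (suc k) l f i (suc j) = sing-sing k l f i j

 pₘ-comm : ∀ i j f → (pₘ i $ (pₘ j $ f)) ≈ₛ (pₘ j $ (pₘ i $ f))
 pₘ-comm i j f = transₛ (Lin.cong Θ (ptₙ λ r → sing-Θ (suc i) (sing (suc j) $ f) r))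
  (transₛ (Θ-swap (λ r l → (sing (suc i) $ (sing (suc j) $ f) l) r)) (Lin.cong Θ (ptₙ λ l → transₛ (Lin.cong Θ (ptₙ λ r → sing-sing (suc i) (suc j) f l r)) (symₛ (sing-Θ (suc j) (sing (suc i) $ f) l)))))

 -- multiplication by p_j; the variable p_0 does not occur and is sent to 0
 pv : ℕ → Lin V V
 pv zero = 0ˡ
 pv (suc i) = pₘ i

 pv-comm : ∀ i j f → (pv i $ (pv j $ f)) ≈ₛ (pv j $ (pv i $ f))
 pv-comm zero j f = symₛ (Lin.zer (pv j))
 pv-comm (suc i) zero f = Lin.zer (pₘ i)
 pv-comm (suc i) (suc j) f = pₘ-comm i j f

 pvs : ℕ → ℕ → Lin V V
 pvs k e = powˡ (pv k) e

 monoFrom : ℕ → List ℕ → Sym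
 monoFrom k [] = one
 monoFrom k (e ∷ es) = pvs k e $ monoFrom (suc k) es

 monomial : List ℕ → Sym
 monomial = monoFrom 0

 pv-pvs : ∀ j k e f → (pv j $ (pvs k e $ f)) ≈ₛ (pvs k e $ (pv j $ f))
 pv-pvs j k zero f = reflₛ
 pv-pvs j k (suc e) f = transₛ (pv-comm j k _) (Lin.cong (pv k) (pv-pvs j k e f))

 monoFrom-suc : ∀ k j es → monoFrom k (D.modAt suc j es) ≈ₛ (pv (j ℕ.+ k) $ monoFrom k es)
 monoFrom-suc k zero [] = reflₛ
 monoFrom-suc k zero (e ∷ es) = reflₛ
 monoFrom-suc k (suc j) [] = transₛ (monoFrom-suc (suc k) j []) (reflexiveₛ (P.cong (λ i → pv i $ one) (NP.+-suc j k)))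
 monoFrom-suc k (suc j) (e ∷ es) = transₛ (Lin.cong (pvs k e) (transₛ (monoFrom-suc (suc k) j es) (reflexiveₛ (P.cong (λ i → pv i $ monoFrom (suc k) es) (NP.+-suc j k)))))
  (symₛ (pv-pvs (suc j ℕ.+ k) k e (monoFrom (suc k) es)))

 monomial-suc : ∀ j pe → monomial (D.modAt suc j pe) ≈ₛ (pv j $ monomial pe)
 monomial-suc j pe = transₛ (monoFrom-suc 0 j pe) (reflexiveₛ (P.cong (λ i → pv i $ monomial pe) (NP.+-identityʳ j)))

 δ-one : ∀ i → (δ i $ one) ≈ₛ 0ₛ
 δ-one i = pt λ w → refl

 δ-pvs-other : ∀ i k e f → suc i ≢ k → (δ i $ (pvs k e $ f)) ≈ₛ (pvs k e $ (δ i $ f))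
 δ-pvs-other i k zero f ne = reflₛ
 δ-pvs-other i zero (suc e) f ne = reflₛ
 δ-pvs-other i (suc k) (suc e) f ne = transₛ (δpₘ-other i k _ (λ eq → ne (P.cong suc eq))) (Lin.cong (pₘ k) (δ-pvs-other i (suc k) e f ne))

 δ-pvs-same : ∀ i e f → (δ i $ f) ≈ₛ 0ₛ → (δ i $ (pvs (suc i) e $ f)) ≈ₛ (nat e *ₛ (pvs (suc i) (ℕ.pred e) $ f))
 δ-pvs-same i zero f z = transₛ z (symₛ (*ₛ-zeroˡ f))
 δ-pvs-same i (suc e) f z = transₛ (δpₘ-same i _) (transₛ (+ₛ-congʳ (transₛ (Lin.cong (pₘ i) (δ-pvs-same i e f z)) (Lin.scal (pₘ i) (nat e) _)))
  (transₛ (+ₛ-congʳ (back e)) (pt λ w → solve 2 (λ n x → n :* x :+ x := (:1 :+ n) :* x) refl (nat e) (fn (pvs (suc i) e $ f) w))))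
  where
  back : ∀ e → (nat e *ₛ (pₘ i $ (pvs (suc i) (ℕ.pred e) $ f))) ≈ₛ (nat e *ₛ (pvs (suc i) e $ f))
  back zero = transₛ (*ₛ-zeroˡ _) (symₛ (*ₛ-zeroˡ _))
  back (suc e) = reflₛ

 δ-monoFrom-below : ∀ i k es → suc i ℕ.< k → (δ i $ monoFrom k es) ≈ₛ 0ₛ
 δ-monoFrom-below i k [] lt = δ-one i
 δ-monoFrom-below i k (e ∷ es) lt = transₛ (δ-pvs-other i k e _ (λ { P.refl → NP.<-irrefl P.refl lt })) (transₛ (Lin.cong (pvs k e) (δ-monoFrom-below i (suc k) es (NP.m<n⇒m<1+n lt))) (Lin.zer (pvs k e)))

 δ-monoFrom : ∀ i k j es → j ℕ.+ k ≡ suc i → (δ i $ monoFrom k es) ≈ₛ (nat (D.getAt es j) *ₛ monoFrom k (D.modAt ℕ.pred j es))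
 δ-monoFrom i k j [] eq = transₛ (δ-one i) (symₛ (*ₛ-zeroˡ _))
 δ-monoFrom i .(suc i) zero (e ∷ es) P.refl = δ-pvs-same i e _ (δ-monoFrom-below i (suc (suc i)) es (NP.n<1+n (suc i)))
 δ-monoFrom i k (suc j) (e ∷ es) eq = transₛ (δ-pvs-other i k e _ (λ { P.refl → NP.<-irrefl (P.sym eq) (ℕ.s≤s (NP.m≤n+m (suc i) j)) }))
  (transₛ (Lin.cong (pvs k e) (δ-monoFrom i (suc k) j es (P.trans (NP.+-suc j k) eq))) (Lin.scal (pvs k e) _ _))

 δ-monomial : ∀ i pe → (δ i $ monomial pe) ≈ₛ (nat (D.getAt pe (suc i)) *ₛ monomial (D.modAt ℕ.pred (suc i) pe))
 δ-monomial i pe = δ-monoFrom i 0 (suc i) pe (NP.+-identityʳ (suc i))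

 getAt-beyond : ∀ j es → length es ℕ.≤ j → D.getAt es j ≡ 0
 getAt-beyond j [] le = P.refl
 getAt-beyond (suc j) (e ∷ es) (ℕ.s≤s le) = getAt-beyond j es le

 Bounded : ℕ → El H → Set
 Bounded B F = ∀ i → B ℕ.≤ i → F i ≈ₛ 0ₛ

 S*-bounded : ∀ {B F} → Bounded (suc B) F → Bounded B (S* $ F)
 S*-bounded h i le = h (suc i) (ℕ.s≤s le)

 -- The catalytic operators are given as finite double sums up to a bound; with this decomposition
 -- A, B and N can be brought into the same form on bounded series.
 decompose : ∀ B F → Bounded B F → F ≈ₕ SH.sum (upTo B) (λ i → sing i $ F i)
 decompose zero F h = ptₙ λ i → h i ℕ.z≤n
 decompose (suc B) F h = transₕ (split F) (transₕ (+ₕ-congˡ (transₕ (Lin.cong S (decompose B (S* $ F) (S*-bounded h))) (transₕ (sum-Lin S (upTo B) (λ i → sing i $ F (suc i)))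
  (symₕ (SH.sum-map suc (upTo B) (λ i → sing i $ F i)))))) (reflexiveₕ (P.cong (λ l → SH.sum l (λ i → sing i $ F i)) (P.sym (upTo-suc B)))))

 Θ-finite : ∀ B F → Bounded (suc B) F → (Θ $ F) ≈ₛ SV.sum (upTo B) (λ j → pₘ j $ F (suc j))
 Θ-finite B F h = transₛ (Lin.cong Θ (transₕ (decompose (suc B) F h) (reflexiveₕ (P.cong (λ l → SH.sum l (λ i → sing i $ F i)) (upTo-suc B)))))
  (transₛ (sum-Lin Θ (0 ∷ map suc (upTo B)) (λ i → sing i $ F i)) (transₛ (+ₛ-cong (Θ-vac (F 0)) (SV.sum-map suc (upTo B) (λ i → Θ $ (sing i $ F i)))) (+ₛ-identityˡ _)))

 drop-bounded : ∀ i {B F} → Bounded B F → Bounded B (drop i F)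
 drop-bounded i h j le = h (i ℕ.+ j) (NP.≤-trans le (NP.m≤n+m j i))

 B-finite : ∀ B′ F → Bounded B′ F → (B $ F) ≈ₕ SH.sum (upTo B′) (λ i → sing i $ SV.sum (upTo B′) (λ j → pₘ j $ F (i ℕ.+ suc j)))
 B-finite B′ F h = transₕ (decompose B′ (B $ F) bd) (SH.sum-cong (upTo B′) (λ i → Lin.cong (sing i) (transₛ (Bfn-drop F i) (Θ-finite B′ (drop i F) (λ j le → drop-bounded i h j (NP.<⇒≤ le))))))
  where
  bd : Bounded B′ (B $ F)
  bd i le = transₛ (Bfn-drop F i) (transₛ (Lin.cong Θ (ptₙ λ j → h (i ℕ.+ j) (NP.≤-trans le (NP.m≤m+n i j)))) (Lin.zer Θ))

 A-sing : ∀ i g → (A $ (sing i $ g)) ≈ₕ (powˡ S i $ (a $ g))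
 A-sing zero g = A-vac g
 A-sing (suc i) g = transₕ (AS (sing i $ g)) (Lin.cong S (A-sing i g))

 powS-sing : ∀ i k f → (powˡ S i $ (sing k $ f)) ≈ₕ (sing (i ℕ.+ k) $ f)
 powS-sing zero k f = reflₕ
 powS-sing (suc i) k f = Lin.cong S (powS-sing i k f)

 a-finite : ∀ B′ g → (∀ j → B′ ℕ.≤ j → (δ j $ g) ≈ₛ 0ₛ) → (a $ g) ≈ₕ SH.sum (upTo B′) (λ j → sing (suc j) $ afn g (suc j))
 a-finite B′ g h = transₕ (decompose (suc B′) (a $ g) bd) (transₕ (reflexiveₕ (P.cong (λ l → SH.sum l (λ i → sing i $ afn g i)) (upTo-suc B′)))
  (transₕ (+ₕ-cong (Lin.zer (sing 0)) (SH.sum-map suc (upTo B′) (λ i → sing i $ afn g i))) (+ₕ-identityˡ _)))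
  where
  bd : Bounded (suc B′) (a $ g)
  bd (suc j) (ℕ.s≤s le) = transₛ (*ₛ-cong refl (h j le)) (*ₛ-zeroʳ _)

 A-finite : ∀ B′ F → Bounded B′ F → (∀ i j → B′ ℕ.≤ j → (δ j $ F i) ≈ₛ 0ₛ) →
  (A $ F) ≈ₕ SH.sum (upTo B′) (λ i → SH.sum (upTo B′) (λ j → sing (i ℕ.+ suc j) $ afn (F i) (suc j)))
 A-finite B′ F h hδ = transₕ (Lin.cong A (decompose B′ F h)) (transₕ (sum-Lin A (upTo B′) (λ i → sing i $ F i)) (SH.sum-cong (upTo B′) (λ i →
  transₕ (A-sing i (F i)) (transₕ (Lin.cong (powˡ S i) (a-finite B′ (F i) (hδ i))) (transₕ (sum-Lin (powˡ S i) (upTo B′) (λ j → sing (suc j) $ afn (F i) (suc j)))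
   (SH.sum-cong (upTo B′) (λ j → powS-sing i (suc j) (afn (F i) (suc j)))))))))

 N-finite : ∀ B′ F → Bounded B′ F → (N $ F) ≈ₕ SH.sum (upTo B′) (λ i → sing (suc i) $ (nat (suc i) *ₛ F (suc i)))
 N-finite B′ F h = transₕ (decompose (suc B′) (N $ F) (λ i le → transₛ (*ₛ-cong refl (h i (NP.<⇒≤ le))) (*ₛ-zeroʳ _)))
  (transₕ (reflexiveₕ (P.cong (λ l → SH.sum l (λ i → sing i $ (nat i *ₛ F i))) (upTo-suc B′)))
   (transₕ (+ₕ-cong (transₕ (Lin.cong (sing 0) (*ₛ-zeroˡ (F 0))) (Lin.zer (sing 0))) (SH.sum-map suc (upTo B′) (λ i → sing i $ (nat i *ₛ F i)))) (+ₕ-identityˡ _)))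

-- Degrees of formal polynomials.

module Terms (K : Scalars) where
 open D hiding (_≈_; size; pv; bnd; splits)
 open Linear K
 open Lax K
 open Series K hiding (P)
 open COperators K
 open Monomials K

 -- Formal coefficients are read in the abstract field through κ. It will be the identity, but here
 -- it keeps concrete fractions out of the calculations.
 record Coefficients : Set where
  field
    κ : Qα → Carrier
    κ-cong : ∀ {x y} → x D.≈ y → κ x ≈ κ y
    1≉0 : ¬ (1# ≈ 0#)
    κ-0 : κ 0q ≈ 0#
    κ-1 : κ 1q ≈ 1#
    κ-+ : ∀ x y → κ (x +q y) ≈ κ x + κ y
    κ-* : ∀ x y → κ (x *q y) ≈ κ x * κ y
    κ-neg : ∀ x → κ (-q x) ≈ - κ x
    κ-ℕ : ∀ n → κ (fromℕ n) ≈ nat n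
    κ-α : κ αq ≈ α
    κ-b : κ bq ≈ b
    κ-1+b : κ (1q +q bq) ≈ α
    κ-inv : κ inv1+b ≈ α⁻¹
    κ-recip : ∀ n → κ (recipSuc n) ≈ inv n

 Term : Set
 Term = Qα × Mono

 ysum : List ℕ → ℕ
 ysum [] = 0
 ysum (e ∷ es) = e ℕ.+ ysum es

 -- Meant for exponent vectors of total degree one in y, where it is the index of the only variable
 -- present.
 yidx : List ℕ → ℕ
 yidx [] = 0
 yidx (zero ∷ es) = suc (yidx es)
 yidx (suc _ ∷ es) = 0

 ysum-suc : ∀ k es → ysum (modAt suc k es) ≡ suc (ysum es)
 ysum-suc zero [] = P.refl
 ysum-suc zero (e ∷ es) = P.refl
 ysum-suc (suc k) [] = ysum-suc k []
 ysum-suc (suc k) (e ∷ es) = P.trans (P.cong (e ℕ.+_) (ysum-suc k es)) (NP.+-suc e _)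

 yidx-suc : ∀ k es → ysum es ≡ 0 → yidx (modAt suc k es) ≡ k
 yidx-suc zero [] h = P.refl
 yidx-suc zero (e ∷ es) h = P.refl
 yidx-suc (suc k) [] h = P.cong suc (yidx-suc k [] P.refl)
 yidx-suc (suc k) (zero ∷ es) h = P.cong suc (yidx-suc k es h)

 getAt-zero : ∀ i es → ysum es ≡ 0 → getAt es i ≡ 0
 getAt-zero i [] h = P.refl
 getAt-zero zero (zero ∷ es) h = P.refl
 getAt-zero (suc i) (zero ∷ es) h = getAt-zero i es h

 getAt-yidx : ∀ es → ysum es ≡ 1 → getAt es (yidx es) ≡ 1
 getAt-yidx (zero ∷ es) h = getAt-yidx es h
 getAt-yidx (suc zero ∷ es) h = P.refl

 getAt-off : ∀ i es → ysum es ≡ 1 → i ≢ yidx es → getAt es i ≡ 0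
 getAt-off i [] h ne = P.refl
 getAt-off zero (zero ∷ es) h ne = P.refl
 getAt-off (suc i) (zero ∷ es) h ne = getAt-off i es h (λ e → ne (P.cong suc e))
 getAt-off zero (suc zero ∷ es) h ne = contradiction P.refl ne
 getAt-off (suc i) (suc zero ∷ es) h ne = getAt-zero i es (P.cong ℕ.pred h)

 ysum-pred : ∀ i es → getAt es i ≢ 0 → suc (ysum (modAt ℕ.pred i es)) ≡ ysum es
 ysum-pred i [] ne = contradiction P.refl ne
 ysum-pred zero (zero ∷ es) ne = contradiction P.refl ne
 ysum-pred zero (suc e ∷ es) ne = P.refl
 ysum-pred (suc i) (e ∷ es) ne = P.trans (P.sym (NP.+-suc e _)) (P.cong (e ℕ.+_) (ysum-pred i es ne))

 pdegFrom : ℕ → List ℕ → ℕ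
 pdegFrom k [] = 0
 pdegFrom k (e ∷ es) = e ℕ.* k ℕ.+ pdegFrom (suc k) es

 pdeg : List ℕ → ℕ
 pdeg = pdegFrom 0

 pdegFrom-suc : ∀ k j es → pdegFrom k (modAt suc j es) ≡ (j ℕ.+ k) ℕ.+ pdegFrom k es
 pdegFrom-suc k zero [] = P.cong (ℕ._+ 0) (NP.*-identityˡ k)
 pdegFrom-suc k zero (e ∷ es) = NP.+-assoc k (e ℕ.* k) _
 pdegFrom-suc k (suc j) [] = P.trans (pdegFrom-suc (suc k) j []) (P.cong (ℕ._+ 0) (NP.+-suc j k))
 pdegFrom-suc k (suc j) (e ∷ es) = P.trans (P.cong (e ℕ.* k ℕ.+_) (P.trans (pdegFrom-suc (suc k) j es) (P.cong (ℕ._+ pdegFrom (suc k) es) (NP.+-suc j k))))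
  (P.trans (P.sym (NP.+-assoc (e ℕ.* k) (suc j ℕ.+ k) _)) (P.trans (P.cong (ℕ._+ pdegFrom (suc k) es) (NP.+-comm (e ℕ.* k) (suc j ℕ.+ k))) (NP.+-assoc (suc j ℕ.+ k) (e ℕ.* k) _)))

 pdeg-suc : ∀ j es → pdeg (modAt suc j es) ≡ j ℕ.+ pdeg es
 pdeg-suc j es = P.trans (pdegFrom-suc 0 j es) (P.cong (ℕ._+ pdeg es) (NP.+-identityʳ j))

 pdegFrom-pred : ∀ k j es → getAt es j ≢ 0 → (j ℕ.+ k) ℕ.+ pdegFrom k (modAt ℕ.pred j es) ≡ pdegFrom k es
 pdegFrom-pred k j [] ne = contradiction P.refl ne
 pdegFrom-pred k zero (zero ∷ es) ne = contradiction P.refl ne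
 pdegFrom-pred k zero (suc e ∷ es) ne = P.sym (NP.+-assoc k (e ℕ.* k) _)
 pdegFrom-pred k (suc j) (e ∷ es) ne = P.trans (P.sym (NP.+-assoc (suc j ℕ.+ k) (e ℕ.* k) _)) (P.trans (P.cong (ℕ._+ pdegFrom (suc k) (modAt ℕ.pred j es)) (NP.+-comm (suc j ℕ.+ k) (e ℕ.* k)))
  (P.trans (NP.+-assoc (e ℕ.* k) (suc j ℕ.+ k) _) (P.cong (e ℕ.* k ℕ.+_) (P.trans (P.cong (ℕ._+ pdegFrom (suc k) (modAt ℕ.pred j es)) (P.sym (NP.+-suc j k))) (pdegFrom-pred (suc k) j es ne)))))

 pdeg-pred : ∀ j es → getAt es j ≢ 0 → j ℕ.+ pdeg (modAt ℕ.pred j es) ≡ pdeg es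
 pdeg-pred j es ne = P.trans (P.cong (ℕ._+ pdeg (modAt ℕ.pred j es)) (P.sym (NP.+-identityʳ j))) (pdegFrom-pred 0 j es ne)

 -- Terms linear in y (resp. free of y), with their degrees recorded relative to the exponent of t.
 record Lin₁ (s d : ℕ) (t : Term) : Set where
  constructor lin₁
  field
    one-y : ysum (ye (proj₂ t)) ≡ 1
    deg₁ : (pdeg (pe (proj₂ t)) ℕ.+ yidx (ye (proj₂ t))) ℕ.+ s ≡ te (proj₂ t) ℕ.+ d
 open Lin₁ public

 record Free (s d : ℕ) (t : Term) : Set where
  constructor free
  field
    no-y : ysum (ye (proj₂ t)) ≡ 0
    deg₀ : pdeg (pe (proj₂ t)) ℕ.+ s ≡ te (proj₂ t) ℕ.+ d
 open Free public

 NoU : Term → Set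
 NoU t = ue (proj₂ t) ≡ 0

 scale-All : ∀ {P : Term → Set} c f → (∀ t → P t → P (c *q proj₁ t , proj₂ t)) → All P f → All P (scale c f)
 scale-All c [] h [] = []
 scale-All c (t ∷ f) h (p ∷ ps) = h t p ∷ scale-All c f h ps

 mulV-All : ∀ {P Q : Term → Set} v f → (∀ t → P t → Q (proj₁ t , modExp suc v (proj₂ t))) → All P f → All Q (mulV v f)
 mulV-All v [] h [] = []
 mulV-All v (t ∷ f) h (p ∷ ps) = h t p ∷ mulV-All v f h ps

 ∂-All : ∀ {P Q : Term → Set} v f → (∀ t → P t → expOf v (proj₂ t) ≢ 0 → Q (proj₁ t *q fromℕ (expOf v (proj₂ t)) , modExp ℕ.pred v (proj₂ t))) → All P f → All Q (∂ v f)
 ∂-All v [] h [] = []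
 ∂-All {Q = Q} v (t ∷ f) h (p ∷ ps) = AllP.++⁺ (pick (expOf v (proj₂ t) ℕ.≟ 0)) (∂-All v f h ps)
  where
  pick : (d : Dec (expOf v (proj₂ t) ≡ 0)) → All Q (if does d then [] else (proj₁ t *q fromℕ (expOf v (proj₂ t)) , modExp ℕ.pred v (proj₂ t)) ∷ [])
  pick (yes _) = []
  pick (no ne) = h t p ne ∷ []

 sumP-All : ∀ {P : Term → Set} {X : Set} (xs : List X) (g : X → Poly) → (∀ x → All P (g x)) → All P (sumP (map g xs))
 sumP-All [] g h = []
 sumP-All (x ∷ xs) g h = AllP.++⁺ (h x) (sumP-All xs g h)

 sumP²-All : ∀ {P : Term → Set} {X Y : Set} (xs : List X) (ys : X → List Y) (g : X → Y → Poly) → (∀ x y → All P (g x y)) → All P (sumP (concatMap (λ x → map (g x) (ys x)) xs))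
 sumP²-All xs ys g h = sumP-All′ (concatMap (λ x → map (g x) (ys x)) xs) (concat-All xs)
  where
  sumP-All′ : ∀ {P : Term → Set} ls → All (All P) ls → All P (sumP ls)
  sumP-All′ [] [] = []
  sumP-All′ (l ∷ ls) (p ∷ ps) = AllP.++⁺ p (sumP-All′ ls ps)
  map-All : ∀ x ys → All (All _) (map (g x) ys)
  map-All x [] = []
  map-All x (y ∷ ys) = h x y ∷ map-All x ys
  concat-All : ∀ xs → All (All _) (concatMap (λ x → map (g x) (ys x)) xs)
  concat-All [] = []
  concat-All (x ∷ xs) = AllP.++⁺ (map-All x (ys x)) (concat-All xs)

 mulY-All : ∀ k {s d} f → All (Free s d) f → All (Lin₁ s (k ℕ.+ d)) (mulV (yv k) f)
 mulY-All k {s} {d} f = mulV-All (yv k) f (λ { (c , mono pe ye ue te) (free n e) → lin₁ (P.trans (ysum-suc k ye) (P.cong suc n))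
  (P.trans (P.cong (λ i → (pdeg pe ℕ.+ i) ℕ.+ s) (yidx-suc k ye n)) (shuffle (pdeg pe) k te e)) })
  where
  shuffle : ∀ p k t → p ℕ.+ s ≡ t ℕ.+ d → (p ℕ.+ k) ℕ.+ s ≡ t ℕ.+ (k ℕ.+ d)
  shuffle p k t e = P.trans (P.cong (ℕ._+ s) (NP.+-comm p k)) (P.trans (NP.+-assoc k p s) (P.trans (P.cong (k ℕ.+_) e) (P.trans (P.sym (NP.+-assoc k t d)) (P.trans (P.cong (ℕ._+ d) (NP.+-comm k t)) (NP.+-assoc t k d)))))

 ∂Y-All : ∀ i {s d} f → All (Lin₁ s d) f → All (Free (i ℕ.+ s) d) (∂ (yv i) f)
 ∂Y-All i {s} {d} f = ∂-All (yv i) f (λ { (c , mono pe ye ue te) (lin₁ n e) ne → free (P.cong ℕ.pred (P.trans (ysum-pred i ye ne) n))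
  (P.trans (P.sym (NP.+-assoc (pdeg pe) i s)) (P.trans (P.cong (λ j → (pdeg pe ℕ.+ j) ℕ.+ s) (hit i ye n ne)) e)) })
  where
  hit : ∀ i ye → ysum ye ≡ 1 → getAt ye i ≢ 0 → i ≡ yidx ye
  hit i ye n ne with i ℕ.≟ yidx ye
  ... | yes e = e
  ... | no off = contradiction (getAt-off i ye n off) ne

 swap-in : ∀ j p q → j ℕ.+ (p ℕ.+ q) ≡ p ℕ.+ (j ℕ.+ q)
 swap-in j p q = P.trans (P.sym (NP.+-assoc j p q)) (P.trans (P.cong (ℕ._+ q) (NP.+-comm j p)) (NP.+-assoc p j q))

 mulP-All : ∀ j {s d} f → All (Free s d) f → All (Free s (j ℕ.+ d)) (mulV (D.pv j) f)
 mulP-All j {s} {d} f = mulV-All (D.pv j) f (λ { (c , mono pe ye ue te) (free n e) → free n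
  (P.trans (P.cong (ℕ._+ s) (pdeg-suc j pe)) (P.trans (NP.+-assoc j (pdeg pe) s) (P.trans (P.cong (j ℕ.+_) e) (swap-in j te d)))) })

 ∂P-All : ∀ j {s d} f → All (Lin₁ s d) f → All (Lin₁ (j ℕ.+ s) d) (∂ (D.pv j) f)
 ∂P-All j {s} {d} f = ∂-All (D.pv j) f (λ { (c , mono pe ye ue te) (lin₁ n e) ne → lin₁ n (P.trans
  (P.sym (swap-in j _ s)) (P.trans (P.sym (NP.+-assoc j _ s)) (P.trans (P.cong (ℕ._+ s) (P.trans (P.sym (NP.+-assoc j _ _)) (P.cong (ℕ._+ yidx ye) (pdeg-pred j pe ne)))) e))) })

 rescale₁ : ∀ {s d} c f → All (Lin₁ s d) f → All (Lin₁ s d) (scale c f)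
 rescale₁ c f = scale-All c f (λ t p → lin₁ (one-y p) (deg₁ p))

 cancel₁ : ∀ s {d} f → All (Lin₁ s (s ℕ.+ d)) f → All (Lin₁ 0 d) f
 cancel₁ s {d} f = All.map (λ {t} p → lin₁ (one-y p) (P.trans (NP.+-identityʳ _) (NP.+-cancelʳ-≡ s _ _ (P.trans (deg₁ p) (P.trans (P.cong (te (proj₂ t) ℕ.+_) (NP.+-comm s d)) (P.sym (NP.+-assoc (te (proj₂ t)) d s)))))))

 reindex₁ : ∀ {s s′ d d′ f} → s ≡ s′ → d ≡ d′ → All (Lin₁ s d) f → All (Lin₁ s′ d′) f
 reindex₁ P.refl P.refl h = h

 Y₊-All : ∀ {d} f → All (Lin₁ 0 d) f → All (Lin₁ 0 (suc d)) (Y₊ f)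
 Y₊-All {d} f h = sumP-All (upTo (D.bnd f)) _ (λ i → cancel₁ i _ (reindex₁ (NP.+-identityʳ i) (P.sym (NP.+-suc i d)) (mulY-All (suc i) (∂ (yv i) f) (∂Y-All i f h))))

 Γ-All : ∀ {d} f → All (Lin₁ 0 d) f → All (Lin₁ 0 (suc d)) (ΓY f)
 Γ-All {d} f h = AllP.++⁺ (rescale₁ (1q +q bq) _ (first Bd)) (AllP.++⁺ (second Bd) (rescale₁ bq _ (third Bd)))
  where
  Bd = D.bnd f
  first : ∀ Bd → All (Lin₁ 0 (suc d)) (sumP (concatMap (λ i → map (λ j → scale (fromℕ j) (mulV (yv (i ℕ.+ j)) (∂ (yv (i ℕ.∸ 1)) (∂ (D.pv j) f)))) (range1 Bd)) (range1 Bd)))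
  first Bd = P.subst (λ l → All (Lin₁ 0 (suc d)) (sumP l)) (P.sym (LP.concatMap-map (λ i → map (λ j → scale (fromℕ j) (mulV (yv (i ℕ.+ j)) (∂ (yv (i ℕ.∸ 1)) (∂ (D.pv j) f)))) (range1 Bd)) suc (upTo Bd)))
    (sumP²-All (upTo Bd) (λ _ → range1 Bd) _ (λ i j → rescale₁ (fromℕ j) _ (cancel₁ (i ℕ.+ j) _ (reindex₁ (P.cong (i ℕ.+_) (NP.+-identityʳ j)) (P.sym (NP.+-suc (i ℕ.+ j) d))
     (mulY-All (suc i ℕ.+ j) _ (∂Y-All i _ (∂P-All j f h)))))))
    where import Data.List.Properties as LP
  second : ∀ Bd → All (Lin₁ 0 (suc d)) (sumP (concatMap (λ i → map (λ j → mulV (yv i) (mulV (D.pv j) (∂ (yv (i ℕ.+ j ℕ.∸ 1)) f))) (range1 Bd)) (range1 Bd)))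
  second Bd = P.subst (λ l → All (Lin₁ 0 (suc d)) (sumP l)) (P.sym (LP.concatMap-map (λ i → map (λ j → mulV (yv i) (mulV (D.pv j) (∂ (yv (i ℕ.+ j ℕ.∸ 1)) f))) (range1 Bd)) suc (upTo Bd)))
    (sumP²-All (upTo Bd) (λ _ → range1 Bd) _ (λ i j → cancel₁ (i ℕ.+ j) _ (reindex₁ (NP.+-identityʳ (i ℕ.+ j)) (P.trans (P.sym (NP.+-assoc (suc i) j d)) (P.sym (NP.+-suc (i ℕ.+ j) d)))
     (mulY-All (suc i) _ (mulP-All j _ (∂Y-All (i ℕ.+ j) f h))))))
    where import Data.List.Properties as LP
  third : ∀ Bd → All (Lin₁ 0 (suc d)) (sumP (map (λ i → scale (fromℕ i) (mulV (yv (suc i)) (∂ (yv i) f))) (range1 Bd)))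
  third Bd = sumP-All (range1 Bd) _ (λ i → rescale₁ (fromℕ i) _ (cancel₁ i _ (reindex₁ (NP.+-identityʳ i) (P.sym (NP.+-suc i d)) (mulY-All (suc i) _ (∂Y-All i f h)))))

 step : Poly → Poly
 step g = ΓY g ++ mulV uv (Y₊ g)

 step-All : ∀ {d} f → All (Lin₁ 0 d) f → All (Lin₁ 0 (suc d)) (step f)
 step-All f h = AllP.++⁺ (Γ-All f h) (mulV-All uv (Y₊ f) (λ { (c , mono pe ye ue te) (lin₁ n e) → lin₁ n e }) (Y₊-All f h))

 iter-All : ∀ n {d} f → All (Lin₁ 0 d) f → All (Lin₁ 0 (n ℕ.+ d)) (iter n step f)
 iter-All zero f h = h
 iter-All (suc n) f h = step-All _ (iter-All n f h)

 seed : Poly → Poly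
 seed f = scale inv1+b (mulV (yv 0) f)

 seed-All : ∀ {d} f → All (Free 0 d) f → All (Lin₁ 0 d) (seed f)
 seed-All f h = rescale₁ inv1+b (mulV (yv 0) f) (mulY-All 0 f h)

 Θ-All : ∀ {d} f → All (Lin₁ 0 d) f → All (Free 0 d) (ΘY f)
 Θ-All {d} f h = sumP-All (range1 (D.bnd f)) _ (λ i → All.map (λ {t} p → free (no-y p) (P.trans (NP.+-identityʳ _) (NP.+-cancelʳ-≡ (i ℕ.+ 0) _ _ (P.trans (deg₀ p) (eq t i)))))
   (mulP-All i _ (∂Y-All i f h)))
  where
  eq : ∀ t i → te (proj₂ t) ℕ.+ (i ℕ.+ d) ≡ (te (proj₂ t) ℕ.+ d) ℕ.+ (i ℕ.+ 0)
  eq t i = P.trans (P.cong (te (proj₂ t) ℕ.+_) (P.trans (NP.+-comm i d) (P.cong (d ℕ.+_) (P.sym (NP.+-identityʳ i))))) (P.sym (NP.+-assoc (te (proj₂ t)) d _))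

 B-All : ∀ n {d} f → All (Free 0 d) f → All (Free 0 (n ℕ.+ d)) (Bop n f)
 B-All n f h = Θ-All _ (iter-All n _ (seed-All f h))

 -- The degree in p equals the exponent of t. This is what permits t = -1 without mixing
 -- coefficients.
 Good : Term → Set
 Good t = Free 0 0 t × NoU t

 coeffU-All : ∀ ℓ {d} f → All (Free 0 d) f → All (λ t → Free 0 d t × NoU t) (coeffU ℓ f)
 coeffU-All ℓ [] [] = []
 coeffU-All ℓ {d} ((c , mono pe ye ue te) ∷ f) (p ∷ ps) = AllP.++⁺ (pick (ue ℕ.≟ ℓ)) (coeffU-All ℓ f ps)
  where
  pick : (q : Dec (ue ≡ ℓ)) → All (λ t → Free 0 d t × NoU t) (if does q then (c , mono pe ye 0 te) ∷ [] else [])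
  pick (yes _) = (free (no-y p) (deg₀ p) , P.refl) ∷ []
  pick (no _) = []

 tpow-All : ∀ n {d} f → All (λ t → Free 0 (n ℕ.+ d) t × NoU t) f → All (λ t → Free 0 d t × NoU t) (iter n (mulV tv) f)
 tpow-All zero f h = h
 tpow-All (suc n) {d} f h = mulV-All tv _ (λ { (c , mono pe ye ue te) (free m e , u) → free m (P.trans e (NP.+-suc te d)) , u })
  (tpow-All n {suc d} f (All.map (λ {t} p → free (no-y (proj₁ p)) (P.trans (deg₀ (proj₁ p)) (P.cong (te (proj₂ t) ℕ.+_) (P.sym (NP.+-suc n d)))) , proj₂ p) h))

 C-All : ∀ N ℓ f → All Good f → All Good (Ctrunc N ℓ f)
 C-All N ℓ f h = sumP-All (range1 N) _ (λ n → scale-All (recipSuc (n ℕ.∸ 1)) (iter n (mulV tv) (coeffU ℓ (Bop n f))) (λ t p → free (no-y (proj₁ p)) (deg₀ (proj₁ p)) , proj₂ p) (tpow-All n {0} _ (coeffU-All ℓ (Bop n f) (B-All n f (All.map proj₁ h)))))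

 Aprod : ℕ → List ℕ → Poly
 Aprod N la = foldr (λ l g → scale (αq *q fromℕ l) (Ctrunc N l g)) onePoly la

 Aprod-All : ∀ N la → All Good (Aprod N la)
 Aprod-All N [] = (free P.refl P.refl , P.refl) ∷ []
 Aprod-All N (l ∷ la) = scale-All (αq *q fromℕ l) (Ctrunc N l (Aprod N la)) (λ t p → free (no-y (proj₁ p)) (deg₀ (proj₁ p)) , proj₂ p) (C-All N l (Aprod N la) (Aprod-All N la))

-- Evaluation of formal polynomials at t = -1.

module Interpretation (K : Scalars) (Q : Terms.Coefficients K) where
 open D hiding (_≈_; size; pv; bnd; splits)
 open Linear K
 open Lax K
 open Series K hiding (P)
 open COperators K
 open Tau K using (sing; sing-same; sing-below; sing-above)
 open Products K using (Avec)
 open Monomials K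
 open Terms K
 open Coefficients Q

 module SU = Sums Hᵤ

 sg : ∀ M → ℕ → Lin M (Seq M)
 sg M k = powˡ (SeqOps.S M) k ∘ˡ SeqOps.vac M

 lift-sg : ∀ {M N} (T : Lin M N) k x → LeftModule._≈ᴹ_ (Seq N) (lift T $ (sg M k $ x)) (sg N k $ (T $ x))
 lift-sg {M} {N} T zero x = ptₙ λ { zero → LeftModule.≈ᴹ-refl N ; (suc i) → Lin.zer T }
 lift-sg {M} {N} T (suc k) x = ptₙ λ { zero → Lin.zer T ; (suc i) → atₙ (lift-sg T k x) i }

 module Interpret (M : Space) (⟦_⟧ᵗ : Term → El M) where
  open LeftModule M
  open Sums M

  int : Poly → El M
  int f = sum f ⟦_⟧ᵗ

  int-sumP : ∀ {X : Set} (xs : List X) (g : X → Poly) → int (sumP (map g xs)) ≈ᴹ sum xs (λ x → int (g x))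
  int-sumP [] g = ≈ᴹ-refl
  int-sumP (x ∷ xs) g = ≈ᴹ-trans (sum-++ (g x) (sumP (map g xs)) ⟦_⟧ᵗ) (+ᴹ-congˡ (int-sumP xs g))

  sumP-++ : ∀ ls ms → sumP (ls ++ ms) ≡ sumP ls ++ sumP ms
  sumP-++ [] ms = P.refl
  sumP-++ (l ∷ ls) ms = P.trans (P.cong (l ++_) (sumP-++ ls ms)) (P.sym (LP.++-assoc l _ _))

  int-sumP² : ∀ {X Y : Set} (xs : List X) (ys : List Y) (g : X → Y → Poly) → int (sumP (concatMap (λ x → map (g x) ys) xs)) ≈ᴹ sum xs (λ x → sum ys (λ y → int (g x y)))
  int-sumP² [] ys g = ≈ᴹ-refl
  int-sumP² (x ∷ xs) ys g = ≈ᴹ-trans (≈ᴹ-reflexive (P.cong int (sumP-++ (map (g x) ys) _))) (≈ᴹ-trans (sum-++ (sumP (map (g x) ys)) _ ⟦_⟧ᵗ) (+ᴹ-cong (int-sumP ys (g x)) (int-sumP² xs ys g)))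

 sum-transport : ∀ {M N} (T : Lin M N) {P : Term → Set} {g : Term → El M} {h : Term → El N} f → All P f → (∀ t → P t → LeftModule._≈ᴹ_ N (h t) (T $ g t)) →
  LeftModule._≈ᴹ_ N (Sums.sum N f h) (T $ Sums.sum M f g)
 sum-transport {M} {N} T [] [] e = LeftModule.≈ᴹ-sym N (Lin.zer T)
 sum-transport {M} {N} T (t ∷ f) (p ∷ ps) e = LeftModule.≈ᴹ-trans N (LeftModule.+ᴹ-cong N (e t p) (sum-transport T f ps e)) (LeftModule.≈ᴹ-sym N (Lin.add T _ _))

 coef : Term → Carrier
 coef (c , m) = κ c * sgnK (te m)

 -- For terms free of y; the index of the sequence is the exponent of u here, whereas in `⟦_⟧₁ᵗ` the
 -- outer index is that of u and the inner one that of y.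
 ⟦_⟧₀ᵗ : Term → El H
 ⟦ t ⟧₀ᵗ = coef t *ₕ (sg V (ue (proj₂ t)) $ monomial (pe (proj₂ t)))

 ⟦_⟧₁ᵗ : Term → El Hᵤ
 ⟦ t ⟧₁ᵗ = coef t *ᵤ (sg H (ue (proj₂ t)) $ (sing (yidx (ye (proj₂ t))) $ monomial (pe (proj₂ t))))

 ⟪_⟫ᵗ : Term → Sym
 ⟪ t ⟫ᵗ = coef t *ₛ monomial (pe (proj₂ t))

 module I₀ = Interpret H ⟦_⟧₀ᵗ
 module I₁ = Interpret Hᵤ ⟦_⟧₁ᵗ
 module Iᵥ = Interpret V ⟪_⟫ᵗ

 ⟦_⟧₀ : Poly → El H
 ⟦_⟧₀ = I₀.int

 ⟦_⟧₁ : Poly → El Hᵤ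
 ⟦_⟧₁ = I₁.int

 ⟪_⟫ : Poly → Sym
 ⟪_⟫ = Iᵥ.int

 scal-scale : ∀ (M : Space) c (t : Term) x → LeftModule._≈ᴹ_ M (LeftModule._*ₗ_ M (coef (c *q proj₁ t , proj₂ t)) x) (LeftModule._*ₗ_ M (κ c) (LeftModule._*ₗ_ M (coef t) x))
 scal-scale M c (d , m) x = LeftModule.≈ᴹ-trans M (LeftModule.*ₗ-cong M (trans (*-congʳ (κ-* c d)) (*-assoc (κ c) (κ d) (sgnK (te m)))) (LeftModule.≈ᴹ-refl M {x})) (LeftModule.*ₗ-assoc M (κ c) (coef (d , m)) x)

 scale-int : ∀ (M : Space) (v : Mono → El M) c f → LeftModule._≈ᴹ_ M (Sums.sum M (scale c f) (λ t → LeftModule._*ₗ_ M (coef t) (v (proj₂ t)))) (LeftModule._*ₗ_ M (κ c) (Sums.sum M f (λ t → LeftModule._*ₗ_ M (coef t) (v (proj₂ t)))))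
 scale-int M v c f = M.≈ᴹ-trans (S.sum-map (λ e → c *q proj₁ e , proj₂ e) f (λ t → coef t M.*ₗ v (proj₂ t))) (M.≈ᴹ-trans (S.sum-cong f (λ t → scal-scale M c t (v (proj₂ t)))) (S.sum-scal (κ c) f (λ t → coef t M.*ₗ v (proj₂ t))))
  where
  module M = LeftModule M
  module S = Sums M

 Y1 Y0 : Term → Set
 Y1 t = ysum (ye (proj₂ t)) ≡ 1
 Y0 t = ysum (ye (proj₂ t)) ≡ 0

 mulY-int : ∀ k f → All Y0 f → ⟦ mulV (yv k) f ⟧₁ ≈ᵤ (lift (sing k) $ ⟦ f ⟧₀)
 mulY-int k f h = transᵤ (SU.sum-map _ f _) (sum-transport (lift (sing k)) f h term)
  where
  term : ∀ t → Y0 t → ⟦ proj₁ t , modExp suc (yv k) (proj₂ t) ⟧₁ᵗ ≈ᵤ (lift (sing k) $ ⟦ t ⟧₀ᵗ)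
  term (c , mono pe ye ue te) z = transᵤ (*ᵤ-cong refl (transᵤ (reflexiveᵤ (P.cong (λ i → sg H ue $ (sing i $ monomial pe)) (yidx-suc k ye z))) (symᵤ (lift-sg (sing k) ue (monomial pe)))))
   (symᵤ (Lin.scal (lift (sing k)) (κ c * sgnK te) (sg V ue $ monomial pe)))

 mulP-int : ∀ j f → ⟦ mulV (D.pv j) f ⟧₀ ≈ₕ (lift (pv j) $ ⟦ f ⟧₀)
 mulP-int j f = transₕ (SH.sum-map _ f _) (transₕ (SH.sum-cong f term) (symₕ (sum-Lin (lift (pv j)) f _)))
  where
  term : ∀ t → ⟦ proj₁ t , modExp suc (D.pv j) (proj₂ t) ⟧₀ᵗ ≈ₕ (lift (pv j) $ ⟦ t ⟧₀ᵗ)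
  term (c , mono pe ye ue te) = transₕ (*ₕ-cong refl (transₕ (Lin.cong (sg V ue) (monomial-suc j pe)) (symₕ (lift-sg (pv j) ue (monomial pe)))))
   (symₕ (Lin.scal (lift (pv j)) (κ c * sgnK te) (sg V ue $ monomial pe)))

 mulU-int : ∀ f → ⟦ mulV uv f ⟧₁ ≈ᵤ (U $ ⟦ f ⟧₁)
 mulU-int f = transᵤ (SU.sum-map _ f _) (transᵤ (SU.sum-cong f (λ { (c , mono pe ye ue te) → symᵤ (Lin.scal U (κ c * sgnK te) _) })) (symᵤ (sum-Lin U f _)))

 ∂-term : Var → Term → Poly
 ∂-term v t = if does (expOf v (proj₂ t) ℕ.≟ 0) then [] else (proj₁ t *q fromℕ (expOf v (proj₂ t)) , modExp ℕ.pred v (proj₂ t)) ∷ []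

 module _ {𝓜 𝓝 : Space} (v : Mono → El 𝓜) (w : Mono → El 𝓝) (T : Lin 𝓜 𝓝) (x : Var) where
  private
   module 𝓜 = LeftModule 𝓜
   module 𝓝 = LeftModule 𝓝
  ∂-int : {P : Term → Set} → (∀ t → P t → (T $ v (proj₂ t)) 𝓝.≈ᴹ (nat (expOf x (proj₂ t)) 𝓝.*ₗ w (modExp ℕ.pred x (proj₂ t)))) →
   (∀ m → te (modExp ℕ.pred x m) ≡ te m) →
   ∀ f → All P f → Sums.sum 𝓝 (∂ x f) (λ t → coef t 𝓝.*ₗ w (proj₂ t)) 𝓝.≈ᴹ (T $ Sums.sum 𝓜 f (λ t → coef t 𝓜.*ₗ v (proj₂ t)))
  ∂-int e te≡ f h = 𝓝.≈ᴹ-trans (Sums.sum-concatMap 𝓝 (∂-term x) f _) (sum-transport T f h (λ t p → 𝓝.≈ᴹ-trans (pick t (expOf x (proj₂ t) ℕ.≟ 0))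
    (𝓝.≈ᴹ-trans (𝓝.*ₗ-cong refl (𝓝.≈ᴹ-sym (e t p))) (𝓝.≈ᴹ-sym (Lin.scal T (coef t) (v (proj₂ t)))))))
   where
   pick : ∀ t (d : Dec (expOf x (proj₂ t) ≡ 0)) →
    Sums.sum 𝓝 (if does d then [] else (proj₁ t *q fromℕ (expOf x (proj₂ t)) , modExp ℕ.pred x (proj₂ t)) ∷ []) (λ t → coef t 𝓝.*ₗ w (proj₂ t))
     𝓝.≈ᴹ (coef t 𝓝.*ₗ (nat (expOf x (proj₂ t)) 𝓝.*ₗ w (modExp ℕ.pred x (proj₂ t))))
   pick t (yes z) = 𝓝.≈ᴹ-sym (𝓝.≈ᴹ-trans (𝓝.*ₗ-cong refl (𝓝.≈ᴹ-trans (𝓝.*ₗ-cong (reflexive (P.cong nat z)) 𝓝.≈ᴹ-refl) (𝓝.*ₗ-zeroˡ _))) (𝓝.*ₗ-zeroʳ _))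
   pick (c , m) (no _) = 𝓝.≈ᴹ-trans (𝓝.+ᴹ-identityʳ _) (𝓝.≈ᴹ-trans (𝓝.*ₗ-cong (trans (*-cong (trans (κ-* c (fromℕ (expOf x m))) (*-congˡ (κ-ℕ (expOf x m)))) (reflexive (P.cong sgnK (te≡ m))))
     (solve 3 (λ c n s → c :* n :* s := c :* s :* n) refl (κ c) (nat (expOf x m)) (sgnK (te m)))) 𝓝.≈ᴹ-refl) (𝓝.*ₗ-assoc _ _ _))

 nat1 : nat 1 ≈ 1#
 nat1 = +-identityʳ 1#

 ∂Y-term : ∀ i pe ye → ysum ye ≡ 1 → (sing (yidx ye) $ monomial pe) i ≈ₛ (nat (getAt ye i) *ₛ monomial pe)
 ∂Y-term i pe ye y1 with i ℕ.≟ yidx ye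
 ... | yes P.refl = transₛ (sing-same (yidx ye) (monomial pe)) (symₛ (transₛ (*ₛ-cong (trans (reflexive (P.cong nat (getAt-yidx ye y1))) nat1) reflₛ) (*ₛ-identityˡ _)))
 ... | no ne = transₛ (off (NP.<-cmp i (yidx ye))) (symₛ (transₛ (*ₛ-cong (reflexive (P.cong nat (getAt-off i ye y1 ne))) reflₛ) (*ₛ-zeroˡ _)))
  where
  open import Relation.Binary.Definitions using (Tri; tri<; tri≈; tri>)
  off : Tri (i ℕ.< yidx ye) (i ≡ yidx ye) (yidx ye ℕ.< i) → (sing (yidx ye) $ monomial pe) i ≈ₛ 0ₛ
  off (tri< lt _ _) = sing-below (yidx ye) i (monomial pe) lt
  off (tri≈ _ eq _) = contradiction eq ne
  off (tri> _ _ gt) = sing-above (yidx ye) i (monomial pe) gt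

 vec₀ : Mono → El H
 vec₀ m = sg V (ue m) $ monomial (pe m)

 vec₁ : Mono → El Hᵤ
 vec₁ m = sg H (ue m) $ (sing (yidx (ye m)) $ monomial (pe m))

 ∂Y-vec : ∀ i m → ysum (ye m) ≡ 1 → (lift (comp i) $ vec₁ m) ≈ₕ (nat (getAt (ye m) i) *ₕ vec₀ m)
 ∂Y-vec i (mono pe ye ue te) y1 = transₕ (lift-sg (comp i) ue _) (transₕ (Lin.cong (sg V ue) (∂Y-term i pe ye y1)) (Lin.scal (sg V ue) _ _))

 ∂Y-int : ∀ i f → All Y1 f → ⟦ ∂ (yv i) f ⟧₀ ≈ₕ (lift (comp i) $ ⟦ f ⟧₁)
 ∂Y-int i = ∂-int vec₁ vec₀ (lift (comp i)) (yv i) (λ { (c , m) p → ∂Y-vec i m p }) (λ m → P.refl)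

 ∂P-vec : ∀ j m → (lift (lift (δ j)) $ vec₁ m) ≈ᵤ (nat (getAt (pe m) (suc j)) *ᵤ vec₁ (modExp ℕ.pred (D.pv (suc j)) m))
 ∂P-vec j (mono pe ye ue te) = transᵤ (lift-sg (lift (δ j)) ue _) (transᵤ (Lin.cong (sg H ue) (transₕ (lift-sg (δ j) (yidx ye) (monomial pe))
  (transₕ (Lin.cong (sing (yidx ye)) (δ-monomial j pe)) (Lin.scal (sing (yidx ye)) _ _)))) (Lin.scal (sg H ue) _ _))

 ∂P-int : ∀ j f → All Y1 f → ⟦ ∂ (D.pv (suc j)) f ⟧₁ ≈ᵤ (lift (lift (δ j)) $ ⟦ f ⟧₁)
 ∂P-int j = ∂-int vec₁ vec₁ (lift (lift (δ j))) (D.pv (suc j)) (λ { (c , m) p → ∂P-vec j m }) (λ m → P.refl)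

 Short : ℕ → Term → Set
 Short B t = length (pe (proj₂ t)) ℕ.+ length (ye (proj₂ t)) ℕ.≤ B

 short : ∀ f → All (Short (D.bnd f)) f
 short f = go f NP.≤-refl
  where
  go : ∀ g {B} → sumℕ (map (λ e → length (pe (proj₂ e)) ℕ.+ length (ye (proj₂ e))) g) ℕ.≤ B → All (Short (suc B)) g
  go [] le = []
  go (t ∷ g) le = NP.≤-trans (NP.m≤m+n _ _) (NP.≤-trans le (NP.n≤1+n _)) ∷ go g (NP.≤-trans (NP.m≤n+m _ (length (pe (proj₂ t)) ℕ.+ length (ye (proj₂ t)))) le)

 -- The bound exceeds the length of every exponent vector of f, so the finite sums over indices
 -- below it exhaust the action of the operators.
 bounded : ∀ f → All Y1 f → ∀ i → D.bnd f ℕ.≤ i → (lift (comp i) $ ⟦ f ⟧₁) ≈ₕ 0ₕ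
 bounded f h i le = transₕ (symₕ (sum-transport (lift (comp i)) {λ t → Y1 t × Short (D.bnd f) t} {⟦_⟧₁ᵗ} {λ _ → 0ₕ} f (All.zip (h , short f)) zero-term)) (SH.sum-zero f (λ _ → reflₕ))
  where
  zero-term : ∀ t → Y1 t × Short (D.bnd f) t → 0ₕ ≈ₕ (lift (comp i) $ ⟦ t ⟧₁ᵗ)
  zero-term (c , m) (y , s) = symₕ (transₕ (Lin.scal (lift (comp i)) (coef (c , m)) (vec₁ m)) (transₕ (*ₕ-cong refl (transₕ (∂Y-vec i m y)
   (transₕ (*ₕ-cong (reflexive (P.cong nat (getAt-beyond i (ye m) (NP.≤-trans (NP.m≤n+m _ (length (pe m))) (NP.≤-trans s le))))) reflₕ) (*ₕ-zeroˡ _)))) (*ₕ-zeroʳ _)))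

 boundedδ : ∀ f → All Y1 f → ∀ j → D.bnd f ℕ.≤ j → (lift (lift (δ j)) $ ⟦ f ⟧₁) ≈ᵤ 0ᵤ
 boundedδ f h j le = transᵤ (symᵤ (sum-transport (lift (lift (δ j))) {Short (D.bnd f)} {⟦_⟧₁ᵗ} {λ _ → 0ᵤ} f (short f) zero-term)) (SU.sum-zero f (λ _ → reflᵤ))
  where
  zero-term : ∀ t → Short (D.bnd f) t → 0ᵤ ≈ᵤ (lift (lift (δ j)) $ ⟦ t ⟧₁ᵗ)
  zero-term (c , m) s = symᵤ (transᵤ (Lin.scal (lift (lift (δ j))) (coef (c , m)) (vec₁ m)) (transᵤ (*ᵤ-cong refl (transᵤ (∂P-vec j m)
   (transᵤ (*ᵤ-cong (reflexive (P.cong nat (getAt-beyond (suc j) (pe m) (NP.≤-trans (NP.m≤m+n _ (length (ye m))) (NP.≤-trans s (NP.≤-trans le (NP.n≤1+n j))))))) reflᵤ) (*ᵤ-zeroˡ _)))) (*ᵤ-zeroʳ _)))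

 slice : ∀ {X : Set} (xs : List X) (g : X → El Hᵤ) e → SU.sum xs g e ≡ SH.sum xs (λ x → g x e)
 slice [] g e = P.refl
 slice (x ∷ xs) g e = P.cong (g x e +ₕ_) (slice xs g e)

 sliceᵥ : ∀ {X : Set} (xs : List X) (g : X → El H) e → SH.sum xs g e ≡ SV.sum xs (λ x → g x e)
 sliceᵥ [] g e = P.refl
 sliceᵥ (x ∷ xs) g e = P.cong (g x e +ₛ_) (sliceᵥ xs g e)

 ∂Y-Y0 : ∀ i f → All Y1 f → All Y0 (∂ (yv i) f)
 ∂Y-Y0 i f = ∂-All (yv i) f (λ { (c , mono pe ye ue te) n ne → P.cong ℕ.pred (P.trans (ysum-pred i ye ne) n) })

 ∂P-Y1 : ∀ j f → All Y1 f → All Y1 (∂ (D.pv j) f)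
 ∂P-Y1 j f = ∂-All (D.pv j) f (λ t p ne → p)

 mulP-Y0 : ∀ j f → All Y0 f → All Y0 (mulV (D.pv j) f)
 mulP-Y0 j f = mulV-All (D.pv j) f (λ t p → p)

 Y₊-int : ∀ f → All Y1 f → ⟦ Y₊ f ⟧₁ ≈ᵤ (lift S $ ⟦ f ⟧₁)
 Y₊-int f h = transᵤ (I₁.int-sumP (upTo (D.bnd f)) (λ i → mulV (yv (suc i)) (∂ (yv i) f))) (transᵤ (SU.sum-cong (upTo (D.bnd f)) (λ i →
   transᵤ (mulY-int (suc i) (∂ (yv i) f) (∂Y-Y0 i f h)) (Lin.cong (lift (sing (suc i))) (∂Y-int i f h))))
  (ptₙ λ e → transₕ (reflexiveₕ (slice (upTo (D.bnd f)) _ e)) (symₕ (transₕ (Lin.cong S (decompose (D.bnd f) (⟦ f ⟧₁ e) (λ i le → atₙ (bounded f h i le) e))) (sum-Lin S (upTo (D.bnd f)) _)))))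

 module _ (f : Poly) (h : All Y1 f) where
  private
   B′ = D.bnd f
   r = upTo B′
   F : ℕ → El H
   F e = ⟦ f ⟧₁ e
   G₁ G₂ G₃ : Poly
   G₁ = sumP (concatMap (λ i → map (λ j → scale (fromℕ j) (mulV (yv (i ℕ.+ j)) (∂ (yv (i ℕ.∸ 1)) (∂ (D.pv j) f)))) (range1 B′)) (range1 B′))
   G₂ = sumP (concatMap (λ i → map (λ j → mulV (yv i) (mulV (D.pv j) (∂ (yv (i ℕ.+ j ℕ.∸ 1)) f))) (range1 B′)) (range1 B′))
   G₃ = sumP (map (λ i → scale (fromℕ i) (mulV (yv (suc i)) (∂ (yv i) f))) (range1 B′))

  Γ-first : ⟦ G₁ ⟧₁
   ≈ᵤ SU.sum r (λ i → SU.sum r (λ j → nat (suc j) *ᵤ (lift (sing (suc i ℕ.+ suc j)) $ (lift (comp i) $ (lift (lift (δ j)) $ ⟦ f ⟧₁)))))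
  Γ-first = transᵤ (I₁.int-sumP² (range1 B′) (range1 B′) (λ i j → scale (fromℕ j) (mulV (yv (i ℕ.+ j)) (∂ (yv (i ℕ.∸ 1)) (∂ (D.pv j) f)))))
   (transᵤ (SU.sum-map suc r _) (SU.sum-cong r (λ i → transᵤ (SU.sum-map suc r _) (SU.sum-cong r (λ j →
    transᵤ (scale-int Hᵤ vec₁ (fromℕ (suc j)) (mulV (yv (suc i ℕ.+ suc j)) (∂ (yv i) (∂ (D.pv (suc j)) f)))) (*ᵤ-cong (κ-ℕ (suc j))
     (transᵤ (mulY-int (suc i ℕ.+ suc j) (∂ (yv i) (∂ (D.pv (suc j)) f)) (∂Y-Y0 i (∂ (D.pv (suc j)) f) (∂P-Y1 (suc j) f h)))
      (Lin.cong (lift (sing (suc i ℕ.+ suc j))) (transₕ (∂Y-int i (∂ (D.pv (suc j)) f) (∂P-Y1 (suc j) f h)) (Lin.cong (lift (comp i)) (∂P-int j f h)))))))))))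

  Γ-second : ⟦ G₂ ⟧₁
   ≈ᵤ SU.sum r (λ i → SU.sum r (λ j → lift (sing (suc i)) $ (lift (pₘ j) $ (lift (comp (i ℕ.+ suc j)) $ ⟦ f ⟧₁))))
  Γ-second = transᵤ (I₁.int-sumP² (range1 B′) (range1 B′) (λ i j → mulV (yv i) (mulV (D.pv j) (∂ (yv (i ℕ.+ j ℕ.∸ 1)) f))))
   (transᵤ (SU.sum-map suc r _) (SU.sum-cong r (λ i → transᵤ (SU.sum-map suc r _) (SU.sum-cong r (λ j →
    transᵤ (mulY-int (suc i) (mulV (D.pv (suc j)) (∂ (yv (i ℕ.+ suc j)) f)) (mulP-Y0 (suc j) (∂ (yv (i ℕ.+ suc j)) f) (∂Y-Y0 (i ℕ.+ suc j) f h)))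
     (Lin.cong (lift (sing (suc i))) (transₕ (mulP-int (suc j) (∂ (yv (i ℕ.+ suc j)) f)) (Lin.cong (lift (pₘ j)) (∂Y-int (i ℕ.+ suc j) f h)))))))))

  Γ-third : ⟦ G₃ ⟧₁
   ≈ᵤ SU.sum r (λ i → nat (suc i) *ᵤ (lift (sing (suc (suc i))) $ (lift (comp (suc i)) $ ⟦ f ⟧₁)))
  Γ-third = transᵤ (I₁.int-sumP (range1 B′) (λ i → scale (fromℕ i) (mulV (yv (suc i)) (∂ (yv i) f))))
   (transᵤ (SU.sum-map suc r _) (SU.sum-cong r (λ i →
    transᵤ (scale-int Hᵤ vec₁ (fromℕ (suc i)) (mulV (yv (suc (suc i))) (∂ (yv (suc i)) f))) (*ᵤ-cong (κ-ℕ (suc i))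
     (transᵤ (mulY-int (suc (suc i)) (∂ (yv (suc i)) f) (∂Y-Y0 (suc i) f h)) (Lin.cong (lift (sing (suc (suc i)))) (∂Y-int (suc i) f h)))))))

  private
   bd : ∀ e → Bounded B′ (F e)
   bd e i le = atₙ (bounded f h i le) e

  slice² : (g : ℕ → ℕ → El Hᵤ) → ∀ e → SU.sum r (λ i → SU.sum r (g i)) e ≈ₕ SH.sum r (λ i → SH.sum r (λ j → g i j e))
  slice² g e = transₕ (reflexiveₕ (slice r _ e)) (SH.sum-cong r (λ i → reflexiveₕ (slice r (g i) e)))

  first-slice : ∀ e → (α *ₕ SU.sum r (λ i → SU.sum r (λ j → nat (suc j) *ᵤ (lift (sing (suc i ℕ.+ suc j)) $ (lift (comp i) $ (lift (lift (δ j)) $ ⟦ f ⟧₁))))) e) ≈ₕ (S $ (A $ F e))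
  first-slice e = transₕ (*ₕ-cong refl (slice² _ e)) (transₕ (symₕ (SH.sum-scal α r _)) (symₕ (transₕ (Lin.cong S (A-finite B′ (F e) (bd e) (λ i j le → atₙ (atₙ (boundedδ f h j le) e) i)))
   (transₕ (sum-Lin S r _) (SH.sum-cong r (λ i → transₕ (sum-Lin S r _) (transₕ (SH.sum-cong r (λ j → transₕ (Lin.scal (sing (suc i ℕ.+ suc j)) (α * nat (suc j)) (δ j $ F e i)) (*ₕ-assoc α (nat (suc j)) _)))
    (SH.sum-scal α r _))))))))

  second-slice : ∀ e → (SU.sum r (λ i → SU.sum r (λ j → lift (sing (suc i)) $ (lift (pₘ j) $ (lift (comp (i ℕ.+ suc j)) $ ⟦ f ⟧₁)))) e) ≈ₕ (S $ (B $ F e))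
  second-slice e = transₕ (slice² _ e) (symₕ (transₕ (Lin.cong S (B-finite B′ (F e) (bd e))) (transₕ (sum-Lin S r _) (SH.sum-cong r (λ i → sum-Lin (sing (suc i)) r _)))))

  third-slice : ∀ e → (SU.sum r (λ i → nat (suc i) *ᵤ (lift (sing (suc (suc i))) $ (lift (comp (suc i)) $ ⟦ f ⟧₁))) e) ≈ₕ (S $ (N $ F e))
  third-slice e = transₕ (reflexiveₕ (slice r _ e)) (symₕ (transₕ (Lin.cong S (N-finite B′ (F e) (bd e))) (transₕ (sum-Lin S r _) (SH.sum-cong r (λ i → Lin.scal (sing (suc (suc i))) (nat (suc i)) (F e (suc i)))))))

  -- The three sums of Γ_Y are y times A, B and b N. The definition of A contains the factor α,
  -- which the first sum supplies as 1 + b.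
  Γ-int : ⟦ ΓY f ⟧₁ ≈ᵤ (lift S $ (lift L $ ⟦ f ⟧₁))
  Γ-int = transᵤ (SU.sum-++ (scale (1q +q bq) G₁) (G₂ ++ scale bq G₃) ⟦_⟧₁ᵗ) (transᵤ
   (+ᵤ-cong (transᵤ (scale-int Hᵤ vec₁ (1q +q bq) G₁) (*ᵤ-cong κ-1+b Γ-first))
    (transᵤ (SU.sum-++ G₂ (scale bq G₃) ⟦_⟧₁ᵗ)
     (+ᵤ-cong Γ-second (transᵤ (scale-int Hᵤ vec₁ bq G₃) (*ᵤ-cong κ-b Γ-third)))))
   (ptₙ λ e → transₕ (+ₕ-cong (first-slice e) (+ₕ-cong (second-slice e) (*ₕ-cong refl (third-slice e))))
    (symₕ (transₕ (Lin.add S ((A $ F e) +ₕ (B $ F e)) (b *ₕ (N $ F e))) (transₕ (+ₕ-cong (Lin.add S (A $ F e) (B $ F e)) (Lin.scal S b (N $ F e))) (+ₕ-assoc _ _ _))))))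

  step-int : ⟦ step f ⟧₁ ≈ᵤ (W.X $ ⟦ f ⟧₁)
  step-int = transᵤ (SU.sum-++ (ΓY f) (mulV uv (Y₊ f)) ⟦_⟧₁ᵗ) (transᵤ (+ᵤ-cong Γ-int
    (transᵤ (mulU-int (Y₊ f)) (transᵤ (Lin.cong U (Y₊-int f h)) (symᵤ (lift-U S ⟦ f ⟧₁)))))
   (symᵤ (Lin.add (lift S) (lift L $ ⟦ f ⟧₁) (U $ ⟦ f ⟧₁))))

  Θ-int : ⟦ ΘY f ⟧₀ ≈ₕ (lift Θ $ ⟦ f ⟧₁)
  Θ-int = transₕ (I₀.int-sumP (range1 B′) (λ i → mulV (D.pv i) (∂ (yv i) f))) (transₕ (SH.sum-map suc r _) (transₕ (SH.sum-cong r (λ j →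
    transₕ (mulP-int (suc j) (∂ (yv (suc j)) f)) (Lin.cong (lift (pₘ j)) (∂Y-int (suc j) f h))))
   (ptₙ λ e → transₛ (reflexiveₛ (sliceᵥ r _ e)) (symₛ (Θ-finite B′ (F e) (λ i le → bd e i (NP.<⇒≤ le)))))))

 Lin⇒Y1 : ∀ {s d f} → All (Lin₁ s d) f → All Y1 f
 Lin⇒Y1 = All.map one-y

 iter-int : ∀ n {d} f → All (Lin₁ 0 d) f → ⟦ iter n step f ⟧₁ ≈ᵤ (N.pow W.X n $ ⟦ f ⟧₁)
 iter-int zero f h = reflᵤ
 iter-int (suc n) f h = transᵤ (step-int (iter n step f) (Lin⇒Y1 (iter-All n f h))) (Lin.cong W.X (iter-int n f h))

 seed-int : ∀ f → All Good f → ⟦ seed f ⟧₁ ≈ᵤ (α⁻¹ *ᵤ (ι $ ⟪ f ⟫))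
 seed-int f h = transᵤ (scale-int Hᵤ vec₁ inv1+b (mulV (yv 0) f)) (*ᵤ-cong κ-inv (transᵤ (mulY-int 0 f (All.map (λ p → no-y (proj₁ p)) h))
  (transᵤ (Lin.cong (lift vac) (sum-transport vac f h (λ { (c , mono pe ye .0 te) (_ , P.refl) → symₕ (Lin.scal vac (κ c * sgnK te) (monomial pe)) })))
   (lift-sg vac 0 ⟪ f ⟫))))

 coeffU-int : ∀ ℓ f → ⟪ coeffU ℓ f ⟫ ≈ₛ ⟦ f ⟧₀ ℓ
 coeffU-int ℓ f = transₛ (SV.sum-concatMap _ f ⟪_⟫ᵗ) (transₛ (SV.sum-cong f (λ { (c , mono pe ye ue te) → pick c pe ye ue te (ue ℕ.≟ ℓ) })) (reflexiveₛ (P.sym (sliceᵥ f ⟦_⟧₀ᵗ ℓ))))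
  where
  open import Relation.Binary.Definitions using (Tri; tri<; tri≈; tri>)
  off : ∀ ue m → ue ≢ ℓ → Tri (ℓ ℕ.< ue) (ℓ ≡ ue) (ue ℕ.< ℓ) → (sing ue $ m) ℓ ≈ₛ 0ₛ
  off ue m ne (tri< lt _ _) = sing-below ue ℓ m lt
  off ue m ne (tri≈ _ eq _) = contradiction (P.sym eq) ne
  off ue m ne (tri> _ _ gt) = sing-above ue ℓ m gt
  pick : ∀ c pe ye ue te (d : Dec (ue ≡ ℓ)) → SV.sum (if does d then (c , mono pe ye 0 te) ∷ [] else []) ⟪_⟫ᵗ ≈ₛ ⟦ c , mono pe ye ue te ⟧₀ᵗ ℓ
  pick c pe ye ue te (yes P.refl) = transₛ (+ₛ-identityʳ _) (*ₛ-cong refl (symₛ (sing-same ue (monomial pe))))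
  pick c pe ye ue te (no ne) = symₛ (transₛ (*ₛ-cong refl (off ue (monomial pe) ne (NP.<-cmp ℓ ue))) (*ₛ-zeroʳ _))

 tpow-int : ∀ n f → ⟪ iter n (mulV tv) f ⟫ ≈ₛ (sgnK n *ₛ ⟪ f ⟫)
 tpow-int zero f = symₛ (*ₛ-identityˡ _)
 tpow-int (suc n) f = transₛ (SV.sum-map _ g ⟪_⟫ᵗ) (transₛ (SV.sum-cong g (λ { (c , mono pe ye ue te) → pt λ w → solve 3 (λ c s x → c :* (:- s) :* x := (:- :1) :* (c :* s :* x)) refl (κ c) (sgnK te) (fn (monomial pe) w) }))
  (transₛ (SV.sum-scal (- 1#) g ⟪_⟫ᵗ) (transₛ (*ₛ-cong refl (tpow-int n f)) (pt λ w → solve 2 (λ s x → (:- :1) :* (s :* x) := (:- s) :* x) refl (sgnK n) (fn ⟪ f ⟫ w)))))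
  where g = iter n (mulV tv) f

 B-int : ∀ n ℓ f → All Good f → ⟪ coeffU ℓ (Bop (suc n) f) ⟫ ≈ₛ (β n ℓ $ ⟪ f ⟫)
 B-int n ℓ f h = transₛ (coeffU-int ℓ (Bop (suc n) f)) (transₛ (atₙ (Θ-int (iter (suc n) step (seed f)) (Lin⇒Y1 (iter-All (suc n) (seed f) sd))) ℓ)
  (transₛ (Lin.cong Θ (atₙ (transᵤ (iter-int (suc n) (seed f) sd) (transᵤ (Lin.cong (N.pow W.X (suc n)) (seed-int f h)) (Lin.scal (N.pow W.X (suc n)) α⁻¹ (ι $ ⟪ f ⟫)))) ℓ))
   (Lin.scal Θ α⁻¹ ((Xᵏ (suc n) $ ⟪ f ⟫) ℓ))))
  where
  sd : All (Lin₁ 0 0) (seed f)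
  sd = seed-All f (All.map proj₁ h)

 C-int : ∀ M ℓ f → All Good f → ⟪ Ctrunc M ℓ f ⟫ ≈ₛ (Cᵗ M ℓ $ ⟪ f ⟫)
 C-int M ℓ f h = transₛ (Iᵥ.int-sumP (range1 M) _) (transₛ (SV.sum-map suc (upTo M) _) (transₛ (SV.sum-cong (upTo M) (λ m →
   transₛ (scale-int V (λ m → monomial (pe m)) (recipSuc m) (iter (suc m) (mulV tv) (coeffU ℓ (Bop (suc m) f))))
    (transₛ (*ₛ-cong (κ-recip m) (transₛ (tpow-int (suc m) (coeffU ℓ (Bop (suc m) f))) (*ₛ-cong refl (B-int m ℓ f h))))
     (transₛ (symₛ (*ₛ-assoc _ _ _)) (*ₛ-cong (*-comm _ _) reflₛ)))))
  (collect M)))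
  where
  term : ℕ → Sym
  term m = (sgnK (suc m) * inv m) *ₛ (β m ℓ $ ⟪ f ⟫)
  collect : ∀ M → SV.sum (upTo M) term ≈ₛ (Cᵗ M ℓ $ ⟪ f ⟫)
  collect zero = reflₛ
  collect (suc M) = transₛ (reflexiveₛ (P.cong (λ l → SV.sum l term) (P.sym (LP.upTo-∷ʳ M)))) (transₛ (SV.sum-++ (upTo M) (M ∷ []) term) (+ₛ-cong (collect M) (+ₛ-identityʳ _)))

 -- Each C_ℓ raises the degree, so below weight M neither the truncation of the last factor nor that
 -- of the earlier ones is visible.
 Aprod-int : ∀ M la w → wt w ℕ.≤ M → fn ⟪ Aprod M la ⟫ w ≈ fn (Avec la) w
 Aprod-int M [] w le = trans (+-identityʳ _) (trans (*-congʳ (trans (*-identityʳ _) κ-1)) (*-identityˡ _))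
 Aprod-int M (l ∷ la) w le = trans (at (scale-int V (λ m → monomial (pe m)) (αq *q fromℕ l) (Ctrunc M l (Aprod M la))) w)
  (*-cong (trans (κ-* αq (fromℕ l)) (*-cong κ-α (κ-ℕ l))) (trans (at (C-int M l (Aprod M la) (Aprod-All M la)) w) (trans (sym (C-agree M l ⟪ Aprod M la ⟫ w le))
   (local {suc M} {suc M} (C l) (λ {f} fl → filₛ-≤ (NP.m≤n+m (suc M) l) (C-fil l fl)) (λ v lt → Aprod-int M la v (NP.≤-pred lt)) w (ℕ.s≤s le)))))

-- The coefficients a^λ_ξ as values of A^λ.

module Extraction (K : Scalars) (Q : Terms.Coefficients K) where
 open D hiding (_≈_; size; pv; bnd; splits)
 open Linear K
 open Lax K
 open Series K hiding (P)
 open COperators K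
 open Triangularity K using (size)
 open Products K using (one; Avec; Avec-fil)
 open Expansion K using (sgn²)
 open Monomials K
 open Terms K
 open Coefficients Q
 open Interpretation K Q
 open import Relation.Nullary using (proof; Reflects; ofʸ; ofⁿ; _×-reflects_)
 open import Relation.Binary.Definitions using (tri<; tri≈; tri>)

 size≡ : ∀ la → D.size la ≡ size la
 size≡ [] = P.refl
 size≡ (x ∷ la) = P.cong (x ℕ.+_) (size≡ la)

 mult-here : ∀ x xs → mult x (x ∷ xs) ≡ suc (mult x xs)
 mult-here x xs = pick (x ℕ.≟ x)
  where
  pick : (d : Dec (x ≡ x)) → (if does d then suc (mult x xs) else mult x xs) ≡ suc (mult x xs)
  pick (yes _) = P.refl
  pick (no ne) = contradiction P.refl ne

 mult-there : ∀ {i x} xs → x ≢ i → mult i (x ∷ xs) ≡ mult i xs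
 mult-there {i} {x} xs ne = pick (x ℕ.≟ i)
  where
  pick : (d : Dec (x ≡ i)) → (if does d then suc (mult i xs) else mult i xs) ≡ mult i xs
  pick (yes e) = contradiction e ne
  pick (no _) = P.refl

 getAt-mod : ∀ h j es → getAt (modAt h j es) j ≡ h (getAt es j)
 getAt-mod h zero [] = P.refl
 getAt-mod h zero (e ∷ es) = P.refl
 getAt-mod h (suc j) [] = getAt-mod h j []
 getAt-mod h (suc j) (e ∷ es) = getAt-mod h j es

 getAt-mod≢ : ∀ h i j es → j ≢ i → getAt (modAt h j es) i ≡ getAt es i
 getAt-mod≢ h zero zero es ne = contradiction P.refl ne
 getAt-mod≢ h (suc i) zero [] ne = P.refl
 getAt-mod≢ h (suc i) zero (e ∷ es) ne = P.refl
 getAt-mod≢ h zero (suc j) [] ne = P.refl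
 getAt-mod≢ h zero (suc j) (e ∷ es) ne = P.refl
 getAt-mod≢ h (suc i) (suc j) [] ne = getAt-mod≢ h i j [] (λ e → ne (P.cong suc e))
 getAt-mod≢ h (suc i) (suc j) (e ∷ es) ne = getAt-mod≢ h i j es (λ e → ne (P.cong suc e))

 Match : List ℕ → List ℕ → Set
 Match pe ξ = ∀ i → getAt pe i ≡ mult i ξ

 match-pred : ∀ x ξ pe → Match pe (x ∷ ξ) → Match (modAt ℕ.pred x pe) ξ
 match-pred x ξ pe h i with x ℕ.≟ i
 ... | yes P.refl = P.trans (getAt-mod ℕ.pred x pe) (P.cong ℕ.pred (P.trans (h x) (mult-here x ξ)))
 ... | no ne = P.trans (getAt-mod≢ ℕ.pred i x pe ne) (P.trans (h i) (mult-there ξ ne))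

 match-suc : ∀ x ξ pe → Match pe ξ → Match (modAt suc x pe) (x ∷ ξ)
 match-suc x ξ pe h i with x ℕ.≟ i
 ... | yes P.refl = P.trans (getAt-mod suc x pe) (P.trans (P.cong suc (h x)) (P.sym (mult-here x ξ)))
 ... | no ne = P.trans (getAt-mod≢ suc i x pe ne) (P.trans (h i) (P.sym (mult-there ξ ne)))

 match-unpred : ∀ x ξ pe → getAt pe x ≢ 0 → Match (modAt ℕ.pred x pe) ξ → Match pe (x ∷ ξ)
 match-unpred x ξ pe nz h i with x ℕ.≟ i
 ... | yes P.refl = P.trans (P.sym (NP.suc-pred (getAt pe x) ⦃ ℕ.≢-nonZero nz ⦄)) (P.trans (P.cong suc (P.trans (P.sym (getAt-mod ℕ.pred x pe)) (h x))) (P.sym (mult-here x ξ)))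
 ... | no ne = P.trans (P.sym (getAt-mod≢ ℕ.pred i x pe ne)) (P.trans (h i) (P.sym (mult-there ξ ne)))

 match-nonzero : ∀ x ξ pe → Match pe (x ∷ ξ) → getAt pe x ≢ 0
 match-nonzero x ξ pe h e with P.trans (P.sym e) (P.trans (h x) (mult-here x ξ))
 ... | ()

 pdeg-match : ∀ ξ pe → Match pe ξ → pdeg pe ≡ D.size ξ
 pdeg-match [] pe h = go 0 pe h
  where
  go : ∀ k es → (∀ i → getAt es i ≡ 0) → pdegFrom k es ≡ 0
  go k [] z = P.refl
  go k (e ∷ es) z = P.cong₂ ℕ._+_ (P.cong (ℕ._* k) (z 0)) (go (suc k) es (λ i → z (suc i)))
 pdeg-match (x ∷ ξ) pe h = P.trans (P.sym (pdeg-pred x pe (match-nonzero x ξ pe h))) (P.cong (x ℕ.+_) (pdeg-match ξ (modAt ℕ.pred x pe) (match-pred x ξ pe h)))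

 -- The product of all m_i!, accumulated letter by letter; it is the value of the monomial p_ξ at
 -- its own word.
 mfact : List ℕ → Carrier
 mfact [] = 1#
 mfact (x ∷ w) = nat (suc (mult (suc x) (map suc w))) * mfact w

 imfact : List ℕ → Carrier
 imfact [] = 1#
 imfact (x ∷ w) = inv (mult (suc x) (map suc w)) * imfact w

 imfact* : ∀ w → imfact w * mfact w ≈ 1#
 imfact* [] = *-identityˡ 1#
 imfact* (x ∷ w) = trans (solve 4 (λ a b c d → a :* b :* (c :* d) := (a :* c) :* (b :* d)) refl (inv (mult (suc x) (map suc w))) (imfact w) (nat (suc (mult (suc x) (map suc w)))) (mfact w)) (trans (*-cong (inv* _) (imfact* w)) (*-identityˡ 1#))

 monoFrom-hit : ∀ k es → (∀ i → getAt es i ≡ 0) → fn (monoFrom k es) [] ≈ 1#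
 monoFrom-hit k [] z = refl
 monoFrom-hit k (zero ∷ es) z = monoFrom-hit (suc k) es (λ i → z (suc i))
 monoFrom-hit k (suc e ∷ es) z = contradiction (z 0) λ ()

 monoFrom-miss : ∀ k es → ¬ (∀ i → getAt es i ≡ 0) → fn (monoFrom k es) [] ≈ 0#
 monoFrom-miss k [] n = contradiction (λ i → P.refl) n
 monoFrom-miss k (zero ∷ es) n = monoFrom-miss (suc k) es (λ h → n λ { zero → P.refl ; (suc i) → h i })
 monoFrom-miss zero (suc e ∷ es) n = refl
 monoFrom-miss (suc k) (suc e ∷ es) n = refl

 monomial-hit : ∀ w pe → Match pe (map suc w) → fn (monomial pe) w ≈ mfact w
 monomial-hit [] pe h = monoFrom-hit 0 pe h
 monomial-hit (x ∷ w) pe h = trans (at (δ-monomial x pe) w) (*-cong (reflexive (P.cong nat (P.trans (h (suc x)) (mult-here (suc x) (map suc w))))) (monomial-hit w (modAt ℕ.pred (suc x) pe) (match-pred (suc x) (map suc w) pe h)))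

 monomial-miss : ∀ w pe → ¬ Match pe (map suc w) → fn (monomial pe) w ≈ 0#
 monomial-miss [] pe n = monoFrom-miss 0 pe n
 monomial-miss (x ∷ w) pe n with getAt pe (suc x) ℕ.≟ 0
 ... | yes z = trans (at (δ-monomial x pe) w) (*-zeroˡ′ (reflexive (P.cong nat z)))
 ... | no nz = trans (at (δ-monomial x pe) w) (*-zeroʳ′ (monomial-miss w (modAt ℕ.pred (suc x) pe) (λ h → n (match-unpred (suc x) (map suc w) pe nz h))))

 rmap : ∀ {P R : Set} {t : Bool} → (P → R) → (R → P) → Reflects P t → Reflects R t
 rmap f g (ofʸ p) = ofʸ (f p)
 rmap f g (ofⁿ np) = ofⁿ (λ r → np (g r))

 eqExp-reflects : ∀ xs ys → Reflects (∀ i → getAt xs i ≡ getAt ys i) (eqExp xs ys)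
 eqExp-reflects [] [] = ofʸ (λ i → P.refl)
 eqExp-reflects [] (y ∷ ys) = rmap (λ { (e , h) zero → P.sym e ; (e , h) (suc i) → h i }) (λ h → P.sym (h 0) , λ i → h (suc i)) (proof (y ℕ.≟ 0) ×-reflects eqExp-reflects [] ys)
 eqExp-reflects (x ∷ xs) [] = rmap (λ { (e , h) zero → e ; (e , h) (suc i) → h i }) (λ h → h 0 , λ i → h (suc i)) (proof (x ℕ.≟ 0) ×-reflects eqExp-reflects xs [])
 eqExp-reflects (x ∷ xs) (y ∷ ys) = rmap (λ { (e , h) zero → e ; (e , h) (suc i) → h i }) (λ h → h 0 , λ i → h (suc i)) (proof (x ℕ.≟ y) ×-reflects eqExp-reflects xs ys)

 mult-large : ∀ i ξ → D.size ξ ℕ.< i → mult i ξ ≡ 0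
 mult-large i [] lt = P.refl
 mult-large i (x ∷ ξ) lt = P.trans (mult-there {i} {x} ξ (λ { P.refl → NP.<-irrefl P.refl (NP.≤-<-trans (NP.m≤m+n x (D.size ξ)) lt) })) (mult-large i ξ (NP.≤-<-trans (NP.m≤n+m _ x) lt))

 getAt-upTo : ∀ (h : ℕ → ℕ) n i → (n ℕ.≤ i → h i ≡ 0) → getAt (map h (upTo n)) i ≡ h i
 getAt-upTo h n i z = P.trans (P.cong (λ l → getAt l i) (LP.map-applyUpTo (λ j → j) h n)) (go h n i z)
  where
  go : ∀ (h : ℕ → ℕ) n i → (n ℕ.≤ i → h i ≡ 0) → getAt (applyUpTo h n) i ≡ h i
  go h zero i z = P.sym (z ℕ.z≤n)
  go h (suc n) zero z = P.refl
  go h (suc n) (suc i) z = go (λ j → h (suc j)) n i (λ le → z (ℕ.s≤s le))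

 getAt-pExp : ∀ ξ i → getAt (pExp ξ) i ≡ mult i ξ
 getAt-pExp ξ i = getAt-upTo (λ j → mult j ξ) (suc (D.size ξ)) i (mult-large i ξ)

 size-suc : ∀ w → D.size (map suc w) ≡ wt w
 size-suc [] = P.refl
 size-suc (x ∷ w) = P.cong (suc x ℕ.+_) (size-suc w)

 -- Of all monomials only p_ξ is nonzero at the word of ξ, with value Π m_i!. For good terms its
 -- exponent of t is |ξ|, and t = -1 contributes the sign.
 coeff-int : ∀ w f → All Good f → κ (coeffTP (wt w) (map suc w) f) * (sgnK (wt w) * mfact w) ≈ fn ⟪ f ⟫ w
 coeff-int w [] [] = *-zeroˡ′ κ-0
 coeff-int w ((c , mono pe ye ue te) ∷ f) ((g , nu) ∷ gs) = trans (*-congʳ (κ-+ _ _)) (trans (distribʳ _ _ _) (+-cong (term reflects) (coeff-int w f gs)))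
  where
  ξ = map suc w
  reflects = eqExp-reflects pe (pExp ξ) ×-reflects (eqExp-reflects ye [] ×-reflects (proof (ue ℕ.≟ 0) ×-reflects proof (te ℕ.≟ wt w)))
  deg : te ≡ pdeg pe
  deg = P.sym (P.trans (P.sym (NP.+-identityʳ _)) (P.trans (deg₀ g) (NP.+-identityʳ te)))
  term : ∀ {t} → Reflects ((∀ i → getAt pe i ≡ getAt (pExp ξ) i) × ((∀ i → getAt ye i ≡ 0) × (ue ≡ 0 × te ≡ wt w))) t →
   κ (if t then c else 0q) * (sgnK (wt w) * mfact w) ≈ κ c * sgnK te * fn (monomial pe) w
  term (ofʸ (h , _ , _ , e)) = trans (sym (*-assoc _ _ _)) (*-cong (*-congˡ (reflexive (P.cong sgnK (P.sym e)))) (sym (monomial-hit w pe (λ i → P.trans (h i) (getAt-pExp ξ i)))))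
  term (ofⁿ n) = trans (*-zeroˡ′ κ-0) (sym (*-zeroʳ′ (monomial-miss w pe (λ h → n ((λ i → P.trans (h i) (P.sym (getAt-pExp ξ i))) , (λ i → getAt-zero i ye (no-y g)) , nu ,
   P.trans deg (P.trans (pdeg-match ξ pe h) (size-suc w)))))))

 Parts : List ℕ → Set
 Parts = All (1 ℕ.≤_)

 word : List ℕ → List ℕ
 word = map ℕ.pred

 suc-word : ∀ {ξ} → Parts ξ → map suc (word ξ) ≡ ξ
 suc-word [] = P.refl
 suc-word (ℕ.s≤s _ ∷ ps) = P.cong (_ ∷_) (suc-word ps)

 wt-word : ∀ {ξ} → Parts ξ → wt (word ξ) ≡ D.size ξ
 wt-word {ξ} ps = P.trans (P.sym (size-suc (word ξ))) (P.cong D.size (suc-word ps))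

 aCoef-fn : ∀ la {ξ} → Parts ξ → κ (aCoef la ξ) * (sgnK (D.size ξ) * mfact (word ξ)) ≈ fn (Avec la) (word ξ)
 aCoef-fn la {ξ} ps = P.subst₂ (λ n ζ → κ (coeffTP n ζ (Aprod n la)) * (sgnK n * mfact (word ξ)) ≈ fn (Avec la) (word ξ)) (wt-word ps) (suc-word ps)
  (trans (coeff-int (word ξ) (Aprod (wt (word ξ)) la) (Aprod-All (wt (word ξ)) la)) (Aprod-int (wt (word ξ)) la (word ξ) NP.≤-refl))

 aCoef-value : ∀ la {ξ} → Parts ξ → κ (aCoef la ξ) ≈ (sgnK (D.size ξ) * imfact (word ξ)) * fn (Avec la) (word ξ)
 aCoef-value la {ξ} ps = sym (begin
  (s * i) * fn (Avec la) (word ξ) ≈⟨ *-congˡ (sym (aCoef-fn la ps)) ⟩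
  (s * i) * (κ (aCoef la ξ) * (s * m)) ≈⟨ solve 4 (λ s i a m → (s :* i) :* (a :* (s :* m)) := (s :* s) :* (i :* m) :* a) refl s i (κ (aCoef la ξ)) m ⟩
  (s * s) * (i * m) * κ (aCoef la ξ) ≈⟨ *-congʳ (trans (*-cong (sgn² (D.size ξ)) (imfact* (word ξ))) (*-identityˡ 1#)) ⟩
  1# * κ (aCoef la ξ) ≈⟨ *-identityˡ _ ⟩
  κ (aCoef la ξ) ∎)
  where
  s = sgnK (D.size ξ)
  i = imfact (word ξ)
  m = mfact (word ξ)

 aCoef-below : ∀ la {ξ} → Parts ξ → D.size ξ ℕ.< D.size la → κ (aCoef la ξ) ≈ 0#
 aCoef-below la {ξ} ps lt = trans (aCoef-value la ps) (*-zeroʳ′ (vatₛ (fatₛ (Avec-fil la) (NP.<-≤-trans lt (NP.≤-reflexive (size≡ la)))) (word ξ) (wt-word ps)))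

 Mon : List ℕ → Sym
 Mon [] = one
 Mon (l ∷ la) = pv l $ Mon la

 peOf : List ℕ → List ℕ
 peOf = foldr (modAt suc) []

 Mon-monomial : ∀ la → Mon la ≈ₛ monomial (peOf la)
 Mon-monomial [] = reflₛ
 Mon-monomial (l ∷ la) = transₛ (Lin.cong (pv l) (Mon-monomial la)) (symₛ (monomial-suc l (peOf la)))

 match-peOf : ∀ la → Match (peOf la) la
 match-peOf [] i = P.refl
 match-peOf (l ∷ la) = match-suc l la (peOf la) (match-peOf la)

 mult-above : ∀ {x y xs} → Linked (λ p q → q ℕ.≤ p) (x ∷ xs) → x ℕ.< y → mult y (x ∷ xs) ≡ 0
 mult-above {x} {y} {[]} _ lt = mult-there {y} {x} [] (λ { P.refl → NP.<-irrefl P.refl lt })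
 mult-above {x} {y} {z ∷ xs} (le ∷ l) lt = P.trans (mult-there {y} {x} (z ∷ xs) (λ { P.refl → NP.<-irrefl P.refl lt })) (mult-above l (NP.≤-<-trans le lt))

 sorted-unique : ∀ {ρ μ} → Linked (λ p q → q ℕ.≤ p) ρ → Linked (λ p q → q ℕ.≤ p) μ → (∀ i → mult i ρ ≡ mult i μ) → ρ ≡ μ
 sorted-unique {[]} {[]} l m h = P.refl
 sorted-unique {[]} {y ∷ ys} l m h with P.trans (h y) (mult-here y ys)
 ... | ()
 sorted-unique {x ∷ xs} {[]} l m h with P.trans (P.sym (h x)) (mult-here x xs)
 ... | ()
 sorted-unique {x ∷ xs} {y ∷ ys} l m h with NP.<-cmp x y
 ... | tri< lt _ _ = contradiction (P.trans (P.sym (mult-above l lt)) (P.trans (h y) (mult-here y ys))) λ ()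
 ... | tri> _ _ gt = contradiction (P.trans (P.sym (mult-above m gt)) (P.trans (P.sym (h x)) (mult-here x xs))) λ ()
 ... | tri≈ _ P.refl _ = P.cong (x ∷_) (sorted-unique (tail l) (tail m) cancel)
  where
  tail : ∀ {z zs} → Linked (λ p q → q ℕ.≤ p) (z ∷ zs) → Linked (λ p q → q ℕ.≤ p) zs
  tail [-] = []
  tail (_ ∷ l) = l
  cancel : ∀ i → mult i xs ≡ mult i ys
  cancel i with x ℕ.≟ i
  ... | yes P.refl = NP.suc-injective (P.trans (P.sym (mult-here x xs)) (P.trans (h x) (mult-here x ys)))
  ... | no ne = P.trans (P.sym (mult-there xs ne)) (P.trans (h i) (mult-there ys ne))

 Mon-same : ∀ {μ} → Parts μ → fn (Mon μ) (word μ) ≈ mfact (word μ)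
 Mon-same {μ} ps = trans (at (Mon-monomial μ) (word μ)) (monomial-hit (word μ) (peOf μ) (λ i → P.trans (match-peOf μ i) (P.cong (mult i) (P.sym (suc-word ps)))))

 Mon-other : ∀ {ρ μ} → IsPartition ρ → IsPartition μ → ρ ≢ μ → fn (Mon ρ) (word μ) ≈ 0#
 Mon-other {ρ} {μ} (_ , lρ) (ps , lμ) ne = trans (at (Mon-monomial ρ) (word μ)) (monomial-miss (word μ) (peOf ρ) (λ h → ne (sorted-unique lρ lμ (λ i → P.trans (P.sym (match-peOf ρ i)) (P.trans (h i) (P.cong (mult i) (suc-word ps)))))))

 pₘ-van : ∀ i {d f} → Vanₛ d f → Vanₛ (suc i ℕ.+ d) (pₘ i $ f)
 pₘ-van i {d} {f} h = Θ-van (go (suc i))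
  where
  go : ∀ k → Van (k ℕ.+ d) (powˡ S k $ (vac $ f))
  go zero = vac-van h
  go (suc k) = S-van (go k)

 sgn-+ : ∀ m n → sgnK (m ℕ.+ n) ≈ sgnK m * sgnK n
 sgn-+ zero n = sym (*-identityˡ _)
 sgn-+ (suc m) n = trans (-‿cong (sgn-+ m n)) (solve 2 (λ x y → :- (x :* y) := (:- x) :* y) refl (sgnK m) (sgnK n))

 -- In lowest degree C_l is multiplication by (-1)^l p_l / (α l), and the normalisation α l of each
 -- factor cancels the denominator.
 Avec-lead : ∀ {la} → Parts la → ∀ w → wt w ≡ D.size la → fn (Avec la) w ≈ sgnK (D.size la) * fn (Mon la) w
 Avec-lead [] w e = sym (*-identityˡ _)
 Avec-lead {suc l ∷ la} (_ ∷ ps) w e = begin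
  (α * nat (suc l)) * fn (C (suc l) $ Avec la) w ≈⟨ *-congˡ (C-lead l (Avec-fil la) w (P.trans e (P.cong (suc l ℕ.+_) (size≡ la)))) ⟩
  (α * nat (suc l)) * (sgnK (suc l) * inv l * (α⁻¹ * fn (pₘ l $ Avec la) w)) ≈⟨ solve 6 (λ a n s i y x → (a :* n) :* (s :* i :* (y :* x)) := (i :* n) :* (y :* a) :* (s :* x)) refl α (nat (suc l)) (sgnK (suc l)) (inv l) α⁻¹ _ ⟩
  (inv l * nat (suc l)) * (α⁻¹ * α) * (sgnK (suc l) * fn (pₘ l $ Avec la) w) ≈⟨ trans (*-congʳ (trans (*-cong (inv* l) α⁻¹*α) (*-identityˡ 1#))) (*-identityˡ _) ⟩
  sgnK (suc l) * fn (pₘ l $ Avec la) w ≈⟨ *-congˡ step′ ⟩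
  sgnK (suc l) * (sgnK (D.size la) * fn (pₘ l $ Mon la) w) ≈⟨ trans (sym (*-assoc _ _ _)) (*-congʳ (sym (sgn-+ (suc l) (D.size la)))) ⟩
  sgnK (suc l ℕ.+ D.size la) * fn (pₘ l $ Mon la) w ∎
  where
  s = sgnK (D.size la)
  diff : Vanₛ (D.size la) (Avec la ⊖ (s *ₛ Mon la))
  diff = vanₛ λ v ev → trans (+-congʳ (Avec-lead ps v ev)) (solve 1 (λ x → x :+ (:- :1) :* x := :0) refl _)
  step′ : fn (pₘ l $ Avec la) w ≈ s * fn (pₘ l $ Mon la) w
  step′ = begin
   fn (pₘ l $ Avec la) w ≈⟨ solve 2 (λ x y → x := (x :+ (:- :1) :* y) :+ y) refl _ (s * fn (pₘ l $ Mon la) w) ⟩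
   (fn (pₘ l $ Avec la) w + - 1# * (s * fn (pₘ l $ Mon la) w)) + s * fn (pₘ l $ Mon la) w
    ≈⟨ +-congʳ (trans (+-congˡ (*-congˡ (sym (at (Lin.scal (pₘ l) s (Mon la)) w)))) (trans (+-congˡ (sym (at (Lin.scal (pₘ l) (- 1#) (s *ₛ Mon la)) w))) (trans (sym (at (Lin.add (pₘ l) (Avec la) ((- 1#) *ₛ (s *ₛ Mon la))) w)) (vatₛ (pₘ-van l diff) w e)))) ⟩
   0# + s * fn (pₘ l $ Mon la) w ≈⟨ +-identityˡ _ ⟩
   s * fn (pₘ l $ Mon la) w ∎

 aCoef-same : ∀ {la} → IsPartition la → κ (aCoef la la) ≈ 1#
 aCoef-same {la} (ps , _) = trans (aCoef-value la ps) (trans (*-congˡ (trans (Avec-lead ps (word la) (wt-word ps)) (*-congˡ (Mon-same ps))))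
  (trans (solve 3 (λ s i m → (s :* i) :* (s :* m) := (s :* s) :* (i :* m)) refl (sgnK (D.size la)) (imfact (word la)) (mfact (word la))) (trans (*-cong (sgn² (D.size la)) (imfact* (word la))) (*-identityˡ 1#))))

 aCoef-other : ∀ {la ξ} → IsPartition la → IsPartition ξ → D.size la ≡ D.size ξ → la ≢ ξ → κ (aCoef la ξ) ≈ 0#
 aCoef-other {la} {ξ} pl pξ e ne = trans (aCoef-value la (proj₁ pξ)) (*-zeroʳ′ (trans (Avec-lead (proj₁ pl) (word ξ) (P.trans (wt-word (proj₁ pξ)) (P.sym e))) (*-zeroʳ′ (Mon-other pl pξ ne))))

-- Combinatorics of partitions.

module Comb where
 open import Defs
 open import Data.Nat as ℕ using (ℕ; zero; suc; _+_; _*_; _∸_; _^_; _≤_; _<_; _!; s≤s; z≤n; s≤s⁻¹)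
 open import Data.Nat.Properties
 open import Data.Nat.Combinatorics using (_C_; k![n∸k]!∣n!; nCk≡n!/k![n-k]!)
 open import Data.Nat.DivMod using (m/n*n≡m)
 open import Data.List using (filter)
 open import Data.List.Properties using (∷-injectiveˡ; ∷-injectiveʳ; upTo-∷ʳ; concatMap-++; ++-identityʳ)
 open import Data.List.Membership.Propositional using (_∈_; lose)
 open import Data.List.Membership.Propositional.Properties using (∈-map⁺; ∈-map⁻; ∈-concatMap⁺; ∈-filter⁺; ∈-upTo⁺)
 open import Data.List.Relation.Unary.AllPairs using (AllPairs)
 import Data.List.Relation.Unary.AllPairs.Properties as AllPairsP
 open import Data.List.Relation.Unary.Any using (here)
 open import Data.Empty using (⊥)
 open import Relation.Binary.Definitions using (tri<; tri≈; tri>)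
 open import Relation.Binary.PropositionalEquality

 Descending : List ℕ → Set
 Descending = Linked (λ x y → y ≤ x)

 tail-desc : ∀ {x xs} → Descending (x ∷ xs) → Descending xs
 tail-desc [-] = []
 tail-desc (_ ∷ l) = l

 parts-sound : ∀ f n k → All (λ ξ → All (1 ≤_) ξ × Descending (k ∷ ξ) × size ξ ≡ n) (partsFuel f n k)
 parts-sound f zero k = ([] , [-] , refl) ∷ []
 parts-sound zero (suc n) k = []
 parts-sound (suc f) (suc n) k = AllP.concat⁺ (AllP.map⁺ (All.zipWith (λ {a} (le , lt) → AllP.map⁺ (All.map (λ (ps , d , e) → (proj₁ lt ∷ ps) , (le ∷ d) , trans (cong (a +_) e) (m+[n∸m]≡n (proj₂ lt))) (parts-sound f (suc n ∸ a) a)))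
  (AllP.all-filter (λ a → a ℕ.≤? k) (range1 (suc n)) , AllP.filter⁺ (λ a → a ℕ.≤? k) range)))
  where
  range : All (λ a → 1 ≤ a × a ≤ suc n) (range1 (suc n))
  range = AllP.map⁺ (All.map (λ lt → s≤s z≤n , lt) (AllP.all-upTo (suc n)))

 parts-complete : ∀ f n k ξ → n ≤ f → All (1 ≤_) ξ → Descending (k ∷ ξ) → size ξ ≡ n → ξ ∈ partsFuel f n k
 parts-complete f zero k [] le ps d e = here refl
 parts-complete f zero k (zero ∷ ξ) le (() ∷ _) d e
 parts-complete (suc f) (suc n) k (suc x ∷ ξ) (s≤s le) (p ∷ ps) (x≤k ∷ d) e = ∈-concatMap⁺ _ (lose (∈-filter⁺ (λ a → a ℕ.≤? k) (∈-map⁺ suc (∈-upTo⁺ (≤-trans (s≤s (m≤m+n x (size ξ))) (≤-reflexive e)))) x≤k)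
  (∈-map⁺ (suc x ∷_) (parts-complete f (n ∸ x) (suc x) ξ (≤-trans (m∸n≤m n x) le) ps d (trans (sym (m+n∸m≡n x (size ξ))) (cong (_∸ x) (suc-injective e))))))

 parts-unique : ∀ f n k → Unique (partsFuel f n k)
 parts-unique f zero k = [] ∷ []
 parts-unique zero (suc n) k = []
 parts-unique (suc f) (suc n) k = Unique.concat⁺ (AllP.map⁺ (All.universal (λ a → Unique.map⁺ ∷-injectiveʳ (parts-unique f (suc n ∸ a) a)) heads))
  (AllPairsP.map⁺ (AllPairs.map disjoint (Unique.filter⁺ (λ a → a ℕ.≤? k) (Unique.map⁺ suc-injective (Unique.upTo⁺ (suc n))))))
  where
  heads = filter (λ a → a ℕ.≤? k) (range1 (suc n))
  disjoint : ∀ {a b} → a ≢ b → ∀ {v} → (v ∈ map (a ∷_) (partsFuel f (suc n ∸ a) a)) × (v ∈ map (b ∷_) (partsFuel f (suc n ∸ b) b)) → ⊥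
  disjoint ne (p , q) with ∈-map⁻ _ p | ∈-map⁻ _ q
  ... | _ , _ , e | _ , _ , e′ = ne (∷-injectiveˡ (trans (sym e) e′))

 partitionsOf-sound : ∀ n → All (λ ξ → IsPartition ξ × size ξ ≡ n) (partitionsOf n)
 partitionsOf-sound n = All.map (λ (ps , d , e) → (ps , tail-desc d) , e) (parts-sound n n n)

 partitionsOf-complete : ∀ ξ → IsPartition ξ → ξ ∈ partitionsOf (size ξ)
 partitionsOf-complete ξ (ps , d) = parts-complete (size ξ) (size ξ) (size ξ) ξ ≤-refl ps (bounded d) refl
  where
  bounded : ∀ {ξ} → Descending ξ → Descending (size ξ ∷ ξ)
  bounded {[]} d = [-]
  bounded {x ∷ ξ} d = m≤m+n x (size ξ) ∷ d

 module Heights (n : ℕ) where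
  b : ℕ
  b = suc (suc n)

  -- Powers of a base are convex. Subtracting 1 gives ψ 0 = 0, so zero entries of an exponent vector
  -- do not change its height.
  ψ : ℕ → ℕ
  ψ k = ℕ.pred (b ^ k)

  suc-ψ : ∀ k → suc (ψ k) ≡ b ^ k
  suc-ψ k = suc-pred (b ^ k) ⦃ m^n≢0 b k ⦄

  -- With b^m′ factored out this is b^x + b^y ≤ 1 + b^(x+y), that is, (b^x - 1)(b^y - 1) ≥ 0.
  ψ-spread : ∀ m n m′ n′ → m′ + n′ ≡ m + n → m′ ≤ m → m′ ≤ n → ψ m + ψ n ≤ ψ m′ + ψ n′
  ψ-spread m n m′ n′ e le le′ = s≤s⁻¹ (s≤s⁻¹ (subst₂ _≤_ (shift m n) (shift m′ n′) bound))
   where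
   x = m ∸ m′
   y = n ∸ m′
   em : m ≡ m′ + x
   em = sym (m+[n∸m]≡n le)
   en : n ≡ m′ + y
   en = sym (m+[n∸m]≡n le′)
   en′ : n′ ≡ m′ + (x + y)
   en′ = +-cancelˡ-≡ m′ _ _ (trans e (trans (cong₂ _+_ em en) (trans (+-assoc m′ x (m′ + y)) (cong (m′ +_) (trans (sym (+-assoc x m′ y)) (trans (cong (_+ y) (+-comm x m′)) (+-assoc m′ x y)))))))
   shift : ∀ m n → b ^ m + b ^ n ≡ suc (suc (ψ m + ψ n))
   shift m n = trans (cong₂ _+_ (sym (suc-ψ m)) (sym (suc-ψ n))) (cong suc (+-suc (ψ m) (ψ n)))
   corner : ∀ p q → suc p + suc q ≤ 1 + suc p * suc q
   corner p q = s≤s (≤-trans (≤-reflexive (trans (+-comm p (suc q)) refl)) (+-monoʳ-≤ (suc q) (m≤m*n p (suc q))))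
   bound : b ^ m + b ^ n ≤ b ^ m′ + b ^ n′
   bound = begin
    b ^ m + b ^ n ≡⟨ cong₂ _+_ (trans (cong (b ^_) em) (^-distribˡ-+-* b m′ x)) (trans (cong (b ^_) en) (^-distribˡ-+-* b m′ y)) ⟩
    b ^ m′ * b ^ x + b ^ m′ * b ^ y ≡⟨ sym (*-distribˡ-+ (b ^ m′) (b ^ x) (b ^ y)) ⟩
    b ^ m′ * (b ^ x + b ^ y) ≤⟨ *-monoʳ-≤ (b ^ m′) (subst₂ (λ p q → p + q ≤ 1 + p * q) (suc-ψ x) (suc-ψ y) (corner (ψ x) (ψ y))) ⟩
    b ^ m′ * (1 + b ^ x * b ^ y) ≡⟨ *-distribˡ-+ (b ^ m′) 1 (b ^ x * b ^ y) ⟩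
    b ^ m′ * 1 + b ^ m′ * (b ^ x * b ^ y) ≡⟨ cong₂ _+_ (*-identityʳ (b ^ m′)) (trans (cong (b ^ m′ *_) (sym (^-distribˡ-+-* b x y))) (trans (sym (^-distribˡ-+-* b m′ (x + y))) (cong (b ^_) (sym en′)))) ⟩
    b ^ m′ + b ^ n′ ∎
    where open ≤-Reasoning

  φ : List ℕ → ℕ
  φ [] = 0
  φ (k ∷ η) = ψ k + φ η

  ψ-mono : ∀ {x y} → x ≤ y → ψ x ≤ ψ y
  ψ-mono le = pred-mono-≤ (^-monoʳ-≤ b le)

  φ-desc : ∀ {x ξ} → Descending (x ∷ ξ) → φ ξ ≤ length ξ * ψ x
  φ-desc {ξ = []} d = z≤n
  φ-desc {x} {y ∷ ξ} (le ∷ d) = +-mono-≤ (ψ-mono le) (≤-trans (φ-desc d) (*-monoʳ-≤ (length ξ) (ψ-mono le)))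

  length≤size : ∀ {ξ} → All (1 ≤_) ξ → length ξ ≤ size ξ
  length≤size [] = z≤n
  length≤size (p ∷ ps) = +-mono-≤ p (length≤size ps)

  ψ-step : ∀ x → n * ψ x < ψ (suc x)
  ψ-step x = s≤s⁻¹ (begin
   suc (suc (n * ψ x)) ≤⟨ s≤s (s≤s (*-monoʳ-≤ n (n≤1+n (ψ x)))) ⟩
   2 + n * suc (ψ x) ≤⟨ +-monoˡ-≤ (n * suc (ψ x)) (s≤s (≤-trans (s≤s z≤n) (m≤n+m (1 * suc (ψ x)) (ψ x)))) ⟩
   (2 * suc (ψ x)) + n * suc (ψ x) ≡⟨ sym (*-distribʳ-+ (suc (ψ x)) 2 n) ⟩
   b * suc (ψ x) ≡⟨ trans (cong (b *_) (suc-ψ x)) (sym (suc-ψ (suc x))) ⟩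
   suc (ψ (suc x)) ∎)
   where open ≤-Reasoning

  -- With base n+2 there is no carrying, so heights compare partitions of n lexicographically.
  lex : ∀ {x y μ} κ → IsPartition (x ∷ μ) → size (x ∷ μ) ≤ n → x < y → φ (x ∷ μ) < φ (y ∷ κ)
  lex {x} {y} {μ} κ (ps , d) le lt = begin-strict
   φ (x ∷ μ) ≤⟨ φ-desc {x} {x ∷ μ} (≤-refl ∷ d) ⟩
   length (x ∷ μ) * ψ x ≤⟨ *-monoˡ-≤ (ψ x) (≤-trans (length≤size ps) le) ⟩
   n * ψ x <⟨ ψ-step x ⟩
   ψ (suc x) ≤⟨ ψ-mono lt ⟩
   ψ y ≤⟨ m≤m+n (ψ y) (φ κ) ⟩
   φ (y ∷ κ) ∎
   where open ≤-Reasoning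

  φ-injective : ∀ {μ κ} → IsPartition μ → IsPartition κ → size μ ≡ size κ → size μ ≤ n → φ μ ≡ φ κ → μ ≡ κ
  φ-injective {[]} {[]} pμ pκ e le h = refl
  φ-injective {[]} {suc y ∷ κ} pμ pκ () le h
  φ-injective {suc x ∷ μ} {[]} pμ pκ () le h
  φ-injective {[]} {zero ∷ κ} pμ ((() ∷ _) , _) e le h
  φ-injective {zero ∷ μ} {[]} ((() ∷ _) , _) pκ e le h
  φ-injective {x ∷ μ} {y ∷ κ} pμ pκ e le h with <-cmp x y
  ... | tri< lt _ _ = contradiction h (<⇒≢ (lex κ pμ le lt))
  ... | tri> _ _ gt = contradiction (sym h) (<⇒≢ (lex μ pκ (≤-trans (≤-reflexive (sym e)) le) gt))
  φ-injective {x ∷ μ} {.x ∷ κ} (_ ∷ ps , d) (_ ∷ qs , d′) e le h | tri≈ _ refl _ =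
   cong (x ∷_) (φ-injective (ps , tail-desc d) (qs , tail-desc d′) (+-cancelˡ-≡ x _ _ e) (≤-trans (m≤n+m _ x) le) (+-cancelˡ-≡ (ψ x) _ _ h))

  -- Dominance implies the lexicographic order: the first parts are compared, and if they agree they
  -- cancel from all partial sums.
  φ-dominated : ∀ {μ κ} → IsPartition μ → IsPartition κ → size μ ≡ size κ → size μ ≤ n → Dominated μ κ → φ μ ≤ φ κ
  φ-dominated {[]} pμ pκ e le dom = z≤n
  φ-dominated {zero ∷ μ} {[]} ((() ∷ _) , _) pκ e le dom
  φ-dominated {x ∷ μ} {y ∷ κ} (p ∷ ps , d) (q ∷ qs , d′) e le dom with m≤n⇒m<n∨m≡n (subst₂ _≤_ (+-identityʳ x) (+-identityʳ y) (dom 1))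
  ... | inj₁ lt = <⇒≤ (lex κ (p ∷ ps , d) le lt)
  ... | inj₂ refl = +-monoʳ-≤ (ψ x) (φ-dominated (ps , tail-desc d) (qs , tail-desc d′) (+-cancelˡ-≡ x _ _ e) (≤-trans (m≤n+m _ x) le) (λ k → +-cancelˡ-≤ x _ _ (dom (suc k))))

 insert : ℕ → List ℕ → List ℕ
 insert x [] = x ∷ []
 insert x (y ∷ ys) with y ℕ.≤? x
 ... | yes _ = x ∷ y ∷ ys
 ... | no _ = y ∷ insert x ys

 insert-↭ : ∀ x ξ → x ∷ ξ ↭ insert x ξ
 insert-↭ x [] = ↭-refl
 insert-↭ x (y ∷ ys) with y ℕ.≤? x
 ... | yes _ = ↭-refl
 ... | no _ = ↭-trans (swap x y ↭-refl) (prep y (insert-↭ x ys))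

 insert-partition : ∀ {x ξ} → 1 ≤ x → IsPartition ξ → IsPartition (insert x ξ)
 insert-partition {x} p (ps , d) = positive ps , sorted d
  where
  positive : ∀ {ξ} → All (1 ≤_) ξ → All (1 ≤_) (insert x ξ)
  positive [] = p ∷ []
  positive {y ∷ ys} (q ∷ qs) with y ℕ.≤? x
  ... | yes _ = p ∷ q ∷ qs
  ... | no _ = q ∷ positive qs
  sorted : ∀ {ξ} → Descending ξ → Descending (insert x ξ)
  below : ∀ {y ys} → x ≤ y → Descending (y ∷ ys) → Descending (y ∷ insert x ys)
  sorted {[]} d = [-]
  sorted {y ∷ ys} d with y ℕ.≤? x
  ... | yes le = le ∷ d
  ... | no nle = below (<⇒≤ (≰⇒> nle)) d
  below {ys = []} le d = le ∷ [-]
  below {y} {z ∷ zs} le (le′ ∷ d) with z ℕ.≤? x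
  ... | yes z≤x = le ∷ z≤x ∷ d
  ... | no nle = le′ ∷ below (<⇒≤ (≰⇒> nle)) d

 -- Zero entries are dropped: exponent vectors may contain them and partitions may not.
 sort : List ℕ → List ℕ
 sort [] = []
 sort (zero ∷ η) = sort η
 sort (suc x ∷ η) = insert (suc x) (sort η)

 sort-partition : ∀ η → IsPartition (sort η)
 sort-partition [] = [] , []
 sort-partition (zero ∷ η) = sort-partition η
 sort-partition (suc x ∷ η) = insert-partition (s≤s z≤n) (sort-partition η)

 size-↭ : ∀ {ξ ζ} → ξ ↭ ζ → size ξ ≡ size ζ
 size-↭ Perm.refl = refl
 size-↭ (prep x p) = cong (x +_) (size-↭ p)
 size-↭ (swap {xs} {ys} x y p) = trans (cong (λ s → x + (y + s)) (size-↭ p)) (trans (sym (+-assoc x y (size ys))) (trans (cong (_+ size ys) (+-comm x y)) (+-assoc y x (size ys))))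
 size-↭ (Perm.trans p q) = trans (size-↭ p) (size-↭ q)

 size-sort : ∀ η → size (sort η) ≡ size η
 size-sort [] = refl
 size-sort (zero ∷ η) = size-sort η
 size-sort (suc x ∷ η) = trans (sym (size-↭ (insert-↭ (suc x) (sort η)))) (cong (suc x +_) (size-sort η))

 -- The product (m+1)(m+2)...(m+r).
 rise : ℕ → ℕ → ℕ
 rise zero m = 1
 rise (suc r) m = suc (r + m) * rise r m

 rise-! : ∀ r m → rise r m * m ! ≡ (r + m) !
 rise-! zero m = *-identityˡ (m !)
 rise-! (suc r) m = trans (*-assoc (suc (r + m)) (rise r m) (m !)) (cong (suc (r + m) *_) (rise-! r m))

 binomial-rise : ∀ r m → ((r + m) C m) * r ! ≡ rise r m
 binomial-rise r m = *-cancelʳ-≡ _ _ (m !) ⦃ m !≢0 ⦄ (begin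
  ((r + m) C m) * r ! * m ! ≡⟨ trans (*-assoc ((r + m) C m) (r !) (m !)) (cong (((r + m) C m) *_) (*-comm (r !) (m !))) ⟩
  ((r + m) C m) * (m ! * r !) ≡⟨ cong (λ z → ((r + m) C m) * (m ! * z !)) (sym (m+n∸n≡m r m)) ⟩
  ((r + m) C m) * (m ! * (r + m ∸ m) !) ≡⟨ cong (_* (m ! * (r + m ∸ m) !)) (nCk≡n!/k![n-k]! (m≤n+m m r)) ⟩
  ((r + m) ! ℕ./ (m ! * (r + m ∸ m) !)) ⦃ m !* (r + m ∸ m) !≢0 ⦄ * (m ! * (r + m ∸ m) !) ≡⟨ m/n*n≡m ⦃ m !* (r + m ∸ m) !≢0 ⦄ (k![n∸k]!∣n! (m≤n+m m r)) ⟩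
  (r + m) ! ≡⟨ sym (rise-! r m) ⟩
  rise r m * m ! ∎)
  where open ≡-Reasoning

 partitionsUpTo-sound : ∀ n → All (λ ξ → IsPartition ξ × size ξ ≤ n) (partitionsUpTo n)
 partitionsUpTo-sound n = AllP.concat⁺ (AllP.map⁺ (All.map (λ {d} lt → All.map (λ (p , e) → p , ≤-trans (≤-reflexive e) (s≤s⁻¹ lt)) (partitionsOf-sound d)) (AllP.all-upTo (suc n))))

 partitionsUpTo-complete : ∀ {n} ξ → IsPartition ξ → size ξ ≤ n → ξ ∈ partitionsUpTo n
 partitionsUpTo-complete ξ p le = ∈-concatMap⁺ partitionsOf (lose (∈-upTo⁺ (s≤s le)) (partitionsOf-complete ξ p))

 partitionsUpTo-unique : ∀ n → Unique (partitionsUpTo n)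
 partitionsUpTo-unique n = Unique.concat⁺ (AllP.map⁺ (All.universal (λ d → parts-unique d d d) (upTo (suc n)))) (AllPairsP.map⁺ (AllPairs.map disjoint (Unique.upTo⁺ (suc n))))
  where
  disjoint : ∀ {c d} → c ≢ d → ∀ {v} → (v ∈ partitionsOf c) × (v ∈ partitionsOf d) → ⊥
  disjoint {c} {d} ne (p , q) = ne (trans (sym (proj₂ (All.lookup (partitionsOf-sound c) p))) (proj₂ (All.lookup (partitionsOf-sound d) q)))

 partitionsUpTo-suc : ∀ n → partitionsUpTo (suc n) ≡ partitionsUpTo n ++ partitionsOf (suc n)
 partitionsUpTo-suc n = trans (cong (concatMap partitionsOf) (sym (upTo-∷ʳ (suc n)))) (trans (concatMap-++ partitionsOf (upTo (suc n)) (suc n ∷ [])) (cong (partitionsUpTo n ++_) (++-identityʳ (partitionsOf (suc n)))))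

-- Expansions in power sums and monomials, and the scalar product.

module SymmetricFunctions (K : Scalars) (Q : Terms.Coefficients K) where
 open D hiding (_≈_; size; pv; bnd; splits)
 open Linear K
 open Lax K
 open Beltrami K using (nat-+)
 open Series K hiding (P)
 open COperators K
 open Tau K using (sing; τ; τ0; τΘ; τ-conv; τ-δ; σfn; R)
 open Triangularity K
 open InnerProduct K
 open Products K using (one)
 open Monomials K
 open Terms K
 open Coefficients Q
 open Interpretation K Q using (lift-sg)
 open Extraction K Q
 open import Data.Nat using (_!)
 open import Data.List.Membership.Propositional using (_∈_; _∉_)
 open import Data.List.Membership.Propositional.Properties using (∈-map⁺; ∈-upTo⁺)
 open import Data.List.Relation.Unary.Any using (here; there)

 κ-sum : ∀ {X : Set} (g : X → Qα) xs → κ (sumq (map g xs)) ≈ sumK xs (λ x → κ (g x))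
 κ-sum g [] = κ-0
 κ-sum g (x ∷ xs) = trans (κ-+ _ _) (+-congˡ (κ-sum g xs))

 nat-* : ∀ m n → nat (m ℕ.* n) ≈ nat m * nat n
 nat-* zero n = sym (zeroˡ _)
 nat-* (suc m) n = trans (nat-+ n (m ℕ.* n)) (trans (+-cong (sym (*-identityˡ _)) (nat-* m n)) (sym (distribʳ _ _ _)))

 symTerm : Qα × List ℕ → Sym
 symTerm (c , ρ) = κ c *ₛ Mon ρ

 ⟦_⟧ : SymF → Sym
 ⟦ F ⟧ = SV.sum F symTerm

 WF : SymF → Set
 WF = All (λ e → IsPartition (proj₂ e))

 pcoeff-fn : ∀ {F ρ} → WF F → IsPartition ρ → κ (pcoeff F ρ) * mfact (word ρ) ≈ fn ⟦ F ⟧ (word ρ)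
 pcoeff-fn [] pρ = *-zeroˡ′ κ-0
 pcoeff-fn {(c , σ) ∷ F} {ρ} (pσ ∷ wf) pρ = trans (*-congʳ (κ-+ _ _)) (trans (distribʳ _ _ _) (+-cong (pick (LP.≡-dec ℕ._≟_ σ ρ)) (pcoeff-fn wf pρ)))
  where
  pick : (d : Dec (σ ≡ ρ)) → κ (if does d then c else 0q) * mfact (word ρ) ≈ κ c * fn (Mon σ) (word ρ)
  pick (yes P.refl) = *-congˡ (sym (Mon-same (proj₁ pρ)))
  pick (no ne) = trans (*-zeroˡ′ κ-0) (sym (*-zeroʳ′ (Mon-other pσ pρ ne)))

 cf-congₛ : ∀ η {f g} → f ≈ₛ g → cf η f ≈ cf η g
 cf-congₛ η e = at (Lin.cong (tt η) e) []

 cf-add : ∀ η f g → cf η (f +ₛ g) ≈ cf η f + cf η g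
 cf-add η f g = at (Lin.add (tt η) f g) []

 cf-scal : ∀ η c f → cf η (c *ₛ f) ≈ c * cf η f
 cf-scal η c f = at (Lin.scal (tt η) c f) []

 cf-0 : ∀ η → cf η 0ₛ ≈ 0#
 cf-0 η = at (Lin.zer (tt η)) []

 τ-one : ∀ k → (τ (suc k) $ one) ≈ₛ 0ₛ
 τ-one k = pt λ w → cancel-nat k _ (trans (at (τ-conv k one) w) (trans (fn-conv idˡ _ k w) (convK-zero k (λ l j _ → *-zeroʳ′ (at (transₛ (symₛ (τ-δ l j one)) (transₛ (Lin.cong (τ l) (δ-one j)) (Lin.zer (τ l)))) w)))))

 cf-one : ∀ η → cf η one ≈ nat (if foldr (λ c acc → does (c ℕ.≟ 0) ∧ acc) true η then 1 else 0)
 cf-one [] = sym (+-identityʳ 1#)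
 cf-one (zero ∷ η) = trans (cf-congₛ η (τ0 one)) (cf-one η)
 cf-one (suc k ∷ η) = trans (cf-congₛ η (τ-one k)) (cf-0 η)

 σ-zero : ∀ {F} m → F ≈ₕ 0ₕ → σfn F m ≈ₛ 0ₛ
 σ-zero zero e = atₙ e 0
 σ-zero (suc m) e = transₛ (+ₛ-cong (transₛ (Lin.cong (τ (suc m)) (atₙ e 0)) (Lin.zer (τ (suc m)))) (σ-zero m (ptₙ λ i → atₙ e (suc i)))) (+ₛ-identityʳ _)

 σ-sing : ∀ i m f → (d : Dec (i ℕ.≤ m)) → σfn (sing i $ f) m ≈ₛ (if does d then τ (m ℕ.∸ i) $ f else 0ₛ)
 σ-sing zero zero f (yes _) = symₛ (τ0 f)
 σ-sing zero (suc m) f (yes _) = transₛ (+ₛ-congˡ (σ-zero {S* $ (vac $ f)} m (ptₙ λ i → reflₛ))) (+ₛ-identityʳ _)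
 σ-sing zero m f (no n) = contradiction ℕ.z≤n n
 σ-sing (suc i) zero f (no _) = reflₛ
 σ-sing (suc i) (suc m) f (yes (ℕ.s≤s le)) = transₛ (+ₛ-cong (Lin.zer (τ (suc m))) (σ-sing i m f (yes le))) (+ₛ-identityˡ _)
 σ-sing (suc i) (suc m) f (no n) = transₛ (+ₛ-cong (Lin.zer (τ (suc m))) (σ-sing i m f (no (λ le → n (ℕ.s≤s le))))) (+ₛ-identityˡ _)

 R-sing : ∀ i k f → (d : Dec (suc i ℕ.≤ k)) → R k (sing (suc i) $ f) ≈ₛ (if does d then τ (k ℕ.∸ suc i) $ f else 0ₛ)
 R-sing i zero f (no _) = reflₛ
 R-sing i (suc k) f (yes (ℕ.s≤s le)) = σ-sing i k f (yes le)
 R-sing i (suc k) f (no n) = σ-sing i k f (no (λ le → n (ℕ.s≤s le)))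

 τ-pₘ : ∀ i k f → (d : Dec (suc i ℕ.≤ k)) → (τ k $ (pₘ i $ f)) ≈ₛ ((pₘ i $ (τ k $ f)) +ₛ (if does d then τ (k ℕ.∸ suc i) $ f else 0ₛ))
 τ-pₘ i k f d = transₛ (τΘ k (sing (suc i) $ f)) (+ₛ-cong (Lin.cong Θ (lift-sg (τ k) (suc i) f)) (R-sing i k f d))

 cf-if : ∀ {P : Set} η (d : Dec P) f → cf η (if does d then f else 0ₛ) ≈ (if does d then cf η f else 0#)
 cf-if η (yes _) f = refl
 cf-if η (no _) f = cf-0 η

 -- p_{i+1} is the sum of the powers x_j^{i+1}, so each variable with a large enough exponent may
 -- supply the factor. This is the recursion of `countMaps`.
 cf-pₘ : ∀ i η f → cf η (pₘ i $ f) ≈ sumK (upTo (length η)) (λ j → if does (suc i ℕ.≤? getAt η j) then cf (subAt j (suc i) η) f else 0#)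
 cf-pₘ i [] f = refl
 cf-pₘ i (k ∷ η) f = begin
  cf η (τ k $ (pₘ i $ f)) ≈⟨ trans (cf-congₛ η (τ-pₘ i k f (suc i ℕ.≤? k))) (cf-add η _ _) ⟩
  cf η (pₘ i $ (τ k $ f)) + cf η (if does (suc i ℕ.≤? k) then τ (k ℕ.∸ suc i) $ f else 0ₛ) ≈⟨ +-cong (cf-pₘ i η (τ k $ f)) (cf-if η (suc i ℕ.≤? k) (τ (k ℕ.∸ suc i) $ f)) ⟩
  sumK (upTo (length η)) (λ j → G (suc j)) + G 0 ≈⟨ +-comm _ _ ⟩
  G 0 + sumK (upTo (length η)) (λ j → G (suc j)) ≈⟨ +-congˡ (sym (sumK-map suc (upTo (length η)) G)) ⟩
  sumK (0 ∷ map suc (upTo (length η))) G ≡⟨ P.cong (λ l → sumK l G) (P.sym (upTo-suc (length η))) ⟩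
  sumK (upTo (suc (length η))) G ∎
  where
  G : ℕ → Carrier
  G j = if does (suc i ℕ.≤? getAt (k ∷ η) j) then cf (subAt j (suc i) (k ∷ η)) f else 0#

 nat-sum : ∀ {X : Set} (g : X → ℕ) xs → nat (sumℕ (map g xs)) ≈ sumK xs (λ x → nat (g x))
 nat-sum g [] = refl
 nat-sum g (x ∷ xs) = trans (nat-+ (g x) _) (+-congˡ (nat-sum g xs))

 cf-Mon : ∀ {ρ} → Parts ρ → ∀ η → cf η (Mon ρ) ≈ nat (countMaps ρ η)
 cf-Mon [] η = cf-one η
 cf-Mon {suc i ∷ ρ} (_ ∷ ps) η = trans (cf-pₘ i η (Mon ρ)) (trans (sumK-cong (upTo (length η)) (λ j → pick j (suc i ℕ.≤? getAt η j)))
   (sym (nat-sum (λ j → if does (suc i ℕ.≤? getAt η j) then countMaps ρ (subAt j (suc i) η) else 0) (upTo (length η)))))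
  where
  pick : ∀ j (d : Dec (suc i ℕ.≤ getAt η j)) → (if does d then cf (subAt j (suc i) η) (Mon ρ) else 0#) ≈ nat (if does d then countMaps ρ (subAt j (suc i) η) else 0)
  pick j (yes _) = cf-Mon ps (subAt j (suc i) η)
  pick j (no _) = refl

 mcoeff-cf : ∀ {F} → WF F → ∀ η → κ (mcoeff F η) ≈ cf η ⟦ F ⟧
 mcoeff-cf [] η = trans κ-0 (sym (cf-0 η))
 mcoeff-cf {(c , ρ) ∷ F} ((ps , _) ∷ wf) η = trans (κ-+ _ _) (trans (+-cong (trans (κ-* c (fromℕ (countMaps ρ η))) (trans (*-congˡ (trans (κ-ℕ (countMaps ρ η)) (sym (cf-Mon ps η)))) (sym (cf-scal η (κ c) (Mon ρ))))) (mcoeff-cf wf η)) (sym (cf-add η _ _)))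

 αprod : List ℕ → Carrier
 αprod [] = 1#
 αprod (x ∷ ρ) = (α * nat x) * αprod ρ

 ipH-sing : ∀ k m f G → ipH (k ℕ.+ m) (sing k $ f) G ≈ ip m f (G k)
 ipH-sing zero m f G = trans (ipH-sym m (vac $ f) G) (trans (ipH-vac m G f) (ip-sym m (G 0) f))
 ipH-sing (suc k) m f G = trans (+-cong (ip-0ˡ (suc (k ℕ.+ m)) (G 0)) (ipH-sing k m f (S* $ G))) (+-identityˡ _)

 ip-Mon : ∀ {ρ} → Parts ρ → ∀ g → ip (D.size ρ) (Mon ρ) g ≈ αprod ρ * fn g (word ρ)
 ip-Mon [] g = refl
 ip-Mon {suc i ∷ ρ} (_ ∷ ps) g = begin
  ip (suc i ℕ.+ D.size ρ) (pₘ i $ Mon ρ) g ≈⟨ Θ-adjoint (suc i ℕ.+ D.size ρ) (sing (suc i) $ Mon ρ) g ⟩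
  ipH (suc i ℕ.+ D.size ρ) (sing (suc i) $ Mon ρ) (a $ g) ≈⟨ ipH-sing (suc i) (D.size ρ) (Mon ρ) (a $ g) ⟩
  ip (D.size ρ) (Mon ρ) (afn g (suc i)) ≈⟨ ip-scalʳ (D.size ρ) (α * nat (suc i)) (Mon ρ) (δ i $ g) ⟩
  (α * nat (suc i)) * ip (D.size ρ) (Mon ρ) (δ i $ g) ≈⟨ *-congˡ (ip-Mon ps (δ i $ g)) ⟩
  (α * nat (suc i)) * (αprod ρ * fn g (i ∷ word ρ)) ≈⟨ sym (*-assoc _ _ _) ⟩
  ((α * nat (suc i)) * αprod ρ) * fn g (i ∷ word ρ) ∎

 Mon-van : ∀ ρ d → d ≢ D.size ρ → Vanₛ d (Mon ρ)
 Mon-van ρ d ne = vanₛ λ w e → trans (at (Mon-monomial ρ) w) (monomial-miss w (peOf ρ) (λ h → ne (P.trans (P.sym e) (P.trans (P.sym (size-suc w)) (P.trans (P.sym (pdeg-match (map suc w) (peOf ρ) h)) (pdeg-match ρ (peOf ρ) (match-peOf ρ)))))))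

 prodℕ : List ℕ → ℕ
 prodℕ [] = 1
 prodℕ (x ∷ ρ) = x ℕ.* prodℕ ρ

 mfℕ : List ℕ → ℕ
 mfℕ [] = 1
 mfℕ (x ∷ ρ) = suc (mult x ρ) ℕ.* mfℕ ρ

 -- The range of the product is made independent of ρ, so that parts can be removed from ρ one at a
 -- time.
 zeeOver : List ℕ → List ℕ → ℕ
 zeeOver L ρ = foldr (λ i acc → ((mult i ρ) !) ℕ.* (i ℕ.^ mult i ρ) ℕ.* acc) 1 L

 zee-skip : ∀ {x} ρ L → x ∉ L → zeeOver L (x ∷ ρ) ≡ zeeOver L ρ
 zee-skip ρ [] nx = P.refl
 zee-skip {x} ρ (i ∷ L) nx = P.cong₂ (λ m z → (m !) ℕ.* (i ℕ.^ m) ℕ.* z) (mult-there {i} {x} ρ (λ e → nx (here e))) (zee-skip ρ L (λ p → nx (there p)))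

 zee-cons : ∀ {x} ρ L → Unique L → x ∈ L → zeeOver L (x ∷ ρ) ≡ (x ℕ.* suc (mult x ρ)) ℕ.* zeeOver L ρ
 zee-cons {x} ρ (.x ∷ L) (u ∷ us) (here P.refl) = P.trans (P.cong₂ (λ m z → (m !) ℕ.* (x ℕ.^ m) ℕ.* z) (mult-here x ρ) (zee-skip ρ L (λ p → All.lookup u p P.refl)))
   (step′ (suc (mult x ρ)) ((mult x ρ) !) x (x ℕ.^ mult x ρ) (zeeOver L ρ))
  where
  open import Data.Nat.Solver using (module +-*-Solver)
  step′ : ∀ s f x p z → (s ℕ.* f) ℕ.* (x ℕ.* p) ℕ.* z ≡ (x ℕ.* s) ℕ.* (f ℕ.* p ℕ.* z)
  step′ = +-*-Solver.solve 5 (λ s f x p z → (s :*′ f) :*′ (x :*′ p) :*′ z :=′ (x :*′ s) :*′ (f :*′ p :*′ z)) P.refl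
   where open +-*-Solver using () renaming (_:*_ to _:*′_; _:=_ to _:=′_)
 zee-cons {x} ρ (i ∷ L) (u ∷ us) (there p) = P.trans (P.cong₂ (λ m z → (m !) ℕ.* (i ℕ.^ m) ℕ.* z) (mult-there {i} {x} ρ (λ e → All.lookup u p (P.sym e))) (zee-cons ρ L us p))
   (step′ ((mult i ρ) !) (i ℕ.^ mult i ρ) (x ℕ.* suc (mult x ρ)) (zeeOver L ρ))
  where
  open import Data.Nat.Solver using (module +-*-Solver)
  step′ : ∀ f p s z → f ℕ.* p ℕ.* (s ℕ.* z) ≡ s ℕ.* (f ℕ.* p ℕ.* z)
  step′ = +-*-Solver.solve 4 (λ f p s z → f :*′ p :*′ (s :*′ z) :=′ s :*′ (f :*′ p :*′ z)) P.refl
   where open +-*-Solver using () renaming (_:*_ to _:*′_; _:=_ to _:=′_)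

 zee-product : ∀ {ρ} L → Unique L → All (_∈ L) ρ → zeeOver L ρ ≡ prodℕ ρ ℕ.* mfℕ ρ
 zee-product {[]} L u [] = empty L
  where
  empty : ∀ L → zeeOver L [] ≡ 1
  empty [] = P.refl
  empty (i ∷ L) = P.cong (λ z → 1 ℕ.* 1 ℕ.* z) (empty L)
 zee-product {x ∷ ρ} L u (p ∷ ps) = P.trans (zee-cons ρ L u p) (P.trans (P.cong ((x ℕ.* suc (mult x ρ)) ℕ.*_) (zee-product L u ps)) (NP.[m*n]*[o*p]≡[m*o]*[n*p] x (suc (mult x ρ)) (prodℕ ρ) (mfℕ ρ)))

 zee≡ : ∀ {ρ} → Parts ρ → zee ρ ≡ prodℕ ρ ℕ.* mfℕ ρ
 zee≡ {ρ} ps = zee-product (range1 (D.size ρ)) (Unique.map⁺ NP.suc-injective (Unique.upTo⁺ (D.size ρ))) (within ps NP.≤-refl)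
  where
  within : ∀ {ξ M} → Parts ξ → D.size ξ ℕ.≤ M → All (_∈ range1 M) ξ
  within [] le = []
  within {suc x ∷ ξ} (_ ∷ ps) le = ∈-map⁺ suc (∈-upTo⁺ (NP.≤-trans (NP.m≤m+n (suc x) (D.size ξ)) le)) ∷ within ps (NP.≤-trans (NP.m≤n+m _ (suc x)) le)

 mfact-ℕ : ∀ {ρ} → Parts ρ → mfact (word ρ) ≈ nat (mfℕ ρ)
 mfact-ℕ [] = sym (+-identityʳ 1#)
 mfact-ℕ {suc x ∷ ρ} (_ ∷ ps) = trans (*-cong (reflexive (P.cong (λ ξ → nat (suc (mult (suc x) ξ))) (suc-word ps))) (mfact-ℕ ps)) (sym (nat-* (suc (mult (suc x) ρ)) (mfℕ ρ)))

 αprod-ℕ : ∀ ρ → αprod ρ ≈ κ (αq ^q length ρ) * nat (prodℕ ρ)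
 αprod-ℕ [] = sym (trans (*-cong κ-1 (+-identityʳ 1#)) (*-identityˡ 1#))
 αprod-ℕ (x ∷ ρ) = trans (*-congˡ (αprod-ℕ ρ)) (trans (solve 4 (λ a n k p → (a :* n) :* (k :* p) := (a :* k) :* (n :* p)) refl α (nat x) (κ (αq ^q length ρ)) (nat (prodℕ ρ)))
  (*-cong (sym (trans (κ-* αq (αq ^q length ρ)) (*-congʳ κ-α))) (sym (nat-* x (prodℕ ρ)))))

 norm-value : ∀ {ρ} → Parts ρ → κ (αq ^q length ρ) * nat (zee ρ) ≈ αprod ρ * mfact (word ρ)
 norm-value {ρ} ps = trans (*-congˡ (trans (reflexive (P.cong nat (zee≡ ps))) (nat-* (prodℕ ρ) (mfℕ ρ)))) (trans (sym (*-assoc _ _ _)) (*-cong (sym (αprod-ℕ ρ)) (sym (mfact-ℕ ps))))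

 κ-sum-++ : ∀ xs ys → κ (sumq (xs ++ ys)) ≈ κ (sumq xs) + κ (sumq ys)
 κ-sum-++ [] ys = sym (trans (+-congʳ κ-0) (+-identityˡ _))
 κ-sum-++ (x ∷ xs) ys = trans (κ-+ x (sumq (xs ++ ys))) (trans (+-congˡ (κ-sum-++ xs ys)) (trans (sym (+-assoc _ _ _)) (+-congʳ (sym (κ-+ x (sumq xs))))))

 innerRow : Qα × List ℕ → SymF → List Qα
 innerRow e G = map (λ e′ → if proj₂ e ==L proj₂ e′ then proj₁ e *q proj₁ e′ *q (αq ^q length (proj₂ e)) *q fromℕ (zee (proj₂ e)) else 0q) G

 inner-row : ∀ c {ρ} {G} → IsPartition ρ → WF G → κ (sumq (innerRow (c , ρ) G)) ≈ κ c * (αprod ρ * fn ⟦ G ⟧ (word ρ))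
 inner-row c {ρ} {[]} pρ [] = trans κ-0 (sym (*-zeroʳ′ (zeroʳ _)))
 inner-row c {ρ} {(d , σ) ∷ G} pρ (pσ ∷ wf) = trans (κ-+ _ _) (trans (+-cong (pick (LP.≡-dec ℕ._≟_ ρ σ)) (inner-row c pρ wf))
   (solve 4 (λ c p x y → c :* (p :* x) :+ c :* (p :* y) := c :* (p :* (x :+ y))) refl (κ c) (αprod ρ) (κ d * fn (Mon σ) (word ρ)) (fn ⟦ G ⟧ (word ρ))))
  where
  pick : (q : Dec (ρ ≡ σ)) → κ (if does q then c *q d *q (αq ^q length ρ) *q fromℕ (zee ρ) else 0q) ≈ κ c * (αprod ρ * (κ d * fn (Mon σ) (word ρ)))
  pick (yes P.refl) = begin
   κ (c *q d *q (αq ^q length ρ) *q fromℕ (zee ρ)) ≈⟨ trans (κ-* _ _) (*-cong (trans (κ-* _ _) (*-congʳ (κ-* c d))) (κ-ℕ (zee ρ))) ⟩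
   κ c * κ d * κ (αq ^q length ρ) * nat (zee ρ) ≈⟨ *-assoc _ _ _ ⟩
   κ c * κ d * (κ (αq ^q length ρ) * nat (zee ρ)) ≈⟨ *-congˡ (norm-value (proj₁ pρ)) ⟩
   κ c * κ d * (αprod ρ * mfact (word ρ)) ≈⟨ solve 4 (λ c d p m → c :* d :* (p :* m) := c :* (p :* (d :* m))) refl (κ c) (κ d) (αprod ρ) (mfact (word ρ)) ⟩
   κ c * (αprod ρ * (κ d * mfact (word ρ))) ≈⟨ *-congˡ (*-congˡ (*-congˡ (sym (Mon-same (proj₁ pρ))))) ⟩
   κ c * (αprod ρ * (κ d * fn (Mon ρ) (word ρ))) ∎
  pick (no ne) = trans κ-0 (sym (trans (*-congˡ (*-congˡ (*-zeroʳ′ (Mon-other pσ pρ (λ e → ne (P.sym e)))))) (*-zeroʳ′ (zeroʳ _))))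

 -- Terms of F of other degrees contribute to neither side because G vanishes there.
 inner-ip : ∀ n {F G} → WF F → WF G → (∀ d → d ≢ n → Vanₛ d ⟦ G ⟧) → κ (inner F G) ≈ ip n ⟦ F ⟧ ⟦ G ⟧
 inner-ip n {[]} [] wg hv = trans κ-0 (sym (ip-0ˡ n _))
 inner-ip n {(c , ρ) ∷ F} {G} (pρ ∷ wf) wg hv = trans (κ-sum-++ (innerRow (c , ρ) G) (concatMap (λ e → innerRow e G) F)) (trans (+-cong (trans (inner-row c pρ wg) (pick (D.size ρ ℕ.≟ n))) (inner-ip n wf wg hv)) (sym (ip-addˡ n _ _ _)))
  where
  pick : Dec (D.size ρ ≡ n) → κ c * (αprod ρ * fn ⟦ G ⟧ (word ρ)) ≈ ip n (κ c *ₛ Mon ρ) ⟦ G ⟧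
  pick (yes P.refl) = sym (trans (ip-scalˡ n (κ c) (Mon ρ) ⟦ G ⟧) (*-congˡ (ip-Mon (proj₁ pρ) ⟦ G ⟧)))
  pick (no ne) = trans (*-congˡ (*-zeroʳ′ (vatₛ (hv (D.size ρ) ne) (word ρ) (wt-word (proj₁ pρ))))) (trans (zeroʳ _)
   (sym (trans (ip-scalˡ n (κ c) (Mon ρ) ⟦ G ⟧) (*-zeroʳ′ (ip-van ⟦ G ⟧ (Mon-van ρ n (λ e → ne (P.sym e))))))))

-- Jack functions as eigenvectors of the I_k.

module JackFunctions (K : Scalars) (Q : Terms.Coefficients K) (J : List ℕ → D.SymF) (isJ : D.IsJackFamily J) where
 open D hiding (_≈_; size; pv; bnd; splits)
 open Linear K
 open Series K hiding (P)
 open Translation K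
 open Tau K using (τ; τ0)
 open Triangularity K
 open InnerProduct K
 open Terms K
 open Coefficients Q
 open Extraction K Q
 open Comb using (Descending; module Heights)
 open SymmetricFunctions K Q
 open IsJackFamily isJ
 open import Data.Nat.Combinatorics using (_C_)
 open import Data.List.Membership.Propositional using (find; lose)
 open import Data.List.Relation.Unary.Any as Any using (Any; any?)
 open import Relation.Nullary.Decidable using (map′)

 Jack : List ℕ → Sym
 Jack la = ⟦ J la ⟧

 cf-sort : ∀ η f → cf η f ≈ cf (Comb.sort η) f
 cf-sort [] f = refl
 cf-sort (zero ∷ η) f = trans (cf-congₛ η (τ0 f)) (cf-sort η f)
 cf-sort (suc x ∷ η) f = trans (cf-sort η (τ (suc x) $ f)) (cf-perm (Comb.insert-↭ (suc x) (Comb.sort η)) f)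

 Jack-tri : ∀ {la} → IsPartition la → ∀ η → ¬ (D.size η ≡ D.size la × Dominated (Comb.sort η) la) → cf η (Jack la) ≈ 0#
 Jack-tri {la} p η n = trans (cf-sort η (Jack la)) (trans (sym (mcoeff-cf (wellFormed la p) (Comb.sort η))) (trans (κ-cong {mcoeff (J la) (Comb.sort η)} {0q} (triangular la (Comb.sort η) p (Comb.sort-partition η) (λ (e , d) → n (P.trans (P.sym (Comb.size-sort η)) e , d)))) κ-0))

 Jack-van : ∀ {la} → IsPartition la → ∀ d → d ≢ D.size la → Vanₛ d (Jack la)
 Jack-van {la} p d ne = null-vanishes d (Jack la) (λ η e → Jack-tri p η (λ (e′ , _) → ne (P.trans (P.sym e) (P.trans (P.sym (size≡ η)) e′))))

 ones-partition : ∀ n → IsPartition (replicate n 1)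
 ones-partition n = AllP.replicate⁺ n (ℕ.s≤s ℕ.z≤n) , sorted n
  where
  sorted : ∀ n → Descending (replicate n 1)
  sorted zero = []
  sorted (suc zero) = [-]
  sorted (suc (suc n)) = NP.≤-refl ∷ sorted (suc n)

 size-ones : ∀ n → D.size (replicate n 1) ≡ n
 size-ones zero = P.refl
 size-ones (suc n) = P.cong suc (size-ones n)

 -- By definiteness a zero norm would make all values vanish, among them the one given by the
 -- coefficient of p₁^n, which is normalised to 1.
 Jack-norm : ∀ {la} → IsPartition la → ¬ (ip (D.size la) (Jack la) (Jack la) ≈ 0#)
 Jack-norm {la} p e = 1≉0 (trans (sym (imfact* w)) (*-zeroʳ′ (trans (sym (trans (*-congʳ (trans (κ-cong {pcoeff (J la) ones} {1q} (normalised la p)) κ-1)) (*-identityˡ _))) (trans (pcoeff-fn (wellFormed la p) (ones-partition n))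
   (ip-definite (Jack la) w (P.subst (λ m → ip m (Jack la) (Jack la) ≈ 0#) (P.sym (P.trans (wt-word (proj₁ (ones-partition n))) (size-ones n))) e))))))
  where
  n = D.size la
  ones = replicate n 1
  w = word ones

 Ix : ℕ → Set
 Ix n = Σ (List ℕ) λ ξ → IsPartition ξ × D.size ξ ≡ n

 Ix-≡ : ∀ {n} {κ μ : Ix n} → proj₁ κ ≡ proj₁ μ → κ ≡ μ
 Ix-≡ {n} {ξ , (ps , d) , e} {.ξ , (ps′ , d′) , e′} P.refl = P.cong₂ (λ q e → ξ , q , e) (P.cong₂ _,_ (All.irrelevant NP.≤-irrelevant ps ps′) (Linked.irrelevant NP.≤-irrelevant d d′)) (NP.≡-irrelevant e e′)

 -- The base n + 2 of the heights is adapted to partitions of n, so each degree has its own flag.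
 module Degree (n : ℕ) where
  open Heights n using (ψ; ψ-spread; φ-injective; φ-dominated) renaming (φ to height)
  open Triangular ψ ψ-spread using (φ; I; Triₛ) public

  φ≡ : ∀ η → φ η ≡ height η
  φ≡ [] = P.refl
  φ≡ (x ∷ η) = P.cong (ψ x ℕ.+_) (φ≡ η)

  φ-↭ : ∀ {ξ ζ} → ξ ↭ ζ → φ ξ ≡ φ ζ
  φ-↭ Perm.refl = P.refl
  φ-↭ (prep x p) = P.cong (ψ x ℕ.+_) (φ-↭ p)
  φ-↭ (swap {xs} {ys} x y p) = P.trans (P.cong (λ s → ψ x ℕ.+ (ψ y ℕ.+ s)) (φ-↭ p)) (swap-in (ψ x) (ψ y) (φ ys))
  φ-↭ (Perm.trans p q) = P.trans (φ-↭ p) (φ-↭ q)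

  φ-sort : ∀ η → φ (Comb.sort η) ≡ φ η
  φ-sort [] = P.refl
  φ-sort (zero ∷ η) = φ-sort η
  φ-sort (suc x ∷ η) = P.trans (P.sym (φ-↭ (Comb.insert-↭ (suc x) (Comb.sort η)))) (P.cong (ψ (suc x) ℕ.+_) (φ-sort η))

  sortedIx : ∀ η → size η ≡ n → Ix n
  sortedIx η e = Comb.sort η , Comb.sort-partition η , P.trans (Comb.size-sort η) (P.trans (size≡ η) e)

  search : ∀ v → Dec (Σ (Ix n) λ κ → φ (proj₁ κ) ≡ v)
  search v = map′ found missing (any? (λ ξ → φ ξ ℕ.≟ v) (partitionsOf n))
   where
   found : Any (λ ξ → φ ξ ≡ v) (partitionsOf n) → Σ (Ix n) λ κ → φ (proj₁ κ) ≡ v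
   found h with find h
   ... | ξ , mem , e = (ξ , All.lookup (Comb.partitionsOf-sound n) mem) , e
   missing : (Σ (Ix n) λ κ → φ (proj₁ κ) ≡ v) → Any (λ ξ → φ ξ ≡ v) (partitionsOf n)
   missing ((ξ , p , P.refl) , e) = lose (Comb.partitionsOf-complete ξ p) e

  _≟ᴵ_ : (κ μ : Ix n) → Dec (κ ≡ μ)
  κ ≟ᴵ μ = map′ Ix-≡ (P.cong proj₁) (LP.≡-dec ℕ._≟_ (proj₁ κ) (proj₁ μ))

  J-tri : ∀ (κ : Ix n) → Triₛ n (suc (φ (proj₁ κ))) (Jack (proj₁ κ))
  J-tri (ξ , p , e) η eη le = Jack-tri p η (λ (e′ , dom) → NP.<-irrefl P.refl (NP.<-≤-trans le (NP.≤-trans (NP.≤-reflexive (P.trans (P.sym (φ-sort η)) (φ≡ (Comb.sort η))))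
   (NP.≤-trans (φ-dominated (Comb.sort-partition η) p (P.trans (Comb.size-sort η) e′) (NP.≤-reflexive (P.trans (Comb.size-sort η) (P.trans (size≡ η) eη))) dom) (NP.≤-reflexive (P.sym (φ≡ ξ)))))))

  J-orth : ∀ (κ μ : Ix n) → κ ≢ μ → ip n (Jack (proj₁ κ)) (Jack (proj₁ μ)) ≈ 0#
  J-orth (ξ , p , e) (μ , q , e′) ne = trans (sym (inner-ip n (wellFormed ξ p) (wellFormed μ q) (λ d ned → Jack-van q d (λ eq → ned (P.trans eq e′)))))
   (trans (κ-cong {inner (J ξ) (J μ)} {0q} (orthogonal ξ μ p q (λ eq → ne (Ix-≡ eq)))) κ-0)

  J-norm : ∀ (κ : Ix n) → ¬ (ip n (Jack (proj₁ κ)) (Jack (proj₁ κ)) ≈ 0#)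
  J-norm (ξ , p , e) = P.subst (λ m → ¬ (ip m (Jack ξ) (Jack ξ) ≈ 0#)) e (Jack-norm p)

  ht-inj : ∀ (κ μ : Ix n) → φ (proj₁ κ) ≡ φ (proj₁ μ) → κ ≡ μ
  ht-inj (ξ , p , e) (μ , q , e′) h = Ix-≡ (φ-injective p q (P.trans e (P.sym e′)) (NP.≤-reflexive e) (P.trans (P.sym (φ≡ ξ)) (P.trans h (φ≡ μ))))

  module G = GramSchmidt ψ P.refl ψ-spread n (Ix n) proj₁ (λ κ → P.trans (P.sym (size≡ (proj₁ κ))) (proj₂ (proj₂ κ)))

  sorted : ∀ η → size η ≡ n → Σ (Ix n) λ κ → (φ (proj₁ κ) ≡ φ η) × (∀ f → cf η f ≈ cf (proj₁ κ) f)
  sorted η e = sortedIx η e , φ-sort η , cf-sort η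

  Functional : Set
  Functional = G.Functional _≟ᴵ_ search sorted ht-inj (λ κ → Jack (proj₁ κ)) J-tri J-orth J-norm

  eigen : ∀ k (κ : Ix n) → Σ Carrier λ e → ∀ w → wt w ≡ n → fn (I k $ Jack (proj₁ κ)) w ≈ e * fn (Jack (proj₁ κ)) w
  eigen = G.eigenvector _≟ᴵ_ search sorted ht-inj (λ κ → Jack (proj₁ κ)) J-tri J-orth J-norm

  heightBound : ℕ
  heightBound = suc (n ℕ.* ψ n)

  bounded : ∀ η → size η ≡ n → φ η ℕ.< heightBound
  bounded η e = ℕ.s≤s (NP.≤-trans (NP.≤-reflexive (P.trans (P.sym (φ-sort η)) (φ≡ (Comb.sort η)))) (NP.≤-trans (Heights.φ-desc n (top (Comb.sort-partition η) (NP.≤-reflexive sz)))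
    (NP.*-monoˡ-≤ (ψ n) (NP.≤-trans (Heights.length≤size n (proj₁ (Comb.sort-partition η))) (NP.≤-reflexive sz)))))
   where
   sz = P.trans (Comb.size-sort η) (P.trans (size≡ η) e)
   top : ∀ {ξ} → IsPartition ξ → D.size ξ ℕ.≤ n → Descending (n ∷ ξ)
   top {[]} p le = [-]
   top {x ∷ ξ} (ps , d) le = NP.≤-trans (NP.m≤m+n x (D.size ξ)) le ∷ d

  span : (Ψ : Functional) → (∀ (κ : Ix n) → G.Functional.ψf Ψ (Jack (proj₁ κ)) ≈ 0#) → ∀ f → G.Functional.ψf Ψ f ≈ 0#
  span = G.spanning _≟ᴵ_ search sorted ht-inj (λ κ → Jack (proj₁ κ)) J-tri J-orth J-norm heightBound bounded

-- Jack characters as values of translated Jack functions.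

module JackCharacters (K : Scalars) (Q : Terms.Coefficients K) (J : List ℕ → D.SymF) (isJ : D.IsJackFamily J) where
 open D hiding (_≈_; size; pv; bnd; splits)
 open Linear K
 open Series K hiding (P)
 open COperators K hiding (C)
 open Translation K
 open Triangularity K
 open InnerProduct K
 open Products K
 open Expansion K
 open Terms K
 open Coefficients Q
 open Extraction K Q
 open Comb using (Descending)
 open SymmetricFunctions K Q
 open JackFunctions K Q J isJ
 open IsJackFamily isJ
 open import Data.Nat using (_!; _∸_)
 open import Data.Nat.Combinatorics using (_C_)

 mult-cons : ∀ i x {ξ ζ} → mult i ξ ≡ mult i ζ → mult i (x ∷ ξ) ≡ mult i (x ∷ ζ)
 mult-cons i x {ξ} {ζ} e with x ℕ.≟ i
 ... | yes P.refl = P.trans (mult-here x ξ) (P.trans (P.cong suc e) (P.sym (mult-here x ζ)))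
 ... | no ne = P.trans (mult-there {i} {x} ξ ne) (P.trans e (P.sym (mult-there {i} {x} ζ ne)))

 mult-swap : ∀ i x y ξ → mult i (x ∷ y ∷ ξ) ≡ mult i (y ∷ x ∷ ξ)
 mult-swap i x y ξ with x ℕ.≟ i | y ℕ.≟ i
 ... | yes P.refl | yes P.refl = P.refl
 ... | yes P.refl | no ne = P.trans (mult-here i (y ∷ ξ)) (P.trans (P.cong suc (mult-there {i} {y} ξ ne)) (P.sym (P.trans (mult-there {i} {y} (i ∷ ξ) ne) (mult-here i ξ))))
 ... | no ne | yes P.refl = P.trans (P.trans (mult-there {i} {x} (i ∷ ξ) ne) (mult-here i ξ)) (P.sym (P.trans (mult-here i (x ∷ ξ)) (P.cong suc (mult-there {i} {x} ξ ne))))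
 ... | no ne | no ne′ = P.trans (P.trans (mult-there {i} {x} (y ∷ ξ) ne) (mult-there {i} {y} ξ ne′)) (P.sym (P.trans (mult-there {i} {y} (x ∷ ξ) ne′) (mult-there {i} {x} ξ ne)))

 mult-↭ : ∀ i {ξ ζ} → ξ ↭ ζ → mult i ξ ≡ mult i ζ
 mult-↭ i Perm.refl = P.refl
 mult-↭ i (prep {ξ} {ζ} x p) = mult-cons i x {ξ} {ζ} (mult-↭ i p)
 mult-↭ i (swap {ξ} {ζ} x y p) = P.trans (mult-swap i x y ξ) (mult-cons i y {x ∷ ξ} {x ∷ ζ} (mult-cons i x {ξ} {ζ} (mult-↭ i p)))
 mult-↭ i (Perm.trans p q) = P.trans (mult-↭ i p) (mult-↭ i q)

 -- Π m_i! is the value of a monomial at its word, and such values do not depend on the order of the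
 -- letters.
 mfact-resp : ∀ {v w} → v ↭ w → mfact v ≈ mfact w
 mfact-resp {v} {w} p = trans (sym (monomial-hit v ex (match-peOf (map suc v)))) (trans (resp (monomial ex) p) (monomial-hit w ex (λ i → P.trans (match-peOf (map suc v) i) (mult-↭ i (PermP.map⁺ suc p)))))
  where
  open Monomials K using (monomial)
  ex = peOf (map suc v)

 mult-zeros : ∀ r w → mult 1 (map suc (zeros r w)) ≡ r ℕ.+ mult 1 (map suc w)
 mult-zeros zero w = P.refl
 mult-zeros (suc r) w = P.cong suc (mult-zeros r w)

 mfact-zeros : ∀ r w → mfact (zeros r w) ≈ nat (Comb.rise r (mult 1 (map suc w))) * mfact w
 mfact-zeros zero w = sym (trans (*-congʳ (+-identityʳ 1#)) (*-identityˡ _))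
 mfact-zeros (suc r) w = trans (*-cong (reflexive (P.cong (λ m → nat (suc m)) (mult-zeros r w))) (mfact-zeros r w)) (trans (sym (*-assoc _ _ _)) (*-congʳ (sym (nat-* (suc (r ℕ.+ mult 1 (map suc w))) (Comb.rise r (mult 1 (map suc w)))))))

 ifact! : ∀ r → ifact r * nat (r !) ≈ 1#
 ifact! zero = trans (*-identityˡ _) (+-identityʳ 1#)
 ifact! (suc r) = trans (*-congˡ (nat-* (suc r) (r !))) (trans (solve 4 (λ i f n g → i :* f :* (n :* g) := (i :* n) :* (f :* g)) refl (inv r) (ifact r) (nat (suc r)) (nat (r !))) (trans (*-cong (inv* r) (ifact! r)) (*-identityˡ 1#)))

 ifact-rise : ∀ r m → ifact r * nat (Comb.rise r m) ≈ nat ((r ℕ.+ m) C m)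
 ifact-rise r m = trans (*-congˡ (trans (reflexive (P.cong nat (P.sym (Comb.binomial-rise r m)))) (nat-* ((r ℕ.+ m) C m) (r !)))) (trans (solve 3 (λ i c f → i :* (c :* f) := (i :* f) :* c) refl (ifact r) (nat ((r ℕ.+ m) C m)) (nat (r !))) (trans (*-congʳ (ifact! r)) (*-identityˡ _)))

 cut-above : ∀ {n t} h → n ℕ.< t → cut n t h ≈ 0#
 cut-above {zero} {suc t} h lt = refl
 cut-above {suc n} {suc t} h (ℕ.s≤s lt) = cut-above h lt

 cut-at : ∀ {n t} h → t ℕ.≤ n → cut n t h ≡ h (n ∸ t)
 cut-at {n} {zero} h le = P.refl
 cut-at {suc n} {suc t} h (ℕ.s≤s le) = cut-at h le

 cut-local : ∀ n t {h h′} → (∀ r → r ℕ.+ t ≡ n → h r ≈ h′ r) → cut n t h ≈ cut n t h′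
 cut-local n zero e = e n (NP.+-identityʳ n)
 cut-local zero (suc t) e = refl
 cut-local (suc n) (suc t) e = cut-local n t (λ r eq → e r (P.trans (NP.+-suc r t) (P.cong suc eq)))

 zeros-++ : ∀ r w → zeros r w ≡ replicate r 0 ++ w
 zeros-++ zero w = P.refl
 zeros-++ (suc r) w = P.cong (0 ∷_) (zeros-++ r w)

 wt-zeros : ∀ r w → wt (zeros r w) ≡ r ℕ.+ wt w
 wt-zeros zero w = P.refl
 wt-zeros (suc r) w = P.cong suc (wt-zeros r w)

 word-ones : ∀ r μ → zeros r (word μ) ↭ word (μ ++ replicate r 1)
 word-ones r μ = ↭-trans (Perm.↭-reflexive (zeros-++ r (word μ))) (↭-trans (PermP.++-comm (replicate r 0) (word μ))
  (Perm.↭-reflexive (P.sym (P.trans (LP.map-++ ℕ.pred μ (replicate r 1)) (P.cong (word μ ++_) (LP.map-replicate ℕ.pred r 1))))))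

 append-ones : ∀ {μ} r → IsPartition μ → IsPartition (μ ++ replicate r 1)
 append-ones {μ} r (ps , d) = AllP.++⁺ ps (proj₁ (ones-partition r)) , sorted′ ps d
  where
  sorted′ : ∀ {μ} → Parts μ → Descending μ → Descending (μ ++ replicate r 1)
  sorted′ [] d = proj₂ (ones-partition r)
  sorted′ {x ∷ []} (p ∷ []) d = first r
   where
   first : ∀ r → Descending (x ∷ replicate r 1)
   first zero = [-]
   first (suc r) = p ∷ proj₂ (ones-partition (suc r))
  sorted′ {x ∷ y ∷ μ} (p ∷ ps) (le ∷ d) = le ∷ sorted′ ps d

 -- K^λ, with values θ_μ(λ) · Π m_i(μ)!
 Kvec : List ℕ → Sym
 Kvec la = Translate.T (D.size la) 0 $ Jack la

 -- Appending r = |λ| - |μ| ones to μ multiplies Π m_i! by (m₁+1)...(m₁+r). Together with the 1/r!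
 -- of the translation this is the binomial coefficient in θ.
 θ-value : ∀ {la μ} → IsPartition la → IsPartition μ → fn (Kvec la) (word μ) ≈ κ (θ J μ la) * mfact (word μ)
 θ-value {la} {μ} pla pμ = trans (reflexive (P.cong (λ t → cut n t h) (wt-word (proj₁ pμ)))) (pick (n ℕ.<? D.size μ))
  where
  n = D.size la
  r = n ∸ D.size μ
  m₁ = mult 1 μ
  h : ℕ → Carrier
  h r = ifact r * fn (Jack la) (zeros r (word μ))
  pc = pcoeff (J la) (μ ++ replicate r 1)
  pick : (d : Dec (n ℕ.< D.size μ)) → cut n (D.size μ) h ≈ κ (if does d then 0q else fromℕ ((r ℕ.+ m₁) C m₁) *q pc) * mfact (word μ)
  pick (yes lt) = trans (cut-above h lt) (sym (*-zeroˡ′ κ-0))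
  pick (no nlt) = begin
   cut n (D.size μ) h ≈⟨ reflexive (cut-at h (NP.≮⇒≥ nlt)) ⟩
   ifact r * fn (Jack la) (zeros r (word μ)) ≈⟨ *-congˡ (trans (resp (Jack la) (word-ones r μ)) (sym (pcoeff-fn (wellFormed la pla) (append-ones r pμ)))) ⟩
   ifact r * (κ pc * mfact (word (μ ++ replicate r 1))) ≈⟨ *-congˡ (*-congˡ (trans (sym (mfact-resp (word-ones r μ))) (mfact-zeros r (word μ)))) ⟩
   ifact r * (κ pc * (nat (Comb.rise r (mult 1 (map suc (word μ)))) * mfact (word μ))) ≡⟨ P.cong (λ ξ → ifact r * (κ pc * (nat (Comb.rise r (mult 1 ξ)) * mfact (word μ)))) (suc-word (proj₁ pμ)) ⟩
   ifact r * (κ pc * (nat (Comb.rise r m₁) * mfact (word μ))) ≈⟨ solve 4 (λ i p c m → i :* (p :* (c :* m)) := (i :* c) :* p :* m) refl (ifact r) (κ pc) (nat (Comb.rise r m₁)) (mfact (word μ)) ⟩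
   ifact r * nat (Comb.rise r m₁) * κ pc * mfact (word μ) ≈⟨ *-congʳ (trans (*-congʳ (trans (ifact-rise r m₁) (sym (κ-ℕ ((r ℕ.+ m₁) C m₁))))) (sym (κ-* (fromℕ ((r ℕ.+ m₁) C m₁)) pc))) ⟩
   κ (fromℕ ((r ℕ.+ m₁) C m₁) *q pc) * mfact (word μ) ∎

 θ-from : ∀ {la μ x} → IsPartition la → IsPartition μ → fn (Kvec la) (word μ) ≈ x * mfact (word μ) → κ (θ J μ la) ≈ x
 θ-from {la} {μ} {x} pla pμ e = trans (sym (clear (κ (θ J μ la)))) (trans (*-congˡ (trans (sym (θ-value pla pμ)) e)) (clear x))
  where
  clear : ∀ y → imfact (word μ) * (y * mfact (word μ)) ≈ y
  clear y = trans (solve 3 (λ i y m → i :* (y :* m) := (i :* m) :* y) refl (imfact (word μ)) y (mfact (word μ))) (trans (*-congʳ (imfact* (word μ))) (*-identityˡ y))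

 θ-top : ∀ {la μ} → IsPartition la → IsPartition μ → D.size μ ≡ D.size la → κ (θ J μ la) ≈ imfact (word μ) * fn (Jack la) (word μ)
 θ-top {la} {μ} pla pμ e = θ-from pla pμ (trans (reflexive (P.cong (λ t → cut (D.size la) t h) (P.trans (wt-word (proj₁ pμ)) e))) (trans (same (D.size la)) (trans (*-identityˡ _)
   (sym (trans (solve 3 (λ i y m → (i :* y) :* m := (i :* m) :* y) refl (imfact (word μ)) (fn (Jack la) (word μ)) (mfact (word μ))) (trans (*-congʳ (imfact* (word μ))) (*-identityˡ _)))))))
  where
  h : ℕ → Carrier
  h r = ifact r * fn (Jack la) (zeros r (word μ))
  same : ∀ n → cut n n h ≈ h 0
  same zero = refl
  same (suc n) = same n

 θ-above : ∀ {la μ} → IsPartition la → IsPartition μ → D.size la ℕ.< D.size μ → κ (θ J μ la) ≈ 0#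
 θ-above {la} {μ} pla pμ lt = θ-from pla pμ (trans (cut-above _ (NP.≤-trans lt (NP.≤-reflexive (P.sym (wt-word (proj₁ pμ)))))) (sym (zeroˡ _)))

 -- The translation intertwines I_k with I⁺_k. The Jack function is homogeneous, so its eigenvalue
 -- in degree |λ| serves for all words of the translate.
 Kvec-eigen : ∀ {la} → IsPartition la → Σ (ℕ → Carrier) λ e → ∀ k v → fn (I⁺ k $ Kvec la) v ≈ e k * fn (Kvec la) v
 Kvec-eigen {la} p = (λ k → proj₁ (Degree.eigen n k ix)) , λ k v → trans (sym (at (Translate.T-I n k (Jack la)) v))
   (trans (cut-local n (wt v) (λ r e → trans (*-congˡ (proj₂ (Degree.eigen n k ix) (zeros r v) (P.trans (wt-zeros r v) e))) (solve 3 (λ i e x → i :* (e :* x) := e :* (i :* x)) refl (ifact r) (proj₁ (Degree.eigen n k ix)) (fn (Jack la) (zeros r v)))))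
    (cut-scal n (wt v) (proj₁ (Degree.eigen n k ix)) _))
  where
  n = D.size la
  ix : Ix n
  ix = la , p , P.refl

 Kvec-1 : ∀ {la} → IsPartition la → fn (Kvec la) [] ≈ 1#
 Kvec-1 {la} p = trans (θ-value {la} {[]} p ([] , [])) (trans (*-identityʳ _) (trans (κ-* (fromℕ ((D.size la ℕ.+ 0) C 0)) (pcoeff (J la) (replicate (D.size la) 1))) (trans (*-cong (trans (κ-ℕ ((D.size la ℕ.+ 0) C 0)) one′) (trans (κ-cong {pcoeff (J la) (replicate (D.size la) 1)} {1q} (normalised la p)) κ-1)) (*-identityˡ 1#))))
  where
  one′ : nat ((D.size la ℕ.+ 0) C 0) ≈ 1#
  one′ = trans (sym (ifact-rise (D.size la) 0)) (trans (*-congˡ (reflexive (P.cong nat (P.trans (P.sym (NP.*-identityʳ (Comb.rise (D.size la) 0))) (P.trans (Comb.rise-! (D.size la) 0) (P.cong _! (NP.+-identityʳ (D.size la)))))))) (ifact! (D.size la)))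

 -- θ_μ(λ) is an exponential generating function of the coefficients a^σ_μ, with weights independent of μ.
 θ-expansion : ∀ {la} → IsPartition la → ∀ M → Σ (Vec Carrier M) λ cs → ∀ {μ} → IsPartition μ → D.size μ ℕ.≤ M →
  κ (θ J μ la) ≈ sgnK (D.size μ) * Expectation.𝔼 (suc M) cs (λ σ → κ (aCoef σ μ))
 θ-expansion {la} p M = cs , λ {μ} pμ le → θ-from p pμ (trans (proj₂ ex (word μ) (NP.≤-trans (NP.≤-reflexive (wt-word (proj₁ pμ))) le))
   (trans (𝔼-cong cs (λ σ _ → trans (sym (aCoef-fn σ (proj₁ pμ))) (*-comm _ _))) (trans (𝔼-scal cs _ _) (solve 3 (λ s m x → (s :* m) :* x := s :* x :* m) refl (sgnK (D.size μ)) (mfact (word μ)) _))))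
  where
  open Expectation (suc M)
  ex = expand (Kvec la) (proj₁ (Kvec-eigen p)) (Kvec-1 p) (proj₂ (Kvec-eigen p)) M
  cs = proj₁ ex

-- Inversion of the matrix a and comparison of structure constants.

module StructureConstants (K : Scalars) (Q : Terms.Coefficients K) (J : List ℕ → D.SymF) (isJ : D.IsJackFamily J) where
 open D hiding (_≈_; size; pv; bnd; splits)
 open Linear K
 open Lax K using (sumK; sumK-cong; sumK-zero; sumK-++; sumK-map; sumK-add; sumK-scal)
 open Series K using (sgnK; vatₛ)
 open Products K
 open Expansion K using (sgn²)
 open Monomials K using (upTo-suc)
 open Terms K using (module Coefficients)
 open Coefficients Q
 open Extraction K Q
 open SymmetricFunctions K Q
 open JackFunctions K Q J isJ
 open JackCharacters K Q J isJ
 open import Data.Nat using (_∸_)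
 open import Data.Integer using (+_)
 open import Data.List.Membership.Propositional using (_∈_)
 open import Data.List.Relation.Unary.Any using (here; there)
 open import Relation.Binary.Definitions using (Tri; tri<; tri≈; tri>)

 sumK-0 : {X : Set} (xs : List X) → sumK xs (λ _ → 0#) ≈ 0#
 sumK-0 xs = sumK-zero xs (λ _ → refl)

 module _ {X : Set} where
  sumK-All : ∀ {P : X → Set} {xs : List X} {g h : X → Carrier} → All P xs → (∀ x → P x → g x ≈ h x) → sumK xs g ≈ sumK xs h
  sumK-All [] e = refl
  sumK-All (p ∷ ps) e = +-cong (e _ p) (sumK-All ps e)

  sumK-single : ∀ {xs : List X} {x} g → Unique xs → x ∈ xs → (∀ y → y ≢ x → g y ≈ 0#) → sumK xs g ≈ g x
  sumK-single {y ∷ xs} g (u ∷ us) (here P.refl) z = trans (+-congˡ (trans (sumK-All u (λ x ne → z x (λ e → ne (P.sym e)))) (sumK-0 xs))) (+-identityʳ _)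
  sumK-single {y ∷ xs} g (u ∷ us) (there p) z = trans (+-cong (z y (All.lookup u p)) (sumK-single g us p z)) (+-identityˡ _)

 sumK-exchange : ∀ {X Y : Set} (xs : List X) (ys : List Y) (G : X → Y → Carrier) → sumK xs (λ x → sumK ys (G x)) ≈ sumK ys (λ y → sumK xs (λ x → G x y))
 sumK-exchange [] ys G = sym (sumK-0 ys)
 sumK-exchange (x ∷ xs) ys G = trans (+-congˡ (sumK-exchange xs ys G)) (sym (sumK-add ys (G x) (λ y → sumK xs (λ x → G x y))))

 κ-pow : ∀ n → κ ((-q 1q) ^q n) ≈ sgnK n
 κ-pow zero = κ-1
 κ-pow (suc n) = trans (κ-* (-q 1q) ((-q 1q) ^q n)) (trans (*-cong (trans (κ-neg 1q) (-‿cong κ-1)) (κ-pow n)) (solve 1 (λ x → (:- :1) :* x := :- x) refl (sgnK n)))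

 sgn-∸ : ∀ {m n} → n ℕ.≤ m → sgnK (m ∸ n) ≈ sgnK m * sgnK n
 sgn-∸ {m} {n} le = sym (trans (*-congʳ (trans (reflexive (P.cong sgnK (P.sym (NP.m∸n+n≡m le)))) (sgn-+ (m ∸ n) n))) (trans (*-assoc _ _ _) (trans (*-congˡ (sgn² n)) (*-identityʳ _))))

 module _ (T : ℕ) (A : List ℕ → List ℕ → Carrier) (G : List ℕ → Carrier) (μ ν : List ℕ) (ups : List (List ℕ)) where
  open Expectation T

  -- The product is a double sum over two independent partitions, hence by multiplicativity of the
  -- weights a sum over splittings of one partition, which the hypothesis rewrites through the
  -- columns of A.
  𝔼-product : ∀ {M} (cs : Vec Carrier M) → (∀ σ τ → T ℕ.< Triangularity.size K σ ℕ.+ Triangularity.size K τ → A σ μ * A τ ν ≈ 0#) →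
   (∀ σ → IsPartition σ → sumK (D.splits σ) (λ s → A (proj₁ s) μ * A (proj₂ s) ν) ≈ sumK ups (λ π → A σ π * G π)) →
   𝔼 cs (λ σ → A σ μ) * 𝔼 cs (λ σ → A σ ν) ≈ sumK ups (λ π → G π * 𝔼 cs (λ σ → A σ π))
  𝔼-product cs z e = begin
   𝔼 cs (λ σ → A σ μ) * 𝔼 cs (λ σ → A σ ν) ≈⟨ *-comm _ _ ⟩
   𝔼 cs (λ σ → A σ ν) * 𝔼 cs (λ σ → A σ μ) ≈⟨ trans (sym (𝔼-scal cs _ _)) (𝔼-cong cs (λ σ _ → trans (*-comm _ _) (sym (𝔼-scal cs (A σ μ) _)))) ⟩
   𝔼 cs (λ σ → 𝔼 cs (λ τ → A σ μ * A τ ν)) ≈⟨ sym (𝔼-split cs (λ σ τ → A σ μ * A τ ν) z) ⟩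
   𝔼 cs (λ σ → sumK (D.splits σ) (λ s → A (proj₁ s) μ * A (proj₂ s) ν)) ≈⟨ 𝔼-cong cs (λ σ (pσ , _) → e σ pσ) ⟩
   𝔼 cs (λ σ → sumK ups (λ π → A σ π * G π)) ≈⟨ 𝔼-sumK cs ups (λ π σ → A σ π * G π) ⟩
   sumK ups (λ π → 𝔼 cs (λ σ → A σ π * G π)) ≈⟨ sumK-cong ups (λ π → trans (𝔼-cong cs (λ σ _ → *-comm _ _)) (𝔼-scal cs (G π) _)) ⟩
   sumK ups (λ π → G π * 𝔼 cs (λ σ → A σ π)) ∎

 signed-product : ∀ {X : Set} {P : X → Set} {xs : List X} (r t g e : X → Carrier) (s : X → Carrier) {x y s₁ s₂ e₁ e₂ n : Carrier} → All P xs → x ≈ s₁ * e₁ → y ≈ s₂ * e₂ → n ≈ s₁ * s₂ →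
  e₁ * e₂ ≈ sumK xs (λ π → g π * e π) → (∀ π → P π → r π ≈ (n * s π) * g π) → (∀ π → P π → t π ≈ s π * e π) → (∀ π → s π * s π ≈ 1#) →
  x * y ≈ sumK xs (λ π → r π * t π)
 signed-product {xs = xs} r t g e s {x} {y} {s₁} {s₂} {e₁} {e₂} {n} ps ex ey en ee er et s² = begin
  x * y ≈⟨ *-cong ex ey ⟩
  (s₁ * e₁) * (s₂ * e₂) ≈⟨ solve 4 (λ s x t y → (s :* x) :* (t :* y) := (s :* t) :* (x :* y)) refl s₁ e₁ s₂ e₂ ⟩
  (s₁ * s₂) * (e₁ * e₂) ≈⟨ *-cong (sym en) ee ⟩
  n * sumK xs (λ π → g π * e π) ≈⟨ sym (sumK-scal n xs _) ⟩
  sumK xs (λ π → n * (g π * e π)) ≈⟨ sumK-All ps (λ π p → sym (begin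
   r π * t π ≈⟨ *-cong (er π p) (et π p) ⟩
   ((n * s π) * g π) * (s π * e π) ≈⟨ solve 4 (λ n s g e → ((n :* s) :* g) :* (s :* e) := (s :* s) :* (n :* (g :* e))) refl n (s π) (g π) (e π) ⟩
   (s π * s π) * (n * (g π * e π)) ≈⟨ trans (*-congʳ (s² π)) (*-identityˡ _) ⟩
   n * (g π * e π) ∎)) ⟩
  sumK xs (λ π → r π * t π) ∎

 module Structure {μ ν : List ℕ} (pμ : IsPartition μ) (pν : IsPartition ν) where
  N : ℕ
  N = D.size μ ℕ.+ D.size ν

  upto : List (List ℕ)
  upto = partitionsUpTo N

  sound : All (λ π → IsPartition π × D.size π ℕ.≤ N) upto
  sound = Comb.partitionsUpTo-sound N

  aκ : List ℕ → List ℕ → Carrier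
  aκ σ π = κ (aCoef σ π)

  dκ : List ℕ → Carrier
  dκ la = κ (dCoef la μ ν)

  a-product-zero : ∀ σ τ → N ℕ.< D.size σ ℕ.+ D.size τ → aκ σ μ * aκ τ ν ≈ 0#
  a-product-zero σ τ lt = pick (NP.<-≤-connex (D.size μ) (D.size σ))
   where
   pick : (D.size μ ℕ.< D.size σ) ⊎ (D.size σ ℕ.≤ D.size μ) → aκ σ μ * aκ τ ν ≈ 0#
   pick (inj₁ big) = *-zeroˡ′ (aCoef-below σ (proj₁ pμ) big)
   pick (inj₂ le) = *-zeroʳ′ (aCoef-below τ (proj₁ pν) (NP.≰⇒> (λ le′ → NP.<-irrefl P.refl (NP.<-≤-trans lt (NP.+-mono-≤ le le′)))))

  d-splits : ∀ la → dκ la ≈ sumK (D.splits la) (λ s → aκ (proj₁ s) μ * aκ (proj₂ s) ν)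
  d-splits la = trans (κ-sum (λ s → aCoef (proj₁ s) μ *q aCoef (proj₂ s) ν) (D.splits la)) (sumK-cong (D.splits la) (λ s → κ-* (aCoef (proj₁ s) μ) (aCoef (proj₂ s) ν)))

  split-size : ∀ la → All (λ s → D.size (proj₁ s) ℕ.+ D.size (proj₂ s) ≡ D.size la) (D.splits la)
  split-size [] = P.refl ∷ []
  split-size (x ∷ la) = AllP.++⁺ (AllP.map⁺ (All.map (λ {s} e → P.trans (NP.+-assoc x (D.size (proj₁ s)) (D.size (proj₂ s))) (P.cong (x ℕ.+_) e)) (split-size la)))
   (AllP.map⁺ (All.map (λ {s} e → P.trans (P.sym (NP.+-assoc (D.size (proj₁ s)) x (D.size (proj₂ s)))) (P.trans (P.cong (ℕ._+ D.size (proj₂ s)) (NP.+-comm (D.size (proj₁ s)) x)) (P.trans (NP.+-assoc x (D.size (proj₁ s)) (D.size (proj₂ s))) (P.cong (x ℕ.+_) e)))) (split-size la)))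

  d-above : ∀ la → N ℕ.< D.size la → dκ la ≈ 0#
  d-above la lt = trans (d-splits la) (trans (sumK-All (split-size la) (λ s e → a-product-zero (proj₁ s) (proj₂ s) (NP.<-≤-trans lt (NP.≤-reflexive (P.sym e))))) (sumK-0 (D.splits la)))

  upper : List ℕ → List ℕ → Carrier
  upper la π = if does (D.size la ℕ.<? D.size π) then aκ la π else 0#

  upper-< : ∀ la π → D.size la ℕ.< D.size π → upper la π ≈ aκ la π
  upper-< la π lt = pick (D.size la ℕ.<? D.size π)
   where
   pick : (d : Dec (D.size la ℕ.< D.size π)) → (if does d then aκ la π else 0#) ≈ aκ la π
   pick (yes _) = refl
   pick (no n) = contradiction lt n

  upper-≮ : ∀ la π → ¬ (D.size la ℕ.< D.size π) → upper la π ≈ 0#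
  upper-≮ la π n = pick (D.size la ℕ.<? D.size π)
   where
   pick : (d : Dec (D.size la ℕ.< D.size π)) → (if does d then aκ la π else 0#) ≈ 0#
   pick (yes lt) = contradiction lt n
   pick (no _) = refl

  chain : ℕ → List ℕ → Carrier
  chain m la = κ (chainSum N μ ν m la)

  chain-suc : ∀ m la → chain (suc m) la ≈ sumK upto (λ π → upper la π * chain m π)
  chain-suc m la = trans (κ-sum (λ π → if does (D.size la ℕ.<? D.size π) then aCoef la π *q chainSum N μ ν m π else 0q) upto) (sumK-cong upto (λ π → pick π (D.size la ℕ.<? D.size π)))
   where
   pick : ∀ π (d : Dec (D.size la ℕ.< D.size π)) → κ (if does d then aCoef la π *q chainSum N μ ν m π else 0q) ≈ (if does d then aκ la π else 0#) * chain m π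
   pick π (yes _) = κ-* (aCoef la π) (chainSum N μ ν m π)
   pick π (no _) = trans κ-0 (sym (zeroˡ _))

  -- Every link raises the size by at least one, and d vanishes above size N. So chains of length at
  -- most N exhaust the sum.
  chain-above : ∀ m la → N ℕ.< m ℕ.+ D.size la → chain m la ≈ 0#
  chain-above zero la lt = d-above la lt
  chain-above (suc m) la lt = trans (chain-suc m la) (trans (sumK-cong upto (λ π → term π (D.size la ℕ.<? D.size π))) (sumK-0 upto))
   where
   term : ∀ π → Dec (D.size la ℕ.< D.size π) → upper la π * chain m π ≈ 0#
   term π (yes lt′) = *-zeroʳ′ (chain-above m π (NP.<-≤-trans lt (NP.≤-trans (NP.≤-reflexive (P.sym (NP.+-suc m (D.size la)))) (NP.+-monoʳ-≤ m lt′))))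
   term π (no n) = *-zeroˡ′ (upper-≮ la π n)

  alternating : ℕ → List ℕ → Carrier
  alternating M la = sumK (upTo M) (λ m → sgnK m * chain m la)

  alternating-suc : ∀ M la → alternating (suc M) la ≈ dκ la + - sumK upto (λ π → upper la π * alternating M π)
  alternating-suc M la = begin
   alternating (suc M) la ≡⟨ P.cong (λ l → sumK l (λ m → sgnK m * chain m la)) (upTo-suc M) ⟩
   1# * dκ la + sumK (map suc (upTo M)) (λ m → sgnK m * chain m la) ≈⟨ +-cong (*-identityˡ _) (sumK-map suc (upTo M) (λ m → sgnK m * chain m la)) ⟩
   dκ la + sumK (upTo M) (λ m → sgnK (suc m) * chain (suc m) la) ≈⟨ +-congˡ (sumK-cong (upTo M) (λ m → trans (*-congˡ (chain-suc m la)) (trans (solve 2 (λ s x → (:- s) :* x := (:- :1) :* (s :* x)) refl (sgnK m) _) (*-congˡ (sym (sumK-scal (sgnK m) upto _)))))) ⟩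
   dκ la + sumK (upTo M) (λ m → - 1# * sumK upto (λ π → sgnK m * (upper la π * chain m π))) ≈⟨ +-congˡ (trans (sumK-scal (- 1#) (upTo M) _) (trans (*-congˡ (sumK-exchange (upTo M) upto _)) (solve 1 (λ x → (:- :1) :* x := :- x) refl _))) ⟩
   dκ la + - sumK upto (λ π → sumK (upTo M) (λ m → sgnK m * (upper la π * chain m π))) ≈⟨ +-congˡ (-‿cong (sumK-cong upto (λ π → trans (sumK-cong (upTo M) (λ m → solve 3 (λ s u c → s :* (u :* c) := u :* (s :* c)) refl (sgnK m) (upper la π) (chain m π))) (sumK-scal (upper la π) (upTo M) _)))) ⟩
   dκ la + - sumK upto (λ π → upper la π * alternating M π) ∎

  Ĝ : List ℕ → Carrier
  Ĝ = alternating (suc N)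

  -- The first link of each chain is peeled off. This relates the sum over lengths up to N + 1 to
  -- the one up to N, and by `chain-above` the additional length contributes nothing.
  Ĝ-recursion : ∀ la → Ĝ la ≈ dκ la + - sumK upto (λ π → upper la π * Ĝ π)
  Ĝ-recursion la = trans (sym stable) (alternating-suc (suc N) la)
   where
   stable : alternating (suc (suc N)) la ≈ Ĝ la
   stable = trans (reflexive (P.cong (λ l → sumK l (λ m → sgnK m * chain m la)) (P.sym (LP.upTo-∷ʳ (suc N))))) (trans (sumK-++ (upTo (suc N)) (suc N ∷ []) _)
    (trans (+-congˡ (trans (+-identityʳ _) (*-zeroʳ′ (chain-above (suc N) la (ℕ.s≤s (NP.m≤m+n N (D.size la))))))) (+-identityʳ _)))

  -- a is unitriangular with respect to the size, so the alternating sum over chains inverts it.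
  inversion : ∀ {la} → IsPartition la → sumK upto (λ π → aκ la π * Ĝ π) ≈ dκ la
  inversion {la} p = either (NP.<-≤-connex N (D.size la))
   where
   diag : List ℕ → Carrier
   diag π = if does (LP.≡-dec ℕ._≟_ π la) then Ĝ π else 0#
   on : (d : Dec (la ≡ la)) → (if does d then Ĝ la else 0#) ≈ Ĝ la
   on (yes _) = refl
   on (no ne) = contradiction P.refl ne
   off : ∀ π → π ≢ la → (d : Dec (π ≡ la)) → (if does d then Ĝ π else 0#) ≈ 0#
   off π ne (yes e) = contradiction e ne
   off π ne (no _) = refl
   zero-sum : ∀ {x y z} → x ≈ 0# → y ≈ 0# → x * z ≈ y * z + 0#
   zero-sum {x} {y} {z} ex ey = trans (*-zeroˡ′ ex) (sym (trans (+-identityʳ _) (*-zeroˡ′ ey)))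
   term : ∀ π → IsPartition π → Tri (D.size la ℕ.< D.size π) (D.size la ≡ D.size π) (D.size π ℕ.< D.size la) → (d : Dec (π ≡ la)) → aκ la π * Ĝ π ≈ upper la π * Ĝ π + (if does d then Ĝ π else 0#)
   term π pπ (tri< lt _ _) (yes P.refl) = contradiction lt (NP.<-irrefl P.refl)
   term π pπ (tri< lt _ _) (no _) = sym (trans (+-identityʳ _) (*-congʳ (upper-< la π lt)))
   term π pπ (tri≈ n _ _) (yes P.refl) = trans (trans (*-congʳ (aCoef-same p)) (*-identityˡ _)) (sym (trans (+-congʳ (*-zeroˡ′ (upper-≮ la la n))) (+-identityˡ _)))
   term π pπ (tri≈ n e _) (no ne) = zero-sum (aCoef-other p pπ e (λ eq → ne (P.sym eq))) (upper-≮ la π n)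
   term π pπ (tri> n _ gt) (yes P.refl) = contradiction gt (NP.<-irrefl P.refl)
   term π pπ (tri> n _ gt) (no _) = zero-sum (aCoef-below la (proj₁ pπ) gt) (upper-≮ la π n)
   -- If |λ| exceeds N, all π in the sum are smaller than λ, so every a^λ_π is zero, and d^λ
   -- vanishes too.
   either : (N ℕ.< D.size la) ⊎ (D.size la ℕ.≤ N) → sumK upto (λ π → aκ la π * Ĝ π) ≈ dκ la
   either (inj₁ big) = trans (sumK-All sound (λ π (pπ , le) → *-zeroˡ′ (aCoef-below la (proj₁ pπ) (NP.≤-<-trans le big)))) (trans (sumK-0 upto) (sym (d-above la big)))
   either (inj₂ le) = begin
    sumK upto (λ π → aκ la π * Ĝ π) ≈⟨ sumK-All sound (λ π (pπ , _) → term π pπ (NP.<-cmp (D.size la) (D.size π)) (LP.≡-dec ℕ._≟_ π la)) ⟩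
    sumK upto (λ π → upper la π * Ĝ π + diag π) ≈⟨ sumK-add upto _ diag ⟩
    sumK upto (λ π → upper la π * Ĝ π) + sumK upto diag ≈⟨ +-congˡ (trans (sumK-single diag (Comb.partitionsUpTo-unique N) (Comb.partitionsUpTo-complete la p le) (λ π ne → off π ne (LP.≡-dec ℕ._≟_ π la))) (on (LP.≡-dec ℕ._≟_ la la))) ⟩
    sumK upto (λ π → upper la π * Ĝ π) + Ĝ la ≈⟨ +-congˡ (Ĝ-recursion la) ⟩
    sumK upto (λ π → upper la π * Ĝ π) + (dκ la + - sumK upto (λ π → upper la π * Ĝ π)) ≈⟨ solve 2 (λ u d → u :+ (d :+ (:- u)) := d) refl _ (dκ la) ⟩
    dκ la ∎

  rκ : List ℕ → Carrier
  rκ π = κ (rhs π μ ν)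

  rhs-Ĝ : ∀ π → rκ π ≈ sgnK ℤ.∣ + N ℤ.- + D.size π ∣ * Ĝ π
  rhs-Ĝ π = trans (κ-* (signq (+ N ℤ.- + D.size π)) (sumq (map (λ m → signq (+ m) *q chainSum N μ ν m π) (upTo (suc N))))) (*-cong (κ-pow ℤ.∣ + N ℤ.- + D.size π ∣) (trans (κ-sum (λ m → signq (+ m) *q chainSum N μ ν m π) (upTo (suc N))) (sumK-cong (upTo (suc N)) (λ m → trans (κ-* (signq (+ m)) (chainSum N μ ν m π)) (*-congʳ (κ-pow m))))))

  rhs-value : ∀ π → D.size π ℕ.≤ N → rκ π ≈ (sgnK N * sgnK (D.size π)) * Ĝ π
  rhs-value π le = trans (rhs-Ĝ π) (*-congʳ (trans (reflexive (P.cong sgnK (P.cong ℤ.∣_∣ (P.trans (ℤP.m-n≡m⊖n N (D.size π)) (ℤP.⊖-≥ le))))) (sgn-∸ le)))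

  rhs-above : ∀ π → N ℕ.< D.size π → rκ π ≈ 0#
  rhs-above π lt = trans (rhs-Ĝ π) (*-zeroʳ′ (trans (sumK-cong (upTo (suc N)) (λ m → *-zeroʳ′ (chain-above m π (NP.<-≤-trans lt (NP.m≤n+m (D.size π) m))))) (sumK-0 (upTo (suc N)))))

  -- One bound N gives a single family of constants for θ_μ, θ_ν and all θ_π, so the product can be
  -- re-expanded by `𝔼-product`. The signs (-1)^|π| of the expansion combine into the sign in front
  -- of the chain sum.
  product : ∀ {la} → IsPartition la → κ (θ J μ la) * κ (θ J ν la) ≈ sumK upto (λ π → rκ π * κ (θ J π la))
  product {la} p = signed-product rκ (λ π → κ (θ J π la)) Ĝ (λ π → 𝔼 cs (λ σ → aκ σ π)) (λ π → sgnK (D.size π)) sound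
    (θ≈ pμ (NP.m≤m+n (D.size μ) (D.size ν))) (θ≈ pν (NP.m≤n+m (D.size ν) (D.size μ))) (sgn-+ (D.size μ) (D.size ν))
    (𝔼-product (suc N) aκ Ĝ μ ν upto cs vanish (λ σ pσ → trans (sym (d-splits σ)) (sym (inversion pσ))))
    (λ π q → rhs-value π (proj₂ q)) (λ π q → θ≈ (proj₁ q) (proj₂ q)) (λ π → sgn² (D.size π))
   where
   open Expectation (suc N)
   cs : Vec Carrier N
   cs = proj₁ (θ-expansion p N)
   θ≈ : ∀ {π} → IsPartition π → D.size π ℕ.≤ N → κ (θ J π la) ≈ sgnK (D.size π) * 𝔼 cs (λ σ → aκ σ π)
   θ≈ = proj₂ (θ-expansion p N)
   vanish : ∀ σ τ → suc N ℕ.< Triangularity.size K σ ℕ.+ Triangularity.size K τ → aκ σ μ * aκ τ ν ≈ 0#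
   vanish σ τ lt = a-product-zero σ τ (NP.≤-trans (NP.n≤1+n (suc N)) (P.subst₂ (λ x y → suc N ℕ.< x ℕ.+ y) (P.sym (size≡ σ)) (P.sym (size≡ τ)) lt))

 extend : ∀ k m (X : List ℕ → Carrier) → (∀ π → IsPartition π → m ℕ.< D.size π → X π ≈ 0#) → sumK (partitionsUpTo (k ℕ.+ m)) X ≈ sumK (partitionsUpTo m) X
 extend zero m X z = refl
 extend (suc k) m X z = trans (reflexive (P.cong (λ l → sumK l X) (Comb.partitionsUpTo-suc (k ℕ.+ m)))) (trans (sumK-++ (partitionsUpTo (k ℕ.+ m)) _ X)
  (trans (+-cong (extend k m X z) (trans (sumK-All (Comb.partitionsOf-sound (suc (k ℕ.+ m))) (λ π (p , e) → z π p (NP.≤-trans (ℕ.s≤s (NP.m≤n+m m k)) (NP.≤-reflexive (P.sym e))))) (sumK-0 (partitionsOf (suc (k ℕ.+ m)))))) (+-identityʳ _)))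

 top-degree : ∀ n (X : List ℕ → Carrier) → (∀ π → IsPartition π → D.size π ℕ.< n → X π ≈ 0#) → sumK (partitionsUpTo n) X ≈ sumK (partitionsOf n) X
 top-degree zero X z = refl
 top-degree (suc n) X z = trans (reflexive (P.cong (λ l → sumK l X) (Comb.partitionsUpTo-suc n))) (trans (sumK-++ (partitionsUpTo n) _ X)
  (trans (+-congʳ (trans (sumK-All (Comb.partitionsUpTo-sound n) (λ π (p , le) → z π p (ℕ.s≤s le))) (sumK-0 (partitionsUpTo n)))) (+-identityˡ _)))

 -- The matrix θ_π(λ) is invertible in each degree because the Jack functions span.
 θ-independent : (h : List ℕ → Carrier) → (∀ la → IsPartition la → sumK (partitionsUpTo (D.size la)) (λ π → h π * κ (θ J π la)) ≈ 0#) → ∀ π → IsPartition π → h π ≈ 0#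
 θ-independent h rel π pπ = below (suc (D.size π)) π pπ (NP.n<1+n (D.size π))
  where
  below : ∀ n π → IsPartition π → D.size π ℕ.< n → h π ≈ 0#
  degree : ∀ n → (∀ π → IsPartition π → D.size π ℕ.< n → h π ≈ 0#) → ∀ π → IsPartition π → D.size π ≡ n → h π ≈ 0#
  below (suc n) π p (ℕ.s≤s le) with NP.m≤n⇒m<n∨m≡n le
  ... | inj₁ lt = below n π p lt
  ... | inj₂ e = degree n (below n) π p e
  degree n ih π p P.refl = begin
   h π ≈⟨ sym (*-identityʳ _) ⟩
   h π * 1# ≈⟨ *-congˡ (sym (trans (*-congˡ (Mon-same (proj₁ p))) (imfact* (word π)))) ⟩
   h π * (imfact (word π) * fn (Mon π) (word π)) ≈⟨ trans (sym (guard π p (LP.≡-dec ℕ._≟_ π π))) (sym (sumK-single (pairing (Mon π)) (Comb.parts-unique n n n) (Comb.partitionsOf-complete π p) (λ ξ ne → elsewhere ξ ne))) ⟩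
   sumK (partitionsOf n) (pairing (Mon π)) ≈⟨ sumK-All (Comb.partitionsOf-sound n) (λ ξ (pξ , _) → guard ξ pξ (LP.≡-dec ℕ._≟_ ξ π)) ⟩
   sumK (partitionsOf n) (λ ξ → h ξ * (imfact (word ξ) * fn (Mon π) (word ξ))) ≈⟨ Degree.span n Ψ onJack (Mon π) ⟩
   0# ∎
   where
   -- The guard makes the summand vanish at every list other than π, as `sumK-single` asks;
   -- `Mon-other` alone gives this for partitions.
   pairing : Sym → List ℕ → Carrier
   pairing f ξ = if does (LP.≡-dec ℕ._≟_ ξ π) then h ξ * (imfact (word ξ) * fn f (word ξ)) else 0#
   elsewhere : ∀ ξ → ξ ≢ π → pairing (Mon π) ξ ≈ 0#
   elsewhere ξ ne = pick (LP.≡-dec ℕ._≟_ ξ π)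
    where
    pick : (d : Dec (ξ ≡ π)) → (if does d then h ξ * (imfact (word ξ) * fn (Mon π) (word ξ)) else 0#) ≈ 0#
    pick (yes e) = contradiction e ne
    pick (no _) = refl
   guard : ∀ ξ → IsPartition ξ → (d : Dec (ξ ≡ π)) → (if does d then h ξ * (imfact (word ξ) * fn (Mon π) (word ξ)) else 0#) ≈ h ξ * (imfact (word ξ) * fn (Mon π) (word ξ))
   guard ξ pξ (yes _) = refl
   guard ξ pξ (no ne) = sym (*-zeroʳ′ (*-zeroʳ′ (Mon-other p pξ (λ e → ne (P.sym e)))))
   -- The functional f ↦ Σ h_ξ [p_ξ] f. On Jack functions it is the given relation in degree n, the
   -- lower h_ξ being zero by induction; on p_π it takes the value h_π.
   ψ : Sym → Carrier
   ψ f = sumK (partitionsOf n) (λ ξ → h ξ * (imfact (word ξ) * fn f (word ξ)))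
   Ψ : Degree.Functional n
   Ψ = record
    { ψf = ψ
    ; fcong = λ e → sumK-cong (partitionsOf n) (λ ξ → *-congˡ (*-congˡ (at e (word ξ))))
    ; fadd = λ f g → trans (sumK-cong (partitionsOf n) (λ ξ → solve 4 (λ h i x y → h :* (i :* (x :+ y)) := h :* (i :* x) :+ h :* (i :* y)) refl (h ξ) (imfact (word ξ)) (fn f (word ξ)) (fn g (word ξ)))) (sumK-add (partitionsOf n) _ _)
    ; fscal = λ c f → trans (sumK-cong (partitionsOf n) (λ ξ → solve 4 (λ h i c x → h :* (i :* (c :* x)) := c :* (h :* (i :* x))) refl (h ξ) (imfact (word ξ)) c (fn f (word ξ)))) (sumK-scal c (partitionsOf n) _)
    ; fvan = λ f v → trans (sumK-All (Comb.partitionsOf-sound n) (λ ξ (pξ , e) → *-zeroʳ′ (*-zeroʳ′ (vatₛ v (word ξ) (P.trans (wt-word (proj₁ pξ)) e))))) (sumK-0 (partitionsOf n)) }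
   onJack : ∀ (ix : Ix n) → ψ (Jack (proj₁ ix)) ≈ 0#
   onJack (la , pla , e) = trans (sumK-All (Comb.partitionsOf-sound n) (λ ξ (pξ , eξ) → *-congˡ (sym (θ-top pla pξ (P.trans eξ (P.sym e))))))
    (trans (sym (top-degree n (λ ξ → h ξ * κ (θ J ξ la)) (λ ξ pξ lt → *-zeroˡ′ (ih ξ pξ lt)))) (trans (reflexive (P.cong (λ m → sumK (partitionsUpTo m) (λ ξ → h ξ * κ (θ J ξ la))) (P.sym e))) (rel la pla)))

 differences-vanish : ∀ {X : Set} (xs ys : List X) (g r t : X → Carrier) {x} → x ≈ sumK xs (λ π → g π * t π) → x ≈ sumK ys (λ π → r π * t π) → sumK ys (λ π → r π * t π) ≈ sumK xs (λ π → r π * t π) →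
  sumK xs (λ π → (g π + - 1# * r π) * t π) ≈ 0#
 differences-vanish xs ys g r t eg er e = begin
  sumK xs (λ π → (g π + - 1# * r π) * t π) ≈⟨ sumK-cong xs (λ π → solve 3 (λ g r t → (g :+ (:- :1) :* r) :* t := g :* t :+ (:- :1) :* (r :* t)) refl (g π) (r π) (t π)) ⟩
  sumK xs (λ π → g π * t π + - 1# * (r π * t π)) ≈⟨ trans (sumK-add xs _ _) (+-congˡ (sumK-scal (- 1#) xs _)) ⟩
  sumK xs (λ π → g π * t π) + - 1# * sumK xs (λ π → r π * t π) ≈⟨ +-cong (trans (sym eg) (trans er e)) refl ⟩
  sumK xs (λ π → r π * t π) + - 1# * sumK xs (λ π → r π * t π) ≈⟨ solve 1 (λ x → x :+ (:- :1) :* x := :0) refl _ ⟩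
  0# ∎

 cancel-difference : ∀ {x y} → x + - 1# * y ≈ 0# → x ≈ y
 cancel-difference {x} {y} e = trans (solve 2 (λ x y → x := (x :+ (:- :1) :* y) :+ y) refl x y) (trans (+-congʳ e) (+-identityˡ _))

 -- Both sums are extended to the bound m + n, one by the vanishing of r above m and the other by
 -- the vanishing of t above n.
 extend-vanishing : ∀ m n (r t : List ℕ → Carrier) → (∀ π → IsPartition π → m ℕ.< D.size π → r π ≈ 0#) → (∀ π → IsPartition π → n ℕ.< D.size π → t π ≈ 0#) →
  sumK (partitionsUpTo m) (λ π → r π * t π) ≈ sumK (partitionsUpTo n) (λ π → r π * t π)
 extend-vanishing m n r t zr zt = trans (sym (extend n m _ (λ π pπ lt → *-zeroˡ′ (zr π pπ lt))))
  (trans (reflexive (P.cong (λ l → sumK (partitionsUpTo l) (λ π → r π * t π)) (NP.+-comm n m))) (extend m n _ (λ π pπ lt → *-zeroʳ′ (zt π pπ lt))))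

 -- The differences of the two families of coefficients annihilate θ at every λ, so independence
 -- applies. The expansions run up to |λ| and up to |μ| + |ν| respectively and are first brought to
 -- a common range.
 structure-constants : ∀ {μ ν} → IsPartition μ → IsPartition ν → (g : List ℕ → Qα) →
  (∀ la → IsPartition la → θ J μ la *q θ J ν la D.≈ sumq (map (λ π → g π *q θ J π la) (partitionsUpTo (D.size la)))) →
  ∀ la → IsPartition la → κ (g la) ≈ κ (rhs la μ ν)
 structure-constants {μ} {ν} pμ pν g hyp la pla = cancel-difference (θ-independent (λ π → κ (g π) + - 1# * rκ π) relation la pla)
  where
  open Structure pμ pν
  t : List ℕ → List ℕ → Carrier
  t la π = κ (θ J π la)
  left : ∀ la → IsPartition la → t la μ * t la ν ≈ sumK (partitionsUpTo (D.size la)) (λ π → κ (g π) * t la π)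
  left la p = trans (sym (κ-* (θ J μ la) (θ J ν la))) (trans (κ-cong {θ J μ la *q θ J ν la} {sumq (map (λ π → g π *q θ J π la) ups)} (hyp la p)) (trans (κ-sum (λ π → g π *q θ J π la) ups) (sumK-cong ups (λ π → κ-* (g π) (θ J π la)))))
   where ups = partitionsUpTo (D.size la)
  relation : ∀ la → IsPartition la → sumK (partitionsUpTo (D.size la)) (λ π → (κ (g π) + - 1# * rκ π) * t la π) ≈ 0#
  relation la p = differences-vanish (partitionsUpTo (D.size la)) upto (λ π → κ (g π)) rκ (t la) (left la p) (product p)
   (extend-vanishing N (D.size la) rκ (t la) (λ π pπ lt → rhs-above π lt) (λ π pπ lt → θ-above p pπ lt))

-- Specialisation to the rational functions in α.

module Instance where
 open RationalFunctions using (Qα-scalars; ≃⇒≈; ≈⇒≃; fromℕ≃nat; 1+b≃α; qα-ring)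
 open CommutativeRing qα-ring using (refl)

 coefficients : Terms.Coefficients Qα-scalars
 coefficients = record
  { κ = λ x → x ; κ-cong = λ {x} {y} → ≈⇒≃ {x} {y} ; 1≉0 = λ e → contradiction (≃⇒≈ e 0) (λ ())
  ; κ-0 = refl {D.0q} ; κ-1 = refl {D.1q} ; κ-+ = λ x y → refl {x D.+q y} ; κ-* = λ x y → refl {x D.*q y} ; κ-neg = λ x → refl {D.-q x}
  ; κ-ℕ = fromℕ≃nat ; κ-α = refl {D.αq} ; κ-b = refl {D.bq} ; κ-1+b = 1+b≃α ; κ-inv = refl {D.inv1+b} ; κ-recip = λ n → refl {D.recipSuc n} }

open import Defs

theorem6p1 : (J : List ℕ → SymF) → IsJackFamily J →
    (la μ ν : List ℕ) → IsPartition la → IsPartition μ → IsPartition ν →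
    (g : List ℕ → Qα) →
    (∀ κ → IsPartition κ →
      θ J μ κ *q θ J ν κ ≈ sumq (map (λ π → g π *q θ J π κ) (partitionsUpTo (size κ)))) →
    g la ≈ rhs la μ ν
theorem6p1 J isJ la μ ν pla pμ pν g hyp =
  RationalFunctions.≃⇒≈ (StructureConstants.structure-constants RationalFunctions.Qα-scalars Instance.coefficients J isJ pμ pν g hyp la pla)
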